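{- With a constant number of periods, the charge scheduling problem with multiple deadlines is weakly NP-complete. If furthermore the demand, supply, or maximum charging speed is polynomially bounded, then the problem is in P.
   Context: Charge scheduling problem with multiple deadlines. Time is discretized into periods $T=\{1,\dots,|T|\}$. In period $t$ a supply $m_t\in\mathbb{R}$ of a perishable resource is available. There are $n$ agents; agent $i$ has triples $(v_{i,k},d_{i,k},w_{i,k})$, $k\in K(i)$, each consisting of a value $v_{i,k}$, a deadline $d_{i,k}$ (a period) and a demand $w_{i,k}$; there may be more than one triple per agent. An allocation to agent $i$ is a function $a_i:T\to\mathbb{R}$, and $\bar a_i(t)=\sum_{t'=1}^{t}a_i(t')$ is the total allocated up to and including period $t$. The value of agent $i$ is $v_i(a_i)=\sum_{k\in K(i):\ \bar a_i(d_{i,k})\ge w_{i,k}}v_{i,k}$. The goal is to maximize $\sum_i v_i(a_i)$ subject to $\sum_i a_i(t)\le m_t$ for every $t$, and subject to the charging-speed constraints; NP-completeness refers to the decision version of this problem. Charging speed: each agent $i$ has a maximum charging speed $s_i$, with $a_i(t)\le s_i$ for all $t$. Three variants are considered: fixed (the maximum charging speed is the same at all times), unbounded (no bound on the charging speed of an individual agent), and gaps (the maximum charging speed may be $0$ for some periods and unbounded for others). "Constant number of periods" means that $|T|$ is an a-priori known constant for all instances. "Polynomially bounded" means that there is a polynomial $p$ such that $m_t\le p(n,|T|)$ for all $t$ (for supply), $w_{i,k}\le p(n,|T|)$ for all $i,k$ (for demand), or, analogously, the maximum charging speeds are at most $p(n,|T|)$. "Weakly NP-complete" has its usual meaning: NP-complete,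 but solvable in pseudo-polynomial time.
   Formalization: Supplies, demands, values, speeds and the target are natural numbers in binary (real inputs have no encoding; with rationals the bounds are vacuous by scaling); allocations are required nonnegative, and are rational, which for such data decides the same problem; at least one period. -}

module Defs where

import Algebra.Properties.Monoid.Sum as Sum
open import Data.Bool using (Bool; true; false; if_then_else_)
open import Data.Fin as Fin using (Fin; toℕ)
open import Data.Integer using (+_)
open import Data.List as List using (List; []; _∷_; _++_; [_]; length)
open import Data.Maybe as Maybe using (Maybe; just; nothing)
import Data.Maybe.Relation.Unary.All as MaybeAll
import Data.Maybe.Relation.Unary.Any as MaybeAny
open import Data.List.Relation.Unary.All using (All)
open import Data.Nat as ℕ using (ℕ; zero; suc; _⊔_)
open import Data.Nat.Binary as ℕᵇ using (ℕᵇ; 2[1+_]; 1+[2_])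
import Data.Nat.ListAction as ListAction
import Data.Nat.Properties as ℕₚ
open import Data.Product using (Σ-syntax; ∃-syntax; _×_; _,_; proj₁)
open import Data.Rational as ℚ using (ℚ; 0ℚ; _/_)
import Data.Rational.Properties as ℚₚ
open import Data.Unit using (⊤)
open import Data.Vec as Vec using (Vec; []; _∷_; lookup)
open import Function using (_∘_; _⇔_)
open import Level using (0ℓ)
open import Relation.Binary.PropositionalEquality using (_≡_)
open import Relation.Nullary using (does)
open import Relation.Unary using (Pred)

------------------------------------------------------------------------
-- Polynomials

-- Polynomials are used only as upper bounds, so natural coefficients lose
-- nothing: every polynomial is bounded on ℕᵏ by one of these.
data Poly (k : ℕ) : Set where
  con     : ℕ → Poly k
  var     : Fin k → Poly k
  _⊕_ _⊗_ : Poly k → Poly k → Poly k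

⟦_⟧ : ∀ {k} → Poly k → Vec ℕ k → ℕ
⟦ con c ⟧ xs = c
⟦ var i ⟧ xs = lookup xs i
⟦ p ⊕ q ⟧ xs = ⟦ p ⟧ xs ℕ.+ ⟦ q ⟧ xs
⟦ p ⊗ q ⟧ xs = ⟦ p ⟧ xs ℕ.* ⟦ q ⟧ xs

------------------------------------------------------------------------
-- Deterministic multi-tape Turing machines

data Symbol (g : ℕ) : Set where
  blank : Symbol g
  bit   : Bool → Symbol g
  aux   : Fin g → Symbol g

data Move : Set where
  left stay right : Move

-- A two-way infinite tape.  Both lists are read outwards from the scanned
-- cell, and all cells beyond them are blank.
record Tape (g : ℕ) : Set where
  constructor tape
  field
    before  : List (Symbol g)
    scanned : Symbol g
    after   : List (Symbol g)

emptyTape : ∀ {g} → Tape g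
emptyTape = tape [] blank []

inputTape : ∀ {g} → List Bool → Tape g
inputTape []      = emptyTape
inputTape (b ∷ w) = tape [] (bit b) (List.map bit w)

move : ∀ {g} → Move → Tape g → Tape g
move left  (tape []       s rs)       = tape [] blank (s ∷ rs)
move left  (tape (l ∷ ls) s rs)       = tape ls l (s ∷ rs)
move stay  t                          = t
move right (tape ls       s [])       = tape (s ∷ ls) blank []
move right (tape ls       s (r ∷ rs)) = tape (s ∷ ls) r rs

act : ∀ {g} → Symbol g × Move → Tape g → Tape g
act (s , m) t = move m (record t { scanned = s })

-- The maximal block of bits that starts at the scanned cell.
readWord : ∀ {g} → Tape g → List Bool
readWord (tape _ s rs) = bits (s ∷ rs)
  where
  bits : List (Symbol _) → List Bool
  bits (bit b ∷ ss) = b ∷ bits ss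
  bits _            = []

record Machine : Set where
  field
    extraTapes : ℕ
    auxSymbols : ℕ
    states     : ℕ
    start      : Fin states

  Sym = Symbol auxSymbols

  -- The machine halts when δ returns nothing.
  field
    δ : Fin states → Vec Sym (suc extraTapes) →
        Maybe (Fin states × Vec (Sym × Move) (suc extraTapes))

  Config : Set
  Config = Fin states × Vec (Tape auxSymbols) (suc extraTapes)

  step : Config → Maybe Config
  step (q , ts) =
    Maybe.map (λ (q′ , as) → q′ , Vec.zipWith act as ts)
              (δ q (Vec.map Tape.scanned ts))

  -- Tape 0 serves both as the input tape and as the output tape.
  initial : List Bool → Config
  initial w = start , inputTape w ∷ Vec.replicate extraTapes emptyTape

  output : Config → List Bool
  output (_ , t ∷ _) = readWord t

  -- c ⇓[ n ] d : the run from c halts in d after at most n steps.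
  data _⇓[_]_ : Config → ℕ → Config → Set where
    halt : ∀ {c n} → step c ≡ nothing → c ⇓[ n ] c
    next : ∀ {c c′ d n} → step c ≡ just c′ → c′ ⇓[ n ] d → c ⇓[ suc n ] d

  Outputs_On_Within_ : List Bool → List Bool → ℕ → Set
  Outputs v On w Within n = ∃[ d ] (initial w ⇓[ n ] d × output d ≡ v)

open Machine using (Outputs_On_Within_)

------------------------------------------------------------------------
-- Complexity classes

Language : Set₁
Language = Pred (List Bool) 0ℓ

PolyTime : (List Bool → List Bool) → Set
PolyTime f =
  Σ[ M ∈ Machine ] ∃[ p ]
    (∀ w → Outputs_On_Within_ M (f w) w (⟦ p ⟧ (length w ∷ [])))

InP : Language → Set
InP L =
  Σ[ f ∈ (List Bool → Bool) ]
    (PolyTime (λ w → [ f w ]) × (∀ w → f w ≡ true ⇔ L w))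

-- Each bit of the first word is preceded by true; false ends that word.
pair : List Bool → List Bool → List Bool
pair []      u = false ∷ u
pair (b ∷ w) u = true ∷ b ∷ pair w u

InNP : Language → Set₁
InNP L =
  Σ[ V ∈ Language ] (InP V × (∃[ p ] ∀ w →
    L w ⇔ (∃[ u ] (length u ℕ.≤ ⟦ p ⟧ (length w ∷ []) × V (pair w u)))))

_≤ₚ_ : Language → Language → Set
L ≤ₚ L′ =
  Σ[ f ∈ (List Bool → List Bool) ] (PolyTime f × (∀ w → L w ⇔ L′ (f w)))

NPHard : Language → Set₁
NPHard L = ∀ L′ → InNP L′ → L′ ≤ₚ L

NPComplete : Language → Set₁
NPComplete L = InNP L × NPHard L

-- A decision problem in the style of Garey and Johnson: magnitude is the
-- largest number occurring in an instance.
record Problem : Set₁ where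
  field
    Instance  : Set
    encode    : Instance → List Bool
    magnitude : Instance → ℕ
    Yes       : Instance → Set

open Problem

language : Problem → Language
language Π w = ∃[ I ] (encode Π I ≡ w × Yes Π I)

PseudoPolynomial : Problem → Set
PseudoPolynomial Π =
  Σ[ f ∈ (Instance Π → Bool) ]
    ((∀ I → f I ≡ true ⇔ Yes Π I) ×
     (Σ[ M ∈ Machine ] ∃[ p ] ∀ I →
        Outputs_On_Within_ M [ f I ] (encode Π I)
          (⟦ p ⟧ (length (encode Π I) ∷ magnitude Π I ∷ []))))

WeaklyNPComplete : Problem → Set₁
WeaklyNPComplete Π = NPComplete (language Π) × PseudoPolynomial Π

restrict : (Π : Problem) → (Instance Π → Set) → Problem
restrict Π P = record
  { Instance  = Σ[ I ∈ Instance Π ] P I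
  ; encode    = encode Π ∘ proj₁
  ; magnitude = magnitude Π ∘ proj₁
  ; Yes       = Yes Π ∘ proj₁
  }

------------------------------------------------------------------------
-- Charge scheduling with multiple deadlines

data Variant : Set where
  fixed unbounded gaps : Variant

-- In the variant with gaps, true marks a period of unbounded speed and
-- false a period in which the maximum speed is 0.
SpeedLimit : Variant → ℕ → Set
SpeedLimit fixed     T = ℕ
SpeedLimit unbounded T = ⊤
SpeedLimit gaps      T = Vec Bool T

-- The maximum charging speed in a period; nothing stands for unbounded.
maxSpeed : ∀ ν {T} → SpeedLimit ν T → Fin T → Maybe ℕ
maxSpeed fixed     s t = just s
maxSpeed unbounded s t = nothing
maxSpeed gaps      s t = if lookup s t then nothing else just 0

record Triple (T : ℕ) : Set where
  constructor triple
  field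
    value    : ℕ
    deadline : Fin T
    demand   : ℕ

record Agent (ν : Variant) (T : ℕ) : Set where
  constructor agent
  field
    triples : List (Triple T)
    speed   : SpeedLimit ν T

-- Numerical data are naturals, as usual for a number problem.  With rational
-- data a bound on the supply would not be a restriction, since all
-- quantities of resource could be scaled down.
record ChargeInstance (ν : Variant) (T : ℕ) : Set where
  constructor chargeInstance
  field
    n      : ℕ
    supply : Vec ℕ T
    agents : Vec (Agent ν T) n
    target : ℕ

open Triple
open Agent
open ChargeInstance

fromℕ : ℕ → ℚ
fromℕ k = + k / 1

-- Once a set of triples to be satisfied is chosen, the constraints on an
-- allocation are finitely many non-strict linear inequalities with integer
-- data, so a rational solution exists whenever a real one does.
Allocation : ℕ → Set
Allocation T = Fin T → ℚ

cumulative : ∀ {T} → Allocation T → Fin T → ℚ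
cumulative {T} a t =
  Sum.sum ℚₚ.+-0-monoid {T} (λ t′ → if does (t′ Fin.≤? t) then a t′ else 0ℚ)

agentValue : ∀ {ν T} → Agent ν T → Allocation T → ℕ
agentValue i a = ListAction.sum (List.map value
  (List.filter (λ k → fromℕ (demand k) ℚ.≤? cumulative a (deadline k))
               (triples i)))

module _ {ν : Variant} {T : ℕ} (I : ChargeInstance ν T) where

  speedAt : Fin (n I) → Fin T → Maybe ℕ
  speedAt i = maxSpeed ν (speed (lookup (agents I) i))

  -- Allocations are nonnegative: otherwise any one agent could hand out
  -- unlimited amounts of resource to the others.
  record Feasible (a : Fin (n I) → Allocation T) : Set where
    field
      nonNegative  : ∀ i t → 0ℚ ℚ.≤ a i t
      withinSpeed  : ∀ i t → MaybeAll.All (λ s → a i t ℚ.≤ fromℕ s) (speedAt i t)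
      withinSupply : ∀ t → Sum.sum ℚₚ.+-0-monoid (λ i → a i t)
                             ℚ.≤ fromℕ (lookup (supply I) t)

  totalValue : (Fin (n I) → Allocation T) → ℕ
  totalValue a =
    Sum.sum ℕₚ.+-0-monoid (λ i → agentValue (lookup (agents I) i) (a i))

  Schedulable : Set
  Schedulable = ∃[ a ] (Feasible a × target I ℕ.≤ totalValue a)

  bound : Poly 2 → ℕ
  bound p = ⟦ p ⟧ (n I ∷ T ∷ [])

  SupplyBounded : Poly 2 → Set
  SupplyBounded p = ∀ t → lookup (supply I) t ℕ.≤ bound p

  DemandBounded : Poly 2 → Set
  DemandBounded p =
    ∀ i → All (λ k → demand k ℕ.≤ bound p) (triples (lookup (agents I) i))

  -- An unbounded speed (nothing) does not satisfy any bound.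
  SpeedBounded : Poly 2 → Set
  SpeedBounded p = ∀ i t → MaybeAny.Any (ℕ._≤ bound p) (speedAt i t)

------------------------------------------------------------------------
-- Encoding of instances

-- Binary notation (bijective, as in Data.Nat.Binary), least significant
-- digit first; each digit is preceded by true, and false ends the number.
encodeℕᵇ : ℕᵇ → List Bool
encodeℕᵇ ℕᵇ.zero  = [ false ]
encodeℕᵇ 2[1+ x ] = true ∷ false ∷ encodeℕᵇ x
encodeℕᵇ 1+[2 x ] = true ∷ true ∷ encodeℕᵇ x

encodeℕ : ℕ → List Bool
encodeℕ = encodeℕᵇ ∘ ℕᵇ.fromℕ

-- The length is fixed beforehand, so no end marker is needed.
encodeVec : ∀ {A : Set} {k} → (A → List Bool) → Vec A k → List Bool
encodeVec f []       = []
encodeVec f (x ∷ xs) = f x ++ encodeVec f xs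

encodeList : ∀ {A : Set} → (A → List Bool) → List A → List Bool
encodeList f []       = [ false ]
encodeList f (x ∷ xs) = true ∷ f x ++ encodeList f xs

encodeTriple : ∀ {T} → Triple T → List Bool
encodeTriple k =
  encodeℕ (value k) ++ encodeℕ (toℕ (deadline k)) ++ encodeℕ (demand k)

encodeSpeed : ∀ ν {T} → SpeedLimit ν T → List Bool
encodeSpeed fixed     s = encodeℕ s
encodeSpeed unbounded s = []
encodeSpeed gaps      s = Vec.toList s

encodeAgent : ∀ {ν T} → Agent ν T → List Bool
encodeAgent {ν} i = encodeList encodeTriple (triples i) ++ encodeSpeed ν (speed i)

encodeInstance : ∀ {ν T} → ChargeInstance ν T → List Bool
encodeInstance I =
  encodeVec encodeℕ (supply I) ++
  encodeList encodeAgent (Vec.toList (agents I)) ++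
  encodeℕ (target I)

maximum : List ℕ → ℕ
maximum = List.foldr _⊔_ 0

tripleMagnitude : ∀ {T} → Triple T → ℕ
tripleMagnitude k = value k ⊔ toℕ (deadline k) ⊔ demand k

speedMagnitude : ∀ ν {T} → SpeedLimit ν T → ℕ
speedMagnitude fixed     s = s
speedMagnitude unbounded s = 0
speedMagnitude gaps      s = 0

agentMagnitude : ∀ {ν T} → Agent ν T → ℕ
agentMagnitude {ν} i =
  maximum (List.map tripleMagnitude (triples i)) ⊔ speedMagnitude ν (speed i)

instanceMagnitude : ∀ {ν T} → ChargeInstance ν T → ℕ
instanceMagnitude I =
  maximum (Vec.toList (supply I)) ⊔
  maximum (List.map agentMagnitude (Vec.toList (agents I))) ⊔
  target I

-- The number of periods T is a parameter: one problem for each constant.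
chargeScheduling : Variant → ℕ → Problem
chargeScheduling ν T = record
  { Instance  = ChargeInstance ν T
  ; encode    = encodeInstance
  ; magnitude = instanceMagnitude
  ; Yes       = Schedulable
  }

{-# OPTIONS --safe #-}

-- Which of the chosen triples are satisfied is a question about a flow with
-- integral data, so every rational schedule can be rounded to an integral one
-- of the same value.  An integral schedule is a certificate.  With a constant
-- number of periods there are only polynomially many vectors of resources with
-- entries up to B, and a dynamic program over them decides the problem; one may
-- take the largest supply for B, which is pseudo-polynomial, or n times a bound
-- on the supply, the demands or the speeds, because an agent never needs more
-- than that bound in a period.
--
-- For hardness, an accepting run of a verifier is described by a propositional
-- formula, the formula is turned into a subset sum problem, and every number x
-- becomes an agent with the single triple (x, 1, x), while x units of value can
-- only be bought with x units of the first period's supply.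
--
-- Running times are counted in a small imperative language on stacks of
-- letters, which Turing machines simulate; functions that are computable there
-- in polynomial time are closed under composition, pairing and folds over lists
-- whose intermediate results stay small.

module Submission where

open import Defs
import Algebra.Properties.Monoid.Sum as Sum using (sum; sum-cong-≗; sum-replicate-zero)
import Data.Bool.Base as Bool using (Bool; true; false; if_then_else_; not; _∧_; _∨_; T)
open Bool
import Data.Bool.ListAction as BoolAction using (all)
import Data.Empty as Empty using (⊥; ⊥-elim)
open Empty
import Data.Fin.Base as Fin using (Fin; zero; suc; toℕ; combine; fromℕ<; join; remQuot; splitAt)
open Fin using (Fin; zero; suc; toℕ)
import Data.Fin.Properties as Finₚ using (_≟_; _≤?_; fromℕ<-toℕ; remQuot-combine; splitAt-join; toℕ-fromℕ<; toℕ-injective; toℕ<n)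
import Data.Integer.Base as ℤ using
  (ℤ; 0ℤ; 1ℤ; -1ℤ; nonNeg; pos; +_; +0; +[1+_]; -[1+_]; +<+; +≤+; -_; positive; _+_; _*_; _-_; _≤_; _<_)
open ℤ using (ℤ; 0ℤ; 1ℤ) renaming (+_ to ⁺_; _+_ to _+ᶻ_; _*_ to _*ᶻ_; _-_ to _-ᶻ_; _≤_ to _≤ᶻ_; _<_ to _<ᶻ_)
import Data.Integer.Properties as ℤₚ using
  (*-comm; *-distribˡ-+; *-identityʳ; *-identityˡ; *-monoˡ-<-pos; *-monoˡ-≤-nonNeg; *-zeroʳ; +-assoc; +-identityʳ; +-identityˡ; +-injective;
   +-mono-<-≤; +-mono-≤; +-mono-≤-<; -1*i≡-i; <-asym; <-irrefl; <-≤-trans; _<?_; i-j≡0⇒i≡j; i≤j⇒i-j≤0; neg-cancel-<; neg-mono-<; neg-mono-≤;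
   pos-*; pos-+; ≤-antisym; ≤-refl; ≤-reflexive; ≤-trans; ≮⇒≥; drop‿+≤+)
import Data.Integer.Solver as IntegerSolver using (module +-*-Solver)
open IntegerSolver.+-*-Solver using () renaming
  (solve to solveᶻ; _:=_ to _:=ᶻ_; _:+_ to _:+ᶻ_; _:*_ to _:*ᶻ_; _:-_ to _:-ᶻ_; :-_ to :-ᶻ_; con to κᶻ)
import Data.List.Base as List using
  (List; []; _∷_; _++_; [_]; length; foldl; foldr; allFin; cartesianProduct; concatMap; downFrom; drop; filter; head; map; replicate; reverse;
   take; _ʳ++_)
open List using (List; []; _∷_; _++_; [_]; length; foldl; foldr)
import Data.List.Properties as Listₚ using
  (++-assoc; ++-identityʳ; ++-is-foldr; foldl-∷ʳ; length-++; length-downFrom; length-map; length-replicate; length-take; map-cong; map-id;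
   map-is-foldr; map-tabulate; map-∘; reverse-++; reverse-foldl; reverse-involutive; ʳ++-defn; ∷-injectiveˡ)
import Data.List.Membership.Propositional as Membership using (_∈_; lose; find)
open Membership
import Data.List.Membership.Propositional.Properties as ∈ₚ using
  (∈-++⁺ʳ; ∈-++⁺ˡ; ∈-++⁻; ∈-allFin; ∈-cartesianProduct⁺; ∈-concatMap⁺; ∈-concatMap⁻; ∈-map⁺; ∈-map⁻; ∈-∃++)
import Data.List.Relation.Unary.All as All using (All; []; _∷_; lookup; map; tabulate)
open All using (All; []; _∷_)
import Data.List.Relation.Unary.All.Properties as Allₚ using (++⁺; map⁺; map⁻)
import Data.List.Relation.Unary.AllPairs as AllPairs using ([]; _∷_)
open AllPairs
import Data.List.Relation.Unary.Any as Any using (here; there; any?)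
open Any
import Data.List.Relation.Unary.Unique.Propositional as Unique using (Unique)
open Unique
import Data.List.Relation.Unary.Unique.Propositional.Properties as Uniqueₚ using (++⁺; allFin⁺; cartesianProduct⁺; map⁺)
import Data.Maybe.Base as Maybe using (Maybe; just; nothing; map; maybe)
open Maybe using (Maybe; just; nothing)
import Data.Maybe.Relation.Unary.All as MaybeAll using (All; just; nothing)
import Data.Maybe.Relation.Unary.Any as MaybeAny using (Any; just)
import Data.Nat.ListAction as ListAction using (sum)
import Data.Nat.Base as ℕ using (ℕ; zero; suc; nonZero; _+_; _*_; _∸_; _⊔_; _⊓_; _≤_; _<_; _≤ᵇ_; _<ᵇ_; _≡ᵇ_; z≤n; s≤s; NonZero)
open ℕ hiding (nonZero; _⊓_)
import Data.Nat.Properties as ℕₚ using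
  (*-assoc; *-cancelˡ-<; *-comm; *-distribʳ-+; *-distribˡ-+; *-identityʳ; *-mono-≤; *-monoʳ-≤; *-monoˡ-≤; *-suc; *-zeroʳ; +-0-monoid; +-assoc;
   +-cancelˡ-<; +-cancelˡ-≡; +-comm; +-identityʳ; +-mono-<-≤; +-mono-≤; +-mono-≤-<; +-monoʳ-<; +-monoʳ-≤; +-monoˡ-≤; +-suc; <-cmp; <-irrefl;
   <⇒≤; <⇒≱; _<?_; m+[n∸m]≡n; m+n≤o⇒m≤o; m+n≤o⇒m≤o∸n; m≤m⊔n; m≤n⊔m; m∸n≤m; m≤m+n; m≤n+m; m≤n+m∸n; m≤n+o⇒m∸n≤o; m≤n⇒m<n∨m≡n; m≤n⇒m≤1+n;
   m≤n⇒m≤o+n; m≤n⇒m⊓n≡m; m≤n⇒m⊔n≡n; m≥n⇒m⊓n≡n; m≥n⇒m⊔n≡m; n≤1+n; ∸-monoʳ-≤; ∸-monoˡ-≤; ≡ᵇ⇒≡; ≡⇒≡ᵇ; ≤-antisym; ≤-pred; ≤-refl;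
   ≤-reflexive; ≤-total; ≤-trans; ≤ᵇ⇒≤; ≤⇒≤ᵇ; ≮⇒≥; ≰⇒>; m⊓n≤m; m⊓n≤n; ⊓-glb; ⊔-sel; module ≤-Reasoning)
open ℕₚ
import Data.Nat.DivMod as DivMod using (_/_; _%_; m%n<n; m≡m%n+[m/n]*n)
open DivMod
import Data.Nat.Binary.Base as ℕᵇ using (ℕᵇ; zero; 2[1+_]; 1+[2_]; fromℕ; toℕ)
open ℕᵇ using (ℕᵇ; 2[1+_]; 1+[2_])
import Data.Nat.Binary.Properties as ℕᵇₚ using (fromℕ-toℕ; toℕ-fromℕ)
import Data.Nat.Solver as NatSolver using (module +-*-Solver)
open NatSolver.+-*-Solver using (solve; _:=_; _:+_; _:*_) renaming (con to κ)
import Data.Product.Base as Product using (Σ; Σ-syntax; ∃-syntax; _×_; _,_; proj₁; proj₂)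
open Product
import Data.Product.Properties as Productₚ using (≡-dec)
import Data.Rational.Base as ℚ using (ℚ; 0ℚ; *≤*; _+_; _/_; _≤_; mkℚ; toℚᵘ)
open ℚ using (ℚ; 0ℚ)
import Data.Rational.Properties as ℚₚ using
  (+-0-monoid; _≤?_; fromℚᵘ-cong; fromℚᵘ-toℚᵘ; toℚᵘ-cancel-≤; toℚᵘ-fromℚᵘ; toℚᵘ-homo-+; toℚᵘ-injective; toℚᵘ-mono-≤)
import Data.Rational.Unnormalised.Base as ℚᵘ using (_≃_; *≡*; *≤*; mkℚᵘ)
import Data.Rational.Unnormalised.Properties as ℚᵘₚ using (+-cong; drop-*≤*; ≃-sym; ≃-trans; ≤-respʳ-≃; ≤-respˡ-≃)
import Data.Sum.Base as Disjoint using (_⊎_; inj₁; inj₂; map)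
open Disjoint using (_⊎_; inj₁; inj₂)
import Data.Sum.Properties as Sumₚ using (≡-dec)
import Data.Unit.Base as Unit using (⊤; tt)
open Unit
import Data.Vec.Base as Vec using
  (Vec; []; _∷_; lookup; fromList; head; map; replicate; tabulate; tail; toList; updateAt; zipWith)
open Vec using (Vec; []; _∷_; lookup)
import Data.Vec.Properties as Vecₚ using
  (lookup-map; lookup-replicate; lookup-zipWith; lookup∘tabulate; lookup∘updateAt; lookup∘updateAt′; toList∘fromList; updateAt-updateAt)
import Function.Base as Function using (_∘_; id; case_of_)
open Function
import Function.Bundles as Bundles using (_⇔_; mk⇔; module Equivalence)
open Bundles
import Relation.Binary.Definitions as Definitions using (DecidableEquality; tri<; tri≈; tri>)
open Definitions
import Relation.Binary.PropositionalEquality.Core as Equality using (_≡_; refl; sym; trans; cong; cong₂; subst; subst₂; _≢_)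
open Equality
import Relation.Nullary.Decidable.Core as Decidable using (Dec; yes; no; does)
open Decidable
import Relation.Nullary.Negation.Core as Negation using (¬_)
open Negation


-- Programs on four stacks

-- A program finds its argument as a self-delimiting code on top of a stack and leaves everything
-- below untouched; this frame property makes composition cheap. Folds are where polynomial time can
-- be lost, so each comes with a bound on its accumulators. In the dynamic program the values may be
-- exponentially large: only the resource vectors must be few, while a value counts by its number of
-- digits. Rounding cannot treat the agents one by one, because the supply couples them in every
-- period. The totals charged so far are therefore made edges of one circulation, in which each
-- limit on supply, speed or demand bounds a single edge, and a circulation can be rounded edge by
-- edge, up or down. The base of the subset sum exceeds every digit sum, so no carry links two
-- digits. A target equal to the supply turns "at least" and "at most" into equality.

Letter : Set
Letter = Maybe Bool

pattern 𝟎 = just false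
pattern 𝟏 = just true
pattern ♯ = nothing

Reg : Set
Reg = Fin 4

Store : Set
Store = Vec (List Letter) 4

data Cmd : Set where
  push     : Reg → Letter → Cmd
  pop      : Reg → Cmd
  _⨾_      : Cmd → Cmd → Cmd
  branch repeat : Reg → (Maybe Letter → Bool) → Cmd → Cmd → Cmd

infixr 5 _⨾_

topmost : Reg → Store → Maybe Letter
topmost r s = List.head (lookup s r)

pushed : Reg → Letter → Store → Store
pushed r x s = Vec.updateAt s r (x ∷_)

popped : Reg → Store → Store
popped r s = Vec.updateAt s r (List.drop 1)

-- The costs are those of the compiled machine: `push` moves left and then writes, `pop` and every
-- test take one transition. The slack `n` in the rules for `push` and `pop` makes every index an
-- upper bound.
data _⊢_⇓[_]_ : Cmd → Store → ℕ → Store → Set where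
  push  : ∀ {r x s n} → push r x ⊢ s ⇓[ 2 + n ] pushed r x s
  pop   : ∀ {r s n} → pop r ⊢ s ⇓[ 1 + n ] popped r s
  _⨾_   : ∀ {c d s s′ s″ m n} → c ⊢ s ⇓[ m ] s′ → d ⊢ s′ ⇓[ n ] s″ →
          (c ⨾ d) ⊢ s ⇓[ m + n ] s″
  taken   : ∀ {r φ c d s s′ n} → φ (topmost r s) ≡ true → c ⊢ s ⇓[ n ] s′ →
          branch r φ c d ⊢ s ⇓[ 1 + n ] s′
  skipped : ∀ {r φ c d s s′ n} → φ (topmost r s) ≡ false → d ⊢ s ⇓[ n ] s′ →
          branch r φ c d ⊢ s ⇓[ 1 + n ] s′
  again   : ∀ {r φ c d s s′ s″ m n} → φ (topmost r s) ≡ true → c ⊢ s ⇓[ m ] s′ →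
          repeat r φ c d ⊢ s′ ⇓[ n ] s″ → repeat r φ c d ⊢ s ⇓[ 1 + (m + n) ] s″
  leave   : ∀ {r φ c d s s′ n} → φ (topmost r s) ≡ false → d ⊢ s ⇓[ n ] s′ →
          repeat r φ c d ⊢ s ⇓[ 1 + n ] s′

weaken : ∀ {c s s′ m n} → c ⊢ s ⇓[ m ] s′ → m ≤ n → c ⊢ s ⇓[ n ] s′
weaken push (s≤s (s≤s _)) = push
weaken pop (s≤s _) = pop
weaken (_⨾_ {m = m} {k} p q) m+k≤n =
  subst (λ z → _ ⊢ _ ⇓[ z ] _) (m+[n∸m]≡n (m+n≤o⇒m≤o m m+k≤n))
    (p ⨾ weaken q (m+n≤o⇒m≤o∸n k (≤-trans (≤-reflexive (+-comm k m)) m+k≤n)))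
weaken (taken e p) (s≤s m≤n) = taken e (weaken p m≤n)
weaken (skipped e p) (s≤s m≤n) = skipped e (weaken p m≤n)
weaken (again {m = m} {k} e p q) (s≤s m+k≤n) =
  subst (λ z → _ ⊢ _ ⇓[ suc z ] _) (m+[n∸m]≡n (m+n≤o⇒m≤o m m+k≤n))
    (again e p (weaken q (m+n≤o⇒m≤o∸n k (≤-trans (≤-reflexive (+-comm k m)) m+k≤n))))
weaken (leave e p) (s≤s m≤n) = leave e (weaken p m≤n)

-- Compilation to Turing machines

Tapes : Set
Tapes = Vec (Tape 1) 4

Actions : Set
Actions = Vec (Symbol 1 × Move) 4

scan : Tapes → Vec (Symbol 1) 4
scan = Vec.map Tape.scanned

-- The mark is an auxiliary symbol, so that the blank remains the sign of an empty stack.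
toSymbol : Letter → Symbol 1
toSymbol (just b) = bit b
toSymbol ♯        = aux zero

fromSymbol : Symbol 1 → Maybe Letter
fromSymbol blank   = nothing
fromSymbol (bit b) = just (just b)
fromSymbol (aux _) = just ♯

idle : Vec (Symbol 1) 4 → Actions
idle = Vec.map (_, stay)

on : Reg → (Symbol 1 → Symbol 1 × Move) → Vec (Symbol 1) 4 → Actions
on r f ss = Vec.updateAt (idle ss) r (f ∘ proj₁)

State : Cmd → Set
State (push r x)      = Bool
State (pop r)         = ⊤
State (c ⨾ d)         = State c ⊎ State d
State (branch r φ c d)    = Maybe (State c ⊎ State d)
State (repeat r φ c d) = Maybe (State c ⊎ State d)

entry : ∀ c → State c
entry (push r x)      = false
entry (pop r)         = tt
entry (c ⨾ d)         = inj₁ (entry c)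
entry (branch r φ c d)    = nothing
entry (repeat r φ c d) = nothing

-- `k` is where control goes when the part has finished. The tape action of its last transition is
-- kept, so that passing control on costs no step and the costs of a sequence simply add up.
redirect : ∀ {A B : Set} → (A → B) → Maybe B → Maybe A × Actions → Maybe B × Actions
redirect f k (just a , as)  = just (f a) , as
redirect f k (nothing , as) = k , as

-- The state nothing leaves the program.
transition : ∀ c → State c → Vec (Symbol 1) 4 → Maybe (State c) × Actions
transition (push r x) false ss = just true , on r (_, left) ss
transition (push r x) true ss = nothing , on r (λ _ → toSymbol x , stay) ss
transition (pop r) tt ss = nothing , on r (λ _ → blank , right) ss
transition (c ⨾ d) (inj₁ a) ss = redirect inj₁ (just (inj₂ (entry d))) (transition c a ss)
transition (c ⨾ d) (inj₂ b) ss = redirect inj₂ nothing (transition d b ss)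
transition (branch r φ c d) nothing ss =
  just (just (if φ (fromSymbol (lookup ss r)) then inj₁ (entry c) else inj₂ (entry d))) , idle ss
transition (branch r φ c d) (just (inj₁ a)) ss = redirect (just ∘ inj₁) nothing (transition c a ss)
transition (branch r φ c d) (just (inj₂ b)) ss = redirect (just ∘ inj₂) nothing (transition d b ss)
transition (repeat r φ c d) nothing ss =
  just (just (if φ (fromSymbol (lookup ss r)) then inj₁ (entry c) else inj₂ (entry d))) , idle ss
transition (repeat r φ c d) (just (inj₁ a)) ss =
  redirect (just ∘ inj₁) (just nothing) (transition c a ss)
transition (repeat r φ c d) (just (inj₂ b)) ss =
  redirect (just ∘ inj₂) nothing (transition d b ss)

data Run {A : Set} (f : A → Vec (Symbol 1) 4 → Maybe A × Actions) : A → Tapes → ℕ → Tapes → Set where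
  exit : ∀ {a ts n as} → f a (scan ts) ≡ (nothing , as) →
         Run f a ts (suc n) (Vec.zipWith act as ts)
  goto : ∀ {a ts a′ n as ts′} → f a (scan ts) ≡ (just a′ , as) →
         Run f a′ (Vec.zipWith act as ts) n ts′ → Run f a ts (suc n) ts′

module _ {A B : Set} {f : A → Vec (Symbol 1) 4 → Maybe A × Actions}
         {g : B → Vec (Symbol 1) 4 → Maybe B × Actions} (e : A → B) where

  run-embed : (∀ a ss → g (e a) ss ≡ redirect e nothing (f a ss)) →
              ∀ {a ts n ts′} → Run f a ts n ts′ → Run g (e a) ts n ts′
  run-embed h {a} {ts} (exit p) = exit (trans (h a (scan ts)) (cong (redirect e nothing) p))
  run-embed h {a} {ts} (goto p r) =
    goto (trans (h a (scan ts)) (cong (redirect e nothing) p)) (run-embed h r)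

  run-then : ∀ {b} → (∀ a ss → g (e a) ss ≡ redirect e (just b) (f a ss)) →
             ∀ {a ts m n ts′ ts″} → Run f a ts m ts′ → Run g b ts′ n ts″ →
             Run g (e a) ts (m + n) ts″
  run-then {b} h {a} {ts} {n = n} (exit {n = m} p) q =
    goto (trans (h a (scan ts)) (cong (redirect e (just b)) p)) (run-weaken (m≤n+m n m) q)
    where
    run-weaken : ∀ {b ts m n ts′} → m ≤ n → Run g b ts m ts′ → Run g b ts n ts′
    run-weaken (s≤s _) (exit p) = exit p
    run-weaken (s≤s l) (goto p r) = goto p (run-weaken l r)
  run-then {b} h {a} {ts} (goto p r) q =
    goto (trans (h a (scan ts)) (cong (redirect e (just b)) p)) (run-then h r q)

data _⊑_ : List Letter → List (Symbol 1) → Set where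
  []  : ∀ {ss} → All (_≡ blank) ss → [] ⊑ ss
  _∷_ : ∀ x {l ss} → l ⊑ ss → (x ∷ l) ⊑ (toSymbol x ∷ ss)

IsStack : List Letter → Tape 1 → Set
IsStack l t = All (_≡ blank) (Tape.before t) × l ⊑ (Tape.scanned t ∷ Tape.after t)

record Represents (s : Store) (ts : Tapes) : Set where
  constructor represents
  field stack : ∀ r → IsStack (lookup s r) (lookup ts r)

open Represents public

isStack-push₁ : ∀ {l t} → IsStack l t → let t′ = act (Tape.scanned t , left) t in
                All (_≡ blank) (Tape.before t′) × l ⊑ Tape.after t′
isStack-push₁ {t = tape [] s rs} (_ , l) = [] , l
isStack-push₁ {t = tape (_ ∷ _) s rs} (refl ∷ bs , l) = bs , l

isStack-pop : ∀ {l t} → IsStack l t → IsStack (List.drop 1 l) (act (blank , right) t)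
isStack-pop {t = tape ls s []} (bs , [] _) = refl ∷ bs , [] (refl ∷ [])
isStack-pop {t = tape ls s (_ ∷ _)} (bs , [] (_ ∷ as)) = refl ∷ bs , [] as
isStack-pop {t = tape ls s []} (bs , x ∷ [] _) = refl ∷ bs , [] (refl ∷ [])
isStack-pop {t = tape ls s (_ ∷ _)} (bs , x ∷ p) = refl ∷ bs , p

fromSymbol-toSymbol : ∀ x → fromSymbol (toSymbol x) ≡ just x
fromSymbol-toSymbol (just b) = refl
fromSymbol-toSymbol ♯ = refl

isStack-topmost : ∀ {l t} → IsStack l t → fromSymbol (Tape.scanned t) ≡ List.head l
isStack-topmost (_ , [] (refl ∷ _)) = refl
isStack-topmost (_ , x ∷ _) = fromSymbol-toSymbol x

zipWith-idle : ∀ ts → Vec.zipWith act (idle (scan ts)) ts ≡ ts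
zipWith-idle ts = go ts
  where
  go : ∀ {k} (ts : Vec (Tape 1) k) →
       Vec.zipWith act (Vec.map (_, stay) (Vec.map Tape.scanned ts)) ts ≡ ts
  go [] = refl
  go (t ∷ ts) = cong (t ∷_) (go ts)

zipWith-on : ∀ r f ts → Vec.zipWith act (on r f (scan ts)) ts ≡
             Vec.updateAt ts r (λ t → act (f (Tape.scanned t)) t)
zipWith-on r f ts = go r ts
  where
  go : ∀ {k} r (ts : Vec (Tape 1) k) →
       Vec.zipWith act (Vec.updateAt (Vec.map (_, stay) (Vec.map Tape.scanned ts)) r (f ∘ proj₁)) ts ≡
       Vec.updateAt ts r (λ t → act (f (Tape.scanned t)) t)
  go zero (t ∷ ts) = cong (_ ∷_) (zipWith-idle′ ts)
    where
    zipWith-idle′ : ∀ {k} (ts : Vec (Tape 1) k) →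
                    Vec.zipWith act (Vec.map (_, stay) (Vec.map Tape.scanned ts)) ts ≡ ts
    zipWith-idle′ [] = refl
    zipWith-idle′ (t ∷ ts) = cong (t ∷_) (zipWith-idle′ ts)
  go (suc r) (t ∷ ts) = cong (t ∷_) (go r ts)

represents-update : ∀ {s ts} r {f g} → Represents s ts →
                    (IsStack (lookup s r) (lookup ts r) →
                     IsStack (f (lookup s r)) (g (lookup ts r))) →
                    Represents (Vec.updateAt s r f) (Vec.updateAt ts r g)
represents-update {s} {ts} r {f} {g} R h = represents go
  where
  go : ∀ q → IsStack (lookup (Vec.updateAt s r f) q) (lookup (Vec.updateAt ts r g) q)
  go q with q Finₚ.≟ r
  ... | yes refl = subst₂ IsStack (sym (Vecₚ.lookup∘updateAt q s)) (sym (Vecₚ.lookup∘updateAt q ts))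
                     (h (stack R q))
  ... | no q≢r = subst₂ IsStack (sym (Vecₚ.lookup∘updateAt′ q r q≢r s))
                   (sym (Vecₚ.lookup∘updateAt′ q r q≢r ts)) (stack R q)

represents-topmost : ∀ {s ts} r → Represents s ts →
                     fromSymbol (lookup (scan ts) r) ≡ topmost r s
represents-topmost {s} {ts} r R =
  trans (cong fromSymbol (Vecₚ.lookup-map r Tape.scanned ts)) (isStack-topmost (stack R r))

simulation : ∀ {c s s′ n ts} → c ⊢ s ⇓[ n ] s′ → Represents s ts →
             ∃[ ts′ ] (Represents s′ ts′ × Run (transition c) (entry c) ts n ts′)
simulation {ts = ts} (push {r} {x} {s}) R =
  _ , represented , goto refl (exit refl)
  where
  ts₁ = Vec.zipWith act (on r (_, left) (scan ts)) ts
  represented : Represents (pushed r x s)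
                 (Vec.zipWith act (on r (λ _ → toSymbol x , stay) (scan ts₁)) ts₁)
  represented rewrite zipWith-on r (λ _ → toSymbol x , stay) ts₁ | zipWith-on r (_, left) ts
                   | Vecₚ.updateAt-updateAt r {λ t → act (toSymbol x , stay) t}
                       {λ t → act (Tape.scanned t , left) t} ts =
    represents-update r {f = x ∷_} R λ i → let bs , l = isStack-push₁ i in bs , x ∷ l
simulation {ts = ts} (pop {r} {s}) R =
  _ , subst (Represents (popped r s)) (sym (zipWith-on r _ ts)) (represents-update r {g = λ t → act (blank , right) t} R isStack-pop) ,
  exit refl
simulation (p ⨾ q) R with simulation p R
... | _ , R₁ , r₁ with simulation q R₁
... | _ , R₂ , r₂ = _ , R₂ , run-then inj₁ (λ _ _ → refl) r₁ (run-embed inj₂ (λ _ _ → refl) r₂)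
simulation {ts = ts} (taken {r} {φ} e p) R with simulation p R
... | _ , R₁ , r₁ = _ , R₁ ,
  goto (cong (λ z → just (just (if z then _ else _)) , _) (trans (cong φ (represents-topmost r R)) e))
    (subst (λ z → Run _ _ z _ _) (sym (zipWith-idle ts)) (run-embed (just ∘ inj₁) (λ _ _ → refl) r₁))
simulation {ts = ts} (skipped {r} {φ} e p) R with simulation p R
... | _ , R₁ , r₁ = _ , R₁ ,
  goto (cong (λ z → just (just (if z then _ else _)) , _) (trans (cong φ (represents-topmost r R)) e))
    (subst (λ z → Run _ _ z _ _) (sym (zipWith-idle ts)) (run-embed (just ∘ inj₂) (λ _ _ → refl) r₁))
simulation {ts = ts} (again {r} {φ} e p q) R with simulation p R
... | _ , R₁ , r₁ with simulation q R₁
... | _ , R₂ , r₂ = _ , R₂ ,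
  goto (cong (λ z → just (just (if z then _ else _)) , _) (trans (cong φ (represents-topmost r R)) e))
    (subst (λ z → Run _ _ z _ _) (sym (zipWith-idle ts))
      (run-then (just ∘ inj₁) (λ _ _ → refl) r₁ r₂))
simulation {ts = ts} (leave {r} {φ} e p) R with simulation p R
... | _ , R₁ , r₁ = _ , R₁ ,
  goto (cong (λ z → just (just (if z then _ else _)) , _) (trans (cong φ (represents-topmost r R)) e))
    (subst (λ z → Run _ _ z _ _) (sym (zipWith-idle ts)) (run-embed (just ∘ inj₂) (λ _ _ → refl) r₁))

-- A retraction of `Fin count` rather than a bijection. This is closed under retracts, so that the
-- instances below arise from sums and products without any counting.
record Finite (A : Set) : Set where
  field
    count   : ℕ
    index   : A → Fin count
    element : Fin count → A
    element-index : ∀ a → element (index a) ≡ a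

open Finite public

finite-⊤ : Finite ⊤
finite-⊤ = record { count = 1 ; index = λ _ → zero ; element = λ _ → tt ; element-index = λ _ → refl }

finite-⊎ : ∀ {A B} → Finite A → Finite B → Finite (A ⊎ B)
finite-⊎ F G = record
  { count = count F + count G
  ; index = Fin.join (count F) (count G) ∘ Disjoint.map (index F) (index G)
  ; element = Disjoint.map (element F) (element G) ∘ Fin.splitAt (count F)
  ; element-index = λ
      { (inj₁ a) → trans (cong (Disjoint.map _ _) (Finₚ.splitAt-join (count F) (count G) (inj₁ (index F a))))
                         (cong inj₁ (element-index F a))
      ; (inj₂ b) → trans (cong (Disjoint.map _ _) (Finₚ.splitAt-join (count F) (count G) (inj₂ (index G b))))
                         (cong inj₂ (element-index G b)) }
  }

finite-retract : ∀ {A B : Set} (f : A → B) (g : B → A) → (∀ a → g (f a) ≡ a) → Finite B → Finite A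
finite-retract f g gf F = record
  { count = count F ; index = index F ∘ f ; element = g ∘ element F
  ; element-index = λ a → trans (cong g (element-index F (f a))) (gf a) }

finite-Bool : Finite Bool
finite-Bool = finite-retract (λ { false → inj₁ tt ; true → inj₂ tt })
  (λ { (inj₁ _) → false ; (inj₂ _) → true }) (λ { false → refl ; true → refl })
  (finite-⊎ finite-⊤ finite-⊤)

finite-Maybe : ∀ {A} → Finite A → Finite (Maybe A)
finite-Maybe F = finite-retract (λ { nothing → inj₁ tt ; (just a) → inj₂ a })
  (λ { (inj₁ _) → nothing ; (inj₂ a) → just a }) (λ { nothing → refl ; (just a) → refl })
  (finite-⊎ finite-⊤ F)

finite-State : ∀ c → Finite (State c)
finite-State (push r x)      = finite-Bool
finite-State (pop r)         = finite-⊤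
finite-State (c ⨾ d)         = finite-⊎ (finite-State c) (finite-State d)
finite-State (branch r φ c d)    = finite-Maybe (finite-⊎ (finite-State c) (finite-State d))
finite-State (repeat r φ c d) = finite-Maybe (finite-⊎ (finite-State c) (finite-State d))

machine : Cmd → Machine
machine c = record
  { extraTapes = 3
  ; auxSymbols = 1
  ; states = count F
  ; start = index F (just (entry c))
  -- The element `nothing` added to the states of `c` is the halting state: there `element F q` is
  -- `nothing`, and so is the transition.
  ; δ = λ q ss → Maybe.map (λ a → let b , as = transition c a ss in index F b , as) (element F q)
  }
  where F = finite-Maybe (finite-State c)

module _ (c : Cmd) where
  private
    F = finite-Maybe (finite-State c)
  open Machine (machine c) using (_⇓[_]_; step; halt; next; Config)

  machine-step : ∀ a ts → step (index F (just a) , ts) ≡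
                 just (let b , as = transition c a (scan ts) in index F b , Vec.zipWith act as ts)
  machine-step a ts rewrite element-index (finite-State c) a = refl

  machine-halt : ∀ ts → step (index F nothing , ts) ≡ nothing
  machine-halt ts = refl

  machine-run : ∀ {a ts n ts′} → Run (transition c) a ts n ts′ →
                (index F (just a) , ts) ⇓[ n ] (index F nothing , ts′)
  machine-run {a} {ts} (exit {as = as} p) =
    next (trans (machine-step a ts)
           (cong (λ z → just (index F (proj₁ z) , Vec.zipWith act (proj₂ z) ts)) p))
         (halt (machine-halt (Vec.zipWith act as ts)))
  machine-run {a} {ts} (goto p r) =
    next (trans (machine-step a ts)
           (cong (λ z → just (index F (proj₁ z) , Vec.zipWith act (proj₂ z) ts)) p))
         (machine-run r)

-- The local function of readWord, which has no name outside Defs.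
readWord-bits : ∀ ls s rs → ∃[ bits ] readWord {1} (tape ls s rs) ≡ bits (s ∷ rs)
readWord-bits ls s rs = bits , spec
  where
  bits : List (Symbol 1) → List Bool
  bits = _

  spec : readWord (tape ls s rs) ≡ bits (s ∷ rs)
  spec with s ∷ rs
  ... | ss = refl

readWord-stack : ∀ {w t} → IsStack (List.map just w) t → readWord t ≡ w
readWord-stack {w} {tape ls s rs} (_ , i) =
  let bits , spec = readWord-bits ls s rs in
  trans spec (bits-⊑ bits (λ _ _ → refl) refl (λ _ → refl) w i)
  where
  bits-⊑ : (bits : List (Symbol 1) → List Bool) →
           (∀ b ss → bits (bit b ∷ ss) ≡ b ∷ bits ss) →
           bits [] ≡ [] → (∀ ss → bits (blank ∷ ss) ≡ []) →
           ∀ w {ss} → List.map just w ⊑ ss → bits ss ≡ w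
  bits-⊑ bits h-bit h-[] h-blank [] ([] []) = h-[]
  bits-⊑ bits h-bit h-[] h-blank [] ([] (refl ∷ _)) = h-blank _
  bits-⊑ bits h-bit h-[] h-blank (b ∷ w) (_ ∷ i) =
    trans (h-bit b _) (cong (b ∷_) (bits-⊑ bits h-bit h-[] h-blank w i))

word-store : List Bool → Store
word-store w = List.map just w ∷ [] ∷ [] ∷ [] ∷ []

inputTape-isStack : ∀ w → IsStack (List.map just w) (inputTape w)
inputTape-isStack [] = [] , [] (refl ∷ [])
inputTape-isStack (b ∷ w) = [] , just b ∷ word w
  where
  word : ∀ w → List.map just w ⊑ List.map bit w
  word [] = [] []
  word (b ∷ w) = just b ∷ word w

machine-outputs : ∀ c {v w n r₁ r₂ r₃} →
                  c ⊢ word-store w ⇓[ n ] (List.map just v ∷ r₁ ∷ r₂ ∷ r₃ ∷ []) →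
                  Machine.Outputs_On_Within_ (machine c) v w n
machine-outputs c {v} {w} p
  with simulation {ts = inputTape w ∷ Vec.replicate 3 emptyTape} p
    (represents λ { zero → inputTape-isStack w
       ; (suc zero) → [] , [] (refl ∷ [])
       ; (suc (suc zero)) → [] , [] (refl ∷ [])
       ; (suc (suc (suc zero))) → [] , [] (refl ∷ []) })
... | t ∷ ts , R , r = _ , machine-run c r , readWord-stack {v} {t} (stack R zero)


-- Polynomial bounds

record _≲_ {A : Set} (f μ : A → ℕ) : Set where
  constructor bounded
  field
    poly   : Poly 1
    bounds : ∀ x → f x ≤ ⟦ poly ⟧ (μ x ∷ [])

open _≲_ public

infix 4 _≲_

⟦⟧-mono : ∀ (p : Poly 1) {m n} → m ≤ n → ⟦ p ⟧ (m ∷ []) ≤ ⟦ p ⟧ (n ∷ [])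
⟦⟧-mono (con c) m≤n = ≤-refl
⟦⟧-mono (var zero) m≤n = m≤n
⟦⟧-mono (p ⊕ q) m≤n = +-mono-≤ (⟦⟧-mono p m≤n) (⟦⟧-mono q m≤n)
⟦⟧-mono (p ⊗ q) m≤n = *-mono-≤ (⟦⟧-mono p m≤n) (⟦⟧-mono q m≤n)

substitute : ∀ {k} → Poly 1 → Poly k → Poly k
substitute (con c) q = con c
substitute (var _) q = q
substitute (p ⊕ p′) q = substitute p q ⊕ substitute p′ q
substitute (p ⊗ p′) q = substitute p q ⊗ substitute p′ q

substitute-⟦⟧ : ∀ {k} p (q : Poly k) xs → ⟦ substitute p q ⟧ xs ≡ ⟦ p ⟧ (⟦ q ⟧ xs ∷ [])
substitute-⟦⟧ (con c) q xs = refl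
substitute-⟦⟧ (var zero) q xs = refl
substitute-⟦⟧ (p ⊕ p′) q xs = cong₂ _+_ (substitute-⟦⟧ p q xs) (substitute-⟦⟧ p′ q xs)
substitute-⟦⟧ (p ⊗ p′) q xs = cong₂ _*_ (substitute-⟦⟧ p q xs) (substitute-⟦⟧ p′ q xs)

module _ {A : Set} {μ : A → ℕ} where

  ≲-con : ∀ k → (λ _ → k) ≲ μ
  ≲-con k = bounded (con k) (λ _ → ≤-refl)

  ≲-id : μ ≲ μ
  ≲-id = bounded (var zero) (λ _ → ≤-refl)

  infixl 6 _≲+_
  infixl 7 _≲*_

  _≲+_ : ∀ {f g} → f ≲ μ → g ≲ μ → (λ x → f x + g x) ≲ μ
  p ≲+ q = bounded (poly p ⊕ poly q) (λ x → +-mono-≤ (bounds p x) (bounds q x))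

  _≲*_ : ∀ {f g} → f ≲ μ → g ≲ μ → (λ x → f x * g x) ≲ μ
  p ≲* q = bounded (poly p ⊗ poly q) (λ x → *-mono-≤ (bounds p x) (bounds q x))

  ≲-mono : ∀ {f g} → (∀ x → f x ≤ g x) → g ≲ μ → f ≲ μ
  ≲-mono f≤g p = bounded (poly p) (λ x → ≤-trans (f≤g x) (bounds p x))

  ≲-trans : ∀ {f g} → f ≲ g → g ≲ μ → f ≲ μ
  ≲-trans p q = bounded (substitute (poly p) (poly q)) λ x →
    ≤-trans (bounds p x) (≤-trans (⟦⟧-mono (poly p) (bounds q x))
      (≤-reflexive (sym (substitute-⟦⟧ (poly p) (poly q) _))))

  ≲-eval : ∀ (p : Poly 1) {f} → f ≲ μ → (λ x → ⟦ p ⟧ (f x ∷ [])) ≲ μ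
  ≲-eval p = ≲-trans (bounded p (λ _ → ≤-refl))

≲-∘ : ∀ {A B : Set} {f μ : A → ℕ} (h : B → A) → f ≲ μ → (f ∘ h) ≲ (μ ∘ h)
≲-∘ h p = bounded (poly p) (λ x → bounds p (h x))

-- Binary trees as a universal data type, written in prefix notation on the stacks

data Tree : Set where
  leaf : Tree
  node : Tree → Tree → Tree

size : Tree → ℕ
size leaf       = 1
size (node u v) = suc (size u + size v)

pattern store m a b c = m ∷ a ∷ b ∷ c ∷ []

pattern rM = zero
pattern rA = suc zero
pattern rB = suc (suc zero)
pattern rC = suc (suc (suc zero))

prefix : Tree → List Letter → List Letter
prefix leaf       l = 𝟎 ∷ l
prefix (node u v) l = 𝟏 ∷ prefix u (prefix v l)

-- The prefix code as it appears on another stack after being moved there letter by letter.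
reversed : Tree → List Letter → List Letter
reversed leaf       l = 𝟎 ∷ l
reversed (node u v) l = reversed v (reversed u (𝟏 ∷ l))

isI : Maybe Letter → Bool
isI (just 𝟏) = true
isI _        = false

unmarked : Maybe Letter → Bool
unmarked (just (just _)) = true
unmarked _               = false

data Side : Set where
  ᴬ ᴮ : Side

reg : Side → Reg
reg ᴬ = rA
reg ᴮ = rB

sided : Side → (m x y c : List Letter) → Store
sided ᴬ m x y c = store m x y c
sided ᴮ m x y c = store m y x c

push! : ∀ {r x s} → push r x ⊢ s ⇓[ 2 ] pushed r x s
push! = push

pop! : ∀ {r s} → pop r ⊢ s ⇓[ 1 ] popped r s
pop! = pop

-- rC counts the subtrees that are still to be moved.
shifting : Side → Cmd
shifting r = repeat rC isI
  (pop rC ⨾ branch rM isI (pop rM ⨾ push (reg r) 𝟏 ⨾ push rC 𝟏 ⨾ push rC 𝟏) (pop rM ⨾ push (reg r) 𝟎))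
  (pop rC)

-- Stated with an arbitrary continuation of the same loop, so that the two subtrees of a node are
-- handled by applying the induction hypothesis twice within one loop.
shifting-tree : ∀ r t {m x y c n s} → shifting r ⊢ sided r m (reversed t x) y c ⇓[ n ] s →
                shifting r ⊢ sided r (prefix t m) x y (𝟏 ∷ c) ⇓[ 10 * size t + n ] s
shifting-tree ᴬ leaf {n = n} p = weaken (again refl (pop! ⨾ skipped refl (pop! ⨾ push!)) p) (+-monoˡ-≤ n (m≤m+n 6 4))
shifting-tree ᴮ leaf {n = n} p = weaken (again refl (pop! ⨾ skipped refl (pop! ⨾ push!)) p) (+-monoˡ-≤ n (m≤m+n 6 4))
shifting-tree ᴬ (node u v) {n = n} p =
  weaken (again refl (pop! ⨾ taken refl (pop! ⨾ push! ⨾ push! ⨾ push!))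
    (shifting-tree ᴬ u (shifting-tree ᴬ v p)))
    (≤-reflexive (solve 3 (λ u v n → κ 10 :+ (κ 10 :* u :+ (κ 10 :* v :+ n)) :=
                                     κ 10 :* (κ 1 :+ (u :+ v)) :+ n) refl (size u) (size v) n))
shifting-tree ᴮ (node u v) {n = n} p =
  weaken (again refl (pop! ⨾ taken refl (pop! ⨾ push! ⨾ push! ⨾ push!))
    (shifting-tree ᴮ u (shifting-tree ᴮ v p)))
    (≤-reflexive (solve 3 (λ u v n → κ 10 :+ (κ 10 :* u :+ (κ 10 :* v :+ n)) :=
                                     κ 10 :* (κ 1 :+ (u :+ v)) :+ n) refl (size u) (size v) n))

-- The mark on the side register shows `unstash` where the tree ends; the mark on `rC` lies below
-- the counter and ends the loop when no subtree is pending.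
stash : Side → Cmd
stash r = push (reg r) ♯ ⨾ push rC ♯ ⨾ push rC 𝟏 ⨾ shifting r

stash-runs : ∀ r t {m x y c} → stash r ⊢ sided r (prefix t m) x y c ⇓[ 10 * size t + 8 ]
             sided r m (reversed t (♯ ∷ x)) y c
stash-runs ᴬ t {c = c} = weaken (push! ⨾ push! ⨾ push! ⨾ shifting-tree ᴬ t {c = ♯ ∷ c} (leave refl pop!))
  (≤-reflexive (trans (+-comm 6 _) (+-assoc (10 * size t) 2 6)))
stash-runs ᴮ t {c = c} = weaken (push! ⨾ push! ⨾ push! ⨾ shifting-tree ᴮ t {c = ♯ ∷ c} (leave refl pop!))
  (≤-reflexive (trans (+-comm 6 _) (+-assoc (10 * size t) 2 6)))

-- Feeds the letters of a register down to the topmost mark to commands.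
drain : Reg → (Bool → Cmd) → Cmd
drain r f = repeat r unmarked (branch r isI (pop r ⨾ f true) (pop r ⨾ f false)) (pop r)

-- `S l x` is the store with `x` on the drained register and `l` as what has been produced. Leaving
-- `S` open lets the same induction serve for restoring a tree and for discarding it.
drain-reversed : ∀ r f {k} (S : List Letter → List Letter → Store) →
  (∀ {l x} → unmarked (topmost r (S l x)) ≡ unmarked (List.head x)) →
  (∀ {l x} → isI (topmost r (S l x)) ≡ isI (List.head x)) →
  (∀ {b l x} → (pop r ⨾ f b) ⊢ S l (just b ∷ x) ⇓[ k ] S (just b ∷ l) x) →
  ∀ t {l x n s} → drain r f ⊢ S (prefix t l) x ⇓[ n ] s →
  drain r f ⊢ S l (reversed t x) ⇓[ (2 + k) * size t + n ] s
drain-reversed r f {k} S h₁ h₂ h₃ leaf {n = n} p =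
  weaken (again h₁ (skipped h₂ h₃) p) (≤-reflexive (cong (λ z → suc (suc z) + n) (sym (*-identityʳ k))))
drain-reversed r f {k} S h₁ h₂ h₃ (node u v) {n = n} p =
  weaken (drain-reversed r f S h₁ h₂ h₃ v (drain-reversed r f S h₁ h₂ h₃ u (again h₁ (taken h₂ h₃) p)))
    (≤-reflexive (solve 4 (λ k u v n → (κ 2 :+ k) :* v :+ ((κ 2 :+ k) :* u :+ (κ 2 :+ k :+ n)) :=
                       (κ 2 :+ k) :* (κ 1 :+ (u :+ v)) :+ n) refl k (size u) (size v) n))

drain-prefix : ∀ r f {k} (S : List Letter → List Letter → Store) →
  (∀ {l x} → unmarked (topmost r (S l x)) ≡ unmarked (List.head x)) →
  (∀ {l x} → isI (topmost r (S l x)) ≡ isI (List.head x)) →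
  (∀ {b l x} → (pop r ⨾ f b) ⊢ S l (just b ∷ x) ⇓[ k ] S (just b ∷ l) x) →
  ∀ t {l x n s} → drain r f ⊢ S (reversed t l) x ⇓[ n ] s →
  drain r f ⊢ S l (prefix t x) ⇓[ (2 + k) * size t + n ] s
drain-prefix r f {k} S h₁ h₂ h₃ leaf {n = n} p =
  weaken (again h₁ (skipped h₂ h₃) p) (≤-reflexive (cong (λ z → suc (suc z) + n) (sym (*-identityʳ k))))
drain-prefix r f {k} S h₁ h₂ h₃ (node u v) {n = n} p =
  weaken (again h₁ (taken h₂ h₃) (drain-prefix r f S h₁ h₂ h₃ u (drain-prefix r f S h₁ h₂ h₃ v p)))
    (≤-reflexive (solve 4 (λ k u v n → κ 2 :+ k :+ ((κ 2 :+ k) :* u :+ ((κ 2 :+ k) :* v :+ n)) :=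
                       (κ 2 :+ k) :* (κ 1 :+ (u :+ v)) :+ n) refl k (size u) (size v) n))

copyTo : Reg → Bool → Cmd
copyTo r b = push r (just b)

unstash : Side → Cmd
unstash r = drain (reg r) (copyTo rM)

unstash-runs : ∀ r t {m x y c} → unstash r ⊢ sided r m (reversed t (♯ ∷ x)) y c ⇓[ 5 * size t + 2 ]
               sided r (prefix t m) x y c
unstash-runs ᴬ t {y = y} {c} =
  drain-reversed rA (copyTo rM) (λ m x → store m x y c) refl refl (pop! ⨾ push!) t (leave refl pop!)
unstash-runs ᴮ t {y = y} {c} =
  drain-reversed rB (copyTo rM) (λ m x → store m y x c) refl refl (pop! ⨾ push!) t (leave refl pop!)

-- Only a moving loop knows where the tree ends, so the tree is first moved aside. Pushing a letter
-- and popping it again acts as the empty command.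
discard : Cmd
discard = stash ᴬ ⨾ drain rA (λ b → copyTo rM b ⨾ pop rM)

discard-runs : ∀ t {m a b c} → discard ⊢ store (prefix t m) a b c ⇓[ 16 * size t + 10 ] store m a b c
discard-runs t {m} {a} {b} {c} =
  weaken (stash-runs ᴬ t ⨾
    drain-reversed rA (λ b → copyTo rM b ⨾ pop rM) (λ _ x → store m x b c) refl refl (pop! ⨾ push! ⨾ pop!) t {l = []} (leave refl pop!))
    (≤-reflexive (solve 1 (λ t → κ 10 :* t :+ κ 8 :+ (κ 6 :* t :+ κ 2) := κ 16 :* t :+ κ 10)
      refl (size t)))

-- Draining `rA` leaves the tree in prefix order both on `rM` and on `rB`. Pushing the latter
-- directly on `rM` would reverse it, so it takes a detour through `rA`.
duplicate : Cmd
duplicate = stash ᴬ ⨾ push rB ♯ ⨾ drain rA (λ b → copyTo rM b ⨾ copyTo rB b) ⨾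
            push rA ♯ ⨾ drain rB (copyTo rA) ⨾ unstash ᴬ

duplicate-runs : ∀ t {m a b c} → duplicate ⊢ store (prefix t m) a b c ⇓[ 27 * size t + 18 ]
                 store (prefix t (prefix t m)) a b c
duplicate-runs t {m} {a} {b} {c} =
  weaken (stash-runs ᴬ t ⨾ push! ⨾ copying t (leave refl pop!) ⨾ push! ⨾
    drain-prefix rB (copyTo rA) (λ a x → store (prefix t m) a x c) refl refl (pop! ⨾ push!) t (leave refl pop!) ⨾
    unstash-runs ᴬ t)
    (≤-reflexive (solve 1 (λ t → κ 10 :* t :+ κ 8 :+ (κ 2 :+ (κ 7 :* t :+ κ 2 :+
      (κ 2 :+ (κ 5 :* t :+ κ 2 :+ (κ 5 :* t :+ κ 2))))) := κ 27 :* t :+ κ 18)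
      refl (size t)))
  where
  copy = λ b → copyTo rM b ⨾ copyTo rB b
  copying : ∀ t {m x b n s} → drain rA copy ⊢ store (prefix t m) x (prefix t b) c ⇓[ n ] s →
            drain rA copy ⊢ store m (reversed t x) b c ⇓[ 7 * size t + n ] s
  copying leaf p = again refl (skipped refl (pop! ⨾ push! ⨾ push!)) p
  copying (node u v) {n = n} p =
    weaken (copying v (copying u (again refl (taken refl (pop! ⨾ push! ⨾ push!)) p)))
      (≤-reflexive (solve 3 (λ u v n → κ 7 :* v :+ (κ 7 :* u :+ (κ 7 :+ n)) :=
        κ 7 :* (κ 1 :+ (u :+ v)) :+ n) refl (size u) (size v) n))


-- Functions that are computable in time polynomial in a measure of the argument

record Code (X : Set) : Set where
  field code : X → Tree

open Code ⦃ ... ⦄ public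

∣_∣ : ∀ {X} ⦃ _ : Code X ⦄ → X → ℕ
∣ x ∣ = size (code x)

-- In `runs` the rest `m` of the main stack and the other registers are arbitrary and are restored,
-- which is what composition rests on. The measure is separate from the size of the code so that a
-- magnitude can be added to it: pseudo-polynomial time is then the same notion with another `μ`.
record Computable {X Y : Set} ⦃ _ : Code X ⦄ ⦃ _ : Code Y ⦄ (μ : X → ℕ) (f : X → Y) : Set where
  field
    cmd    : Cmd
    size≤  : ∀ x → ∣ x ∣ ≤ μ x
    cost   : X → ℕ
    cost≲  : cost ≲ μ
    runs   : ∀ x {m a b c} → cmd ⊢ store (prefix (code x) m) a b c ⇓[ cost x ]
                                    store (prefix (code (f x)) m) a b c

open Computable public

Poly-time : ∀ {X Y : Set} ⦃ _ : Code X ⦄ ⦃ _ : Code Y ⦄ → (X → Y) → Set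
Poly-time f = Computable ∣_∣ f

-- A command lengthens the main stack by no more than it costs. Hence the running time also bounds
-- the size of the result, and computable functions need no separate bound on their values.
length-growth : ∀ {c s s′ n} → c ⊢ s ⇓[ n ] s′ → length (lookup s′ rM) ≤ length (lookup s rM) + n
length-growth (push {zero} {s = m ∷ _}) = ≤-trans (≤-reflexive (+-comm 1 _)) (+-monoʳ-≤ (length m) (s≤s z≤n))
length-growth (push {suc r} {s = m ∷ _}) = m≤m+n (length m) _
length-growth (pop {zero} {s = [] ∷ _}) = z≤n
length-growth (pop {zero} {s = (_ ∷ m) ∷ _}) = m≤n⇒m≤1+n (m≤m+n (length m) _)
length-growth (pop {suc r} {s = m ∷ _}) = m≤m+n (length m) _
length-growth {s = s} (_⨾_ {m = m} p q) =
  ≤-trans (length-growth q) (≤-trans (+-monoˡ-≤ _ (length-growth p)) (≤-reflexive (+-assoc (length (lookup s rM)) m _)))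
length-growth {s = s} (taken e p) = ≤-trans (length-growth p) (+-monoʳ-≤ (length (lookup s rM)) (n≤1+n _))
length-growth {s = s} (skipped e p) = ≤-trans (length-growth p) (+-monoʳ-≤ (length (lookup s rM)) (n≤1+n _))
length-growth {s = s} (again {m = m} e p q) =
  ≤-trans (length-growth q) (≤-trans (+-monoˡ-≤ _ (length-growth p))
    (≤-trans (≤-reflexive (+-assoc (length (lookup s rM)) m _)) (+-monoʳ-≤ (length (lookup s rM)) (n≤1+n _))))
length-growth {s = s} (leave e p) = ≤-trans (length-growth p) (+-monoʳ-≤ (length (lookup s rM)) (n≤1+n _))

length-prefix : ∀ t l → length (prefix t l) ≡ size t + length l
length-prefix leaf l = refl
length-prefix (node u v) l = cong suc (trans (length-prefix u (prefix v l))
  (trans (cong (size u +_) (length-prefix v l)) (sym (+-assoc (size u) (size v) _))))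

module _ {X Y : Set} ⦃ _ : Code X ⦄ ⦃ _ : Code Y ⦄ {μ : X → ℕ} {f : X → Y} where

  input≲ : Computable μ f → (λ x → ∣ x ∣) ≲ μ
  input≲ F = ≲-mono (size≤ F) ≲-id

  output≲ : Computable μ f → (λ x → ∣ f x ∣) ≲ μ
  output≲ F = ≲-mono (λ x → subst₂ (λ i j → i ≤ j + cost F x)
      (trans (length-prefix (code (f x)) []) (+-identityʳ _))
      (trans (length-prefix (code x) []) (+-identityʳ _))
      (length-growth (runs F x {[]} {[]} {[]} {[]})))
    (input≲ F ≲+ cost≲ F)

  infixr 9 _⊙_

  _⊙_ : ∀ {Z : Set} ⦃ _ : Code Z ⦄ {g : Y → Z} → Poly-time g → Computable μ f → Computable μ (g ∘ f)
  G ⊙ F = record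
    { cmd = cmd F ⨾ cmd G
    ; size≤ = size≤ F
    ; cost = λ x → cost F x + cost G (f x)
    ; cost≲ = cost≲ F ≲+ ≲-trans (≲-∘ f (cost≲ G)) (output≲ F)
    ; runs = λ x → runs F x ⨾ runs G (f x)
    }

  recoded : ∀ {Z : Set} ⦃ _ : Code Z ⦄ {g : X → Z} → (∀ x → code (f x) ≡ code (g x)) →
            Computable μ f → Computable μ g
  recoded f≗g F = record
    { cmd = cmd F ; size≤ = size≤ F ; cost = cost F ; cost≲ = cost≲ F
    ; runs = λ x {m} {a} {b} {c} → subst (λ t → cmd F ⊢ _ ⇓[ _ ] store (prefix t m) a b c)
                                          (f≗g x) (runs F x) }

  extensional : ∀ {g} → (∀ x → f x ≡ g x) → Computable μ f → Computable μ g
  extensional f≗g = recoded (λ x → cong code (f≗g x))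

  remeasure : ∀ {W : Set} ⦃ _ : Code W ⦄ {ν : W → ℕ} (h : W → X) → (∀ w → code (h w) ≡ code w) →
              (∀ w → μ (h w) ≤ ν w) → Computable μ f → Computable ν (f ∘ h)
  remeasure {ν = ν} h h-code h-μ F = record
    { cmd = cmd F
    ; size≤ = λ w → ≤-trans (≤-reflexive (cong size (sym (h-code w)))) (≤-trans (size≤ F (h w)) (h-μ w))
    ; cost = cost F ∘ h
    ; cost≲ = ≲-trans (≲-∘ h (cost≲ F)) (≲-mono h-μ ≲-id)
    ; runs = λ w {m} {a} {b} {c} → subst (λ t → cmd F ⊢ store (prefix t m) a b c ⇓[ _ ] _)
                                     (h-code w) (runs F (h w))
    }

-- A function that does not change the representation costs nothing.
recode : ∀ {X Y : Set} ⦃ _ : Code X ⦄ ⦃ _ : Code Y ⦄ (f : X → Y) → (∀ x → code (f x) ≡ code x) →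
         ∀ {μ} → (∀ x → ∣ x ∣ ≤ μ x) → Computable μ f
recode f f-code h = record
  { cmd = push rA 𝟎 ⨾ pop rA
  ; size≤ = h
  ; cost = λ _ → 3
  ; cost≲ = ≲-con 3
  ; runs = λ x {m} {a} {b} {c} → subst (λ t → _ ⊢ _ ⇓[ _ ] store (prefix t m) a b c) (sym (f-code x)) (push! ⨾ pop!)
  }

instance
  code-⊤ : Code ⊤
  code-⊤ = record { code = λ _ → leaf }

  code-Bool : Code Bool
  code-Bool = record { code = λ { false → leaf ; true → node leaf leaf } }

  code-× : ∀ {X Y} ⦃ _ : Code X ⦄ ⦃ _ : Code Y ⦄ → Code (X × Y)
  code-× = record { code = λ (x , y) → node (code x) (code y) }

  code-Maybe : ∀ {X} ⦃ _ : Code X ⦄ → Code (Maybe X)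
  code-Maybe = record { code = λ { nothing → leaf ; (just x) → node (code x) leaf } }

size-Bool : ∀ (b : Bool) → ∣ b ∣ ≤ 3
size-Bool false = s≤s z≤n
size-Bool true  = ≤-refl

codeList : ∀ {X} ⦃ _ : Code X ⦄ → List X → Tree
codeList []       = leaf
codeList (x ∷ xs) = node (code x) (codeList xs)

instance
  code-List : ∀ {X} ⦃ _ : Code X ⦄ → Code (List X)
  code-List = record { code = codeList }

module _ {X : Set} ⦃ _ : Code X ⦄ where

  idᶜ : Poly-time (λ (x : X) → x)
  idᶜ = recode id (λ _ → refl) (λ _ → ≤-refl)

  constᶜ : ∀ {Y} ⦃ _ : Code Y ⦄ (y : Y) → Poly-time (λ (x : X) → y)
  constᶜ y = record
    { cmd = discard ⨾ write (code y)
    ; size≤ = λ _ → ≤-refl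
    ; cost = λ x → 16 * ∣ x ∣ + 10 + 3 * size (code y)
    ; cost≲ = ≲-con 16 ≲* ≲-id ≲+ ≲-con 10 ≲+ ≲-con _
    ; runs = λ x → discard-runs (code x) ⨾ write-runs (code y)
    }
    where
    write : Tree → Cmd
    write leaf       = push rM 𝟎
    write (node u v) = write v ⨾ write u ⨾ push rM 𝟏
    write-runs : ∀ t {m a b c} → write t ⊢ store m a b c ⇓[ 3 * size t ] store (prefix t m) a b c
    write-runs leaf = push
    write-runs (node u v) = weaken (write-runs v ⨾ write-runs u ⨾ push!)
      (≤-trans (m≤m+n _ 1) (≤-reflexive (solve 2 (λ u v → κ 3 :* v :+ (κ 3 :* u :+ κ 2) :+ κ 1 :=
        κ 3 :* (κ 1 :+ (u :+ v))) refl (size u) (size v))))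

module _ {X Y Z : Set} ⦃ _ : Code X ⦄ ⦃ _ : Code Y ⦄ ⦃ _ : Code Z ⦄ {μ : X → ℕ}
         {f : X → Y} {g : X → Z} where

  infixr 4 _▵_

  _▵_ : Computable μ f → Computable μ g → Computable μ (λ x → f x , g x)
  F ▵ G = record
    { cmd = duplicate ⨾ cmd F ⨾ stash ᴬ ⨾ cmd G ⨾ unstash ᴬ ⨾ push rM 𝟏
    ; size≤ = size≤ F
    ; cost = λ x → 27 * ∣ x ∣ + 18 + (cost F x + (10 * ∣ f x ∣ + 8 + (cost G x + (5 * ∣ f x ∣ + 2 + 2))))
    ; cost≲ = ≲-con 27 ≲* input≲ F ≲+ ≲-con 18 ≲+ (cost≲ F ≲+ (≲-con 10 ≲* output≲ F ≲+ ≲-con 8 ≲+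
              (cost≲ G ≲+ (≲-con 5 ≲* output≲ F ≲+ ≲-con 2 ≲+ ≲-con 2))))
    ; runs = λ x → duplicate-runs (code x) ⨾ runs F x ⨾ stash-runs ᴬ (code (f x)) ⨾ runs G x ⨾
                   unstash-runs ᴬ (code (f x)) ⨾ push!
    }

module _ {X Y : Set} ⦃ _ : Code X ⦄ ⦃ _ : Code Y ⦄ where

  fstᶜ : Poly-time (λ (p : X × Y) → proj₁ p)
  fstᶜ = record
    { cmd = pop rM ⨾ stash ᴬ ⨾ discard ⨾ unstash ᴬ
    ; size≤ = λ _ → ≤-refl
    ; cost = λ (x , y) → 1 + (10 * ∣ x ∣ + 8 + (16 * ∣ y ∣ + 10 + (5 * ∣ x ∣ + 2)))
    ; cost≲ = ≲-con 1 ≲+ (≲-con 10 ≲* x≲ ≲+ ≲-con 8 ≲+ (≲-con 16 ≲* y≲ ≲+ ≲-con 10 ≲+ (≲-con 5 ≲* x≲ ≲+ ≲-con 2)))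
    ; runs = λ (x , y) → pop! ⨾ stash-runs ᴬ (code x) ⨾ discard-runs (code y) ⨾ unstash-runs ᴬ (code x)
    }
    where
    x≲ = ≲-mono (λ (x , y) → m≤n⇒m≤1+n (m≤m+n ∣ x ∣ ∣ y ∣)) ≲-id
    y≲ = ≲-mono (λ (x , y) → m≤n⇒m≤1+n (m≤n+m ∣ y ∣ ∣ x ∣)) ≲-id

  sndᶜ : Poly-time (λ (p : X × Y) → proj₂ p)
  sndᶜ = record
    { cmd = pop rM ⨾ discard
    ; size≤ = λ _ → ≤-refl
    ; cost = λ (x , y) → 1 + (16 * ∣ x ∣ + 10)
    ; cost≲ = ≲-con 1 ≲+ (≲-con 16 ≲* x≲ ≲+ ≲-con 10)
    ; runs = λ (x , y) → pop! ⨾ discard-runs (code x)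
    }
    where
    x≲ = ≲-mono (λ (x , y) → m≤n⇒m≤1+n (m≤m+n ∣ x ∣ ∣ y ∣)) ≲-id

-- Booleans, options and lists all reveal their constructor at the root of the code, so one test of
-- the first letter serves for all of them. `w` is the content of a node, such as the pair of head
-- and tail, read as a value with the same code.
RootCases : ∀ {X S W Z : Set} ⦃ _ : Code S ⦄ ⦃ _ : Code W ⦄ →
            (X → S) → (X → Z) → (W × X → Z) → (X → Z) → X → Set
RootCases s g h f x = (code (s x) ≡ leaf × f x ≡ g x) ⊎
                      ∃[ w ] (code (s x) ≡ code w × ∃[ u ] ∃[ v ] code w ≡ node u v × f x ≡ h (w , x))

module _ {X S W Z : Set} ⦃ _ : Code X ⦄ ⦃ _ : Code S ⦄ ⦃ _ : Code W ⦄ ⦃ _ : Code Z ⦄ {μ : X → ℕ}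
         {s : X → S} {g : X → Z} {h : W × X → Z} {f : X → Z} where

  caseᶜ : Computable μ s → Computable μ g → Poly-time h →
          (∀ x → RootCases s g h f x) →
          Computable μ f
  caseᶜ S G H cases = record
    -- The codes of `s x` and `x` lie on top of each other: a further `𝟏` in front turns them into
    -- the code of the pair `(w , x)`, and popping a leaf leaves `x` alone.
    { cmd = duplicate ⨾ cmd S ⨾ branch rM isI (push rM 𝟏 ⨾ cmd H) (pop rM ⨾ cmd G)
    ; size≤ = size≤ S
    ; cost = λ x → 27 * ∣ x ∣ + 18 + (cost S x + (4 + cost-cases x (cases x)))
    ; cost≲ = ≲-con 27 ≲* input≲ S ≲+ ≲-con 18 ≲+ (cost≲ S ≲+ (≲-con 4 ≲+
        ≲-mono (λ x → cost-cases≤ x (cases x))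
          (cost≲ G ≲+ ≲-eval (poly (cost≲ H)) (≲-con 1 ≲+ (output≲ S ≲+ input≲ S)))))
    ; runs = λ x → duplicate-runs (code x) ⨾ runs S x ⨾ branch-runs x (cases x)
    }
    where
    Cases : X → Set
    Cases = RootCases s g h f

    cost-cases : ∀ x → Cases x → ℕ
    cost-cases x (inj₁ _)       = cost G x
    cost-cases x (inj₂ (w , _)) = cost H (w , x)

    cost-cases≤ : ∀ x (k : Cases x) → cost-cases x k ≤
                  cost G x + ⟦ poly (cost≲ H) ⟧ ((1 + (∣ s x ∣ + ∣ x ∣)) ∷ [])
    cost-cases≤ x (inj₁ _) = m≤m+n (cost G x) _
    cost-cases≤ x (inj₂ (w , e , _)) = ≤-trans (bounds (cost≲ H) (w , x))
      (≤-trans (≤-reflexive (cong (λ t → ⟦ poly (cost≲ H) ⟧ ((1 + (size t + ∣ x ∣)) ∷ [])) (sym e)))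
               (m≤n+m _ (cost G x)))

    branch-runs : ∀ x (k : Cases x) {m a b c} →
      branch rM isI (push rM 𝟏 ⨾ cmd H) (pop rM ⨾ cmd G) ⊢
      store (prefix (code (s x)) (prefix (code x) m)) a b c ⇓[ 4 + cost-cases x k ]
      store (prefix (code (f x)) m) a b c
    branch-runs x (inj₁ (e , q)) rewrite e | q =
      skipped refl (weaken (pop! ⨾ runs G x) (s≤s (m≤n+m _ 2)))
    branch-runs x (inj₂ (w , e , u , v , e′ , q)) {m} {a} {b} {c} rewrite trans e e′ | q =
      taken refl (weaken (push! ⨾ subst (λ t → cmd H ⊢ store (𝟏 ∷ prefix t (prefix (code x) m)) a b c ⇓[ _ ] store (prefix (code (h (w , x))) m) a b c) e′ (runs H (w , x)))
                         (s≤s (s≤s (m≤n+m _ 1))))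


size-suffix : ∀ {X} ⦃ _ : Code X ⦄ (ys : List X) {zs l} → ys ++ zs ≡ l → ∣ zs ∣ ≤ ∣ l ∣
size-suffix [] refl = ≤-refl
size-suffix (y ∷ ys) refl = m≤n⇒m≤1+n (≤-trans (size-suffix ys refl) (m≤n+m _ ∣ y ∣))

length≤size : ∀ {X} ⦃ _ : Code X ⦄ (xs : List X) → length xs ≤ ∣ xs ∣
length≤size []       = z≤n
length≤size (x ∷ xs) = s≤s (≤-trans (length≤size xs) (m≤n+m _ ∣ x ∣))

module _ {X E Y : Set} ⦃ _ : Code X ⦄ ⦃ _ : Code E ⦄ ⦃ _ : Code Y ⦄ {μ : X → ℕ}
         {i : X → Y} {l : X → List E} {s : E × (Y × X) → Y} where

  -- Iterating a polynomial-time step can produce values of exponential size, whence the hypothesis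
  -- that the accumulators of all prefixes of the list stay below a polynomial bound.
  foldlᶜ : Computable μ i → Computable μ l → Poly-time s →
           (bound : X → ℕ) → bound ≲ μ →
           (∀ x ys zs → ys ++ zs ≡ l x → ∣ foldl (λ y e → s (e , y , x)) (i x) ys ∣ ≤ bound x) →
           Computable μ (λ x → foldl (λ y e → s (e , y , x)) (i x) (l x))
  foldlᶜ I L S bound bound≲ small = record
    { cmd = duplicate ⨾ cmd I ⨾ stash ᴬ ⨾ duplicate ⨾ cmd L ⨾ stash ᴮ ⨾ unstash ᴬ ⨾ unstash ᴮ ⨾ iterate
    ; size≤ = size≤ L
    ; cost = λ x → 27 * ∣ x ∣ + 18 + (cost I x + (10 * ∣ i x ∣ + 8 + (27 * ∣ x ∣ + 18 +
        (cost L x + (10 * ∣ l x ∣ + 8 + (5 * ∣ i x ∣ + 2 + (5 * ∣ l x ∣ + 2 +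
        (length (l x) * (1 + per-step x) + finish x))))))))
    ; cost≲ = ≲-con 27 ≲* x≲ ≲+ ≲-con 18 ≲+ (cost≲ I ≲+ (≲-con 10 ≲* output≲ I ≲+ ≲-con 8 ≲+
        (≲-con 27 ≲* x≲ ≲+ ≲-con 18 ≲+ (cost≲ L ≲+ (≲-con 10 ≲* output≲ L ≲+ ≲-con 8 ≲+
        (≲-con 5 ≲* output≲ I ≲+ ≲-con 2 ≲+ (≲-con 5 ≲* output≲ L ≲+ ≲-con 2 ≲+
        (≲-mono (λ x → length≤size (l x)) (output≲ L) ≲* (≲-con 1 ≲+ per-step≲) ≲+ finish≲))))))))
    ; runs = λ x → duplicate-runs (code x) ⨾ runs I x ⨾ stash-runs ᴬ (code (i x)) ⨾
        duplicate-runs (code x) ⨾ runs L x ⨾ stash-runs ᴮ (code (l x)) ⨾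
        unstash-runs ᴬ (code (i x)) ⨾ unstash-runs ᴮ (code (l x)) ⨾ iterate-runs x [] (l x) refl
    }
    where
    acc : X → List E → Y
    acc x = foldl (λ y e → s (e , y , x)) (i x)

    x≲ : (λ x → ∣ x ∣) ≲ μ
    x≲ = input≲ L

    total : X → ℕ
    total x = ∣ l x ∣ + bound x + ∣ x ∣

    per-step finish : X → ℕ
    per-step x = 40 * total x + 60 + ⟦ poly (cost≲ S) ⟧ ((1 + total x) ∷ [])
    finish x = 15 * bound x + 16 * ∣ x ∣ + 22

    total≲ : total ≲ μ
    total≲ = output≲ L ≲+ bound≲ ≲+ x≲

    per-step≲ : per-step ≲ μ
    per-step≲ = ≲-con 40 ≲* total≲ ≲+ ≲-con 60 ≲+ ≲-eval (poly (cost≲ S)) (≲-con 1 ≲+ total≲)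

    finish≲ : finish ≲ μ
    finish≲ = ≲-con 15 ≲* bound≲ ≲+ ≲-con 16 ≲* x≲ ≲+ ≲-con 22

    body iterate : Cmd
    -- From the list, the accumulator and `x` on the main stack this builds the triple
    -- `(e , acc , x)` above a second copy of `x`, while the rest of the list waits on `rB`.
    body = pop rM ⨾ stash ᴬ ⨾ stash ᴮ ⨾ stash ᴬ ⨾ duplicate ⨾ unstash ᴬ ⨾ push rM 𝟏 ⨾
           unstash ᴬ ⨾ push rM 𝟏 ⨾ cmd S ⨾ unstash ᴮ
    iterate = repeat rM isI body (pop rM ⨾ stash ᴬ ⨾ discard ⨾ unstash ᴬ)

    step-cost : ∀ x ys e zs → ys ++ e ∷ zs ≡ l x →
      1 + (10 * ∣ e ∣ + 8 + (10 * ∣ zs ∣ + 8 + (10 * ∣ acc x ys ∣ + 8 + (27 * ∣ x ∣ + 18 +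
      (5 * ∣ acc x ys ∣ + 2 + (2 + (5 * ∣ e ∣ + 2 + (2 + (cost S (e , acc x ys , x) +
      (5 * ∣ zs ∣ + 2)))))))))) ≤ per-step x
    step-cost x ys e zs p = begin
      _ ≡⟨ solve 5 (λ e z a x k → κ 1 :+ (κ 10 :* e :+ κ 8 :+ (κ 10 :* z :+ κ 8 :+
             (κ 10 :* a :+ κ 8 :+ (κ 27 :* x :+ κ 18 :+ (κ 5 :* a :+ κ 2 :+ (κ 2 :+
             (κ 5 :* e :+ κ 2 :+ (κ 2 :+ (k :+ (κ 5 :* z :+ κ 2)))))))))) :=
             κ 15 :* (κ 1 :+ (e :+ z) :+ a) :+ κ 27 :* x :+ κ 38 :+ k) refl
             (∣ e ∣) (∣ zs ∣) (∣ acc x ys ∣) (∣ x ∣) (cost S (e , acc x ys , x)) ⟩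
      15 * (∣ e ∷ zs ∣ + ∣ acc x ys ∣) + 27 * ∣ x ∣ + 38 + cost S (e , acc x ys , x)
        ≤⟨ +-mono-≤ (+-mono-≤ (+-mono-≤ (*-mono-≤ (m≤m+n 15 25) sizes) (*-monoˡ-≤ (∣ x ∣) (m≤m+n 27 13)))
             (m≤m+n 38 22)) (≤-trans (bounds (cost≲ S) _) (⟦⟧-mono (poly (cost≲ S)) sizes′)) ⟩
      40 * (∣ l x ∣ + bound x) + 40 * ∣ x ∣ + 60 + ⟦ poly (cost≲ S) ⟧ ((1 + total x) ∷ [])
        ≡⟨ cong (λ z → z + 60 + ⟦ poly (cost≲ S) ⟧ ((1 + total x) ∷ []))
             (sym (*-distribˡ-+ 40 (∣ l x ∣ + bound x) (∣ x ∣))) ⟩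
      per-step x ∎
      where
      open ≤-Reasoning
      sizes : ∣ e ∷ zs ∣ + ∣ acc x ys ∣ ≤ ∣ l x ∣ + bound x
      sizes = +-mono-≤ (size-suffix ys p) (small x ys (e ∷ zs) p)
      sizes′ : ∣ (e , acc x ys , x) ∣ ≤ 1 + total x
      sizes′ = s≤s (≤-trans (≤-trans (≤-reflexive (trans (+-suc (∣ e ∣) _)
          (cong suc (sym (+-assoc (∣ e ∣) (∣ acc x ys ∣) (∣ x ∣))))))
        (+-monoˡ-≤ (∣ x ∣) (+-monoˡ-≤ (∣ acc x ys ∣) (s≤s (m≤m+n (∣ e ∣) (∣ zs ∣))))))
        (+-monoˡ-≤ (∣ x ∣) sizes))

    iterate-runs : ∀ x ys zs → ys ++ zs ≡ l x → ∀ {m a b c} →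
      iterate ⊢ store (prefix (code zs) (prefix (code (acc x ys)) (prefix (code x) m))) a b c
        ⇓[ length zs * (1 + per-step x) + finish x ]
      store (prefix (code (acc x (l x))) m) a b c
    iterate-runs x ys [] p {m} {a} {b} {c} =
      subst (λ k → iterate ⊢ store (𝟎 ∷ prefix (code (acc x ys)) (prefix (code x) m)) a b c ⇓[ finish x ]
                       store (prefix (code (acc x k)) m) a b c)
        (trans (sym (Listₚ.++-identityʳ ys)) p)
      (weaken (leave refl (pop! ⨾ stash-runs ᴬ (code (acc x ys)) ⨾ discard-runs (code x) ⨾
        unstash-runs ᴬ (code (acc x ys))))
        (≤-trans (≤-reflexive (solve 2 (λ a x → κ 2 :+ (κ 10 :* a :+ κ 8 :+
            (κ 16 :* x :+ κ 10 :+ (κ 5 :* a :+ κ 2))) := κ 15 :* a :+ κ 16 :* x :+ κ 22)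
            refl (∣ acc x ys ∣) (∣ x ∣)))
          (+-monoˡ-≤ 22 (+-monoˡ-≤ (16 * ∣ x ∣) (*-monoʳ-≤ 15 (small x ys [] p))))))
    iterate-runs x ys (e ∷ zs) p {m} {a} {b} {c} =
      weaken (again refl
        (weaken (pop! ⨾ stash-runs ᴬ (code e) ⨾ stash-runs ᴮ (code zs) ⨾ stash-runs ᴬ (code (acc x ys)) ⨾
          duplicate-runs (code x) ⨾ unstash-runs ᴬ (code (acc x ys)) ⨾ push! ⨾ unstash-runs ᴬ (code e) ⨾
          push! ⨾ runs S (e , acc x ys , x) ⨾ unstash-runs ᴮ (code zs)) (step-cost x ys e zs p))
        (subst (λ y → iterate ⊢ store (prefix (code zs) (prefix (code y) (prefix (code x) m))) a b c
                        ⇓[ length zs * (1 + per-step x) + finish x ]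
                        store (prefix (code (acc x (l x))) m) a b c)
          (Listₚ.foldl-∷ʳ _ (i x) e ys)
          (iterate-runs x (ys ++ [ e ]) zs (trans (Listₚ.++-assoc ys [ e ] zs) p))))
        (≤-reflexive (cong suc (sym (+-assoc (per-step x) _ _))))

  -- If a step adds an amount that does not depend on the accumulator, the accumulators grow at most
  -- linearly with the number of steps, at a rate polynomial in the measure.
  foldl-growthᶜ : Computable μ i → Computable μ l → Poly-time s →
                  (growth : E × X → ℕ) → growth ≲ ∣_∣ →
                  (∀ e y x → ∣ s (e , y , x) ∣ ≤ ∣ y ∣ + growth (e , x)) →
                  Computable μ (λ x → foldl (λ y e → s (e , y , x)) (i x) (l x))
  foldl-growthᶜ I L S growth growth≲ grows =
    foldlᶜ I L S
      (λ x → ∣ i x ∣ + ∣ l x ∣ * rate x)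
      (output≲ I ≲+ output≲ L ≲* ≲-eval (poly growth≲) (≲-con 1 ≲+ output≲ L ≲+ input≲ L))
      (λ x ys zs p → ≤-trans
        (go x ys (i x) zs p)
        (+-monoʳ-≤ (∣ i x ∣) (*-monoˡ-≤ (rate x) (≤-trans (m≤m+n _ (length zs))
          (≤-trans (≤-reflexive (trans (sym (Listₚ.length-++ ys)) (cong length p))) (length≤size (l x)))))))
    where
    rate : X → ℕ
    rate x = ⟦ poly growth≲ ⟧ ((1 + ∣ l x ∣ + ∣ x ∣) ∷ [])
    go′ : ∀ x ys y w → (∀ {us e vs} → us ++ e ∷ vs ≡ ys → growth (e , x) ≤ w) →
          ∣ foldl (λ y e → s (e , y , x)) y ys ∣ ≤ ∣ y ∣ + length ys * w
    go′ x [] y w h = m≤m+n _ _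
    go′ x (e ∷ ys) y w h = ≤-trans (go′ x ys (s (e , y , x)) w (λ {us} q → h {e ∷ us} (cong (e ∷_) q)))
      (≤-trans (+-monoˡ-≤ (length ys * w) (≤-trans (grows e y x) (+-monoʳ-≤ (∣ y ∣) (h {[]} refl))))
        (≤-reflexive (+-assoc (∣ y ∣) w (length ys * w))))
    go : ∀ x ys y zs → ys ++ zs ≡ l x →
         ∣ foldl (λ y e → s (e , y , x)) y ys ∣ ≤ ∣ y ∣ + length ys * rate x
    go x ys y zs p = go′ x ys y (rate x) λ {us} {e} {vs} q →
      ≤-trans (bounds growth≲ (e , x)) (⟦⟧-mono (poly growth≲) (s≤s (+-monoˡ-≤ (∣ x ∣)
        (≤-trans (≤-trans (m≤m+n _ _) (n≤1+n _)) (size-suffix us {e ∷ (vs ++ zs)}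
          (trans (trans (sym (Listₚ.++-assoc us (e ∷ vs) zs)) (cong (_++ zs) q)) p))))))

-- Words on the tapes

nonempty : Maybe Letter → Bool
nonempty (just _) = true
nonempty nothing  = false

push-bit : Bool → Cmd
push-bit false = push rM 𝟎 ⨾ push rM 𝟏
push-bit true  = push rM 𝟎 ⨾ push rM 𝟎 ⨾ push rM 𝟏 ⨾ push rM 𝟏

read : Cmd
read = push rA ♯ ⨾ repeat rM nonempty (branch rM isI (pop rM ⨾ push rA 𝟏) (pop rM ⨾ push rA 𝟎))
                                      (push rM 𝟎 ⨾ drain rA push-bit)

drain-ʳ++ : ∀ f (S : List Bool → Store) {x} k →
  (∀ {b v x} → (pop rA ⨾ f b) ⊢ Vec.updateAt (S v) rA (λ _ → just b ∷ x) ⇓[ k ]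
                                Vec.updateAt (S (b ∷ v)) rA (λ _ → x)) →
  (∀ {v x} → topmost rA (Vec.updateAt (S v) rA (λ _ → x)) ≡ List.head x) →
  ∀ w v {n s} → drain rA f ⊢ Vec.updateAt (S (w ++ v)) rA (λ _ → x) ⇓[ n ] s →
  drain rA f ⊢ Vec.updateAt (S v) rA (λ _ → List.map just w List.ʳ++ x) ⇓[ (2 + k) * length w + n ] s
drain-ʳ++ f S {x} k h top [] v {n} p = weaken p (m≤n+m n _)
drain-ʳ++ f S {x} k h top (b ∷ w) v {n} p =
  weaken (drain-ʳ++ f S k h top w v (once b p))
    (≤-reflexive (solve 3 (λ k w n → (κ 2 :+ k) :* w :+ (κ 2 :+ k :+ n) :=
      (κ 2 :+ k) :* (κ 1 :+ w) :+ n) refl k (length w) n))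
  where
  once : ∀ b {v x n s} → drain rA f ⊢ Vec.updateAt (S (b ∷ v)) rA (λ _ → x) ⇓[ n ] s →
         drain rA f ⊢ Vec.updateAt (S v) rA (λ _ → just b ∷ x) ⇓[ 2 + k + n ] s
  once false p = again (cong unmarked top) (skipped (cong isI top) h) p
  once true  p = again (cong unmarked top) (taken (cong isI top) h) p

module _ where
  private
    exit-read loop-read : Cmd
    exit-read = push rM 𝟎 ⨾ drain rA push-bit
    loop-read = repeat rM nonempty (branch rM isI (pop rM ⨾ push rA 𝟏) (pop rM ⨾ push rA 𝟎)) exit-read

    reading : ∀ w {x n s} → loop-read ⊢ store [] (List.map just w List.ʳ++ x) [] [] ⇓[ n ] s →
              loop-read ⊢ store (List.map just w) x [] [] ⇓[ 5 * length w + n ] s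
    reading [] p = p
    reading (false ∷ w) {n = n} p = weaken (again refl (skipped refl (pop! ⨾ push!)) (reading w p))
      (≤-reflexive (solve 2 (λ w n → κ 5 :+ (κ 5 :* w :+ n) := κ 5 :* (κ 1 :+ w) :+ n) refl (length w) n))
    reading (true ∷ w) {n = n} p = weaken (again refl (taken refl (pop! ⨾ push!)) (reading w p))
      (≤-reflexive (solve 2 (λ w n → κ 5 :+ (κ 5 :* w :+ n) := κ 5 :* (κ 1 :+ w) :+ n) refl (length w) n))

    drained : ∀ w → drain rA push-bit ⊢ store (prefix leaf []) (List.map just w List.ʳ++ [ ♯ ]) [] []
              ⇓[ 11 * length w + 2 ] store (prefix (code w) []) [] [] []
    drained w = drain-ʳ++ push-bit (λ v → store (prefix (code v) []) [] [] []) 9 (λ {b} → once b) refl w []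
      (subst (λ v → drain rA push-bit ⊢ store (prefix (code v) []) [ ♯ ] [] [] ⇓[ 2 ]
                      store (prefix (code w) []) [] [] []) (sym (Listₚ.++-identityʳ w))
        (leave refl pop!))
      where
      once : ∀ b {v x} → (pop rA ⨾ push-bit b) ⊢ store (prefix (codeList v) []) (just b ∷ x) [] [] ⇓[ 9 ]
                                               store (prefix (codeList (b ∷ v)) []) x [] []
      once false = weaken (pop! ⨾ push! ⨾ push!) (m≤m+n 5 4)
      once true  = pop! ⨾ push! ⨾ push! ⨾ push! ⨾ push!

  read-runs : ∀ w → read ⊢ word-store w ⇓[ 16 * length w + 7 ] store (prefix (code w) []) [] [] []
  read-runs w = weaken (push! ⨾ reading w (leave refl (push! ⨾ drained w)))
    (≤-reflexive (solve 1 (λ w → κ 2 :+ (κ 5 :* w :+ (κ 3 :+ (κ 11 :* w :+ κ 2))) :=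
      κ 16 :* w :+ κ 7) refl (length w)))

write : Cmd
write = push rA ♯ ⨾ repeat rM isI (pop rM ⨾ branch rM isI (pop rM ⨾ pop rM ⨾ pop rM ⨾ push rA 𝟏)
                                                          (pop rM ⨾ push rA 𝟎))
                                  (pop rM ⨾ drain rA (copyTo rM))

module _ where
  private
    loop-write : Cmd
    loop-write = repeat rM isI (pop rM ⨾ branch rM isI (pop rM ⨾ pop rM ⨾ pop rM ⨾ push rA 𝟏)
                                                       (pop rM ⨾ push rA 𝟎))
                               (pop rM ⨾ drain rA (copyTo rM))

    writing : ∀ w {x n s} → loop-write ⊢ store [ 𝟎 ] (List.map just w List.ʳ++ x) [] [] ⇓[ n ] s →
              loop-write ⊢ store (prefix (code w) []) x [] [] ⇓[ 8 * length w + n ] s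
    writing [] p = p
    writing (false ∷ w) {n = n} p = weaken (again refl (pop! ⨾ skipped refl (pop! ⨾ push!)) (writing w p))
      (≤-trans (m≤m+n _ 2) (≤-reflexive (solve 2 (λ w n → κ 6 :+ (κ 8 :* w :+ n) :+ κ 2 :=
        κ 8 :* (κ 1 :+ w) :+ n) refl (length w) n)))
    writing (true ∷ w) {n = n} p =
      weaken (again refl (pop! ⨾ taken refl (pop! ⨾ pop! ⨾ pop! ⨾ push!)) (writing w p))
      (≤-reflexive (solve 2 (λ w n → κ 8 :+ (κ 8 :* w :+ n) := κ 8 :* (κ 1 :+ w) :+ n) refl (length w) n))

    emptied : ∀ w → drain rA (copyTo rM) ⊢ store [] (List.map just w List.ʳ++ [ ♯ ]) [] []
              ⇓[ 5 * length w + 2 ] word-store w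
    emptied w = drain-ʳ++ (copyTo rM) word-store 3 (pop! ⨾ push!) refl w []
      (subst (λ v → drain rA (copyTo rM) ⊢ store (List.map just v) [ ♯ ] [] [] ⇓[ 2 ]
                      store (List.map just w) [] [] []) (sym (Listₚ.++-identityʳ w))
        (leave refl pop!))

  write-runs : ∀ w → write ⊢ store (prefix (code w) []) [] [] [] ⇓[ 13 * length w + 6 ] word-store w
  write-runs w = weaken (push! ⨾ writing w (leave refl (pop! ⨾ emptied w)))
    (≤-reflexive (solve 1 (λ w → κ 2 :+ (κ 8 :* w :+ (κ 2 :+ (κ 5 :* w :+ κ 2))) :=
      κ 13 :* w :+ κ 6) refl (length w)))

size-word : ∀ (w : List Bool) → ∣ w ∣ ≤ 4 * length w + 1
size-word [] = ≤-refl
size-word (false ∷ w) = ≤-trans (+-monoʳ-≤ 2 (size-word w)) (≤-trans (m≤m+n _ 2)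
  (≤-reflexive (solve 1 (λ w → κ 2 :+ (κ 4 :* w :+ κ 1) :+ κ 2 := κ 4 :* (κ 1 :+ w) :+ κ 1) refl (length w))))
size-word (true ∷ w) = ≤-trans (+-monoʳ-≤ 4 (size-word w))
  (≤-reflexive (solve 1 (λ w → κ 4 :+ (κ 4 :* w :+ κ 1) := κ 4 :* (κ 1 :+ w) :+ κ 1) refl (length w)))

-- The argument is known to the machine only as the word `word x`, but the time may be measured by
-- other data of `x`, such as its magnitude.
computable-machine : ∀ {X : Set} (word : X → List Bool) {μ : X → ℕ} {f : X → List Bool} →
  let instance _ = record { code = λ x → code (word x) } in
  Computable μ f →
  Σ[ N ∈ Machine ] ∃[ p ] ∀ x → Machine.Outputs_On_Within_ N (f x) (word x) (⟦ p ⟧ (μ x ∷ []))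
computable-machine {X} word {μ} {f} F =
  machine (read ⨾ cmd F ⨾ write) , poly time≲ , λ x →
  machine-outputs (read ⨾ cmd F ⨾ write) (weaken (read-runs (word x) ⨾ runs F x ⨾ write-runs (f x)) (bounds time≲ x))
  where
  instance _ = record { code = λ x → code (word x) }
  time : X → ℕ
  time x = 16 * length (word x) + 7 + (cost F x + (13 * length (f x) + 6))
  time≲ : time ≲ μ
  time≲ = ≲-con 16 ≲* ≲-mono (λ x → length≤size (word x)) (input≲ F) ≲+ ≲-con 7 ≲+
          (cost≲ F ≲+ (≲-con 13 ≲* ≲-mono (λ x → length≤size (f x)) (output≲ F) ≲+ ≲-con 6))

polyTime : ∀ {f} → Poly-time f → PolyTime f
polyTime {f} F =
  let N , p , h = computable-machine id {λ w → 4 * length w + 1} {f}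
                    (remeasure {μ = ∣_∣} id (λ _ → refl) size-word F)
  in N , substitute p ((con 4 ⊗ var zero) ⊕ con 1) , λ w →
  subst (Machine.Outputs_On_Within_ N (f w) w) (sym (substitute-⟦⟧ p ((con 4 ⊗ var zero) ⊕ con 1) (length w ∷ []))) (h w)


-- Lists

module _ {X E : Set} ⦃ _ : Code X ⦄ ⦃ _ : Code E ⦄ where

  consᶜ : ∀ {f : X → E} {g} → Poly-time f → Poly-time g → Poly-time (λ x → f x ∷ g x)
  consᶜ F G = recode (λ (e , es) → e ∷ es) (λ _ → refl) (λ _ → ≤-refl) ⊙ (F ▵ G)

  justᶜ : ∀ {f : X → E} → Poly-time f → Poly-time (λ x → just (f x))
  justᶜ F = recode (λ (e , _) → just e) (λ _ → refl) (λ _ → ≤-refl) ⊙ (F ▵ constᶜ tt)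

maybe-case : ∀ {E Z : Set} → Maybe E → Z → (E → Z) → Z
maybe-case nothing  z f = z
maybe-case (just e) z f = f e

list-case : ∀ {E Z : Set} → List E → Z → (E → List E → Z) → Z
list-case []       z f = z
list-case (e ∷ es) z f = f e es

module _ {X : Set} ⦃ _ : Code X ⦄ where

  module _ {E : Set} ⦃ _ : Code E ⦄ where

    reverseᶜ : ∀ {l : X → List E} → Poly-time l → Poly-time (λ x → List.reverse (l x))
    reverseᶜ L = foldl-growthᶜ (constᶜ []) L (consᶜ fstᶜ (fstᶜ ⊙ sndᶜ)) (λ (e , _) → suc ∣ e ∣)
      (≲-con 1 ≲+ output≲ fstᶜ) (λ e y x → ≤-reflexive (+-comm (suc ∣ e ∣) ∣ y ∣))

    module _ {Z : Set} ⦃ _ : Code Z ⦄ where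

      maybe-caseᶜ : ∀ {m : X → Maybe E} {g : X → Z} {h : E × X → Z} →
                    Poly-time m → Poly-time g → Poly-time h →
                    Poly-time (λ x → maybe-case (m x) (g x) (λ e → h (e , x)))
      maybe-caseᶜ {m} {g} {h} M G H = caseᶜ {W = E × ⊤} {h = λ ((e , _) , x) → h (e , x)} M G
        (H ⊙ (fstᶜ ⊙ fstᶜ ▵ sndᶜ)) cases
        where
        cases : ∀ x → RootCases m g (λ ((e , _) , x) → h (e , x)) (λ x → maybe-case (m x) (g x) (λ e → h (e , x))) x
        cases x with m x
        ... | nothing = inj₁ (refl , refl)
        ... | just e  = inj₂ ((e , tt) , refl , _ , _ , refl , refl)

      list-caseᶜ : ∀ {l : X → List E} {g : X → Z} {h : (E × List E) × X → Z} →
                   Poly-time l → Poly-time g → Poly-time h →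
                   Poly-time (λ x → list-case (l x) (g x) (λ e es → h ((e , es) , x)))
      list-caseᶜ {l} {g} {h} L G H = caseᶜ L G H cases
        where
        cases : ∀ x → RootCases l g h (λ x → list-case (l x) (g x) (λ e es → h ((e , es) , x))) x
        cases x with l x
        ... | []     = inj₁ (refl , refl)
        ... | e ∷ es = inj₂ ((e , es) , refl , _ , _ , refl , refl)

  module _ {Z : Set} ⦃ _ : Code Z ⦄ where

    ifᶜ : ∀ {t} {f g : X → Z} → Poly-time t → Poly-time f → Poly-time g →
          Poly-time (λ x → if t x then f x else g x)
    ifᶜ {t} {f} {g} T F G = caseᶜ {W = ⊤ × ⊤} T G (F ⊙ sndᶜ) cases
      where
      cases : ∀ x → RootCases t g (f ∘ proj₂) (λ x → if t x then f x else g x) x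
      cases x with t x
      ... | false = inj₁ (refl , refl)
      ... | true  = inj₂ ((tt , tt) , refl , _ , _ , refl , refl)

    split-Boolᶜ : ∀ {t} {f : Bool → X → Z} → Poly-time t → (∀ b → Poly-time (f b)) →
                  Poly-time (λ x → f (t x) x)
    split-Boolᶜ {t} {f} T F = extensional (λ x → cases x (t x)) (ifᶜ T (F true) (F false))
      where
      cases : ∀ x b → (if b then f true x else f false x) ≡ f b x
      cases x false = refl
      cases x true  = refl

  ∧ᶜ : ∀ {f g : X → Bool} → Poly-time f → Poly-time g → Poly-time (λ x → f x ∧ g x)
  ∧ᶜ {g = g} F G = split-Boolᶜ {f = λ b x → b ∧ g x} F λ { true → G ; false → constᶜ false }

  ∨ᶜ : ∀ {f g : X → Bool} → Poly-time f → Poly-time g → Poly-time (λ x → f x ∨ g x)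
  ∨ᶜ {g = g} F G = split-Boolᶜ {f = λ b x → b ∨ g x} F λ { true → constᶜ true ; false → G }

module _ {X E Y : Set} ⦃ _ : Code X ⦄ ⦃ _ : Code E ⦄ ⦃ _ : Code Y ⦄
         {i : X → Y} {l : X → List E} {s : E × (Y × X) → Y} where

  foldrᶜ : Poly-time i → Poly-time l → Poly-time s → (bound : X → ℕ) → bound ≲ ∣_∣ →
           (∀ x ys zs → ys ++ zs ≡ l x → ∣ foldr (λ e y → s (e , y , x)) (i x) zs ∣ ≤ bound x) →
           Poly-time (λ x → foldr (λ e y → s (e , y , x)) (i x) (l x))
  foldrᶜ I L S bound bound≲ small =
    extensional (λ x → Listₚ.reverse-foldl _ (i x) (l x))
      (foldlᶜ I (reverseᶜ L) S bound bound≲ λ x ys zs p →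
        subst (λ y → ∣ y ∣ ≤ bound x)
          (trans (sym (Listₚ.reverse-foldl _ (i x) (List.reverse ys)))
            (cong (foldl _ (i x)) (Listₚ.reverse-involutive ys)))
          (small x (List.reverse zs) (List.reverse ys)
            (trans (sym (Listₚ.reverse-++ ys zs)) (trans (cong List.reverse p) (Listₚ.reverse-involutive (l x))))))

  foldr-growthᶜ : Poly-time i → Poly-time l → Poly-time s →
                  (growth : E × X → ℕ) → growth ≲ ∣_∣ →
                  (∀ e y x → ∣ s (e , y , x) ∣ ≤ ∣ y ∣ + growth (e , x)) →
                  Poly-time (λ x → foldr (λ e y → s (e , y , x)) (i x) (l x))
  foldr-growthᶜ I L S growth growth≲ grows =
    extensional (λ x → Listₚ.reverse-foldl _ (i x) (l x))
      (foldl-growthᶜ I (reverseᶜ L) S growth growth≲ grows)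

module _ {E : Set} ⦃ _ : Code E ⦄ where

  size-++ : ∀ (xs ys : List E) → ∣ xs ++ ys ∣ ≤ ∣ ys ∣ + ∣ xs ∣
  size-++ []       ys = m≤m+n _ 1
  size-++ (x ∷ xs) ys = ≤-trans (s≤s (+-monoʳ-≤ (∣ x ∣) (size-++ xs ys)))
    (≤-reflexive (solve 3 (λ a b c → κ 1 :+ (a :+ (b :+ c)) := b :+ (κ 1 :+ (a :+ c))) refl (∣ x ∣) (∣ ys ∣) (∣ xs ∣)))

module _ {X E : Set} ⦃ _ : Code X ⦄ ⦃ _ : Code E ⦄ where

  ++ᶜ : ∀ {f g : X → List E} → Poly-time f → Poly-time g → Poly-time (λ x → f x ++ g x)
  ++ᶜ {f} {g} F G = extensional (λ x → sym (Listₚ.++-is-foldr (f x) (g x)))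
    (foldr-growthᶜ G F (consᶜ fstᶜ (fstᶜ ⊙ sndᶜ)) (λ (e , _) → suc ∣ e ∣)
      (≲-con 1 ≲+ output≲ fstᶜ) (λ e y x → ≤-reflexive (+-comm (suc ∣ e ∣) ∣ y ∣)))

  allᶜ : ∀ {l : X → List E} {p : E × X → Bool} → Poly-time l → Poly-time p →
         Poly-time (λ x → BoolAction.all (λ e → p (e , x)) (l x))
  allᶜ {l} {p} L P = extensional (λ x → all-foldr x (l x))
    (foldr-growthᶜ {i = λ _ → true} {s = λ (e , b , x) → p (e , x) ∧ b} (constᶜ true) L
      (∧ᶜ (P ⊙ (fstᶜ ▵ sndᶜ ⊙ sndᶜ)) (fstᶜ ⊙ sndᶜ)) (λ _ → 3) (≲-con 3) λ e y x → size-∧ (p (e , x)) y)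
    where
    size-∧ : ∀ a b → ∣ a ∧ b ∣ ≤ ∣ b ∣ + 3
    size-∧ true b = m≤m+n _ 3
    size-∧ false b = m≤n⇒m≤o+n ∣ b ∣ (s≤s z≤n)
    all-foldr : ∀ x es → foldr (λ e b → p (e , x) ∧ b) true es ≡ BoolAction.all (λ e → p (e , x)) es
    all-foldr x []       = refl
    all-foldr x (e ∷ es) = cong (p (e , x) ∧_) (all-foldr x es)

module _ {X E Z : Set} ⦃ _ : Code X ⦄ ⦃ _ : Code E ⦄ ⦃ _ : Code Z ⦄ where

  mapᶜ : ∀ {l : X → List E} {s : E × X → Z} → Poly-time l → Poly-time s →
         Poly-time (λ x → List.map (λ e → s (e , x)) (l x))
  mapᶜ {l} {s} L S = extensional (λ x → sym (Listₚ.map-is-foldr (l x)))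
    (foldr-growthᶜ (constᶜ []) L (consᶜ (S ⊙ (fstᶜ ▵ sndᶜ ⊙ sndᶜ)) (fstᶜ ⊙ sndᶜ))
      (λ (e , x) → suc ∣ s (e , x) ∣) (≲-con 1 ≲+ output≲ S)
      (λ e y x → ≤-reflexive (+-comm (suc ∣ s (e , x) ∣) ∣ y ∣)))

  concatMapᶜ : ∀ {l : X → List E} {s : E × X → List Z} → Poly-time l → Poly-time s →
               Poly-time (λ x → List.concatMap (λ e → s (e , x)) (l x))
  concatMapᶜ {l} {s} L S = extensional (λ x → concatMap-foldr x (l x))
    (foldr-growthᶜ (constᶜ []) L (++ᶜ (S ⊙ (fstᶜ ▵ sndᶜ ⊙ sndᶜ)) (fstᶜ ⊙ sndᶜ))
      (λ (e , x) → ∣ s (e , x) ∣) (output≲ S) (λ e y x → size-++ (s (e , x)) y))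
    where
    concatMap-foldr : ∀ x es → foldr (λ e zs → s (e , x) ++ zs) [] es ≡ List.concatMap (λ e → s (e , x)) es
    concatMap-foldr x []       = refl
    concatMap-foldr x (e ∷ es) = cong (s (e , x) ++_) (concatMap-foldr x es)


-- Natural numbers in bijective binary notation

data Digit : Set where
  one two : Digit

-- Both digits have codes of the same size, so the size of a number depends only on its length.
codeDigit : Digit → Tree
codeDigit one = node (node leaf leaf) leaf
codeDigit two = node leaf (node leaf leaf)

instance
  code-Digit : Code Digit
  code-Digit = record { code = codeDigit }

isOne : Digit → Bool
isOne one = true
isOne two = false

toDigit : Bool → Digit
toDigit b = if b then one else two

digit : Digit → ℕ
digit one = 1
digit two = 2

size-digit : ∀ (d : Digit) → ∣ d ∣ ≡ 5
size-digit one = refl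
size-digit two = refl

digitsᵇ : ℕᵇ → List Digit
digitsᵇ ℕᵇ.zero  = []
digitsᵇ 2[1+ x ] = two ∷ digitsᵇ x
digitsᵇ 1+[2 x ] = one ∷ digitsᵇ x

fromDigits : List Digit → ℕᵇ
fromDigits []         = ℕᵇ.zero
fromDigits (one ∷ ds) = 1+[2 fromDigits ds ]
fromDigits (two ∷ ds) = 2[1+ fromDigits ds ]

digits : ℕ → List Digit
digits n = digitsᵇ (ℕᵇ.fromℕ n)

valueᵈ : List Digit → ℕ
valueᵈ []       = 0
valueᵈ (d ∷ ds) = digit d + 2 * valueᵈ ds

instance
  code-ℕ : Code ℕ
  code-ℕ = record { code = λ n → codeList (digits n) }

digitsᵇ-fromDigits : ∀ ds → digitsᵇ (fromDigits ds) ≡ ds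
digitsᵇ-fromDigits []         = refl
digitsᵇ-fromDigits (one ∷ ds) = cong (one ∷_) (digitsᵇ-fromDigits ds)
digitsᵇ-fromDigits (two ∷ ds) = cong (two ∷_) (digitsᵇ-fromDigits ds)

value-digitsᵇ : ∀ x → valueᵈ (digitsᵇ x) ≡ ℕᵇ.toℕ x
value-digitsᵇ ℕᵇ.zero  = refl
value-digitsᵇ 2[1+ x ] = trans (cong (λ z → 2 + 2 * z) (value-digitsᵇ x)) (sym (*-distribˡ-+ 2 1 (ℕᵇ.toℕ x)))
value-digitsᵇ 1+[2 x ] = cong (λ z → 1 + 2 * z) (value-digitsᵇ x)

value-digits : ∀ n → valueᵈ (digits n) ≡ n
value-digits n = trans (value-digitsᵇ (ℕᵇ.fromℕ n)) (ℕᵇₚ.toℕ-fromℕ n)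

digits-value : ∀ ds → digits (valueᵈ ds) ≡ ds
digits-value ds = trans (cong digitsᵇ (trans (cong ℕᵇ.fromℕ
    (trans (cong valueᵈ (sym (digitsᵇ-fromDigits ds))) (value-digitsᵇ (fromDigits ds))))
  (ℕᵇₚ.fromℕ-toℕ (fromDigits ds)))) (digitsᵇ-fromDigits ds)

size-digits : ∀ (ds : List Digit) → ∣ ds ∣ ≡ 6 * length ds + 1
size-digits [] = refl
size-digits (d ∷ ds) = trans (cong₂ (λ a b → suc (a + b)) (size-digit d) (size-digits ds))
  (solve 1 (λ n → κ 6 :+ (κ 6 :* n :+ κ 1) := κ 6 :* (κ 1 :+ n) :+ κ 1) refl (length ds))

length≤valueᵈ : ∀ ds → length ds ≤ valueᵈ ds
length≤valueᵈ [] = z≤n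
length≤valueᵈ (one ∷ ds) = s≤s (≤-trans (length≤valueᵈ ds) (m≤m+n _ _))
length≤valueᵈ (two ∷ ds) = s≤s (m≤n⇒m≤1+n (≤-trans (length≤valueᵈ ds) (m≤m+n _ _)))

-- In bijective notation there are no leading zeros: even a string of ones exceeds every shorter
-- string of twos. Consequently the size of a number is monotone in the number.
value-length-< : ∀ ms ns → length ms < length ns → valueᵈ ms < valueᵈ ns
value-length-< [] (one ∷ ns) _ = s≤s z≤n
value-length-< [] (two ∷ ns) _ = s≤s z≤n
value-length-< (m ∷ ms) (n ∷ ns) (s≤s l) =
  ≤-trans (s≤s (+-monoˡ-≤ (2 * valueᵈ ms) (digit≤2 m)))
    (≤-trans (≤-reflexive (cong suc (sym (*-distribˡ-+ 2 1 (valueᵈ ms)))))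
      (+-mono-≤ (1≤digit n) (*-monoʳ-≤ 2 (value-length-< ms ns l))))
  where
  digit≤2 : ∀ d → digit d ≤ 2
  digit≤2 one = s≤s z≤n
  digit≤2 two = ≤-refl
  1≤digit : ∀ d → 1 ≤ digit d
  1≤digit one = ≤-refl
  1≤digit two = s≤s z≤n

length-digits-mono : ∀ {m n} → m ≤ n → length (digits m) ≤ length (digits n)
length-digits-mono {m} {n} m≤n = ≮⇒≥ λ l → <⇒≱
  (subst₂ _<_ (value-digits n) (value-digits m) (value-length-< (digits n) (digits m) l)) m≤n

size-ℕ : ∀ (n : ℕ) → ∣ n ∣ ≡ 6 * length (digits n) + 1
size-ℕ n = size-digits (digits n)

size-ℕ-mono : ∀ {m n : ℕ} → m ≤ n → ∣ m ∣ ≤ ∣ n ∣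
size-ℕ-mono {m} {n} m≤n = subst₂ _≤_ (sym (size-ℕ m)) (sym (size-ℕ n))
  (+-monoˡ-≤ 1 (*-monoʳ-≤ 6 (length-digits-mono m≤n)))

size-ℕ≤ : ∀ (n : ℕ) → ∣ n ∣ ≤ 6 * n + 1
size-ℕ≤ n = subst (_≤ 6 * n + 1) (sym (size-ℕ n))
  (+-monoˡ-≤ 1 (*-monoʳ-≤ 6 (subst (length (digits n) ≤_) (value-digits n) (length≤valueᵈ (digits n)))))

-- Addition

-- The first component is always a digit: when the first number is exhausted, the digits of the
-- second take its place.
align : List Digit → List Digit → List (Digit × Maybe Digit)
align []       ys       = List.map (_, nothing) ys
align (x ∷ xs) []       = (x , nothing) ∷ align xs []
align (x ∷ xs) (y ∷ ys) = (x , just y) ∷ align xs ys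

align-step : List (Digit × Maybe Digit) × List Digit → Digit → List (Digit × Maybe Digit) × List Digit
align-step (out , ys) x = list-case ys ((x , nothing) ∷ out , []) (λ y ys → (x , just y) ∷ out , ys)

align-foldl : ∀ xs out ys → let out′ , ys′ = foldl align-step (out , ys) xs in
              out′ List.ʳ++ List.map (_, nothing) ys′ ≡ out List.ʳ++ align xs ys
align-foldl [] out ys = refl
align-foldl (x ∷ xs) out [] = align-foldl xs ((x , nothing) ∷ out) []
align-foldl (x ∷ xs) out (y ∷ ys) = align-foldl xs ((x , just y) ∷ out) ys

carry : Maybe Digit → ℕ
carry = Maybe.maybe digit 0

-- The sum of a digit, an optional digit and a carry lies between 1 and 6, and these are exactly the
-- numbers that a digit 1 or 2 forms with a carry of 0, 1 or 2. Carries therefore have the type of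
-- optional digits.
adder : Digit → Maybe Digit → Maybe Digit → Digit × Maybe Digit
adder one nothing    nothing    = one , nothing
adder one nothing    (just one) = two , nothing
adder one nothing    (just two) = one , just one
adder one (just one) nothing    = two , nothing
adder one (just one) (just one) = one , just one
adder one (just one) (just two) = two , just one
adder one (just two) nothing    = one , just one
adder one (just two) (just one) = two , just one
adder one (just two) (just two) = one , just two
adder two nothing    nothing    = two , nothing
adder two nothing    (just one) = one , just one
adder two nothing    (just two) = two , just one
adder two (just one) nothing    = one , just one
adder two (just one) (just one) = two , just one
adder two (just one) (just two) = one , just two
adder two (just two) nothing    = two , just one
adder two (just two) (just one) = one , just two
adder two (just two) (just two) = two , just two

Adds : Digit → Maybe Digit → Maybe Digit → Set
Adds x y c = let d , c′ = adder x y c in digit d + 2 * carry c′ ≡ digit x + carry y + carry c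

adder-adds : ∀ x y c → Adds x y c
adder-adds one nothing    nothing    = refl
adder-adds one nothing    (just one) = refl
adder-adds one nothing    (just two) = refl
adder-adds one (just one) nothing    = refl
adder-adds one (just one) (just one) = refl
adder-adds one (just one) (just two) = refl
adder-adds one (just two) nothing    = refl
adder-adds one (just two) (just one) = refl
adder-adds one (just two) (just two) = refl
adder-adds two nothing    nothing    = refl
adder-adds two nothing    (just one) = refl
adder-adds two nothing    (just two) = refl
adder-adds two (just one) nothing    = refl
adder-adds two (just one) (just one) = refl
adder-adds two (just one) (just two) = refl
adder-adds two (just two) nothing    = refl
adder-adds two (just two) (just one) = refl
adder-adds two (just two) (just two) = refl

ripple : Maybe Digit → List (Digit × Maybe Digit) → List Digit
ripple c []             = maybe-case c [] (λ d → d ∷ [])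
ripple c ((x , y) ∷ zs) = let d , c′ = adder x y c in d ∷ ripple c′ zs

ripple-step : List Digit × Maybe Digit → Digit × Maybe Digit → List Digit × Maybe Digit
ripple-step (out , c) (x , y) = proj₁ (adder x y c) ∷ out , proj₂ (adder x y c)

ripple-foldl : ∀ zs out c → let out′ , c′ = foldl ripple-step (out , c) zs in
               out′ List.ʳ++ ripple c′ [] ≡ out List.ʳ++ ripple c zs
ripple-foldl []             out c = refl
ripple-foldl ((x , y) ∷ zs) out c = ripple-foldl zs (proj₁ (adder x y c) ∷ out) (proj₂ (adder x y c))

aligned : List (Digit × Maybe Digit) → ℕ
aligned []             = 0
aligned ((x , y) ∷ zs) = digit x + carry y + 2 * aligned zs

aligned-align : ∀ xs ys → aligned (align xs ys) ≡ valueᵈ xs + valueᵈ ys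
aligned-align [] [] = refl
aligned-align [] (y ∷ ys) = cong₂ (λ a b → a + 2 * b) (+-identityʳ (digit y)) (aligned-align [] ys)
aligned-align (x ∷ xs) [] = trans (cong₂ (λ a b → a + 2 * b) (+-identityʳ (digit x))
    (trans (aligned-align xs []) (+-identityʳ (valueᵈ xs))))
  (sym (+-identityʳ _))
aligned-align (x ∷ xs) (y ∷ ys) = trans (cong (λ b → digit x + digit y + 2 * b) (aligned-align xs ys))
  (solve 4 (λ a b x y → a :+ b :+ κ 2 :* (x :+ y) := (a :+ κ 2 :* x) :+ (b :+ κ 2 :* y)) refl
    (digit x) (digit y) (valueᵈ xs) (valueᵈ ys))

value-ripple : ∀ c zs → valueᵈ (ripple c zs) ≡ carry c + aligned zs
value-ripple nothing  [] = refl
value-ripple (just d) [] = refl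
value-ripple c ((x , y) ∷ zs) =
  trans (cong (λ v → digit (proj₁ (adder x y c)) + 2 * v) (value-ripple (proj₂ (adder x y c)) zs))
    (trans (solve 3 (λ d c z → d :+ κ 2 :* (c :+ z) := (d :+ κ 2 :* c) :+ κ 2 :* z) refl
             (digit (proj₁ (adder x y c))) (carry (proj₂ (adder x y c))) (aligned zs))
      (trans (cong (_+ 2 * aligned zs) (adder-adds x y c))
        (solve 4 (λ x y c z → x :+ y :+ c :+ z := c :+ (x :+ y :+ z)) refl
          (digit x) (carry y) (carry c) (2 * aligned zs))))

digits-+ : ∀ m n → digits (m + n) ≡ ripple nothing (align (digits m) (digits n))
digits-+ m n = trans (cong digits (sym (trans (value-ripple nothing (align (digits m) (digits n)))
    (trans (aligned-align (digits m) (digits n)) (cong₂ _+_ (value-digits m) (value-digits n))))))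
  (digits-value _)

length-align : ∀ xs ys → length (align xs ys) ≤ length xs + length ys
length-align [] ys = ≤-reflexive (Listₚ.length-map _ ys)
length-align (x ∷ xs) [] = s≤s (length-align xs [])
length-align (x ∷ xs) (y ∷ ys) = s≤s (≤-trans (length-align xs ys) (+-monoʳ-≤ (length xs) (n≤1+n _)))

length-ripple : ∀ c zs → length (ripple c zs) ≤ length zs + 1
length-ripple nothing  [] = z≤n
length-ripple (just _) [] = ≤-refl
length-ripple c (_ ∷ zs)  = s≤s (length-ripple _ zs)

size-+ : ∀ (m n : ℕ) → ∣ m + n ∣ ≤ ∣ m ∣ + (∣ n ∣ + 5)
size-+ m n = subst₂ _≤_ (sym (size-ℕ (m + n)))
  (sym (trans (cong₂ (λ a b → a + (b + 5)) (size-ℕ m) (size-ℕ n))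
    (solve 2 (λ a b → κ 6 :* a :+ κ 1 :+ (κ 6 :* b :+ κ 1 :+ κ 5) := κ 6 :* (a :+ b :+ κ 1) :+ κ 1) refl
      (length (digits m)) (length (digits n)))))
  (+-monoˡ-≤ 1 (*-monoʳ-≤ 6 (≤-trans (≤-reflexive (cong length (digits-+ m n)))
    (≤-trans (length-ripple nothing (align (digits m) (digits n)))
      (+-monoˡ-≤ 1 (length-align (digits m) (digits n)))))))

-- The code of a digit is also the code of a pair of Booleans, the first of which tells whether the
-- digit is `one`.
isOneᶜ : Poly-time isOne
isOneᶜ = fstᶜ ⊙ recode (λ d → isOne d , not (isOne d)) (λ { one → refl ; two → refl }) (λ _ → ≤-refl)

module _ {X : Set} ⦃ _ : Code X ⦄ where

  module _ {Z : Set} ⦃ _ : Code Z ⦄ where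

    split-Digitᶜ : ∀ {d} {f : Digit → X → Z} → Poly-time d → (∀ d → Poly-time (f d)) →
                   Poly-time (λ x → f (d x) x)
    split-Digitᶜ {d} {f} D F = extensional (λ x → cong (λ d → f d x) (digit-isOne (d x)))
      (split-Boolᶜ {f = λ b x → f (toDigit b) x} (isOneᶜ ⊙ D) (λ b → F (toDigit b)))
      where
      digit-isOne : ∀ d → toDigit (isOne d) ≡ d
      digit-isOne one = refl
      digit-isOne two = refl

  valueᵈᶜ : ∀ {f : X → List Digit} → Poly-time f → Poly-time (λ x → valueᵈ (f x))
  valueᵈᶜ {f} F = recode valueᵈ (λ ds → cong codeList (digits-value ds)) (λ _ → ≤-refl) ⊙ F

  digitsᶜ : ∀ {f : X → ℕ} → Poly-time f → Poly-time (λ x → digits (f x))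
  digitsᶜ F = recode digits (λ _ → refl) (λ _ → ≤-refl) ⊙ F

module _ {X Z : Set} ⦃ _ : Code X ⦄ ⦃ _ : Code Z ⦄ where

  split-carryᶜ : ∀ {c} {f : Maybe Digit → X → Z} → Poly-time c → (∀ c → Poly-time (f c)) →
                 Poly-time (λ x → f (c x) x)
  split-carryᶜ {c} {f} C F = extensional (λ x → cases x (c x))
    (maybe-caseᶜ {h = λ (d , x) → f (just d) x} C (F nothing)
      (split-Digitᶜ {f = λ d p → f (just d) (proj₂ p)} fstᶜ (λ d → F (just d) ⊙ sndᶜ)))
    where
    cases : ∀ x c → maybe-case c (f nothing x) (λ d → f (just d) x) ≡ f c x
    cases x nothing  = refl
    cases x (just d) = refl

alignᶜ : Poly-time (λ (p : List Digit × List Digit) → align (proj₁ p) (proj₂ p))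
alignᶜ = extensional
  (λ (xs , ys) → trans (sym (Listₚ.ʳ++-defn (proj₁ (foldl align-step ([] , ys) xs)))) (align-foldl xs [] ys))
  (++ᶜ (reverseᶜ (fstᶜ ⊙ scanᶜ)) (mapᶜ (sndᶜ ⊙ scanᶜ) (fstᶜ ▵ constᶜ nothing)))
  where
  Out = List (Digit × Maybe Digit) × List Digit
  next-out : (Digit × List Digit) × Digit × Out × List Digit × List Digit → Out
  next-out ((y , ys) , (x , ((out , _) , _))) = (x , just y) ∷ out , ys
  stepᶜ : Poly-time {Digit × Out × List Digit × List Digit} (λ (x , (s , _)) → align-step s x)
  stepᶜ = list-caseᶜ {h = next-out} (sndᶜ ⊙ fstᶜ ⊙ sndᶜ)
    (consᶜ (fstᶜ ▵ constᶜ nothing) (fstᶜ ⊙ fstᶜ ⊙ sndᶜ) ▵ constᶜ [])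
    (consᶜ (fstᶜ ⊙ sndᶜ ▵ justᶜ (fstᶜ ⊙ fstᶜ)) (fstᶜ ⊙ fstᶜ ⊙ sndᶜ ⊙ sndᶜ) ▵ sndᶜ ⊙ fstᶜ)
  grows : ∀ x s → ∣ align-step s x ∣ ≤ ∣ s ∣ + 16
  grows x (out , []) = ≤-trans
    (≤-reflexive (trans (cong (λ k → 1 + (1 + (1 + (k + 1)) + size (codeList out) + 1)) (size-digit x))
      (solve 1 (λ o → κ 1 :+ (κ 8 :+ o :+ κ 1) := κ 1 :+ (o :+ κ 1) :+ κ 8) refl (size (codeList out)))))
    (+-monoʳ-≤ (1 + (size (codeList out) + 1)) (m≤m+n 8 8))
  grows x (out , y ∷ ys) = ≤-trans
    (≤-reflexive (trans (cong₂ (λ k l → 1 + (1 + (1 + (k + (1 + (l + 1)))) + size (codeList out) + size (codeList ys)))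
        (size-digit x) (size-digit y))
      (solve 2 (λ o r → κ 1 :+ (κ 14 :+ o :+ r) := κ 1 :+ (o :+ (κ 6 :+ r)) :+ κ 8) refl
        (size (codeList out)) (size (codeList ys)))))
    (≤-trans (≤-reflexive (cong (λ l → 1 + (size (codeList out) + (1 + (l + size (codeList ys)))) + 8) (sym (size-digit y))))
      (+-monoʳ-≤ (∣ (out , y ∷ ys) ∣) (m≤m+n 8 8)))
  scanᶜ : Poly-time (λ ((xs , ys) : List Digit × List Digit) → foldl align-step ([] , ys) xs)
  scanᶜ = foldl-growthᶜ {s = λ (x , (s , _)) → align-step s x} (constᶜ [] ▵ sndᶜ) fstᶜ stepᶜ (λ _ → 16) (≲-con 16)
    (λ x s _ → grows x s)

rippleᶜ : Poly-time (ripple nothing)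
rippleᶜ = extensional
  (λ zs → trans (sym (Listₚ.ʳ++-defn (proj₁ (foldl ripple-step ([] , nothing) zs)))) (ripple-foldl zs [] nothing))
  (++ᶜ (reverseᶜ (fstᶜ ⊙ scanᶜ))
       (maybe-caseᶜ {h = λ (d , _) → d ∷ []} (sndᶜ ⊙ scanᶜ) (constᶜ []) (consᶜ fstᶜ (constᶜ []))))
  where
  In = (Digit × Maybe Digit) × ((List Digit × Maybe Digit) × List (Digit × Maybe Digit))
  adderᶜ : Poly-time {In} (λ ((x , y) , ((_ , c) , _)) → adder x y c)
  adderᶜ = split-Digitᶜ {f = λ x ((_ , y) , ((_ , c) , _)) → adder x y c} (fstᶜ ⊙ fstᶜ) λ x →
    split-carryᶜ {f = λ y (_ , ((_ , c) , _)) → adder x y c} (sndᶜ ⊙ fstᶜ) λ y →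
    split-carryᶜ {f = λ c _ → adder x y c} (sndᶜ ⊙ fstᶜ ⊙ sndᶜ) λ c → constᶜ (adder x y c)
  size-carry : ∀ (c : Maybe Digit) → ∣ c ∣ ≤ 7
  size-carry nothing = s≤s z≤n
  size-carry (just d) = ≤-reflexive (cong (λ k → 1 + (k + 1)) (size-digit d))
  scanᶜ : Poly-time (λ (zs : List (Digit × Maybe Digit)) → foldl ripple-step ([] , nothing) zs)
  scanᶜ = foldl-growthᶜ {s = λ (z , (s , _)) → ripple-step s z} (constᶜ ([] , nothing)) idᶜ
    (consᶜ (fstᶜ ⊙ adderᶜ) (fstᶜ ⊙ fstᶜ ⊙ sndᶜ) ▵ sndᶜ ⊙ adderᶜ) (λ _ → 13) (≲-con 13)
    (λ { (x , y) (out , c) _ → ≤-trans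
      (s≤s (+-mono-≤ (+-monoˡ-≤ (size (codeList out)) (s≤s (≤-reflexive (size-digit (proj₁ (adder x y c))))))
        (size-carry (proj₂ (adder x y c)))))
      (≤-trans (≤-reflexive (solve 1 (λ o → κ 1 :+ (κ 6 :+ o :+ κ 7) := κ 1 :+ (o :+ κ 0) :+ κ 13) refl (size (codeList out))))
        (+-monoˡ-≤ 13 (s≤s (+-monoʳ-≤ (size (codeList out)) z≤n)))) })

module _ {X : Set} ⦃ _ : Code X ⦄ where

  +ᶜ : ∀ {f g : X → ℕ} → Poly-time f → Poly-time g → Poly-time (λ x → f x + g x)
  +ᶜ {f} {g} F G = extensional
    (λ x → trans (cong valueᵈ (sym (digits-+ (f x) (g x)))) (value-digits (f x + g x)))
    (valueᵈᶜ (rippleᶜ ⊙ alignᶜ ⊙ (digitsᶜ F ▵ digitsᶜ G)))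


-- Comparison of numbers

-- Comparison starts at the least significant digit. The flag tells whether a tie in the remaining
-- digits counts as below; it is initially true for "at most", and unequal digits overrule it.
below : Bool → Digit → Digit → Bool
below o one one = o
below o one two = true
below o two one = false
below o two two = o

compare-step : Bool × List Digit → Digit → Bool × List Digit
compare-step (o , ys) x = list-case ys (false , []) (λ y ys → below o x y , ys)

compare-result : Bool × List Digit → Bool
compare-result (o , ys) = list-case ys o (λ _ _ → true)

private
  2*-<ᵇ-2* : ∀ m n → (2 * m <ᵇ 2 * n) ≡ (m <ᵇ n)
  2*-<ᵇ-2* zero zero = refl
  2*-<ᵇ-2* zero (suc n) = refl
  2*-<ᵇ-2* (suc m) zero = refl
  2*-<ᵇ-2* (suc m) (suc n) rewrite +-suc m (m + 0) | +-suc n (n + 0) = 2*-<ᵇ-2* m n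

  2*-<ᵇ-1+2* : ∀ m n → (2 * m <ᵇ suc (2 * n)) ≡ (m <ᵇ suc n)
  2*-<ᵇ-1+2* zero n = refl
  2*-<ᵇ-1+2* (suc m) zero = refl
  2*-<ᵇ-1+2* (suc m) (suc n) rewrite +-suc m (m + 0) | +-suc n (n + 0) = 2*-<ᵇ-1+2* m n

  1+2*-<ᵇ-2* : ∀ m n → (suc (2 * m) <ᵇ 2 * n) ≡ (m <ᵇ n)
  1+2*-<ᵇ-2* zero zero = refl
  1+2*-<ᵇ-2* zero (suc n) rewrite +-suc n (n + 0) = refl
  1+2*-<ᵇ-2* (suc m) zero = refl
  1+2*-<ᵇ-2* (suc m) (suc n) rewrite +-suc m (m + 0) | +-suc n (n + 0) = 1+2*-<ᵇ-2* m n

below-<ᵇ : ∀ o x y m n → (m <ᵇ (if below o x y then suc n else n)) ≡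
           (digit x + 2 * m <ᵇ (if o then suc (digit y + 2 * n) else digit y + 2 * n))
below-<ᵇ false one one m n = sym (2*-<ᵇ-2* m n)
below-<ᵇ true  one one m n = sym (2*-<ᵇ-1+2* m n)
below-<ᵇ false one two m n = sym (2*-<ᵇ-1+2* m n)
below-<ᵇ true  one two m n = sym (trans (cong (λ z → 2 * m <ᵇ suc z) (sym (+-suc n (n + 0)))) (2*-<ᵇ-2* m (suc n)))
below-<ᵇ false two one m n = sym (1+2*-<ᵇ-2* m n)
below-<ᵇ true  two one m n = sym (2*-<ᵇ-2* m n)
below-<ᵇ false two two m n = sym (2*-<ᵇ-2* m n)
below-<ᵇ true  two two m n = sym (2*-<ᵇ-1+2* m n)

compare-foldl : ∀ xs o ys → compare-result (foldl compare-step (o , ys) xs) ≡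
                (valueᵈ xs <ᵇ (if o then suc (valueᵈ ys) else valueᵈ ys))
compare-foldl [] false [] = refl
compare-foldl [] true [] = refl
compare-foldl [] false (one ∷ ys) = refl
compare-foldl [] true (one ∷ ys) = refl
compare-foldl [] false (two ∷ ys) = refl
compare-foldl [] true (two ∷ ys) = refl
compare-foldl (x ∷ xs) o [] = trans (compare-foldl xs false []) (lemma o x)
  where
  lemma : ∀ o x → false ≡ (digit x + 2 * valueᵈ xs <ᵇ (if o then 1 else 0))
  lemma false x = refl
  lemma true one = refl
  lemma true two = refl
compare-foldl (x ∷ xs) o (y ∷ ys) = trans (compare-foldl xs (below o x y) ys) (below-<ᵇ o x y (valueᵈ xs) (valueᵈ ys))

leq-digits : ∀ m n → compare-result (foldl compare-step (true , digits n) (digits m)) ≡ (m ≤ᵇ n)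
leq-digits m n = trans (compare-foldl (digits m) true (digits n))
  (trans (cong₂ (λ a b → a <ᵇ suc b) (value-digits m) (value-digits n)) (<ᵇ-suc m))
  where
  <ᵇ-suc : ∀ m → (m <ᵇ suc n) ≡ (m ≤ᵇ n)
  <ᵇ-suc zero    = refl
  <ᵇ-suc (suc m) = refl

module _ {X : Set} ⦃ _ : Code X ⦄ where

  ≤ᵇᶜ : ∀ {f g : X → ℕ} → Poly-time f → Poly-time g → Poly-time (λ x → f x ≤ᵇ g x)
  ≤ᵇᶜ {f} {g} F G = extensional (λ x → leq-digits (f x) (g x))
    (resultᶜ ⊙ foldl-growthᶜ {s = λ (x , (s , _)) → compare-step s x}
      (constᶜ true ▵ digitsᶜ G) (digitsᶜ F) stepᶜ (λ _ → 3) (≲-con 3) (λ x s _ → grows x s))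
    where
    resultᶜ : Poly-time compare-result
    resultᶜ = list-caseᶜ {h = λ _ → true} sndᶜ fstᶜ (constᶜ true)
    belowᶜ : Poly-time {(Digit × List Digit) × (Digit × ((Bool × List Digit) × X))}
                       (λ ((y , ys) , (x , ((o , _) , _))) → below o x y)
    belowᶜ = split-Digitᶜ {f = λ y (_ , (x , ((o , _) , _))) → below o x y} (fstᶜ ⊙ fstᶜ) λ y →
      split-Digitᶜ {f = λ x (_ , (_ , ((o , _) , _))) → below o x y} (fstᶜ ⊙ sndᶜ) λ x →
      split-Boolᶜ {f = λ o _ → below o x y} (fstᶜ ⊙ fstᶜ ⊙ sndᶜ ⊙ sndᶜ) λ o → constᶜ (below o x y)
    stepᶜ : Poly-time {Digit × ((Bool × List Digit) × X)} (λ (x , (s , _)) → compare-step s x)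
    stepᶜ = list-caseᶜ {h = λ ((y , ys) , (x , ((o , _) , _))) → below o x y , ys} (sndᶜ ⊙ fstᶜ ⊙ sndᶜ)
      (constᶜ (false , [])) (belowᶜ ▵ sndᶜ ⊙ fstᶜ)
    grows : ∀ x (s : Bool × List Digit) → ∣ compare-step s x ∣ ≤ ∣ s ∣ + 3
    grows x (o , []) = m≤n+m 3 (1 + (size (code o) + 1))
    grows x (o , y ∷ ys) = s≤s (≤-trans (≤-trans (+-mono-≤ (size-Bool (below o x y))
        (≤-trans (m≤n+m (size (codeList ys)) (size (codeDigit y))) (n≤1+n _)))
      (≤-reflexive (+-comm 3 _))) (+-monoˡ-≤ 3 (m≤n+m _ (size (code o)))))

  ≡ᵇᶜ : ∀ {f g : X → ℕ} → Poly-time f → Poly-time g → Poly-time (λ x → f x ≡ᵇ g x)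
  ≡ᵇᶜ {f} {g} F G = extensional (λ x → antisym (f x) (g x)) (∧ᶜ (≤ᵇᶜ F G) (≤ᵇᶜ G F))
    where
    <ᵇ-antisym : ∀ m n → (m <ᵇ suc n) ∧ (n <ᵇ suc m) ≡ (m ≡ᵇ n)
    <ᵇ-antisym zero zero = refl
    <ᵇ-antisym zero (suc n) = refl
    <ᵇ-antisym (suc m) zero = refl
    <ᵇ-antisym (suc m) (suc n) = <ᵇ-antisym m n
    antisym : ∀ m n → (m ≤ᵇ n) ∧ (n ≤ᵇ m) ≡ (m ≡ᵇ n)
    antisym zero zero = refl
    antisym zero (suc n) = refl
    antisym (suc m) zero = refl
    antisym (suc m) (suc n) = <ᵇ-antisym m n

  sucᶜ : ∀ {f : X → ℕ} → Poly-time f → Poly-time (λ x → suc (f x))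
  sucᶜ F = extensional (λ x → +-comm _ 1) (+ᶜ F (constᶜ 1))

module _ {X E : Set} ⦃ _ : Code X ⦄ ⦃ _ : Code E ⦄ where

  sumᶜ : ∀ {l : X → List E} {s : E × X → ℕ} → Poly-time l → Poly-time s →
         Poly-time (λ x → foldr (λ e n → s (e , x) + n) 0 (l x))
  sumᶜ {l} {s} L S = foldr-growthᶜ {s = λ (e , n , x) → s (e , x) + n} (constᶜ 0) L
    (+ᶜ (S ⊙ (fstᶜ ▵ sndᶜ ⊙ sndᶜ)) (fstᶜ ⊙ sndᶜ)) (λ p → ∣ s p ∣ + 5) (output≲ S ≲+ ≲-con 5)
    (λ e n x → subst (λ k → ∣ k ∣ ≤ ∣ n ∣ + (∣ s (e , x) ∣ + 5)) (+-comm n _) (size-+ n (s (e , x))))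

  lengthᶜ : ∀ {l : X → List E} → Poly-time l → Poly-time (λ x → length (l x))
  lengthᶜ {l} L = extensional (λ x → go (l x)) (sumᶜ {s = λ _ → 1} L (constᶜ 1))
    where
    go : ∀ (es : List E) → foldr (λ _ n → 1 + n) 0 es ≡ length es
    go [] = refl
    go (e ∷ es) = cong suc (go es)

module _ {X E : Set} ⦃ _ : Code X ⦄ ⦃ _ : Code E ⦄ where

  downFromᶜ : ∀ {l : X → List E} → Poly-time l → Poly-time (λ x → List.downFrom (length (l x)))
  downFromᶜ {l} L = extensional (λ x → go (l x))
    (foldrᶜ {s = λ (_ , ns , _) → length ns ∷ ns} (constᶜ []) L (consᶜ (lengthᶜ (fstᶜ ⊙ sndᶜ)) (fstᶜ ⊙ sndᶜ))
      (λ x → 1 + length (l x) * (1 + (6 * length (l x) + 1)))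
      (≲-con 1 ≲+ l≲ ≲* (≲-con 1 ≲+ (≲-con 6 ≲* l≲ ≲+ ≲-con 1)))
      λ x ys zs p → subst (λ ns → ∣ ns ∣ ≤ _) (sym (go zs))
        (≤-trans (small (length zs))
          (s≤s (*-mono-≤ (shorter x ys zs p) (s≤s (+-monoˡ-≤ 1 (*-monoʳ-≤ 6 (shorter x ys zs p))))))))
    where
    l≲ : (λ x → length (l x)) ≲ ∣_∣
    l≲ = ≲-mono (λ x → length≤size (l x)) (output≲ L)
    go : ∀ (es : List E) → foldr (λ _ ns → length ns ∷ ns) [] es ≡ List.downFrom (length es)
    go [] = refl
    go (e ∷ es) = trans (cong (λ ns → length ns ∷ ns) (go es))
      (cong (_∷ List.downFrom (length es)) (Listₚ.length-downFrom (length es)))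
    shorter : ∀ x ys zs → ys ++ zs ≡ l x → length zs ≤ length (l x)
    shorter x ys zs p = ≤-trans (m≤n+m (length zs) (length ys))
      (≤-reflexive (trans (sym (Listₚ.length-++ ys)) (cong length p)))
    small : ∀ n → ∣ List.downFrom n ∣ ≤ 1 + n * (1 + (6 * n + 1))
    small zero = ≤-refl
    small (suc n) = s≤s (≤-trans (+-mono-≤ (size-ℕ≤ n) (small n))
      (≤-trans (≤-reflexive (+-suc (6 * n + 1) _))
        (+-mono-≤ (s≤s (+-monoˡ-≤ 1 (*-monoʳ-≤ 6 (n≤1+n n))))
          (*-monoʳ-≤ n (s≤s (+-monoˡ-≤ 1 (*-monoʳ-≤ 6 (n≤1+n n))))))))


-- Vectors and unary numbers

instance
  code-Vec : ∀ {X n} ⦃ _ : Code X ⦄ → Code (Vec X n)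
  code-Vec = record { code = λ v → codeList (Vec.toList v) }

module _ {X E : Set} ⦃ _ : Code X ⦄ ⦃ _ : Code E ⦄ where

  toListᶜ : ∀ {n} {v : X → Vec E n} → Poly-time v → Poly-time (λ x → Vec.toList (v x))
  toListᶜ V = recode Vec.toList (λ _ → refl) (λ _ → ≤-refl) ⊙ V

  vconsᶜ : ∀ {n} {f : X → E} {g : X → Vec E n} → Poly-time f → Poly-time g → Poly-time (λ x → f x ∷ g x)
  vconsᶜ F G = recode (λ (e , es) → e ∷ es) (λ _ → refl) (λ _ → ≤-refl) ⊙ (F ▵ G)

  unconsᶜ : ∀ {n} {v : X → Vec E (suc n)} → Poly-time v → Poly-time (λ x → Vec.head (v x) , Vec.tail (v x))
  unconsᶜ V = recode (λ v → Vec.head v , Vec.tail v) (λ { (_ ∷ _) → refl }) (λ _ → ≤-refl) ⊙ V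

module _ {X E : Set} ⦃ _ : Code X ⦄ ⦃ _ : Code E ⦄ where

  lookupᶜ : ∀ {n} {v : X → Vec E n} → Poly-time v → ∀ i → Poly-time (λ x → lookup (v x) i)
  lookupᶜ {v = v} V zero = extensional (λ x → head-lookup (v x)) (fstᶜ ⊙ unconsᶜ V)
    where
    head-lookup : ∀ {n} (v : Vec E (suc n)) → Vec.head v ≡ lookup v zero
    head-lookup (_ ∷ _) = refl
  lookupᶜ {v = v} V (suc i) = extensional (λ x → tail-lookup (v x)) (lookupᶜ (sndᶜ ⊙ unconsᶜ V) i)
    where
    tail-lookup : ∀ {n i} (v : Vec E (suc n)) → lookup (Vec.tail v) i ≡ lookup v (suc i)
    tail-lookup (_ ∷ _) = refl

  tabulateᶜ : ∀ {n} {f : Fin n → X → E} → (∀ i → Poly-time (f i)) → Poly-time (λ x → Vec.tabulate (λ i → f i x))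
  tabulateᶜ {zero}  F = constᶜ []
  tabulateᶜ {suc n} F = vconsᶜ (F zero) (tabulateᶜ (F ∘ suc))

Unary : Set
Unary = List ⊤

-- Bounds are wanted as lists of that length, over which one can fold, and the unary value of a
-- polynomial at unary arguments is still of polynomial size.
⟦_⟧ᵘ : ∀ {k} → Poly k → Vec Unary k → Unary
⟦ con c ⟧ᵘ us = List.replicate c tt
⟦ var i ⟧ᵘ us = lookup us i
⟦ p ⊕ q ⟧ᵘ us = ⟦ p ⟧ᵘ us ++ ⟦ q ⟧ᵘ us
⟦ p ⊗ q ⟧ᵘ us = List.concatMap (λ _ → ⟦ q ⟧ᵘ us) (⟦ p ⟧ᵘ us)

length-⟦⟧ᵘ : ∀ {k} (p : Poly k) us → length (⟦ p ⟧ᵘ us) ≡ ⟦ p ⟧ (Vec.map length us)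
length-⟦⟧ᵘ (con c) us = Listₚ.length-replicate c
length-⟦⟧ᵘ (var i) us = sym (Vecₚ.lookup-map i length us)
length-⟦⟧ᵘ (p ⊕ q) us = trans (Listₚ.length-++ (⟦ p ⟧ᵘ us)) (cong₂ _+_ (length-⟦⟧ᵘ p us) (length-⟦⟧ᵘ q us))
length-⟦⟧ᵘ (p ⊗ q) us = trans (product (⟦ p ⟧ᵘ us)) (cong₂ _*_ (length-⟦⟧ᵘ p us) (length-⟦⟧ᵘ q us))
  where
  product : ∀ (u : Unary) → length (List.concatMap (λ _ → ⟦ q ⟧ᵘ us) u) ≡ length u * length (⟦ q ⟧ᵘ us)
  product [] = refl
  product (_ ∷ u) = trans (Listₚ.length-++ (⟦ q ⟧ᵘ us)) (cong (length (⟦ q ⟧ᵘ us) +_) (product u))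

polyᶜ : ∀ {X k} ⦃ _ : Code X ⦄ (p : Poly k) {us : X → Vec Unary k} → Poly-time us → Poly-time (λ x → ⟦ p ⟧ᵘ (us x))
polyᶜ (con c) U = constᶜ _
polyᶜ (var i) U = lookupᶜ U i
polyᶜ (p ⊕ q) U = ++ᶜ (polyᶜ p U) (polyᶜ q U)
polyᶜ (p ⊗ q) {us} U = concatMapᶜ {s = λ (_ , x) → ⟦ q ⟧ᵘ (us x)} (polyᶜ p U) (polyᶜ q U ⊙ sndᶜ)

unaryᶜ : ∀ {X E} ⦃ _ : Code X ⦄ ⦃ _ : Code E ⦄ {l : X → List E} → Poly-time l → Poly-time (λ x → List.map (λ _ → tt) (l x))
unaryᶜ L = mapᶜ {s = λ _ → tt} L (constᶜ tt)

-- Parsing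

Parser : Set → Set
Parser E = List Bool → Maybe (E × List Bool)

parseBool : Parser Bool
parseBool []      = nothing
parseBool (b ∷ w) = just (b , w)

mapParser : ∀ {E F : Set} → (E → Maybe F) → Parser E → Parser F
mapParser f p w = maybe-case (p w) nothing λ (e , r) → maybe-case (f e) nothing λ e′ → just (e′ , r)

_then_ : ∀ {E F : Set} → Parser E → Parser F → Parser (E × F)
(p then q) w = maybe-case (p w) nothing λ (e , r) → maybe-case (q r) nothing λ (f , r′) → just ((e , f) , r′)

-- Soundness is as important as completeness: the languages consist of encodings only, so every
-- other word has to be rejected.
record IsParser {E : Set} (encode : E → List Bool) (p : Parser E) : Set where
  field
    complete : ∀ e r → p (encode e ++ r) ≡ just (e , r)
    sound    : ∀ w {e r} → p w ≡ just (e , r) → w ≡ encode e ++ r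

open IsParser public

isParser-Bool : IsParser [_] parseBool
isParser-Bool = record { complete = λ e r → refl ; sound = λ { (b ∷ w) refl → refl } }

isParser-then : ∀ {E F : Set} {encodeE : E → List Bool} {encodeF : F → List Bool} {p q} →
                IsParser encodeE p → IsParser encodeF q → IsParser (λ (e , f) → encodeE e ++ encodeF f) (p then q)
isParser-then {encodeE = encodeE} {encodeF} {p} {q} P Q = record { complete = complete′ ; sound = sound′ }
  where
  complete′ : ∀ e r → (p then q) ((encodeE (proj₁ e) ++ encodeF (proj₂ e)) ++ r) ≡ just (e , r)
  complete′ (e , f) r rewrite Listₚ.++-assoc (encodeE e) (encodeF f) r | complete P e (encodeF f ++ r)
                            | complete Q f r = refl
  sound′ : ∀ w {e r} → (p then q) w ≡ just (e , r) → w ≡ (encodeE (proj₁ e) ++ encodeF (proj₂ e)) ++ r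
  sound′ w eq with p w in eq₁
  ... | just (e , r₁) with q r₁ in eq₂
  sound′ w refl | just (e , r₁) | just (f , r) =
    trans (sound P w eq₁) (trans (cong (encodeE e ++_) (sound Q r₁ eq₂)) (sym (Listₚ.++-assoc (encodeE e) _ _)))

isParser-map : ∀ {E F : Set} {encodeE : E → List Bool} {encodeF : F → List Bool} {p} f (g : F → E) →
               (∀ e′ → f (g e′) ≡ just e′) → (∀ e {e′} → f e ≡ just e′ → g e′ ≡ e) →
               (∀ e′ → encodeF e′ ≡ encodeE (g e′)) → IsParser encodeE p → IsParser encodeF (mapParser f p)
isParser-map {encodeE = encodeE} {encodeF} {p} f g fg gf enc P = record { complete = complete′ ; sound = sound′ }
  where
  complete′ : ∀ e r → mapParser f p (encodeF e ++ r) ≡ just (e , r)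
  complete′ e r rewrite enc e | complete P (g e) r | fg e = refl
  sound′ : ∀ w {e r} → mapParser f p w ≡ just (e , r) → w ≡ encodeF e ++ r
  sound′ w eq with p w in eq₁
  ... | just (e , r₁) with f e in eq₂
  sound′ w refl | just (e , r₁) | just e′ =
    trans (sound P w eq₁) (cong (_++ r₁) (trans (cong encodeE (sym (gf e eq₂))) (sym (enc e′))))

-- The elements found are collected in reverse; the flag tells whether the end
-- of the list is still to be found.
ParserState : Set → Set
ParserState E = Maybe ((List E × List Bool) × Bool)

module _ {E : Set} (p : Parser E) where

  parse-element : List E → List Bool → ParserState E
  parse-element es r = list-case r nothing λ b r → if b
    then maybe-case (p r) nothing (λ (e , r) → just ((e ∷ es , r) , true))
    else just ((es , r) , false)

  parse-step : ParserState E → ParserState E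
  parse-step s = maybe-case s nothing λ ((es , r) , b) → if b then parse-element es r else just ((es , r) , false)

  parse-result : ParserState E → Maybe (List E × List Bool)
  parse-result s = maybe-case s nothing λ ((es , r) , b) → if b then nothing else just (List.reverse es , r)

  parse-loop : List Bool → ParserState E → ParserState E
  parse-loop fuel s = foldl (λ s _ → parse-step s) s fuel

  parseList : Parser (List E)
  -- The word is its own fuel, since each element and the end of the list take at least one letter.
  parseList w = parse-result (parse-loop w (just (([] , w) , true)))

parseVec : ∀ {E : Set} n → Parser E → Parser (Vec E n)
parseVec zero    p w = just ([] , w)
parseVec (suc n) p   = mapParser (λ (e , v) → just (e ∷ v)) (p then parseVec n p)

isParser-Vec : ∀ {E : Set} {encode : E → List Bool} n {p} → IsParser encode p →
               IsParser (encodeVec {k = n} encode) (parseVec n p)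
isParser-Vec zero P = record { complete = λ { [] r → refl } ; sound = λ { w refl → refl } }
isParser-Vec {encode = encode} (suc n) P =
  isParser-map (λ (e , v) → just (e ∷ v)) (λ v → Vec.head v , Vec.tail v) (λ { (_ ∷ _) → refl }) (λ { _ refl → refl })
    (λ { (_ ∷ _) → refl }) (isParser-then P (isParser-Vec n P))

module _ {E : Set} {encode : E → List Bool} {p : Parser E} (P : IsParser encode p) where

  parse-loop-stop : ∀ fuel {x} → parse-loop p fuel (just (x , false)) ≡ just (x , false)
  parse-loop-stop [] = refl
  parse-loop-stop (_ ∷ fuel) = parse-loop-stop fuel

  parse-loop-fail : ∀ fuel → parse-loop p fuel nothing ≡ nothing
  parse-loop-fail [] = refl
  parse-loop-fail (_ ∷ fuel) = parse-loop-fail fuel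

  parse-loop-complete : ∀ es fuel acc r → length es < length fuel →
    parse-loop p fuel (just ((acc , encodeList encode es ++ r) , true)) ≡ just ((es List.ʳ++ acc , r) , false)
  parse-loop-complete [] (_ ∷ fuel) acc r _ = parse-loop-stop fuel
  parse-loop-complete (e ∷ es) (_ ∷ fuel) acc r (s≤s l)
    rewrite Listₚ.++-assoc (encode e) (encodeList encode es) r | complete P e (encodeList encode es ++ r) =
    parse-loop-complete es fuel (e ∷ acc) r l

  parse-loop-sound : ∀ fuel acc w {es r} → parse-loop p fuel (just ((acc , w) , true)) ≡ just ((es , r) , false) →
    ∃[ es′ ] (es ≡ es′ List.ʳ++ acc × w ≡ encodeList encode es′ ++ r)
  parse-loop-sound (_ ∷ fuel) acc [] eq with () ← trans (sym eq) (parse-loop-fail fuel)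
  parse-loop-sound (_ ∷ fuel) acc (false ∷ w) eq with refl ← trans (sym eq) (parse-loop-stop fuel) = [] , refl , refl
  parse-loop-sound (_ ∷ fuel) acc (true ∷ w) eq with p w in eq₁
  ... | nothing with () ← trans (sym eq) (parse-loop-fail fuel)
  ... | just (e , r₁) with parse-loop-sound fuel (e ∷ acc) r₁ eq
  ... | es′ , eq₂ , eq₃ = e ∷ es′ , eq₂ ,
    cong (true ∷_) (trans (sound P w eq₁) (trans (cong (encode e ++_) eq₃) (sym (Listₚ.++-assoc (encode e) _ _))))

  length-encodeList : ∀ es → length es < length (encodeList encode es)
  length-encodeList [] = s≤s z≤n
  length-encodeList (e ∷ es) = s≤s (≤-trans (length-encodeList es)
    (≤-trans (m≤n+m _ (length (encode e))) (≤-reflexive (sym (Listₚ.length-++ (encode e))))))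

  isParser-List : IsParser (encodeList encode) (parseList p)
  isParser-List = record { complete = complete′ ; sound = sound′ }
    where
    complete′ : ∀ es r → parseList p (encodeList encode es ++ r) ≡ just (es , r)
    complete′ es r rewrite parse-loop-complete es (encodeList encode es ++ r) [] r
        (≤-trans (length-encodeList es) (≤-trans (m≤m+n _ (length r)) (≤-reflexive (sym (Listₚ.length-++ (encodeList encode es)))))) =
      cong (λ z → just (z , r)) (Listₚ.reverse-involutive es)
    sound′ : ∀ w {es r} → parseList p w ≡ just (es , r) → w ≡ encodeList encode es ++ r
    sound′ w eq with parse-loop p w (just (([] , w) , true)) in eq₁
    sound′ w refl | just ((es , r) , false) with parse-loop-sound w [] w eq₁
    ... | es′ , refl , eq₃ = trans eq₃ (cong (λ z → encodeList encode z ++ r)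
      (sym (Listₚ.reverse-involutive es′)))

parseBoolᶜ : Poly-time parseBool
parseBoolᶜ = extensional (λ { [] → refl ; (b ∷ w) → refl })
  (list-caseᶜ {h = λ (bw , _) → just bw} idᶜ (constᶜ nothing) (justᶜ fstᶜ))

module _ {E F : Set} ⦃ _ : Code E ⦄ ⦃ _ : Code F ⦄ {p : Parser E} where

  thenᶜ : {q : Parser F} → Poly-time p → Poly-time q → Poly-time (p then q)
  thenᶜ {q} P Q = maybe-caseᶜ
    {h = λ ((e , r) , _) → maybe-case (q r) nothing λ (f , r′) → just ((e , f) , r′)} P (constᶜ nothing)
    (maybe-caseᶜ {h = λ ((f , r′) , ((e , _) , _)) → just ((e , f) , r′)} (Q ⊙ sndᶜ ⊙ fstᶜ) (constᶜ nothing)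
      (justᶜ ((fstᶜ ⊙ fstᶜ ⊙ sndᶜ ▵ fstᶜ ⊙ fstᶜ) ▵ sndᶜ ⊙ fstᶜ)))

  mapParserᶜ : {f : E → Maybe F} → Poly-time f → Poly-time p → Poly-time (mapParser f p)
  mapParserᶜ {f} G P = maybe-caseᶜ {h = λ ((e , r) , _) → maybe-case (f e) nothing λ e′ → just (e′ , r)}
    P (constᶜ nothing)
    (maybe-caseᶜ {h = λ (e′ , ((_ , r) , _)) → just (e′ , r)} (G ⊙ fstᶜ ⊙ fstᶜ) (constᶜ nothing)
      (justᶜ (fstᶜ ▵ sndᶜ ⊙ fstᶜ ⊙ sndᶜ)))

parseVecᶜ : ∀ {E : Set} ⦃ _ : Code E ⦄ {p : Parser E} n → Poly-time p → Poly-time (parseVec n p)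
parseVecᶜ zero    P = justᶜ (constᶜ [] ▵ idᶜ)
parseVecᶜ (suc n) P = mapParserᶜ (justᶜ (vconsᶜ fstᶜ sndᶜ)) (thenᶜ P (parseVecᶜ n P))

module _ {E : Set} ⦃ _ : Code E ⦄ {encode : E → List Bool} {p : Parser E} (isP : IsParser encode p) where

  -- Soundness of `p` bounds the state: what remains is always a suffix of the word, so every
  -- element is parsed from something no larger than `w` and has size at most `Q w`.
  parseListᶜ : Poly-time p → Poly-time (parseList p)
  parseListᶜ P = resultᶜ ⊙ foldlᶜ {s = λ (_ , s , _) → parse-step p s}
      (justᶜ ((constᶜ [] ▵ idᶜ) ▵ constᶜ true)) idᶜ (stepᶜ ⊙ fstᶜ ⊙ sndᶜ)
      (λ w → 7 + (1 + length w * (1 + Q w)) + ∣ w ∣)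
      (≲-con 7 ≲+ (≲-con 1 ≲+ ≲-mono length≤size ≲-id ≲* (≲-con 1 ≲+ bounded Q-poly (λ _ → ≤-refl))) ≲+ ≲-id)
      λ w ys zs eq → size-state w ys (loop-small w ys 0 (just (([] , w) , true)) (≤-refl , ≤-refl)) (prefix-length ys eq)
    where
    elementᶜ : Poly-time (λ ((es , r) : List E × List Bool) → parse-element p es r)
    elementᶜ = list-caseᶜ
      {h = λ ((b , r) , (es , _)) → if b then maybe-case (p r) nothing (λ (e , r) → just ((e ∷ es , r) , true))
                                         else just ((es , r) , false)}
      sndᶜ (constᶜ nothing)
      (ifᶜ (fstᶜ ⊙ fstᶜ)
        (maybe-caseᶜ {h = λ ((e , r) , (_ , (es , _))) → just ((e ∷ es , r) , true)} (P ⊙ sndᶜ ⊙ fstᶜ) (constᶜ nothing)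
          (justᶜ ((consᶜ (fstᶜ ⊙ fstᶜ) (fstᶜ ⊙ sndᶜ ⊙ sndᶜ) ▵ sndᶜ ⊙ fstᶜ) ▵ constᶜ true)))
        (justᶜ ((fstᶜ ⊙ sndᶜ ▵ sndᶜ ⊙ fstᶜ) ▵ constᶜ false)))
    stepᶜ : Poly-time (parse-step p)
    stepᶜ = maybe-caseᶜ {h = λ (((es , r) , b) , _) → if b then parse-element p es r else just ((es , r) , false)}
      idᶜ (constᶜ nothing)
      (ifᶜ (sndᶜ ⊙ fstᶜ) (elementᶜ ⊙ fstᶜ ⊙ fstᶜ) (justᶜ (fstᶜ ⊙ fstᶜ ▵ constᶜ false)))
    resultᶜ : Poly-time (parse-result p)
    resultᶜ = maybe-caseᶜ {h = λ (((es , r) , b) , _) → if b then nothing else just (List.reverse es , r)}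
      idᶜ (constᶜ nothing)
      (ifᶜ (sndᶜ ⊙ fstᶜ) (constᶜ nothing) (justᶜ (reverseᶜ (fstᶜ ⊙ fstᶜ ⊙ fstᶜ) ▵ sndᶜ ⊙ fstᶜ ⊙ fstᶜ)))

    Q-poly : Poly 1
    Q-poly = poly (output≲ P)
    Q : List Bool → ℕ
    Q w = ⟦ Q-poly ⟧ (∣ w ∣ ∷ [])

    Small : List Bool → ℕ → ParserState E → Set
    Small w k nothing               = ⊤
    Small w k (just ((es , r) , _)) = ∣ es ∣ ≤ 1 + k * (1 + Q w) × ∣ r ∣ ≤ ∣ w ∣

    size-rest : ∀ {w e r} → p w ≡ just (e , r) → ∣ r ∣ ≤ ∣ w ∣
    size-rest {w} {e} eq = size-suffix (encode e) (sym (sound isP w eq))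

    size-element : ∀ {w e r} → p w ≡ just (e , r) → ∣ e ∣ ≤ Q w
    size-element {w} {e} {r} eq = ≤-trans (≤-trans (m≤m+n ∣ e ∣ ∣ r ∣) (≤-trans (n≤1+n _) (≤-trans (m≤m+n _ 1) (n≤1+n _))))
      (subst (λ z → ∣ z ∣ ≤ Q w) eq (bounds (output≲ P) w))

    step-small : ∀ w k s → Small w k s → Small w (suc k) (parse-step p s)
    step-small w k nothing h = _
    step-small w k (just ((es , r) , false)) (h , h′) = ≤-trans h (s≤s (m≤n+m _ _)) , h′
    step-small w k (just ((es , []) , true)) (h , h′) = _
    step-small w k (just ((es , false ∷ r) , true)) (h , h′) =
      ≤-trans h (s≤s (m≤n+m _ _)) , ≤-trans (≤-trans (n≤1+n _) (n≤1+n _)) h′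
    step-small w k (just ((es , true ∷ r) , true)) (h , h′) with p r in eq
    ... | nothing = _
    ... | just (e , r′) = s≤s (≤-trans (+-mono-≤ (≤-trans (size-element {r} eq) (⟦⟧-mono Q-poly r≤w)) h) (≤-reflexive (+-suc (Q w) _)))
          , ≤-trans (size-rest {r} eq) r≤w
      where
      r≤w = ≤-trans (m≤n+m ∣ r ∣ 4) h′

    loop-small : ∀ w ys k s → Small w k s → Small w (k + length ys) (parse-loop p ys s)
    loop-small w [] k s h = subst (λ k → Small w k s) (sym (+-identityʳ k)) h
    loop-small w (y ∷ ys) k s h = subst (λ k → Small w k (parse-loop p (y ∷ ys) s)) (sym (+-suc k (length ys)))
      (loop-small w ys (suc k) (parse-step p s) (step-small w k s h))

    prefix-length : ∀ {w} ys {zs : List Bool} → ys ++ zs ≡ w → length ys ≤ length w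
    prefix-length ys eq = ≤-trans (m≤m+n _ _) (≤-reflexive (trans (sym (Listₚ.length-++ ys)) (cong length eq)))

    size-state : ∀ w ys {s} → Small w (length ys) s → length ys ≤ length w →
                 ∣ s ∣ ≤ 7 + (1 + length w * (1 + Q w)) + ∣ w ∣
    size-state w ys {nothing} _ _ = s≤s z≤n
    size-state w ys {just ((es , r) , b)} (h , h′) l = ≤-trans
      (s≤s (+-monoˡ-≤ 1 (s≤s (+-mono-≤ (s≤s (+-mono-≤
        (≤-trans h (s≤s (*-monoˡ-≤ (1 + Q w) l))) h′)) (size-Bool b)))))
      (≤-reflexive (solve 2 (λ a b → κ 2 :+ ((κ 1 :+ (a :+ b)) :+ κ 3 :+ κ 1) := κ 7 :+ a :+ b) refl
        (1 + length w * (1 + Q w)) ∣ w ∣))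


-- Parsing instances

open Triple public
open Agent public
open ChargeInstance public

instance
  code-Fin : ∀ {T} → Code (Fin T)
  code-Fin = record { code = λ d → code (toℕ d) }

  code-Triple : ∀ {T} → Code (Triple T)
  code-Triple = record { code = λ k → code (value k , (deadline k , demand k)) }

codeSpeed : ∀ ν {T} → SpeedLimit ν T → Tree
codeSpeed fixed     s = code {ℕ} s
codeSpeed unbounded s = leaf
codeSpeed gaps      s = code s

instance
  code-Agent : ∀ {ν T} → Code (Agent ν T)
  code-Agent {ν} = record { code = λ i → node (code (triples i)) (codeSpeed ν (speed i)) }

  code-ChargeInstance : ∀ {ν T} → Code (ChargeInstance ν T)
  code-ChargeInstance = record { code = λ I → code (supply I , (Vec.toList (agents I) , target I)) }

parseℕ : Parser ℕ
parseℕ = mapParser (λ bs → just (valueᵈ (List.map toDigit bs))) (parseList parseBool)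

isOne-toDigit : ∀ b → isOne (toDigit b) ≡ b
isOne-toDigit false = refl
isOne-toDigit true  = refl

toDigit-isOne : ∀ d → toDigit (isOne d) ≡ d
toDigit-isOne one = refl
toDigit-isOne two = refl

encodeℕᵇ-digits : ∀ x → encodeℕᵇ x ≡ encodeList [_] (List.map isOne (digitsᵇ x))
encodeℕᵇ-digits ℕᵇ.zero  = refl
encodeℕᵇ-digits 2[1+ x ] = cong (λ w → true ∷ false ∷ w) (encodeℕᵇ-digits x)
encodeℕᵇ-digits 1+[2 x ] = cong (λ w → true ∷ true ∷ w) (encodeℕᵇ-digits x)

isParser-ℕ : IsParser encodeℕ parseℕ
isParser-ℕ = isParser-map (λ bs → just (valueᵈ (List.map toDigit bs))) (λ n → List.map isOne (digits n))
  (λ n → cong just (trans (cong valueᵈ (trans (sym (Listₚ.map-∘ (digits n)))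
    (trans (Listₚ.map-cong toDigit-isOne (digits n)) (Listₚ.map-id (digits n))))) (value-digits n)))
  (λ { bs refl → trans (cong (List.map isOne) (digits-value _))
    (trans (sym (Listₚ.map-∘ bs)) (trans (Listₚ.map-cong isOne-toDigit bs) (Listₚ.map-id bs))) })
  (λ n → encodeℕᵇ-digits (ℕᵇ.fromℕ n))
  (isParser-List isParser-Bool)

parseℕᶜ : Poly-time parseℕ
parseℕᶜ = mapParserᶜ (justᶜ (valueᵈᶜ (mapᶜ {s = λ (b , _) → toDigit b} idᶜ (ifᶜ fstᶜ (constᶜ one) (constᶜ two)))))
  (parseListᶜ isParser-Bool parseBoolᶜ)

toFin : ∀ {T} → ℕ → Maybe (Fin T)
toFin {T} n with n ℕₚ.<? T
... | yes n<T = just (Fin.fromℕ< n<T)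
... | no _    = nothing

toFinᶜ : ∀ {T} → Poly-time (toFin {T})
toFinᶜ {T} = recoded {g = toFin {T}} same (ifᶜ (≤ᵇᶜ (sucᶜ idᶜ) (constᶜ T)) (justᶜ idᶜ) (constᶜ nothing))
  where
  same : ∀ n → code (if suc n ≤ᵇ T then just n else nothing) ≡ code (toFin {T} n)
  same n with n ℕₚ.<? T
  ... | yes n<T rewrite Finₚ.toℕ-fromℕ< n<T = cong (λ b → code (if b then just n else nothing)) (dec-true n<T)
    where
    dec-true : n < T → (suc n ≤ᵇ T) ≡ true
    dec-true l with suc n ≤ᵇ T in eq
    ... | true = refl
    ... | false with () ← subst (λ b → Bool.T b) eq (≤⇒≤ᵇ l)
  ... | no n≮T = cong (λ b → code (if b then just n else nothing)) (dec-false n≮T)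
    where
    dec-false : ¬ n < T → (suc n ≤ᵇ T) ≡ false
    dec-false l with suc n ≤ᵇ T in eq
    ... | false = refl
    ... | true = ⊥-elim (l (≤ᵇ⇒≤ (suc n) T (subst Bool.T (sym eq) _)))

parseFin : ∀ {T} → Parser (Fin T)
parseFin = mapParser toFin parseℕ

isParser-Fin : ∀ {T} → IsParser (λ (d : Fin T) → encodeℕ (toℕ d)) parseFin
isParser-Fin {T} = isParser-map toFin toℕ to from (λ _ → refl) isParser-ℕ
  where
  to : ∀ (d : Fin T) → toFin (toℕ d) ≡ just d
  to d with toℕ d ℕₚ.<? T
  ... | yes p = cong just (Finₚ.fromℕ<-toℕ d p)
  ... | no ¬p = ⊥-elim (¬p (Finₚ.toℕ<n d))
  from : ∀ n {d} → toFin {T} n ≡ just d → toℕ d ≡ n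
  from n eq with n ℕₚ.<? T
  from n refl | yes p = Finₚ.toℕ-fromℕ< p

parseTriple : ∀ {T} → Parser (Triple T)
parseTriple = mapParser (λ (v , (d , w)) → just (triple v d w)) (parseℕ then (parseFin then parseℕ))

isParser-Triple : ∀ {T} → IsParser encodeTriple (parseTriple {T})
isParser-Triple = isParser-map (λ (v , (d , w)) → just (triple v d w)) (λ k → value k , (deadline k , demand k)) (λ _ → refl) (λ { _ refl → refl }) (λ _ → refl)
  (isParser-then isParser-ℕ (isParser-then isParser-Fin isParser-ℕ))

parseTripleᶜ : ∀ {T} → Poly-time (parseTriple {T})
parseTripleᶜ = mapParserᶜ
  (justᶜ (recode (λ (v , (d , w)) → triple v d w) (λ _ → refl) (λ _ → ≤-refl)))
  (thenᶜ parseℕᶜ (thenᶜ (mapParserᶜ toFinᶜ parseℕᶜ) parseℕᶜ))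

code-Speed : ∀ ν {T} → Code (SpeedLimit ν T)
code-Speed ν = record { code = codeSpeed ν }

parseSpeed : ∀ ν {T} → Parser (SpeedLimit ν T)
parseSpeed fixed         = parseℕ
parseSpeed unbounded     = λ w → just (tt , w)
parseSpeed gaps      {T} = parseVec T parseBool

isParser-Speed : ∀ ν {T} → IsParser (encodeSpeed ν {T}) (parseSpeed ν)
isParser-Speed fixed = isParser-ℕ
isParser-Speed unbounded = record { complete = λ _ _ → refl ; sound = λ { w refl → refl } }
isParser-Speed gaps {T} = record
  { complete = λ s r → subst (λ w → parseVec T parseBool (w ++ r) ≡ just (s , r)) (encodeVec-toList s) (complete P s r)
  ; sound = λ w {s} {r} eq → trans (sound P w eq) (cong (_++ r) (encodeVec-toList s)) }
  where
  P = isParser-Vec T isParser-Bool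
  encodeVec-toList : ∀ {k} (s : Vec Bool k) → encodeVec [_] s ≡ Vec.toList s
  encodeVec-toList []      = refl
  encodeVec-toList (b ∷ s) = cong (b ∷_) (encodeVec-toList s)

parseSpeedᶜ : ∀ ν {T} → let instance _ = code-Speed ν {T} in Poly-time (parseSpeed ν {T})
parseSpeedᶜ fixed         = parseℕᶜ
parseSpeedᶜ unbounded     = justᶜ (constᶜ tt ▵ idᶜ)
parseSpeedᶜ gaps      {T} = parseVecᶜ T parseBoolᶜ

module _ {ν : Variant} {T : ℕ} where
  parseAgent : Parser (Agent ν T)
  parseAgent = mapParser (λ (ks , s) → just (agent ks s)) (parseList parseTriple then parseSpeed ν)

  isParser-Agent : IsParser encodeAgent parseAgent
  isParser-Agent = isParser-map (λ (ks , s) → just (agent ks s)) (λ i → triples i , speed i) (λ _ → refl) (λ { _ refl → refl }) (λ _ → refl)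
    (isParser-then (isParser-List isParser-Triple) (isParser-Speed ν))

  parseAgentᶜ : Poly-time parseAgent
  parseAgentᶜ = mapParserᶜ (justᶜ (recode (λ (ks , s) → agent ks s) (λ _ → refl) (λ _ → ≤-refl)))
    (thenᶜ (parseListᶜ isParser-Triple parseTripleᶜ) (parseSpeedᶜ ν))
    where instance _ = code-Speed ν

  fromParts : Vec ℕ T × (List (Agent ν T) × ℕ) → ChargeInstance ν T
  fromParts (m , (as , v)) = chargeInstance (length as) m (Vec.fromList as) v

  toParts : ChargeInstance ν T → Vec ℕ T × (List (Agent ν T) × ℕ)
  toParts I = supply I , (Vec.toList (agents I) , target I)

  fromParts-toParts : ∀ I → fromParts (toParts I) ≡ I
  fromParts-toParts I = cong (λ (n , as) → chargeInstance n (supply I) as (target I)) (fromList-toList (agents I))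
    where
    fromList-toList : ∀ {n} (as : Vec (Agent ν T) n) →
      _≡_ {A = Σ ℕ (Vec (Agent ν T))} (length (Vec.toList as) , Vec.fromList (Vec.toList as)) (n , as)
    fromList-toList []       = refl
    fromList-toList (a ∷ as) = cong (λ (n , as) → suc n , a ∷ as) (fromList-toList as)

  toParts-fromParts : ∀ p → toParts (fromParts p) ≡ p
  toParts-fromParts (m , (as , v)) = cong (λ as → m , (as , v)) (Vecₚ.toList∘fromList as)

  parseInstance : Parser (ChargeInstance ν T)
  parseInstance = mapParser (just ∘ fromParts) (parseVec T parseℕ then (parseList parseAgent then parseℕ))

  isParser-Instance : IsParser encodeInstance parseInstance
  isParser-Instance = isParser-map (just ∘ fromParts) toParts (λ I → cong just (fromParts-toParts I))
    (λ { p refl → toParts-fromParts p }) (λ _ → refl)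
    (isParser-then (isParser-Vec T isParser-ℕ) (isParser-then (isParser-List isParser-Agent) isParser-ℕ))

  parseInstanceᶜ : Poly-time parseInstance
  parseInstanceᶜ = mapParserᶜ (justᶜ (recode fromParts (λ p → cong code (toParts-fromParts p)) (λ _ → ≤-refl)))
    (thenᶜ (parseVecᶜ T parseℕᶜ) (thenᶜ (parseListᶜ isParser-Agent parseAgentᶜ) parseℕᶜ))

decode : ∀ {E : Set} → Parser E → List Bool → Maybe E
decode p w = maybe-case (p w) nothing λ (e , r) → list-case r (just e) (λ _ _ → nothing)

decode-encode : ∀ {E : Set} {encode : E → List Bool} {p} → IsParser encode p → ∀ e → decode p (encode e) ≡ just e
decode-encode {encode = encode} {p} P e
  rewrite trans (cong p (sym (Listₚ.++-identityʳ (encode e)))) (complete P e []) = refl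

encode-decode : ∀ {E : Set} {encode : E → List Bool} {p} → IsParser encode p →
                ∀ w {e} → decode p w ≡ just e → encode e ≡ w
encode-decode {p = p} P w eq with p w in eq₁
encode-decode {p = p} P w refl | just (e , []) = sym (trans (sound P w eq₁) (Listₚ.++-identityʳ _))

decodeᶜ : ∀ {E : Set} ⦃ _ : Code E ⦄ {p : Parser E} → Poly-time p → Poly-time (decode p)
decodeᶜ P = maybe-caseᶜ {h = λ ((e , r) , _) → list-case r (just e) (λ _ _ → nothing)} P (constᶜ nothing)
  (list-caseᶜ {h = λ _ → nothing} (sndᶜ ⊙ fstᶜ) (justᶜ (fstᶜ ⊙ fstᶜ)) (constᶜ nothing))


-- Scheduling with integral allocations

sumᶠ : ∀ {n} → (Fin n → ℕ) → ℕ
sumᶠ = Sum.sum +-0-monoid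

allᶠ : ∀ {n} → (Fin n → Bool) → Bool
allᶠ {zero}  p = true
allᶠ {suc n} p = p zero ∧ allᶠ (p ∘ suc)

T⇒≡true : ∀ {b} → T b → b ≡ true
T⇒≡true {true} _ = refl

T-∧⁻ : ∀ {a b} → T (a ∧ b) → T a × T b
T-∧⁻ {true} h = _ , h

T-∧⁺ : ∀ {a b} → T a → T b → T (a ∧ b)
T-∧⁺ {true} _ h = h

T-allᶠ⁻ : ∀ {n} {p : Fin n → Bool} → T (allᶠ p) → ∀ i → T (p i)
T-allᶠ⁻ h zero    = proj₁ (T-∧⁻ h)
T-allᶠ⁻ h (suc i) = T-allᶠ⁻ (proj₂ (T-∧⁻ h)) i

T-allᶠ⁺ : ∀ {n} {p : Fin n → Bool} → (∀ i → T (p i)) → T (allᶠ p)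
T-allᶠ⁺ {zero}  h = _
T-allᶠ⁺ {suc n} h = T-∧⁺ (h zero) (T-allᶠ⁺ (h ∘ suc))

cumulativeℕ : ∀ {n} → Vec ℕ n → Fin n → ℕ
cumulativeℕ x d = sumᶠ (λ t → if toℕ t ≤ᵇ toℕ d then lookup x t else 0)

tripleValue : ∀ {n} → Vec ℕ n → Triple n → ℕ
tripleValue x k = if demand k ≤ᵇ cumulativeℕ x (deadline k) then value k else 0

sumOver : ∀ {E : Set} → (E → ℕ) → List E → ℕ
sumOver f = foldr (λ e n → f e + n) 0

agentValueℕ : ∀ {ν n} → Agent ν n → Vec ℕ n → ℕ
agentValueℕ a x = sumOver (tripleValue x) (triples a)

respects : ∀ ν {n} → SpeedLimit ν n → Vec ℕ n → Bool
respects fixed     s x = allᶠ (λ t → lookup x t ≤ᵇ s)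
respects unbounded s x = true
respects gaps      s x = allᶠ (λ t → lookup s t ∨ (lookup x t ≤ᵇ 0))

_≤ᵛ_ : ∀ {n} → Vec ℕ n → Vec ℕ n → Set
x ≤ᵛ y = ∀ t → lookup x t ≤ lookup y t

_+ᵛ_ : ∀ {n} → Vec ℕ n → Vec ℕ n → Vec ℕ n
x +ᵛ y = Vec.tabulate (λ t → lookup x t + lookup y t)

_≤ᵛᵇ_ : ∀ {n} → Vec ℕ n → Vec ℕ n → Bool
x ≤ᵛᵇ y = allᶠ (λ t → lookup x t ≤ᵇ lookup y t)

≤ᵛᵇ⇒≤ᵛ : ∀ {n} (x y : Vec ℕ n) → T (x ≤ᵛᵇ y) → x ≤ᵛ y
≤ᵛᵇ⇒≤ᵛ x y h t = ≤ᵇ⇒≤ _ _ (T-allᶠ⁻ h t)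

≤ᵛ⇒≤ᵛᵇ : ∀ {n} (x y : Vec ℕ n) → x ≤ᵛ y → T (x ≤ᵛᵇ y)
≤ᵛ⇒≤ᵛᵇ x y h = T-allᶠ⁺ (λ t → ≤⇒≤ᵇ (h t))

lookup-+ᵛ : ∀ {n} (x y : Vec ℕ n) t → lookup (x +ᵛ y) t ≡ lookup x t + lookup y t
lookup-+ᵛ x y t = Vecₚ.lookup∘tabulate _ t

-- Achieves as r v: the agents can realise the value v with the resources r.
data Achieves {ν : Variant} {n : ℕ} : List (Agent ν n) → Vec ℕ n → ℕ → Set where
  []  : ∀ {r} → Achieves [] r 0
  add : ∀ {a as r r′ v} x → T (respects ν (speed a) x) → (x +ᵛ r′) ≤ᵛ r → Achieves as r′ v →
        Achieves (a ∷ as) r (agentValueℕ a x + v)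

achieves-mono : ∀ {ν n} {as : List (Agent ν n)} {r r′ v} → r ≤ᵛ r′ → Achieves as r v → Achieves as r′ v
achieves-mono r≤r′ [] = []
achieves-mono r≤r′ (add x s h p) = add x s (λ t → ≤-trans (h t) (r≤r′ t)) p

totalTriples : ∀ {ν n} → Agent ν n → ℕ
totalTriples a = sumOver value (triples a)

agentValueℕ≤ : ∀ {ν n} (a : Agent ν n) x → agentValueℕ a x ≤ totalTriples a
agentValueℕ≤ a x = go (triples a)
  where
  go : ∀ ks → sumOver (tripleValue x) ks ≤ sumOver value ks
  go [] = z≤n
  go (k ∷ ks) with demand k ≤ᵇ cumulativeℕ x (deadline k)
  ... | true  = +-monoʳ-≤ (value k) (go ks)
  ... | false = ≤-trans (go ks) (m≤n+m _ (value k))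

module _ {X : Set} ⦃ _ : Code X ⦄ where

  sumᶠᶜ : ∀ {n} {f : Fin n → X → ℕ} → (∀ i → Poly-time (f i)) → Poly-time (λ x → sumᶠ (λ i → f i x))
  sumᶠᶜ {zero}  F = constᶜ 0
  sumᶠᶜ {suc n} F = +ᶜ (F zero) (sumᶠᶜ (F ∘ suc))

  allᶠᶜ : ∀ {n} {f : Fin n → X → Bool} → (∀ i → Poly-time (f i)) → Poly-time (λ x → allᶠ (λ i → f i x))
  allᶠᶜ {zero}  F = constᶜ true
  allᶠᶜ {suc n} F = ∧ᶜ (F zero) (allᶠᶜ (F ∘ suc))

  ≤ᵛᵇᶜ : ∀ {n} {f g : X → Vec ℕ n} → Poly-time f → Poly-time g → Poly-time (λ x → f x ≤ᵛᵇ g x)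
  ≤ᵛᵇᶜ F G = allᶠᶜ (λ t → ≤ᵇᶜ (lookupᶜ F t) (lookupᶜ G t))

  +ᵛᶜ : ∀ {n} {f g : X → Vec ℕ n} → Poly-time f → Poly-time g → Poly-time (λ x → f x +ᵛ g x)
  +ᵛᶜ F G = tabulateᶜ (λ t → +ᶜ (lookupᶜ F t) (lookupᶜ G t))

  valueᶜ : ∀ {n} {k : X → Triple n} → Poly-time k → Poly-time (λ x → value (k x))
  valueᶜ K = fstᶜ ⊙ recode (λ k → value k , (deadline k , demand k)) (λ _ → refl) (λ _ → ≤-refl) ⊙ K

  demandᶜ : ∀ {n} {k : X → Triple n} → Poly-time k → Poly-time (λ x → demand (k x))
  demandᶜ K = sndᶜ ⊙ sndᶜ ⊙ recode (λ k → value k , (deadline k , demand k)) (λ _ → refl) (λ _ → ≤-refl) ⊙ K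

  deadlineᶜ : ∀ {n} {k : X → Triple n} → Poly-time k → Poly-time (λ x → toℕ (deadline (k x)))
  deadlineᶜ K = recode toℕ (λ _ → refl) (λ _ → ≤-refl) ⊙ fstᶜ ⊙ sndᶜ ⊙
                recode (λ k → value k , (deadline k , demand k)) (λ _ → refl) (λ _ → ≤-refl) ⊙ K

  module _ {ν n} {a : X → Agent ν n} where

    triplesᶜ : Poly-time a → Poly-time (λ x → triples (a x))
    triplesᶜ A = fstᶜ ⊙ recode (λ a → triples a , speed a) (λ _ → refl) (λ _ → ≤-refl) ⊙ A
      where instance _ = code-Speed ν

    speedᶜ : let instance _ = code-Speed ν in Poly-time a → Poly-time (λ x → speed (a x))
    speedᶜ A = sndᶜ ⊙ recode (λ a → triples a , speed a) (λ _ → refl) (λ _ → ≤-refl) ⊙ A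
      where instance _ = code-Speed ν

  respectsᶜ : ∀ ν {n} {s : X → SpeedLimit ν n} {v : X → Vec ℕ n} → let instance _ = code-Speed ν in
              Poly-time s → Poly-time v → Poly-time (λ x → respects ν (s x) (v x))
  respectsᶜ fixed     S V = allᶠᶜ (λ t → ≤ᵇᶜ (lookupᶜ V t) S)
  respectsᶜ unbounded S V = constᶜ true
  respectsᶜ gaps      S V = allᶠᶜ (λ t → ∨ᶜ (lookupᶜ S t) (≤ᵇᶜ (lookupᶜ V t) (constᶜ 0)))

  supplyᶜ : ∀ {ν n} {I : X → ChargeInstance ν n} → Poly-time I → Poly-time (λ x → supply (I x))
  supplyᶜ F = fstᶜ ⊙ recode toParts (λ _ → refl) (λ _ → ≤-refl) ⊙ F

  agentsᶜ : ∀ {ν n} {I : X → ChargeInstance ν n} → Poly-time I → Poly-time (λ x → Vec.toList (agents (I x)))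
  agentsᶜ F = fstᶜ ⊙ sndᶜ ⊙ recode toParts (λ _ → refl) (λ _ → ≤-refl) ⊙ F

  targetᶜ : ∀ {ν n} {I : X → ChargeInstance ν n} → Poly-time I → Poly-time (λ x → target (I x))
  targetᶜ F = sndᶜ ⊙ sndᶜ ⊙ recode toParts (λ _ → refl) (λ _ → ≤-refl) ⊙ F

module _ {X : Set} ⦃ _ : Code X ⦄ where

  tripleValueᶜ : ∀ {n} {v : X → Vec ℕ n} {k : X → Triple n} → Poly-time v → Poly-time k →
                 Poly-time (λ x → tripleValue (v x) (k x))
  tripleValueᶜ V K = ifᶜ (≤ᵇᶜ (demandᶜ K) (sumᶠᶜ λ t →
      ifᶜ (≤ᵇᶜ (constᶜ (toℕ t)) (deadlineᶜ K)) (lookupᶜ V t) (constᶜ 0)))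
    (valueᶜ K) (constᶜ 0)

  totalTriplesᶜ : ∀ {ν n} {a : X → Agent ν n} → Poly-time a → Poly-time (λ x → totalTriples (a x))
  totalTriplesᶜ A = sumᶜ {s = λ (k , _) → value k} (triplesᶜ A) (valueᶜ fstᶜ)

module _ {X : Set} ⦃ _ : Code X ⦄ where

  agentValueᶜ : ∀ {ν n} {a : X → Agent ν n} {v : X → Vec ℕ n} → Poly-time a → Poly-time v →
                Poly-time (λ x → agentValueℕ (a x) (v x))
  agentValueᶜ {v = v} A V = sumᶜ {s = λ (k , x) → tripleValue (v x) k} (triplesᶜ A) (tripleValueᶜ (V ⊙ sndᶜ) fstᶜ)


-- Dynamic programming over all vectors of resources

grid : ∀ n → List ℕ → List (Vec ℕ n)
grid zero    ks = [ [] ]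
grid (suc n) ks = List.concatMap (λ k → List.map (k ∷_) (grid n ks)) ks

∈-grid : ∀ {n ks} (v : Vec ℕ n) → (∀ t → lookup v t ∈ ks) → v ∈ grid n ks
∈-grid [] h = here refl
∈-grid {ks = ks} (k ∷ v) h = ∈ₚ.∈-concatMap⁺ _
  (lose (h zero) (∈ₚ.∈-map⁺ (k ∷_) (∈-grid v (h ∘ suc))))

-- The default 0 for a split that is not allowed is harmless: by giving nothing to anyone, every
-- vector of resources achieves some value, which is at least 0.
candidate : ∀ {ν n} → Agent ν n → Vec ℕ n → Vec ℕ n → Vec ℕ n × ℕ → ℕ
candidate {ν} a r x (r′ , v) = if respects ν (speed a) x ∧ ((x +ᵛ r′) ≤ᵛᵇ r) then agentValueℕ a x + v else 0

best : ∀ {ν n} → List (Vec ℕ n) → Agent ν n → Vec ℕ n → List (Vec ℕ n × ℕ) → ℕ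
best g a r tbl = maximum (List.concatMap (λ e → List.map (λ x → candidate a r x e) g) tbl)

layer : ∀ {ν n} → List (Vec ℕ n) → Agent ν n → List (Vec ℕ n × ℕ) → List (Vec ℕ n × ℕ)
layer g a tbl = List.map (λ r → r , best g a r tbl) g

table : ∀ {ν n} → List (Vec ℕ n) → List (Agent ν n) → List (Vec ℕ n × ℕ)
table g = foldr (layer g) (List.map (_, 0) g)

optimum : ∀ {n} → Vec ℕ n → List (Vec ℕ n × ℕ) → ℕ
optimum m tbl = maximum (List.map (λ (r , v) → if r ≤ᵛᵇ m then v else 0) tbl)

decide : ∀ {ν n} → Unary → ChargeInstance ν n → Bool
decide {n = n} u I = target I ≤ᵇ
  -- The extra `tt` makes the entries range up to `length u` inclusive. The supply itself may lie
  -- outside the grid, so all grid points below it are considered.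
  optimum (supply I) (table (grid n (List.downFrom (length (tt ∷ u)))) (Vec.toList (agents I)))

≤-maximum : ∀ {n ns} → n ∈ ns → n ≤ maximum ns
≤-maximum {ns = n ∷ ns} (here refl) = m≤m⊔n n (maximum ns)
≤-maximum {ns = n ∷ ns} (there p)   = ≤-trans (≤-maximum p) (m≤n⊔m n (maximum ns))

maximum-∈ : ∀ ns → maximum ns ≡ 0 ⊎ maximum ns ∈ ns
maximum-∈ [] = inj₁ refl
maximum-∈ (n ∷ ns) with ⊔-sel n (maximum ns) | maximum-∈ ns
... | inj₁ e | _      = inj₂ (here e)
... | inj₂ e | inj₁ z = inj₁ (trans e z)
... | inj₂ e | inj₂ p = inj₂ (there (subst (_∈ ns) (sym e) p))

module _ {ν : Variant} {n : ℕ} where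

  zeros : Vec ℕ n
  zeros = Vec.replicate n 0

  lookup-zeros : ∀ t → lookup zeros t ≡ 0
  lookup-zeros t = Vecₚ.lookup-replicate t 0

  respects-zeros : ∀ ν s → T (respects ν {n} s zeros)
  respects-zeros fixed     s = T-allᶠ⁺ λ t → ≤⇒≤ᵇ (≤-trans (≤-reflexive (lookup-zeros t)) z≤n)
  respects-zeros unbounded s = _
  respects-zeros gaps      s = T-allᶠ⁺ λ t → subst (λ b → T (lookup s t ∨ (b ≤ᵇ 0))) (sym (lookup-zeros t)) (T-∨ʳ (lookup s t))
    where
    T-∨ʳ : ∀ b → T (b ∨ true)
    T-∨ʳ false = _
    T-∨ʳ true = _

  some-value : ∀ (as : List (Agent ν n)) r → ∃[ w ] Achieves as r w
  some-value [] r = 0 , []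
  some-value (a ∷ as) r = let w , p = some-value as r in
    _ , add zeros (respects-zeros ν (speed a))
      (λ t → ≤-reflexive (trans (lookup-+ᵛ zeros r t) (cong (_+ lookup r t) (lookup-zeros t)))) p

  table-sound : ∀ g (as : List (Agent ν n)) {r v} → (r , v) ∈ table g as → ∃[ w ] (v ≤ w × Achieves as r w)
  table-sound g [] p with ∈ₚ.∈-map⁻ (_, 0) p
  ... | r , _ , refl = 0 , z≤n , []
  table-sound g (a ∷ as) p with ∈ₚ.∈-map⁻ _ p
  ... | r , _ , refl with maximum-∈ (List.concatMap (λ e → List.map (λ x → candidate a r x e) g) (table g as))
  ... | inj₁ z = let w , q = some-value (a ∷ as) r in w , ≤-trans (≤-reflexive z) z≤n , q
  ... | inj₂ q with find (∈ₚ.∈-concatMap⁻ (λ e → List.map (λ x → candidate a r x e) g) {xs = table g as} q)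
  ... | (r′ , v) , e∈ , q′ with ∈ₚ.∈-map⁻ _ q′
  ... | x , _ , eq with respects ν (speed a) x ∧ ((x +ᵛ r′) ≤ᵛᵇ r) in test
  ... | false = let w , q = some-value (a ∷ as) r in w , ≤-trans (≤-reflexive eq) z≤n , q
  ... | true = let w , v≤w , p′ = table-sound g as e∈
                   h , h′ = T-∧⁻ {respects ν (speed a) x} (subst T (sym test) _)
               in _ , ≤-trans (≤-reflexive eq) (+-monoʳ-≤ (agentValueℕ a x) v≤w) , add x h (≤ᵛᵇ⇒≤ᵛ (x +ᵛ r′) r h′) p′

  -- Required of all numbers below an entry and not only of the entries, so that it passes on to the
  -- smaller vectors `x` and `r′` of the recursion.
  Bounded : List ℕ → Vec ℕ n → Set
  Bounded ks r = ∀ k → (∃[ t ] k ≤ lookup r t) → k ∈ ks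

  table-complete : ∀ {ks} (as : List (Agent ν n)) {r v} → Bounded ks r → Achieves as r v →
                   ∃[ w ] (v ≤ w × (r , w) ∈ table (grid n ks) as)
  table-complete {ks} [] b [] = 0 , z≤n , ∈ₚ.∈-map⁺ (_, 0) (∈-grid _ (λ t → b _ (t , ≤-refl)))
  table-complete {ks} (a ∷ as) {r} b (add {r′ = r′} {v} x s h p) =
    let w , v≤w , q = table-complete as (λ k (t , l) → b k (t , ≤-trans l (r′≤ t))) p in
    _ , ≤-trans (+-monoʳ-≤ (agentValueℕ a x) v≤w)
          (≤-maximum (∈ₚ.∈-concatMap⁺ (λ e → List.map (λ x → candidate a r x e) (grid n ks)) (lose q
            (subst (_∈ List.map (λ x → candidate a r x (r′ , w)) (grid n ks))
              (cong (λ b → if b then agentValueℕ a x + w else 0) (T⇒≡true (T-∧⁺ s (≤ᵛ⇒≤ᵛᵇ (x +ᵛ r′) r h))))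
              (∈ₚ.∈-map⁺ (λ x → candidate a r x (r′ , w)) (∈-grid x (λ t → b _ (t , x≤ t)))))))) ,
    ∈ₚ.∈-map⁺ _ (∈-grid r (λ t → b _ (t , ≤-refl)))
    where
    x≤ : x ≤ᵛ r
    x≤ t = ≤-trans (≤-trans (m≤m+n _ (lookup r′ t)) (≤-reflexive (sym (lookup-+ᵛ x r′ t)))) (h t)
    r′≤ : r′ ≤ᵛ r
    r′≤ t = ≤-trans (≤-trans (m≤n+m _ (lookup x t)) (≤-reflexive (sym (lookup-+ᵛ x r′ t)))) (h t)

  achieves-≤ : ∀ {as : List (Agent ν n)} {r v} → Achieves as r v → v ≤ sumOver totalTriples as
  achieves-≤ [] = z≤n
  achieves-≤ (add {a = a} x s h p) = +-mono-≤ (agentValueℕ≤ a x) (achieves-≤ p)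

  ∈-downFrom : ∀ {k m} → k < m → k ∈ List.downFrom m
  ∈-downFrom {k} {suc m} k<1+m with m≤n⇒m<n∨m≡n (≤-pred k<1+m)
  ... | inj₁ k<m  = there (∈-downFrom k<m)
  ... | inj₂ refl = here refl

  decide-sound : ∀ u (I : ChargeInstance ν n) → decide u I ≡ true →
                 ∃[ w ] (target I ≤ w × Achieves (Vec.toList (agents I)) (supply I) w)
  decide-sound u I eq with maximum-∈ (List.map (λ (r , v) → if r ≤ᵛᵇ supply I then v else 0)
                             (table (grid n (List.downFrom (length (tt ∷ u)))) (Vec.toList (agents I))))
                         | ≤ᵇ⇒≤ (target I) _ (subst T (sym eq) _)
  ... | inj₁ z | l = let w , p = some-value (Vec.toList (agents I)) (supply I) in
                     w , ≤-trans l (≤-trans (≤-reflexive z) z≤n) , p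
  ... | inj₂ q | l with ∈ₚ.∈-map⁻ _ q
  ... | (r , v) , e∈ , eq′ with r ≤ᵛᵇ supply I in test
  ... | false = let w , p = some-value (Vec.toList (agents I)) (supply I) in
                w , ≤-trans l (≤-trans (≤-reflexive eq′) z≤n) , p
  ... | true  = let w , v≤w , p = table-sound _ (Vec.toList (agents I)) e∈ in
                w , ≤-trans l (≤-trans (≤-reflexive eq′) v≤w) , achieves-mono (≤ᵛᵇ⇒≤ᵛ r (supply I) (subst T (sym test) _)) p

  -- Only the resources `r` that are actually used have to fit into the grid. This is how bounds on
  -- demands or speeds can replace a bound on the supply.
  decide-complete : ∀ u (I : ChargeInstance ν n) {r v} → r ≤ᵛ supply I → (∀ t → lookup r t ≤ length u) →
                    target I ≤ v → Achieves (Vec.toList (agents I)) r v → decide u I ≡ true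
  decide-complete u I {r} {v} r≤m r≤u t≤v p =
    let w , v≤w , q = table-complete (Vec.toList (agents I))
                        (λ k (t , l) → ∈-downFrom (s≤s (≤-trans l (r≤u t)))) p
    in T⇒≡true (≤⇒≤ᵇ (≤-trans t≤v (≤-trans v≤w
      (≤-maximum (subst (_∈ List.map (λ (r , v) → if r ≤ᵛᵇ supply I then v else 0)
          (table (grid n (List.downFrom (length (tt ∷ u)))) (Vec.toList (agents I))))
        (cong (λ b → if b then w else 0) (T⇒≡true (≤ᵛ⇒≤ᵛᵇ r (supply I) r≤m)))
        (∈ₚ.∈-map⁺ (λ (r , v) → if r ≤ᵛᵇ supply I then v else 0) q))))))

module _ {X : Set} ⦃ _ : Code X ⦄ where

  ⊔ᶜ : ∀ {f g : X → ℕ} → Poly-time f → Poly-time g → Poly-time (λ x → f x ⊔ g x)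
  ⊔ᶜ {f} {g} F G = extensional (λ x → max (f x) (g x)) (ifᶜ (≤ᵇᶜ F G) G F)
    where
    max : ∀ m n → (if m ≤ᵇ n then n else m) ≡ m ⊔ n
    max m n with m ≤ᵇ n in eq
    ... | true  = sym (m≤n⇒m⊔n≡n (≤ᵇ⇒≤ m n (subst T (sym eq) _)))
    ... | false = sym (m≥n⇒m⊔n≡m (<⇒≤ (≰⇒> λ m≤n → subst T eq (≤⇒≤ᵇ m≤n))))

module _ {X : Set} ⦃ _ : Code X ⦄ where

  maximumᶜ : ∀ {l : X → List ℕ} → Poly-time l → Poly-time (λ x → maximum (l x))
  maximumᶜ L = foldr-growthᶜ {s = λ (m , (n , _)) → m ⊔ n} (constᶜ 0) L (⊔ᶜ fstᶜ (fstᶜ ⊙ sndᶜ))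
    (λ (m , _) → ∣ m ∣) (output≲ fstᶜ) (λ m n _ → size-⊔ m n)
    where
    size-⊔ : ∀ (m n : ℕ) → ∣ m ⊔ n ∣ ≤ ∣ n ∣ + ∣ m ∣
    size-⊔ m n with ⊔-sel m n
    ... | inj₁ e rewrite e = m≤n+m _ _
    ... | inj₂ e rewrite e = m≤m+n _ _

  gridᶜ : ∀ n {l : X → List ℕ} → Poly-time l → Poly-time (λ x → grid n (l x))
  gridᶜ zero    L = constᶜ _
  gridᶜ (suc n) {l} L = concatMapᶜ {s = λ (k , x) → List.map (k ∷_) (grid n (l x))} L
    (mapᶜ {s = λ (v , (k , _)) → k ∷ v} (gridᶜ n L ⊙ sndᶜ) (vconsᶜ (fstᶜ ⊙ sndᶜ) fstᶜ))

size-map : ∀ {E F : Set} ⦃ _ : Code F ⦄ (f : E → F) es {w} → (∀ {e} → e ∈ es → ∣ f e ∣ ≤ w) →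
           ∣ List.map f es ∣ ≤ 1 + length es * (1 + w)
size-map f [] h = ≤-refl
size-map f (e ∷ es) {w} h = s≤s (≤-trans (+-mono-≤ (h (here refl)) (size-map f es (h ∘ there)))
  (≤-reflexive (+-suc w (length es * (1 + w)))))

size-∈ : ∀ {E : Set} ⦃ _ : Code E ⦄ {e : E} {es} → e ∈ es → ∣ e ∣ ≤ ∣ es ∣
size-∈ {es = e ∷ es} (here refl) = m≤n⇒m≤1+n (m≤m+n _ _)
size-∈ {es = e ∷ es} (there p) = m≤n⇒m≤1+n (≤-trans (size-∈ p) (m≤n+m _ _))

sumOver-suffix : ∀ {E : Set} (f : E → ℕ) ys zs → sumOver f zs ≤ sumOver f (ys ++ zs)
sumOver-suffix f []       zs = ≤-refl
sumOver-suffix f (y ∷ ys) zs = ≤-trans (sumOver-suffix f ys zs) (m≤n+m _ (f y))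

module _ {ν : Variant} {n : ℕ} where

  candidateᶜ : Poly-time (λ ((a , r , x , e) : Agent ν n × Vec ℕ n × Vec ℕ n × Vec ℕ n × ℕ) → candidate a r x e)
  candidateᶜ = ifᶜ (∧ᶜ (respectsᶜ ν (speedᶜ fstᶜ) (fstᶜ ⊙ sndᶜ ⊙ sndᶜ))
                       (≤ᵛᵇᶜ (+ᵛᶜ (fstᶜ ⊙ sndᶜ ⊙ sndᶜ) (fstᶜ ⊙ sndᶜ ⊙ sndᶜ ⊙ sndᶜ)) (fstᶜ ⊙ sndᶜ)))
    (+ᶜ (agentValueᶜ fstᶜ (fstᶜ ⊙ sndᶜ ⊙ sndᶜ)) (sndᶜ ⊙ sndᶜ ⊙ sndᶜ ⊙ sndᶜ)) (constᶜ 0)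

  bestᶜ : Poly-time (λ ((r , a , tbl , g) : Vec ℕ n × Agent ν n × List (Vec ℕ n × ℕ) × List (Vec ℕ n)) → best g a r tbl)
  bestᶜ = maximumᶜ (concatMapᶜ {s = λ (e , (r , (a , (_ , g)))) → List.map (λ x → candidate a r x e) g}
    (fstᶜ ⊙ sndᶜ ⊙ sndᶜ)
    (mapᶜ {s = λ (x , (e , (r , (a , _)))) → candidate a r x e} (sndᶜ ⊙ sndᶜ ⊙ sndᶜ ⊙ sndᶜ)
      (candidateᶜ ⊙ (fstᶜ ⊙ sndᶜ ⊙ sndᶜ ⊙ sndᶜ ▵ fstᶜ ⊙ sndᶜ ⊙ sndᶜ ▵ fstᶜ ▵ fstᶜ ⊙ sndᶜ))))

  -- The entries are achievable values, hence at most the sum of the values of all triples. They may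
  -- be exponentially large, but have no more digits than that sum, which is polynomial in the size
  -- of the agents.
  tableᶜ : Poly-time (λ ((g , as) : List (Vec ℕ n) × List (Agent ν n)) → table g as)
  tableᶜ = foldrᶜ {s = λ (a , (tbl , (g , _))) → layer g a tbl}
    (mapᶜ {s = λ (r , _) → r , 0} fstᶜ (fstᶜ ▵ constᶜ 0)) sndᶜ
    (mapᶜ {s = λ (r , (a , (tbl , (g , _)))) → r , best g a r tbl} (fstᶜ ⊙ sndᶜ ⊙ sndᶜ)
      (fstᶜ ▵ bestᶜ ⊙ (fstᶜ ▵ fstᶜ ⊙ sndᶜ ▵ fstᶜ ⊙ sndᶜ ⊙ sndᶜ ▵ fstᶜ ⊙ sndᶜ ⊙ sndᶜ ⊙ sndᶜ)))
    (λ (g , as) → 1 + length g * (1 + (1 + (∣ g ∣ + ∣ sumOver totalTriples as ∣))))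
    (≲-con 1 ≲+ ≲-mono (λ (g , _) → length≤size g) (output≲ fstᶜ) ≲*
      (≲-con 1 ≲+ (≲-con 1 ≲+ (output≲ fstᶜ ≲+
        output≲ (sumᶜ {s = λ (a , _) → totalTriples a} sndᶜ (totalTriplesᶜ fstᶜ))))))
    λ { (g , as) ys zs refl → small g ys zs }
    where
    entry-small : ∀ g (as : List (Agent ν n)) {r v} → r ∈ g → (r , v) ∈ table g as →
                  ∣ (r , v) ∣ ≤ 1 + (∣ g ∣ + ∣ sumOver totalTriples as ∣)
    entry-small g as r∈ p = let w , v≤w , q = table-sound g as p in
      s≤s (+-mono-≤ (size-∈ r∈) (size-ℕ-mono (≤-trans v≤w (achieves-≤ q))))
    small : ∀ g (ys zs : List (Agent ν n)) → ∣ table g zs ∣ ≤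
            1 + length g * (1 + (1 + (∣ g ∣ + ∣ sumOver totalTriples (ys ++ zs) ∣)))
    small g ys [] = size-map (_, 0) g λ r∈ → ≤-trans (entry-small g [] r∈ (∈ₚ.∈-map⁺ (_, 0) r∈))
      (s≤s (+-monoʳ-≤ ∣ g ∣ (size-ℕ-mono (sumOver-suffix totalTriples ys []))))
    small g ys (z ∷ zs) = size-map _ g λ r∈ → ≤-trans (entry-small g (z ∷ zs) r∈ (∈ₚ.∈-map⁺ _ r∈))
      (s≤s (+-monoʳ-≤ ∣ g ∣ (size-ℕ-mono (sumOver-suffix totalTriples ys (z ∷ zs)))))

  decideᶜ : ∀ {X} ⦃ _ : Code X ⦄ {u : X → Unary} {I : X → ChargeInstance ν n} → Poly-time u → Poly-time I →
            Poly-time (λ x → decide (u x) (I x))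
  decideᶜ {u = u} {I} U F = ≤ᵇᶜ (targetᶜ F) (maximumᶜ
    (mapᶜ {s = λ ((r , v) , x) → if r ≤ᵛᵇ supply (I x) then v else 0}
      (tableᶜ ⊙ (gridᶜ n (downFromᶜ (consᶜ (constᶜ tt) U)) ▵ agentsᶜ F))
      (ifᶜ (≤ᵛᵇᶜ (fstᶜ ⊙ fstᶜ) (supplyᶜ F ⊙ sndᶜ)) (sndᶜ ⊙ fstᶜ) (constᶜ 0))))


-- Verification of integral allocations

Consumption : ℕ → Set
Consumption n = Maybe (List (Vec ℕ n) × (Vec ℕ n × ℕ))

consume-step : ∀ {ν n} → Agent ν n → Consumption n → Consumption n
consume-step {ν} a s = maybe-case s nothing λ (xs , (u , v)) → list-case xs nothing λ x xs →
  if respects ν (speed a) x then just (xs , (x +ᵛ u , agentValueℕ a x + v)) else nothing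

-- The fold begins with the last agent, so a certificate lists the allocations from the last agent
-- to the first.
consume : ∀ {ν n} → List (Agent ν n) → List (Vec ℕ n) → Consumption n
consume {n = n} as xs = foldr consume-step (just (xs , (Vec.replicate n 0 , 0))) as

verify : ∀ {ν n} → ChargeInstance ν n → List (Vec ℕ n) → Bool
verify I xs = maybe-case (consume (Vec.toList (agents I)) xs) false λ (_ , (u , v)) →
  (u ≤ᵛᵇ supply I) ∧ (target I ≤ᵇ v)

module _ {ν : Variant} {n : ℕ} where

  consume-sound : ∀ (as : List (Agent ν n)) xs {xs′ u v} → consume as xs ≡ just (xs′ , (u , v)) → Achieves as u v
  consume-sound [] xs refl = []
  consume-sound (a ∷ as) xs eq with consume as xs in eq₁
  ... | just (x ∷ xs′ , (u , v)) with respects ν (speed a) x in eq₂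
  consume-sound (a ∷ as) xs refl | just (x ∷ xs′ , (u , v)) | true =
    add x (subst T (sym eq₂) _) (λ t → ≤-refl) (consume-sound as xs eq₁)

  verify-sound : ∀ (I : ChargeInstance ν n) xs → verify I xs ≡ true →
                 ∃[ w ] (target I ≤ w × Achieves (Vec.toList (agents I)) (supply I) w)
  verify-sound I xs eq with consume (Vec.toList (agents I)) xs in eq₁
  ... | just (_ , (u , v)) =
    let h , h′ = T-∧⁻ {u ≤ᵛᵇ supply I} (subst T (sym eq) _) in
    v , ≤ᵇ⇒≤ (target I) v h′ , achieves-mono (≤ᵛᵇ⇒≤ᵛ u (supply I) h) (consume-sound (Vec.toList (agents I)) xs eq₁)

  consume-complete : ∀ {as : List (Agent ν n)} {r v} → Achieves as r v →
    ∃[ ys ] (All (_≤ᵛ r) ys × length ys ≡ length as ×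
             (∀ zs → ∃[ u ] (u ≤ᵛ r × consume as (ys ++ zs) ≡ just (zs , (u , v)))))
  consume-complete [] = [] , [] , refl , λ zs → Vec.replicate n 0 , (λ t → ≤-trans (≤-reflexive (Vecₚ.lookup-replicate t 0)) z≤n) , refl
  consume-complete {a ∷ as} {r} (add {r′ = r′} {v} x s h p) with consume-complete p
  ... | ys , small , len , q =
    ys ++ [ x ] , Allₚ.++⁺ (All.map (λ y≤ t → ≤-trans (y≤ t) (r′≤ t)) small) (x≤ ∷ []) ,
    trans (Listₚ.length-++ ys) (trans (+-comm (length ys) 1) (cong suc len)) , λ zs →
    let u , u≤ , eq = q (x ∷ zs) in
    x +ᵛ u ,
    (λ t → ≤-trans (≤-reflexive (lookup-+ᵛ x u t)) (≤-trans (+-monoʳ-≤ (lookup x t) (u≤ t))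
      (≤-trans (≤-reflexive (sym (lookup-+ᵛ x r′ t))) (h t)))) ,
    trans (cong (consume-step a) (trans (cong (consume as) (Listₚ.++-assoc ys [ x ] zs)) eq))
      (cong (λ b → if b then just (zs , (x +ᵛ u , agentValueℕ a x + v)) else nothing) (T⇒≡true s))
    where
    x≤ : x ≤ᵛ r
    x≤ t = ≤-trans (≤-trans (m≤m+n _ (lookup r′ t)) (≤-reflexive (sym (lookup-+ᵛ x r′ t)))) (h t)
    r′≤ : r′ ≤ᵛ r
    r′≤ t = ≤-trans (≤-trans (m≤n+m _ (lookup x t)) (≤-reflexive (sym (lookup-+ᵛ x r′ t)))) (h t)

  verify-complete : ∀ (I : ChargeInstance ν n) {w} → target I ≤ w → Achieves (Vec.toList (agents I)) (supply I) w →
    ∃[ ys ] (All (_≤ᵛ supply I) ys × length ys ≡ length (Vec.toList (agents I)) × verify I ys ≡ true)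
  verify-complete I {w} t≤w p with consume-complete p
  ... | ys , small , len , q with q []
  ... | u , u≤ , eq = ys , small , len ,
    trans (cong check (trans (cong (consume (Vec.toList (agents I))) (sym (Listₚ.++-identityʳ ys))) eq))
          (T⇒≡true (T-∧⁺ (≤ᵛ⇒≤ᵛᵇ u (supply I) u≤) (≤⇒≤ᵇ t≤w)))
    where
    check : Consumption n → Bool
    check c = maybe-case c false λ (_ , (u , v)) → (u ≤ᵛᵇ supply I) ∧ (target I ≤ᵇ v)

size-+ᵛ : ∀ {n} (x u : Vec ℕ n) → ∣ x +ᵛ u ∣ ≤ ∣ u ∣ + ∣ x ∣ + 5 * n
size-+ᵛ [] [] = s≤s z≤n
size-+ᵛ {suc n} (x ∷ xs) (u ∷ us) = s≤s (≤-trans (+-mono-≤ (size-+ x u) (size-+ᵛ xs us))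
  (≤-trans (n≤1+n _) (≤-reflexive (solve 5 (λ x u xs us n →
     κ 1 :+ (x :+ (u :+ κ 5) :+ (us :+ xs :+ κ 5 :* n)) := u :+ us :+ (κ 1 :+ (x :+ xs)) :+ κ 5 :* (κ 1 :+ n)) refl
     (∣ x ∣) (∣ u ∣) (∣ xs ∣) (∣ us ∣) n))))

module _ {ν : Variant} {n : ℕ} where

  consume-offerᶜ : Poly-time {(Vec ℕ n × List (Vec ℕ n)) × ((Vec ℕ n × ℕ) × Agent ν n)} (λ ((x , xs) , ((u , v) , a)) →
                     if respects ν (speed a) x then just (xs , (x +ᵛ u , agentValueℕ a x + v)) else nothing)
  consume-offerᶜ = ifᶜ (respectsᶜ ν (speedᶜ (sndᶜ ⊙ sndᶜ)) (fstᶜ ⊙ fstᶜ))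
    (justᶜ (sndᶜ ⊙ fstᶜ ▵ (+ᵛᶜ (fstᶜ ⊙ fstᶜ) (fstᶜ ⊙ fstᶜ ⊙ sndᶜ) ▵
            +ᶜ (agentValueᶜ (sndᶜ ⊙ sndᶜ) (fstᶜ ⊙ fstᶜ)) (sndᶜ ⊙ fstᶜ ⊙ sndᶜ))))
    (constᶜ nothing)

  consume-stepᶜ : Poly-time {Agent ν n × Consumption n} (λ (a , s) → consume-step a s)
  consume-stepᶜ = maybe-caseᶜ
    {h = λ ((xs , (u , v)) , (a , _)) → list-case xs nothing λ x xs →
           if respects ν (speed a) x then just (xs , (x +ᵛ u , agentValueℕ a x + v)) else nothing}
    sndᶜ (constᶜ nothing)
    (list-caseᶜ
      {h = λ ((x , xs) , ((_ , (u , v)) , (a , _))) →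
             if respects ν (speed a) x then just (xs , (x +ᵛ u , agentValueℕ a x + v)) else nothing}
      (fstᶜ ⊙ fstᶜ) (constᶜ nothing) (consume-offerᶜ ⊙ (fstᶜ ▵ (sndᶜ ⊙ fstᶜ ⊙ sndᶜ ▵ fstᶜ ⊙ sndᶜ ⊙ sndᶜ))))

  consumeᶜ : Poly-time (λ ((as , xs) : List (Agent ν n) × List (Vec ℕ n)) → consume as xs)
  consumeᶜ = foldr-growthᶜ {s = λ (a , (s , _)) → consume-step a s}
    (justᶜ (sndᶜ ▵ constᶜ (Vec.replicate n 0 , 0))) fstᶜ
    (consume-stepᶜ ⊙ (fstᶜ ▵ fstᶜ ⊙ sndᶜ))
    (λ (a , _) → 5 * n + (∣ totalTriples a ∣ + 5)) (≲-con (5 * n) ≲+ (output≲ (totalTriplesᶜ fstᶜ) ≲+ ≲-con 5))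
    (λ a s _ → grows a s)
    where
    grows : ∀ (a : Agent ν n) (s : Consumption n) → ∣ consume-step a s ∣ ≤ ∣ s ∣ + (5 * n + (∣ totalTriples a ∣ + 5))
    grows a nothing = s≤s z≤n
    grows a (just ([] , _)) = s≤s z≤n
    grows a (just (x ∷ xs , (u , v))) with respects ν (speed a) x
    ... | false = s≤s z≤n
    ... | true = s≤s (≤-trans (+-monoˡ-≤ 1 (s≤s (+-monoʳ-≤ ∣ xs ∣ (s≤s (+-mono-≤ (size-+ᵛ x u)
        (≤-trans (≤-reflexive (cong ∣_∣ (+-comm (agentValueℕ a x) v)))
          (≤-trans (size-+ v (agentValueℕ a x))
            (+-monoʳ-≤ ∣ v ∣ (+-monoˡ-≤ 5 (size-ℕ-mono (agentValueℕ≤ a x)))))))))))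
      (≤-trans (n≤1+n _) (≤-reflexive (solve 6 (λ x xs u v n t →
        κ 1 :+ (κ 1 :+ (xs :+ (κ 1 :+ (u :+ x :+ n :+ (v :+ (t :+ κ 5))))) :+ κ 1) :=
        (κ 1 :+ ((κ 1 :+ (x :+ xs)) :+ (κ 1 :+ (u :+ v))) :+ κ 1) :+ (n :+ (t :+ κ 5))) refl
        (∣ x ∣) (∣ xs ∣) (∣ u ∣) (∣ v ∣) (5 * n) (∣ totalTriples a ∣)))))

  verifyᶜ : Poly-time (λ ((I , xs) : ChargeInstance ν n × List (Vec ℕ n)) → verify I xs)
  verifyᶜ = maybe-caseᶜ {h = λ ((_ , (u , v)) , (I , _)) → (u ≤ᵛᵇ supply I) ∧ (target I ≤ᵇ v)}
    (consumeᶜ ⊙ (agentsᶜ fstᶜ ▵ sndᶜ)) (constᶜ false)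
    (∧ᶜ (≤ᵛᵇᶜ (fstᶜ ⊙ sndᶜ ⊙ fstᶜ) (supplyᶜ (fstᶜ ⊙ sndᶜ))) (≤ᵇᶜ (targetᶜ (fstᶜ ⊙ sndᶜ)) (sndᶜ ⊙ sndᶜ ⊙ fstᶜ)))

-- Certificates

length-encodeℕ : ∀ n → length (encodeℕ n) ≡ 2 * length (digits n) + 1
length-encodeℕ n = go (ℕᵇ.fromℕ n)
  where
  go : ∀ x → length (encodeℕᵇ x) ≡ 2 * length (digitsᵇ x) + 1
  go ℕᵇ.zero = refl
  go 2[1+ x ] = trans (cong (2 +_) (go x)) (cong (_+ 1) (sym (*-distribˡ-+ 2 1 (length (digitsᵇ x)))))
  go 1+[2 x ] = trans (cong (2 +_) (go x)) (cong (_+ 1) (sym (*-distribˡ-+ 2 1 (length (digitsᵇ x)))))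

length-encodeVec-mono : ∀ {n} (x y : Vec ℕ n) → x ≤ᵛ y → length (encodeVec encodeℕ x) ≤ length (encodeVec encodeℕ y)
length-encodeVec-mono [] [] h = z≤n
length-encodeVec-mono (x ∷ xs) (y ∷ ys) h =
  subst₂ _≤_ (sym (Listₚ.length-++ (encodeℕ x))) (sym (Listₚ.length-++ (encodeℕ y)))
    (+-mono-≤ (subst₂ _≤_ (sym (length-encodeℕ x)) (sym (length-encodeℕ y))
        (+-monoˡ-≤ 1 (*-monoʳ-≤ 2 (length-digits-mono (h zero)))))
      (length-encodeVec-mono xs ys (h ∘ suc)))

length-encodeList-≤ : ∀ {E : Set} (encode : E → List Bool) {w} {es} → All (λ e → length (encode e) ≤ w) es →
                      length (encodeList encode es) ≤ 1 + length es * (1 + w)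
length-encodeList-≤ encode [] = ≤-refl
length-encodeList-≤ encode {w} {e ∷ es} (h ∷ hs) = s≤s (≤-trans (≤-reflexive (Listₚ.length-++ (encode e)))
  (≤-trans (+-mono-≤ h (length-encodeList-≤ encode hs)) (≤-reflexive (+-suc w _))))

pair-encode : ∀ w u → pair w u ≡ encodeList [_] w ++ u
pair-encode []      u = refl
pair-encode (b ∷ w) u = cong (λ z → true ∷ b ∷ z) (pair-encode w u)

module _ {ν : Variant} {n : ℕ} where

  Solvable : ChargeInstance ν n → Set
  Solvable I = ∃[ w ] (target I ≤ w × Achieves (Vec.toList (agents I)) (supply I) w)

  parseCertificate : Parser (List (Vec ℕ n))
  parseCertificate = parseList (parseVec n parseℕ)

  isParser-Certificate : IsParser (encodeList (encodeVec encodeℕ)) parseCertificate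
  isParser-Certificate = isParser-List (isParser-Vec n isParser-ℕ)

  check : List Bool → Bool
  check x = maybe-case (parseList parseBool x) false λ (w , u) →
            maybe-case (decode (parseInstance {ν} {n}) w) false λ I →
            maybe-case (decode parseCertificate u) false λ xs → verify I xs

  checkᶜ : Poly-time check
  checkᶜ = maybe-caseᶜ {h = λ ((w , u) , _) → maybe-case (decode (parseInstance {ν} {n}) w) false λ I →
                            maybe-case (decode parseCertificate u) false λ xs → verify I xs}
    (parseListᶜ isParser-Bool parseBoolᶜ) (constᶜ false)
    (maybe-caseᶜ {h = λ (I , ((_ , u) , _)) → maybe-case (decode parseCertificate u) false λ xs → verify I xs}
      (decodeᶜ parseInstanceᶜ ⊙ fstᶜ ⊙ fstᶜ) (constᶜ false)
      (maybe-caseᶜ {h = λ (xs , (I , _)) → verify I xs}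
        (decodeᶜ (parseListᶜ (isParser-Vec n isParser-ℕ) (parseVecᶜ n parseℕᶜ)) ⊙ sndᶜ ⊙ fstᶜ ⊙ sndᶜ) (constᶜ false)
        (verifyᶜ ⊙ (fstᶜ ⊙ sndᶜ ▵ fstᶜ))))

  parse-pair : ∀ w u → parseList parseBool (pair w u) ≡ just (w , u)
  parse-pair w u = trans (cong (parseList parseBool) (pair-encode w u)) (complete (isParser-List isParser-Bool) w u)

  check-sound : ∀ w u → check (pair w u) ≡ true → ∃[ I ] (encodeInstance I ≡ w × Solvable I)
  check-sound w u eq rewrite parse-pair w u with decode (parseInstance {ν} {n}) w in eq₁
  ... | just I with decode parseCertificate u
  ... | just xs = I , encode-decode isParser-Instance w eq₁ , verify-sound I xs eq

  certificate-bound : Poly 1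
  certificate-bound = con 1 ⊕ (var zero ⊗ (con 1 ⊕ var zero))

  -- Each integral allocation lies below the supply in every period, so its encoding is no longer
  -- than that of the supply; there is one allocation per agent. Both numbers are at most the length
  -- of the input.
  check-complete : ∀ I → Solvable I → ∃[ u ] (length u ≤ ⟦ certificate-bound ⟧ (length (encodeInstance I) ∷ []) ×
                                               check (pair (encodeInstance I) u) ≡ true)
  check-complete I (w , t≤w , p) with verify-complete I t≤w p
  ... | ys , small , len , eq = encodeList (encodeVec encodeℕ) ys ,
    ≤-trans (length-encodeList-≤ (encodeVec encodeℕ) (All.map (λ {y} h → ≤-trans (length-encodeVec-mono y (supply I) h) supply≤) small))
      (s≤s (*-monoˡ-≤ (1 + length (encodeInstance I)) (≤-trans (≤-reflexive len) agents≤))) ,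
    checks
    where
    supply≤ : length (encodeVec encodeℕ (supply I)) ≤ length (encodeInstance I)
    supply≤ = ≤-trans (m≤m+n _ _) (≤-reflexive (sym (Listₚ.length-++ (encodeVec encodeℕ (supply I)))))
    agents≤ : length (Vec.toList (agents I)) ≤ length (encodeInstance I)
    agents≤ = ≤-trans (<⇒≤ (length-encodeList isParser-Agent (Vec.toList (agents I))))
      (≤-trans (≤-trans (m≤m+n _ _) (≤-reflexive (sym (Listₚ.length-++ (encodeList encodeAgent (Vec.toList (agents I)))))))
        (≤-trans (m≤n+m _ (length (encodeVec encodeℕ (supply I)))) (≤-reflexive (sym (Listₚ.length-++ (encodeVec encodeℕ (supply I)))))))
    checks : check (pair (encodeInstance I) (encodeList (encodeVec encodeℕ) ys)) ≡ true
    checks rewrite parse-pair (encodeInstance I) (encodeList (encodeVec encodeℕ) ys)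
                 | decode-encode isParser-Instance I | decode-encode isParser-Certificate ys = eq


-- Rounding flows

record Enumeration (A : Set) : Set where
  field
    list      : List A
    unique    : Unique list
    enumerate : ∀ a → a ∈ list
    decEq     : DecidableEquality A

open Enumeration public

Σᶻ : ∀ {A : Set} → List A → (A → ℤ) → ℤ
Σᶻ xs f = foldr (λ x s → f x +ᶻ s) 0ℤ xs

module _ {A : Set} where

  Σᶻ-cong : ∀ (xs : List A) {f g} → (∀ x → f x ≡ g x) → Σᶻ xs f ≡ Σᶻ xs g
  Σᶻ-cong [] h = refl
  Σᶻ-cong (x ∷ xs) h = cong₂ _+ᶻ_ (h x) (Σᶻ-cong xs h)

  Σᶻ-0 : ∀ (xs : List A) → Σᶻ xs (λ _ → 0ℤ) ≡ 0ℤ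
  Σᶻ-0 [] = refl
  Σᶻ-0 (x ∷ xs) = trans (ℤₚ.+-identityˡ _) (Σᶻ-0 xs)

  Σᶻ-+ : ∀ (xs : List A) f g → Σᶻ xs (λ x → f x +ᶻ g x) ≡ Σᶻ xs f +ᶻ Σᶻ xs g
  Σᶻ-+ [] f g = refl
  Σᶻ-+ (x ∷ xs) f g = trans (cong (f x +ᶻ g x +ᶻ_) (Σᶻ-+ xs f g))
    (solveᶻ 4 (λ a b c d → a :+ᶻ b :+ᶻ (c :+ᶻ d) :=ᶻ (a :+ᶻ c) :+ᶻ (b :+ᶻ d)) refl (f x) (g x) (Σᶻ xs f) (Σᶻ xs g))

  Σᶻ-* : ∀ (xs : List A) k f → Σᶻ xs (λ x → k *ᶻ f x) ≡ k *ᶻ Σᶻ xs f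
  Σᶻ-* [] k f = sym (ℤₚ.*-zeroʳ k)
  Σᶻ-* (x ∷ xs) k f = trans (cong (k *ᶻ f x +ᶻ_) (Σᶻ-* xs k f)) (sym (ℤₚ.*-distribˡ-+ k (f x) _))

  Σᶻ-≤0 : ∀ (xs : List A) {f} → (∀ x → f x ≤ᶻ 0ℤ) → Σᶻ xs f ≤ᶻ 0ℤ
  Σᶻ-≤0 [] h = ℤₚ.≤-refl
  Σᶻ-≤0 (x ∷ xs) h = ℤₚ.+-mono-≤ (h x) (Σᶻ-≤0 xs h)

  Σᶻ-<0 : ∀ {xs : List A} {f y} → (∀ x → f x ≤ᶻ 0ℤ) → y ∈ xs → f y <ᶻ 0ℤ → Σᶻ xs f <ᶻ 0ℤ
  Σᶻ-<0 {x ∷ xs} h (here refl) l = ℤₚ.+-mono-<-≤ l (Σᶻ-≤0 xs h)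
  Σᶻ-<0 {x ∷ xs} h (there p) l = ℤₚ.+-mono-≤-< (h x) (Σᶻ-<0 h p l)

Σᶻ-swap : ∀ {A B : Set} (xs : List A) (ys : List B) (f : A → B → ℤ) →
          Σᶻ xs (λ x → Σᶻ ys (f x)) ≡ Σᶻ ys (λ y → Σᶻ xs (λ x → f x y))
Σᶻ-swap [] ys f = sym (Σᶻ-0 ys)
Σᶻ-swap (x ∷ xs) ys f = trans (cong (Σᶻ ys (f x) +ᶻ_) (Σᶻ-swap xs ys f)) (sym (Σᶻ-+ ys (f x) (λ y → Σᶻ xs (λ x → f x y))))

⟨_⟩ : Bool → ℤ
⟨ true ⟩  = 1ℤ
⟨ false ⟩ = 0ℤ

Σᶻ-update : ∀ {A : Set} {xs : List A} {f g a} → Unique xs → a ∈ xs → (∀ x → x ≢ a → f x ≡ g x) →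
            Σᶻ xs f ≡ Σᶻ xs g +ᶻ (f a -ᶻ g a)
Σᶻ-update {xs = x ∷ xs} {f} {g} (x∉ ∷ _) (here refl) h =
  trans (cong (f x +ᶻ_) (others x∉))
    (solveᶻ 3 (λ a b c → a :+ᶻ b :=ᶻ c :+ᶻ b :+ᶻ (a :-ᶻ c)) refl (f x) (Σᶻ xs g) (g x))
  where
  others : ∀ {ys} → All (x ≢_) ys → Σᶻ ys f ≡ Σᶻ ys g
  others [] = refl
  others (y≢x ∷ h′) = cong₂ _+ᶻ_ (h _ (λ e → y≢x (sym e))) (others h′)
Σᶻ-update {xs = x ∷ xs} {f} {g} {a} (x∉ ∷ u) (there p) h =
  trans (cong₂ _+ᶻ_ (h x (All.lookup x∉ p)) (Σᶻ-update u p h)) (sym (ℤₚ.+-assoc (g x) (Σᶻ xs g) _))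

module Rounding {V E : Set} (𝒱 : Enumeration V) (ℰ : Enumeration E) (src dst : E → V) where

  indicator : V → V → ℤ
  indicator a v = ⟨ does (decEq 𝒱 a v) ⟩

  net : (E → ℤ) → V → ℤ
  net c v = Σᶻ (list ℰ) (λ e → c e *ᶻ (indicator (dst e) v -ᶻ indicator (src e) v))

  -- The pairing of a flow with the differences of a potential `g`. For the indicator of a set of
  -- vertices it is the net flow into that set, for that of a single vertex it is `net`.
  flux : (E → ℤ) → (V → ℤ) → ℤ
  flux c g = Σᶻ (list ℰ) (λ e → c e *ᶻ (g (dst e) -ᶻ g (src e)))

  Σᶻ-indicator : ∀ (g : V → ℤ) a → Σᶻ (list 𝒱) (λ v → g v *ᶻ indicator a v) ≡ g a
  Σᶻ-indicator g a = trans
    (Σᶻ-update {g = λ _ → 0ℤ} (unique 𝒱) (enumerate 𝒱 a) zero-elsewhere)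
    (trans (cong₂ (λ i j → i +ᶻ (g a *ᶻ j -ᶻ 0ℤ)) (Σᶻ-0 (list 𝒱)) one-at)
      (solveᶻ 1 (λ x → κᶻ 0ℤ :+ᶻ (x :*ᶻ κᶻ 1ℤ :-ᶻ κᶻ 0ℤ) :=ᶻ x) refl (g a)))
    where
    one-at : indicator a a ≡ 1ℤ
    one-at with decEq 𝒱 a a
    ... | yes _ = refl
    ... | no ¬p = ⊥-elim (¬p refl)
    zero-elsewhere : ∀ v → v ≢ a → g v *ᶻ indicator a v ≡ 0ℤ
    zero-elsewhere v v≢a with decEq 𝒱 a v
    ... | yes a≡v = ⊥-elim (v≢a (sym a≡v))
    ... | no _ = ℤₚ.*-zeroʳ (g v)

  -- Exchanging the two sums: a discrete divergence theorem. Conservation at all vertices thus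
  -- becomes vanishing flux for all potentials, and a suitable potential isolates a cut or a single
  -- edge.
  Σᶻ-net : ∀ g c → Σᶻ (list 𝒱) (λ v → g v *ᶻ net c v) ≡ flux c g
  Σᶻ-net g c = trans (Σᶻ-cong (list 𝒱) (λ v → sym (Σᶻ-* (list ℰ) (g v) (λ e → c e *ᶻ (indicator (dst e) v -ᶻ indicator (src e) v)))))
    (trans (Σᶻ-swap (list 𝒱) (list ℰ) (λ v e → g v *ᶻ (c e *ᶻ (indicator (dst e) v -ᶻ indicator (src e) v)))) (Σᶻ-cong (list ℰ) λ e →
      trans (Σᶻ-cong (list 𝒱) (λ v → solveᶻ 4 (λ g c i j → g :*ᶻ (c :*ᶻ (i :-ᶻ j)) :=ᶻ
               c :*ᶻ (g :*ᶻ i :+ᶻ (κᶻ ℤ.-1ℤ :*ᶻ (g :*ᶻ j)))) refl (g v) (c e) (indicator (dst e) v) (indicator (src e) v)))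
        (trans (Σᶻ-* (list 𝒱) (c e) (λ v → g v *ᶻ indicator (dst e) v +ᶻ ℤ.-1ℤ *ᶻ (g v *ᶻ indicator (src e) v))) (cong (c e *ᶻ_)
          (trans (Σᶻ-+ (list 𝒱) (λ v → g v *ᶻ indicator (dst e) v) (λ v → ℤ.-1ℤ *ᶻ (g v *ᶻ indicator (src e) v)))
            (cong₂ _+ᶻ_ (Σᶻ-indicator g (dst e))
              (trans (Σᶻ-* (list 𝒱) ℤ.-1ℤ (λ v → g v *ᶻ indicator (src e) v))
                (trans (cong (ℤ.-1ℤ *ᶻ_) (Σᶻ-indicator g (src e))) (ℤₚ.-1*i≡-i _)))))))))

  net-linear : ∀ k c d v → net (λ e → k *ᶻ c e +ᶻ d e) v ≡ k *ᶻ net c v +ᶻ net d v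
  net-linear k c d v = trans
    (Σᶻ-cong (list ℰ) (λ e → solveᶻ 4 (λ k c d i → (k :*ᶻ c :+ᶻ d) :*ᶻ i :=ᶻ k :*ᶻ (c :*ᶻ i) :+ᶻ d :*ᶻ i) refl
      k (c e) (d e) (indicator (dst e) v -ᶻ indicator (src e) v)))
    (trans (Σᶻ-+ (list ℰ) (λ e → k *ᶻ (c e *ᶻ i e)) (λ e → d e *ᶻ i e))
      (cong (_+ᶻ net d v) (Σᶻ-* (list ℰ) k (λ e → c e *ᶻ i e))))
    where
    i : E → ℤ
    i e = indicator (dst e) v -ᶻ indicator (src e) v

  -- r = q b on the vertices, where q is the common denominator of the flow r / q
  -- with fractional values.  We look for an integral flow u with values in {0, 1}
  -- that is supported by r and has the same divergence b.
  module Fractional (q : ℕ) (q>0 : 0 < q) (r : E → ℕ) (r<q : ∀ e → r e < q) (b : V → ℤ)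
                    (divergence : ∀ v → net (λ e → ⁺ r e) v ≡ ⁺ q *ᶻ b v) where

    Supported : (E → Bool) → Set
    Supported u = ∀ e → u e ≡ true → 0 < r e

    excess : (E → Bool) → V → ℤ
    excess u v = net (λ e → ⟨ u e ⟩) v -ᶻ b v

    set : (E → Bool) → E → Bool → E → Bool
    set u e x e′ = if does (decEq ℰ e′ e) then x else u e′

    set-same : ∀ u e x → set u e x e ≡ x
    set-same u e x with decEq ℰ e e
    ... | yes _ = refl
    ... | no ¬p = ⊥-elim (¬p refl)

    set-other : ∀ u {e e′} x → e′ ≢ e → set u e x e′ ≡ u e′
    set-other u {e} {e′} x e′≢e with decEq ℰ e′ e
    ... | yes p = ⊥-elim (e′≢e p)
    ... | no _ = refl

    excess-set : ∀ u e x v → excess (set u e x) v ≡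
                 excess u v +ᶻ (⟨ x ⟩ -ᶻ ⟨ u e ⟩) *ᶻ (indicator (dst e) v -ᶻ indicator (src e) v)
    excess-set u e x v = trans
      (cong (_-ᶻ b v) (Σᶻ-update {f = λ e′ → ⟨ set u e x e′ ⟩ *ᶻ (indicator (dst e′) v -ᶻ indicator (src e′) v)}
        {g = λ e′ → ⟨ u e′ ⟩ *ᶻ (indicator (dst e′) v -ᶻ indicator (src e′) v)}
        (unique ℰ) (enumerate ℰ e) (λ e′ ne → cong (λ z → ⟨ z ⟩ *ᶻ (indicator (dst e′) v -ᶻ indicator (src e′) v)) (set-other u x ne))))
      (trans (cong (λ z → net (λ e → ⟨ u e ⟩) v +ᶻ (⟨ z ⟩ *ᶻ i -ᶻ ⟨ u e ⟩ *ᶻ i) -ᶻ b v) (set-same u e x))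
        (solveᶻ 5 (λ n x y i b → n :+ᶻ (x :*ᶻ i :-ᶻ y :*ᶻ i) :-ᶻ b :=ᶻ n :-ᶻ b :+ᶻ (x :-ᶻ y) :*ᶻ i) refl
          (net (λ e → ⟨ u e ⟩) v) ⟨ x ⟩ ⟨ u e ⟩ i (b v)))
      where i = indicator (dst e) v -ᶻ indicator (src e) v

    -- Since `r` has divergence `q b`, multiplying the excess of `u` by `q` gives the divergence of
    -- `q u - r`. With the indicator of a set as `g` only the edges across its boundary remain; with
    -- a constant `g` the excesses are seen to sum to 0.
    weighted-excess : ∀ u g → Σᶻ (list 𝒱) (λ v → g v *ᶻ (⁺ q *ᶻ excess u v)) ≡
                      flux (λ e → ⁺ q *ᶻ ⟨ u e ⟩ +ᶻ (ℤ.- (⁺ r e))) g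
    weighted-excess u g = trans
      (Σᶻ-cong (list 𝒱) (λ v → cong (g v *ᶻ_) (trans
        (solveᶻ 3 (λ q n b → q :*ᶻ (n :-ᶻ b) :=ᶻ q :*ᶻ n :+ᶻ :-ᶻ (q :*ᶻ b)) refl (⁺ q) (net (λ e → ⟨ u e ⟩) v) (b v))
        (trans (cong (λ z → ⁺ q *ᶻ net (λ e → ⟨ u e ⟩) v +ᶻ (ℤ.- z)) (sym (divergence v)))
          (sym (trans (net-linear (⁺ q) (λ e → ⟨ u e ⟩) (λ e → ℤ.- (⁺ r e)) v)
            (cong (⁺ q *ᶻ net (λ e → ⟨ u e ⟩) v +ᶻ_) (net-neg v))))))))
      (Σᶻ-net g (λ e → ⁺ q *ᶻ ⟨ u e ⟩ +ᶻ (ℤ.- (⁺ r e))))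
      where
      net-neg : ∀ v → net (λ e → ℤ.- (⁺ r e)) v ≡ ℤ.- net (λ e → ⁺ r e) v
      net-neg v = trans (Σᶻ-cong (list ℰ) (λ e → solveᶻ 2 (λ r i → :-ᶻ r :*ᶻ i :=ᶻ κᶻ ℤ.-1ℤ :*ᶻ (r :*ᶻ i)) refl
          (⁺ r e) (indicator (dst e) v -ᶻ indicator (src e) v)))
        (trans (Σᶻ-* (list ℰ) ℤ.-1ℤ (λ e → ⁺ r e *ᶻ (indicator (dst e) v -ᶻ indicator (src e) v))) (ℤₚ.-1*i≡-i _))

    -- Moves one unit of excess along an edge.
    Augmentation : (E → Bool) → V → V → Set
    Augmentation u s t = ∃[ u′ ] (Supported u′ × ∀ v → excess u′ v ≡ excess u v -ᶻ indicator s v +ᶻ indicator t v)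

    module Search (u : E → Bool) (supported : Supported u) (s : V) (s>0 : 0ℤ <ᶻ excess u s) where

      inside : (V → Bool) → E → Bool
      inside S e = S (src e) ∧ S (dst e)

      -- The augmentation may change only edges inside `S`. An edge that leaves `S` then still has
      -- its value under `u`, so it can be appended to the path.
      Reachable : (V → Bool) → V → Set
      Reachable S a = Σ[ (u′ , _) ∈ Augmentation u s a ] (∀ e → inside S e ≡ false → u′ e ≡ u e)

      extend : (V → Bool) → V → V → Bool
      extend S b v = S v ∨ does (decEq 𝒱 v b)

      extend-old : ∀ S b v → S v ≡ true → extend S b v ≡ true
      extend-old S b v h rewrite h = refl

      extend-new : ∀ S b → extend S b b ≡ true
      extend-new S b with S b | decEq 𝒱 b b
      ... | true  | _     = refl
      ... | false | yes _ = refl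
      ... | false | no ¬p = ⊥-elim (¬p refl)

      outside : ∀ S b e → inside (extend S b) e ≡ false → inside S e ≡ false
      outside S b e h with S (src e) in p | S (dst e) in q
      ... | false | _ = refl
      ... | true | false = refl
      ... | true | true = h

      Residual : (V → Bool) → E → Set
      Residual S e = (S (src e) ≡ true × S (dst e) ≡ false × u e ≡ false × 0 < r e) ⊎
                     (S (dst e) ≡ true × S (src e) ≡ false × u e ≡ true)

      residual? : ∀ S e → Dec (Residual S e)
      residual? S e with S (src e) | S (dst e) | u e | 0 ℕₚ.<? r e
      ... | true  | false | false | yes h = yes (inj₁ (refl , refl , refl , h))
      ... | false | true  | true  | _     = yes (inj₂ (refl , refl , refl))
      ... | true  | true  | _     | _     = no λ { (inj₁ ()) ; (inj₂ ()) }
      ... | false | false | _     | _     = no λ { (inj₁ ()) ; (inj₂ ()) }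
      ... | true  | false | true  | _     = no λ { (inj₁ ()) ; (inj₂ ()) }
      ... | true  | false | false | no h  = no λ { (inj₁ (_ , _ , _ , h′)) → h h′ ; (inj₂ ()) }
      ... | false | true  | false | _     = no λ { (inj₁ ()) ; (inj₂ ()) }

      cross : ∀ S e → Residual S e → (∀ a → S a ≡ true → Reachable S a) →
              ∃[ b ] (S b ≡ false × Reachable (extend S b) b)
      cross S e (inj₁ (a∈S , b∉S , ue , re)) reach with reach (src e) a∈S
      ... | (u′ , sup , ex) , agree = dst e , b∉S , ((set u′ e true , sup′ , ex′) , agree′)
        where
        u′e : u′ e ≡ false
        u′e = trans (agree e (trans (cong (S (src e) ∧_) b∉S) (∧-zeroʳ (S (src e))))) ue
          where
          ∧-zeroʳ : ∀ x → x ∧ false ≡ false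
          ∧-zeroʳ true = refl
          ∧-zeroʳ false = refl
        sup′ : Supported (set u′ e true)
        sup′ e′ h with decEq ℰ e′ e
        ... | yes refl = re
        ... | no _ = sup e′ h
        ex′ : ∀ v → excess (set u′ e true) v ≡ excess u v -ᶻ indicator s v +ᶻ indicator (dst e) v
        ex′ v = trans (excess-set u′ e true v) (trans
          (cong₂ (λ x y → x +ᶻ (1ℤ -ᶻ ⟨ y ⟩) *ᶻ (indicator (dst e) v -ᶻ indicator (src e) v)) (ex v) u′e)
          (solveᶻ 4 (λ x s a b → x :-ᶻ s :+ᶻ a :+ᶻ (κᶻ 1ℤ :-ᶻ κᶻ 0ℤ) :*ᶻ (b :-ᶻ a) :=ᶻ x :-ᶻ s :+ᶻ b) refl
            (excess u v) (indicator s v) (indicator (src e) v) (indicator (dst e) v)))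
        agree′ : ∀ e′ → inside (extend S (dst e)) e′ ≡ false → set u′ e true e′ ≡ u e′
        agree′ e′ h with decEq ℰ e′ e
        ... | no _ = agree e′ (outside S (dst e) e′ h)
        ... | yes refl with () ← trans (sym h) (cong₂ _∧_ (extend-old S (dst e) (src e) a∈S) (extend-new S (dst e)))
      cross S e (inj₂ (a∈S , b∉S , ue)) reach with reach (dst e) a∈S
      ... | (u′ , sup , ex) , agree = src e , b∉S , ((set u′ e false , sup′ , ex′) , agree′)
        where
        u′e : u′ e ≡ true
        u′e = trans (agree e (cong (_∧ S (dst e)) b∉S)) ue
        sup′ : Supported (set u′ e false)
        sup′ e′ h with decEq ℰ e′ e
        ... | no _ = sup e′ h
        ex′ : ∀ v → excess (set u′ e false) v ≡ excess u v -ᶻ indicator s v +ᶻ indicator (src e) v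
        ex′ v = trans (excess-set u′ e false v) (trans
          (cong₂ (λ x y → x +ᶻ (0ℤ -ᶻ ⟨ y ⟩) *ᶻ (indicator (dst e) v -ᶻ indicator (src e) v)) (ex v) u′e)
          (solveᶻ 4 (λ x s a b → x :-ᶻ s :+ᶻ a :+ᶻ (κᶻ 0ℤ :-ᶻ κᶻ 1ℤ) :*ᶻ (a :-ᶻ b) :=ᶻ x :-ᶻ s :+ᶻ b) refl
            (excess u v) (indicator s v) (indicator (dst e) v) (indicator (src e) v)))
        agree′ : ∀ e′ → inside (extend S (src e)) e′ ≡ false → set u′ e false e′ ≡ u e′
        agree′ e′ h with decEq ℰ e′ e
        ... | no _ = agree e′ (outside S (src e) e′ h)
        ... | yes refl with () ← trans (sym h) (cong₂ _∧_ (extend-new S (src e)) (extend-old S (src e) (dst e) a∈S))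

      -- Without residual edges the flow through the cut S would be impossible.
      blocked : ∀ S → S s ≡ true → (∀ a → S a ≡ true → 0ℤ ≤ᶻ excess u a) → ¬ (∀ e → ¬ Residual S e)
      blocked S s∈S nonneg none = ℤₚ.<-irrefl refl (ℤₚ.<-≤-trans positive (ℤₚ.≤-trans (ℤₚ.≤-reflexive (weighted-excess u (λ v → ⟨ S v ⟩))) (Σᶻ-≤0 (list ℰ) edge≤0)))
        where
        edge≤0 : ∀ e → (⁺ q *ᶻ ⟨ u e ⟩ +ᶻ (ℤ.- (⁺ r e))) *ᶻ (⟨ S (dst e) ⟩ -ᶻ ⟨ S (src e) ⟩) ≤ᶻ 0ℤ
        edge≤0 e with S (src e) in p | S (dst e) in p′ | u e in pu
        ... | true | true | x = ℤₚ.≤-reflexive (ℤₚ.*-zeroʳ (⁺ q *ᶻ ⟨ x ⟩ +ᶻ (ℤ.- (⁺ r e))))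
        ... | false | false | x = ℤₚ.≤-reflexive (ℤₚ.*-zeroʳ (⁺ q *ᶻ ⟨ x ⟩ +ᶻ (ℤ.- (⁺ r e))))
        ... | false | true | true = ⊥-elim (none e (inj₂ (p′ , p , pu)))
        ... | false | true | false = ℤₚ.≤-trans (ℤₚ.≤-reflexive
              (solveᶻ 2 (λ q r → (q :*ᶻ κᶻ 0ℤ :+ᶻ :-ᶻ r) :*ᶻ (κᶻ 1ℤ :-ᶻ κᶻ 0ℤ) :=ᶻ :-ᶻ r) refl (⁺ q) (⁺ r e)))
              (ℤₚ.neg-mono-≤ {0ℤ} {⁺ r e} (ℤ.+≤+ z≤n))
        ... | true | false | true = ℤₚ.≤-trans (ℤₚ.≤-reflexive
              (solveᶻ 2 (λ q r → (q :*ᶻ κᶻ 1ℤ :+ᶻ :-ᶻ r) :*ᶻ (κᶻ 0ℤ :-ᶻ κᶻ 1ℤ) :=ᶻ r :-ᶻ q) refl (⁺ q) (⁺ r e)))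
              (ℤₚ.i≤j⇒i-j≤0 (ℤ.+≤+ (<⇒≤ (r<q e))))
        ... | true | false | false with r e in pr
        ...   | zero = ℤₚ.≤-reflexive
              (solveᶻ 1 (λ q → (q :*ᶻ κᶻ 0ℤ :+ᶻ :-ᶻ (κᶻ 0ℤ)) :*ᶻ (κᶻ 0ℤ :-ᶻ κᶻ 1ℤ) :=ᶻ κᶻ 0ℤ) refl (⁺ q))
        ...   | suc _ = ⊥-elim (none e (inj₁ (p , p′ , pu , subst (0 <_) (sym pr) (s≤s z≤n))))
        q*-pos : ∀ {x} → 0ℤ <ᶻ x → 0ℤ <ᶻ 1ℤ *ᶻ (⁺ q *ᶻ x)
        q*-pos {x} h = subst (0ℤ <ᶻ_) (sym (ℤₚ.*-identityˡ _))
          (subst (_<ᶻ ⁺ q *ᶻ x) (ℤₚ.*-zeroʳ (⁺ q)) (ℤₚ.*-monoˡ-<-pos (⁺ q) ⦃ ℤ.positive (ℤ.+<+ q>0) ⦄ h))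
        positive : 0ℤ <ᶻ Σᶻ (list 𝒱) (λ v → ⟨ S v ⟩ *ᶻ (⁺ q *ᶻ excess u v))
        positive = ℤₚ.neg-cancel-< (subst (_<ᶻ 0ℤ)
          (trans (Σᶻ-* (list 𝒱) ℤ.-1ℤ (λ v → ⟨ S v ⟩ *ᶻ (⁺ q *ᶻ excess u v))) (ℤₚ.-1*i≡-i _))
          (Σᶻ-<0 {f = λ v → ℤ.-1ℤ *ᶻ (⟨ S v ⟩ *ᶻ (⁺ q *ᶻ excess u v))} nonpos (enumerate 𝒱 s)
            (subst (_<ᶻ 0ℤ) (sym (ℤₚ.-1*i≡-i _)) (ℤₚ.neg-mono-< (subst (λ x → 0ℤ <ᶻ ⟨ x ⟩ *ᶻ (⁺ q *ᶻ excess u s)) (sym s∈S) (q*-pos s>0))))))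
          where
          nonpos : ∀ v → ℤ.-1ℤ *ᶻ (⟨ S v ⟩ *ᶻ (⁺ q *ᶻ excess u v)) ≤ᶻ 0ℤ
          nonpos v with S v in p
          ... | false = ℤₚ.≤-refl
          ... | true = subst (_≤ᶻ 0ℤ) (sym (ℤₚ.-1*i≡-i _)) (ℤₚ.neg-mono-≤ (subst (0ℤ ≤ᶻ_) (sym (ℤₚ.*-identityˡ _))
                (subst (_≤ᶻ ⁺ q *ᶻ excess u v) (ℤₚ.*-zeroʳ (⁺ q)) (ℤₚ.*-monoˡ-≤-nonNeg (⁺ q) (nonneg v p)))))

      -- The reachable set grows by one vertex per call, while `rest`, which covers all vertices
      -- outside, shrinks. It ends at a vertex of negative excess, because a set without such
      -- vertices and without residual edges is excluded by `blocked`.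
      search : ∀ k (S : V → Bool) (rest : List V) → length rest ≤ k → (∀ v → S v ≡ false → v ∈ rest) →
               S s ≡ true → (∀ a → S a ≡ true → Reachable S a) → ∃[ t ] (excess u t <ᶻ 0ℤ × Augmentation u s t)
      search k S rest len missing s∈S reach
        with any? (λ v → Σ-dec (S v) (excess u v ℤₚ.<? 0ℤ)) (list 𝒱)
        where
        Σ-dec : ∀ {P : Set} x → Dec P → Dec (x ≡ true × P)
        Σ-dec true (yes p) = yes (refl , p)
        Σ-dec true (no ¬p) = no (λ (_ , p) → ¬p p)
        Σ-dec false _ = no λ ()
      ... | yes found = let t , _ , t∈S , t<0 = find found in t , t<0 , proj₁ (reach t t∈S)
      ... | no none with any? (residual? S) (list ℰ)
      ...   | no blocked′ = ⊥-elim (blocked S s∈S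
                (λ a a∈S → ℤₚ.≮⇒≥ λ l → none (lose (enumerate 𝒱 a) (a∈S , l)))
                (λ e ρ → blocked′ (lose (enumerate ℰ e) ρ)))
      ...   | yes found with find found
      ...     | e , _ , ρ with cross S e ρ reach
      ...       | b , b∉S , reach-b with ∈ₚ.∈-∃++ (missing b b∉S)
      search zero S rest len missing s∈S reach | no none | yes found | e , _ , ρ | b , b∉S , reach-b | ys , zs , refl
        with ys | len
      ... | [] | ()
      ... | _ ∷ _ | ()
      search (suc k) S rest len missing s∈S reach | no none | yes found | e , _ , ρ | b , b∉S , reach-b | ys , zs , refl =
        search k (extend S b) (ys ++ zs) shorter missing′ (extend-old S b s s∈S) reach′
        where
        shorter : length (ys ++ zs) ≤ k
        shorter = ≤-pred (≤-trans (≤-reflexive (trans (cong suc (Listₚ.length-++ ys))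
          (trans (sym (+-suc (length ys) (length zs))) (sym (Listₚ.length-++ ys))))) len)
        missing′ : ∀ v → extend S b v ≡ false → v ∈ ys ++ zs
        missing′ v h with S v in p | decEq 𝒱 v b
        missing′ v h | false | no v≢b with ∈ₚ.∈-++⁻ ys (missing v p)
        ... | inj₁ l = ∈ₚ.∈-++⁺ˡ l
        ... | inj₂ (here v≡b) = ⊥-elim (v≢b v≡b)
        ... | inj₂ (there l) = ∈ₚ.∈-++⁺ʳ ys l
        reach′ : ∀ a → extend S b a ≡ true → Reachable (extend S b) a
        reach′ a h with S a in p | decEq 𝒱 a b
        ... | false | yes refl = reach-b
        ... | true | _ = let aug , agree = reach a p in aug , λ e h → agree e (outside S b e h)

    positivePart : ℤ → ℕ
    positivePart (ℤ.+ n)     = n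
    positivePart ℤ.-[1+ n ] = 0

    sumOver-< : ∀ {A : Set} {f g : A → ℕ} {a xs} → (∀ x → f x ≤ g x) → a ∈ xs → f a < g a → sumOver f xs < sumOver g xs
    sumOver-< {f = f} {g} f≤g (here {xs = xs} refl) l = +-mono-<-≤ l (go xs)
      where
      go : ∀ xs → sumOver f xs ≤ sumOver g xs
      go [] = z≤n
      go (x ∷ xs) = +-mono-≤ (f≤g x) (go xs)
    sumOver-< f≤g (there {x} p) l = +-mono-≤-< (f≤g x) (sumOver-< f≤g p l)

    Balanced : (E → Bool) → Set
    Balanced u = ∀ v → excess u v ≡ 0ℤ

    positivePart-pred : ∀ {x} → 0ℤ <ᶻ x → positivePart (x -ᶻ 1ℤ +ᶻ 0ℤ) < positivePart x
    positivePart-pred {ℤ.+[1+ n ]} _ = s≤s (≤-reflexive (+-identityʳ n))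
    positivePart-pred {ℤ.+0} (ℤ.+<+ ())

    positivePart-suc : ∀ {x} → x <ᶻ 0ℤ → positivePart (x -ᶻ 0ℤ +ᶻ 1ℤ) ≡ 0
    positivePart-suc {ℤ.-[1+ zero ]} _ = refl
    positivePart-suc {ℤ.-[1+ suc n ]} _ = refl
    positivePart-suc {ℤ.+ _} (ℤ.+<+ ())

    decreases : ∀ {u u′ s t} → 0ℤ <ᶻ excess u s → excess u t <ᶻ 0ℤ →
                (∀ v → excess u′ v ≡ excess u v -ᶻ indicator s v +ᶻ indicator t v) →
                sumOver (positivePart ∘ excess u′) (list 𝒱) < sumOver (positivePart ∘ excess u) (list 𝒱)
    decreases {u} {u′} {s} {t} s>0 t<0 ex = sumOver-< weakly (enumerate 𝒱 s) strictly
      where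
      strictly : positivePart (excess u′ s) < positivePart (excess u s)
      strictly rewrite ex s with decEq 𝒱 s s | decEq 𝒱 t s
      ... | no ¬p | _ = ⊥-elim (¬p refl)
      ... | yes _ | yes refl = ⊥-elim (ℤₚ.<-asym s>0 t<0)
      ... | yes _ | no _ = positivePart-pred s>0
      weakly : ∀ v → positivePart (excess u′ v) ≤ positivePart (excess u v)
      weakly v rewrite ex v with decEq 𝒱 s v | decEq 𝒱 t v
      ... | yes refl | yes refl = ⊥-elim (ℤₚ.<-asym s>0 t<0)
      ... | yes refl | no _ = <⇒≤ (positivePart-pred s>0)
      ... | no _ | yes refl = ≤-trans (≤-reflexive (positivePart-suc t<0)) z≤n
      ... | no _ | no _ = ≤-reflexive (cong positivePart (solveᶻ 1 (λ x → x :-ᶻ κᶻ 0ℤ :+ᶻ κᶻ 0ℤ :=ᶻ x) refl (excess u v)))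

    -- Every augmentation from positive to negative excess lowers the total positive excess. When no
    -- excess is positive, all of them vanish, because they sum to 0.
    balance : ∀ k u → Supported u → sumOver (positivePart ∘ excess u) (list 𝒱) ≤ k → ∃[ u′ ] (Supported u′ × Balanced u′)
    balance k u sup Φ≤k with any? (λ v → 0ℤ ℤₚ.<? excess u v) (list 𝒱)
    ... | no none = u , sup , λ v → ℤₚ.≤-antisym (nonpos v) (ℤₚ.≮⇒≥ λ l → ℤₚ.<-irrefl total (Σᶻ-<0 weighted-nonpos (enumerate 𝒱 v) (neg l)))
      where
      nonpos : ∀ v → excess u v ≤ᶻ 0ℤ
      nonpos v = ℤₚ.≮⇒≥ λ l → none (lose (enumerate 𝒱 v) l)
      weighted-nonpos : ∀ v → 1ℤ *ᶻ (⁺ q *ᶻ excess u v) ≤ᶻ 0ℤ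
      weighted-nonpos v = subst (_≤ᶻ 0ℤ) (sym (ℤₚ.*-identityˡ _))
        (subst (⁺ q *ᶻ excess u v ≤ᶻ_) (ℤₚ.*-zeroʳ (⁺ q)) (ℤₚ.*-monoˡ-≤-nonNeg (⁺ q) (nonpos v)))
      neg : ∀ {x} → x <ᶻ 0ℤ → 1ℤ *ᶻ (⁺ q *ᶻ x) <ᶻ 0ℤ
      neg {x} h = subst (_<ᶻ 0ℤ) (sym (ℤₚ.*-identityˡ _))
        (subst (⁺ q *ᶻ x <ᶻ_) (ℤₚ.*-zeroʳ (⁺ q)) (ℤₚ.*-monoˡ-<-pos (⁺ q) ⦃ ℤ.positive (ℤ.+<+ q>0) ⦄ h))
      total : Σᶻ (list 𝒱) (λ v → 1ℤ *ᶻ (⁺ q *ᶻ excess u v)) ≡ 0ℤ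
      total = trans (weighted-excess u (λ _ → 1ℤ))
        (trans (Σᶻ-cong (list ℰ) (λ e → ℤₚ.*-zeroʳ (⁺ q *ᶻ ⟨ u e ⟩ +ᶻ (ℤ.- (⁺ r e))))) (Σᶻ-0 (list ℰ)))
    ... | yes found with find found
    ...   | s , _ , s>0 with Search.search u sup s s>0 (length (list 𝒱)) (λ v → does (decEq 𝒱 v s)) (list 𝒱) ≤-refl
                               (λ v _ → enumerate 𝒱 v) s∈S reach
      where
      s∈S : does (decEq 𝒱 s s) ≡ true
      s∈S with decEq 𝒱 s s
      ... | yes _ = refl
      ... | no ¬p = ⊥-elim (¬p refl)
      reach : ∀ a → does (decEq 𝒱 a s) ≡ true → Search.Reachable u sup s s>0 (λ v → does (decEq 𝒱 v s)) a
      reach a h with decEq 𝒱 a s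
      ... | yes refl = (u , sup , λ v → solveᶻ 2 (λ x i → x :=ᶻ x :-ᶻ i :+ᶻ i) refl (excess u v) (indicator s v)) , λ _ _ → refl
    ...     | t , t<0 , u′ , sup′ , ex with k
    ...       | zero   = ⊥-elim (<⇒≱ (decreases {u} {u′} s>0 t<0 ex) (≤-trans Φ≤k z≤n))
    ...       | suc k′ = balance k′ u′ sup′ (≤-pred (≤-trans (decreases {u} {u′} s>0 t<0 ex) Φ≤k))

  module _ (q : ℕ) (q>0 : 0 < q) (z : E → ℕ) (conserved : ∀ v → net (λ e → ⁺ z e) v ≡ 0ℤ)
           (lo rem : E → ℕ) (rem<q : ∀ e → rem e < q) (expand : ∀ e → z e ≡ rem e + q * lo e) where

    -- The circulation `z` is the sum of `rem` and `q lo`, so the remainders have to compensate the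
    -- integral parts. That makes their divergence a multiple of `q`.
    divergence : ∀ v → net (λ e → ⁺ rem e) v ≡ ⁺ q *ᶻ (ℤ.- net (λ e → ⁺ lo e) v)
    divergence v = trans
      (solveᶻ 3 (λ r q n → r :=ᶻ (q :*ᶻ n :+ᶻ r) :+ᶻ q :*ᶻ (:-ᶻ n)) refl (net (λ e → ⁺ rem e) v) (⁺ q) (net (λ e → ⁺ lo e) v))
      (trans (cong (_+ᶻ ⁺ q *ᶻ (ℤ.- net (λ e → ⁺ lo e) v))
        (trans (sym (net-linear (⁺ q) (λ e → ⁺ lo e) (λ e → ⁺ rem e) v))
          (trans (Σᶻ-cong (list ℰ) (λ e → cong (_*ᶻ (indicator (dst e) v -ᶻ indicator (src e) v)) (divided e))) (conserved v))))
        (ℤₚ.+-identityˡ _))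
      where
      divided : ∀ e → ⁺ q *ᶻ ⁺ lo e +ᶻ ⁺ rem e ≡ ⁺ z e
      divided e = trans (cong (_+ᶻ ⁺ rem e) (sym (ℤₚ.pos-* q (lo e))))
        (cong ⁺_ (trans (+-comm (q * lo e) (rem e)) (sym (expand e))))

    open Fractional q q>0 rem rem<q (λ v → ℤ.- net (λ e → ⁺ lo e) v) divergence

    -- The strict inequalities say that `y e` is `z e / q` rounded up or down, and is exact if `q`
    -- divides `z e`. Integral upper and lower bounds therefore survive rounding.
    Rounded : (E → ℕ) → Set
    Rounded y = (∀ g → flux (λ e → ⁺ y e) g ≡ 0ℤ) × (∀ e → q * y e < z e + q) × (∀ e → z e < q * y e + q)

    rounded : ∀ u → Supported u → Balanced u → ∃[ y ] Rounded y
    rounded u sup bal = y , circulates , lower , upper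
      where
      y : E → ℕ
      y e = (if u e then 1 else 0) + lo e
      y-net : ∀ v → net (λ e → ⁺ y e) v ≡ 0ℤ
      y-net v = trans (Σᶻ-cong (list ℰ) (λ e → cong (_*ᶻ (indicator (dst e) v -ᶻ indicator (src e) v)) (split e)))
        (trans (net-linear 1ℤ (λ e → ⟨ u e ⟩) (λ e → ⁺ lo e) v)
          (trans (solveᶻ 2 (λ a b → κᶻ 1ℤ :*ᶻ a :+ᶻ b :=ᶻ a :-ᶻ (:-ᶻ b)) refl (net (λ e → ⟨ u e ⟩) v) (net (λ e → ⁺ lo e) v))
            (bal v)))
        where
        split : ∀ e → ⁺ y e ≡ 1ℤ *ᶻ ⟨ u e ⟩ +ᶻ ⁺ lo e
        split e with u e
        ... | true = refl
        ... | false = refl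
      circulates : ∀ g → flux (λ e → ⁺ y e) g ≡ 0ℤ
      circulates g = trans (sym (Σᶻ-net g (λ e → ⁺ y e)))
        (trans (Σᶻ-cong (list 𝒱) (λ v → trans (cong (g v *ᶻ_) (y-net v)) (ℤₚ.*-zeroʳ (g v)))) (Σᶻ-0 (list 𝒱)))
      lower : ∀ e → q * y e < z e + q
      lower e with u e in eq
      ... | false = ≤-trans (s≤s (≤-trans (m≤n+m (q * lo e) (rem e)) (≤-reflexive (sym (expand e)))))
                      (≤-trans (≤-reflexive (+-comm 1 (z e))) (+-monoʳ-≤ (z e) q>0))
      ... | true = ≤-trans (s≤s (≤-reflexive (*-suc q (lo e))))
                     (≤-trans (≤-reflexive (cong suc (+-comm q (q * lo e))))
                       (+-monoˡ-≤ q (≤-trans (+-monoˡ-≤ (q * lo e) (sup e eq)) (≤-reflexive (sym (expand e))))))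
      upper : ∀ e → z e < q * y e + q
      upper e = ≤-trans (s≤s (≤-reflexive (expand e)))
        (≤-trans (+-monoˡ-≤ (q * lo e) (rem<q e)) (≤-trans (≤-reflexive (+-comm q (q * lo e)))
          (+-monoˡ-≤ q (*-monoʳ-≤ q (m≤n+m (lo e) (if u e then 1 else 0))))))

  round : ∀ q .⦃ _ : NonZero q ⦄ (z : E → ℕ) → (∀ v → net (λ e → ⁺ z e) v ≡ 0ℤ) →
          Σ[ y ∈ (E → ℕ) ] ((∀ g → flux (λ e → ⁺ y e) g ≡ 0ℤ) × (∀ e → q * y e < z e + q) × (∀ e → z e < q * y e + q))
  round q@(suc _) z conserved =
    let u , sup , bal = balance (sumOver (positivePart ∘ excess (λ _ → false)) (list 𝒱)) (λ _ → false) (λ _ ()) ≤-refl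
    in rounded q (s≤s z≤n) z conserved (λ e → z e / q) (λ e → z e % q) (λ e → m%n<n (z e) q) expand u sup bal
    where
    expand : ∀ e → z e ≡ z e % q + q * (z e / q)
    expand e = trans (m≡m%n+[m/n]*n (z e) q) (cong (z e % q +_) (*-comm (z e / q) q))
    open Fractional q (s≤s z≤n) (λ e → z e % q) (λ e → m%n<n (z e) q) (λ v → ℤ.- net (λ e → ⁺ (z e / q)) v)
      (divergence q (s≤s z≤n) z conserved (λ e → z e / q) (λ e → z e % q) (λ e → m%n<n (z e) q) expand)


-- The network of a schedule

enumeration-⊤ : Enumeration ⊤
enumeration-⊤ = record { list = [ tt ] ; unique = [] ∷ [] ; enumerate = λ _ → here refl ; decEq = λ _ _ → yes refl }

enumeration-Fin : ∀ n → Enumeration (Fin n)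
enumeration-Fin n = record { list = List.allFin n ; unique = Uniqueₚ.allFin⁺ n ; enumerate = ∈ₚ.∈-allFin ; decEq = Finₚ._≟_ }

enumeration-⊎ : ∀ {A B : Set} → Enumeration A → Enumeration B → Enumeration (A ⊎ B)
enumeration-⊎ 𝒜 ℬ = record
  { list = List.map inj₁ (list 𝒜) ++ List.map inj₂ (list ℬ)
  ; unique = Uniqueₚ.++⁺ (Uniqueₚ.map⁺ (λ { refl → refl }) (unique 𝒜)) (Uniqueₚ.map⁺ (λ { refl → refl }) (unique ℬ)) disjoint
  ; enumerate = λ { (inj₁ a) → ∈ₚ.∈-++⁺ˡ (∈ₚ.∈-map⁺ inj₁ (enumerate 𝒜 a))
                  ; (inj₂ b) → ∈ₚ.∈-++⁺ʳ (List.map inj₁ (list 𝒜)) (∈ₚ.∈-map⁺ inj₂ (enumerate ℬ b)) }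
  ; decEq = Sumₚ.≡-dec (decEq 𝒜) (decEq ℬ)
  }
  where
  disjoint : ∀ {v} → ¬ (v ∈ List.map inj₁ (list 𝒜) × v ∈ List.map inj₂ (list ℬ))
  disjoint (p , p′) with ∈ₚ.∈-map⁻ inj₁ p | ∈ₚ.∈-map⁻ inj₂ p′
  ... | _ , _ , refl | _ , _ , ()

enumeration-× : ∀ {A B : Set} → Enumeration A → Enumeration B → Enumeration (A × B)
enumeration-× 𝒜 ℬ = record
  { list = List.cartesianProduct (list 𝒜) (list ℬ)
  ; unique = Uniqueₚ.cartesianProduct⁺ (unique 𝒜) (unique ℬ)
  ; enumerate = λ (a , b) → ∈ₚ.∈-cartesianProduct⁺ (enumerate 𝒜 a) (enumerate ℬ b)
  ; decEq = Productₚ.≡-dec (decEq 𝒜) (decEq ℬ)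
  }

Σᶻ-++ : ∀ {A : Set} (xs ys : List A) f → Σᶻ (xs ++ ys) f ≡ Σᶻ xs f +ᶻ Σᶻ ys f
Σᶻ-++ [] ys f = sym (ℤₚ.+-identityˡ _)
Σᶻ-++ (x ∷ xs) ys f = trans (cong (f x +ᶻ_) (Σᶻ-++ xs ys f)) (sym (ℤₚ.+-assoc (f x) _ _))

Σᶻ-map : ∀ {A B : Set} (h : A → B) xs f → Σᶻ (List.map h xs) f ≡ Σᶻ xs (f ∘ h)
Σᶻ-map h [] f = refl
Σᶻ-map h (x ∷ xs) f = cong (f (h x) +ᶻ_) (Σᶻ-map h xs f)

Σᶻ-× : ∀ {A B : Set} (xs : List A) (ys : List B) f →
       Σᶻ (List.cartesianProduct xs ys) f ≡ Σᶻ xs (λ x → Σᶻ ys (λ y → f (x , y)))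
Σᶻ-× [] ys f = refl
Σᶻ-× (x ∷ xs) ys f = trans (Σᶻ-++ (List.map (x ,_) ys) _ f) (cong₂ _+ᶻ_ (Σᶻ-map (x ,_) ys f) (Σᶻ-× xs ys f))

Σᶠ : ∀ {n} → (Fin n → ℤ) → ℤ
Σᶠ {n} = Σᶻ (List.allFin n)

Σᶠ-suc : ∀ {n} (f : Fin (suc n) → ℤ) → Σᶠ f ≡ f zero +ᶻ Σᶠ (f ∘ suc)
Σᶠ-suc {n} f = cong (f zero +ᶻ_) (trans (cong (λ l → Σᶻ l f) (sym (Listₚ.map-tabulate id suc))) (Σᶻ-map suc (List.allFin n) f))

Σᶠ-sumᶠ : ∀ {n} (f : Fin n → ℕ) → Σᶠ (λ i → ⁺ f i) ≡ ⁺ sumᶠ f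
Σᶠ-sumᶠ {zero} f = refl
Σᶠ-sumᶠ {suc n} f = trans (Σᶠ-suc (λ i → ⁺ f i)) (cong (⁺ f zero +ᶻ_) (Σᶠ-sumᶠ (f ∘ suc)))

Σᶠ-delta : ∀ {n} (f : Fin n → ℤ) a → Σᶠ (λ i → f i *ᶻ ⟨ does (a Finₚ.≟ i) ⟩) ≡ f a
Σᶠ-delta {n} f = Rounding.Σᶻ-indicator (enumeration-Fin n) (enumeration-Fin n) id id f

-- The vertex after t on a path that ends in h.
start-on : ∀ {A : Set} {n} → (Fin n → A) → A → A
start-on {n = zero}  π h = h
start-on {n = suc n} π h = π zero

next-on : ∀ {A : Set} {n} → (Fin n → A) → A → Fin n → A
next-on π h zero    = start-on (π ∘ suc) h
next-on π h (suc t) = next-on (π ∘ suc) h t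

next-on-∘ : ∀ {A B : Set} {n} (g : A → B) (π : Fin n → A) h t → g (next-on π h t) ≡ next-on (g ∘ π) (g h) t
next-on-∘ {n = suc zero} g π h zero = refl
next-on-∘ {n = suc (suc n)} g π h zero = refl
next-on-∘ g π h (suc t) = next-on-∘ g (π ∘ suc) h t

prefixSum : ∀ {n} → (Fin n → ℕ) → Fin n → ℕ
prefixSum z zero    = z zero
prefixSum z (suc t) = z zero + prefixSum (z ∘ suc) t

sumᶠ-cong : ∀ {n} {f g : Fin n → ℕ} → (∀ i → f i ≡ g i) → sumᶠ f ≡ sumᶠ g
sumᶠ-cong = Sum.sum-cong-≗ +-0-monoid

prefixSum-sumᶠ : ∀ {n} (z : Fin n → ℕ) d → sumᶠ (λ t → if toℕ t ≤ᵇ toℕ d then z t else 0) ≡ prefixSum z d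
prefixSum-sumᶠ {suc n} z zero = trans (cong (z zero +_) (Sum.sum-replicate-zero +-0-monoid n)) (+-identityʳ (z zero))
prefixSum-sumᶠ {suc n} z (suc d) = cong (z zero +_)
  (trans (sumᶠ-cong (λ t → cong (λ b → if b then z (suc t) else 0) (<ᵇ-suc (toℕ t)))) (prefixSum-sumᶠ (z ∘ suc) d))
  where
  <ᵇ-suc : ∀ m → (m <ᵇ suc (toℕ d)) ≡ (m ≤ᵇ toℕ d)
  <ᵇ-suc zero    = refl
  <ᵇ-suc (suc m) = refl

-- Summation by parts.
path-flux : ∀ {n} (c₀ : ℕ) (z : Fin n → ℕ) (π : Fin n → ℤ) h →
  Σᶠ (λ t → ⁺ z t *ᶻ (π t -ᶻ h)) +ᶻ Σᶠ (λ t → ⁺ (c₀ + prefixSum z t) *ᶻ (next-on π h t -ᶻ π t)) ≡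
  ℤ.- (⁺ c₀ *ᶻ (start-on π h -ᶻ h))
path-flux {zero} c₀ z π h = solveᶻ 2 (λ c h → κᶻ 0ℤ :=ᶻ :-ᶻ (c :*ᶻ (h :-ᶻ h))) refl (⁺ c₀) h
path-flux {suc n} c₀ z π h = trans
  (cong₂ _+ᶻ_ (Σᶠ-suc (λ t → ⁺ z t *ᶻ (π t -ᶻ h))) (trans (Σᶠ-suc (λ t → ⁺ (c₀ + prefixSum z t) *ᶻ (next-on π h t -ᶻ π t)))
    (cong (⁺ (c₀ + z zero) *ᶻ (start-on (π ∘ suc) h -ᶻ π zero) +ᶻ_) (Σᶻ-cong (List.allFin n) (λ t →
      cong (λ k → ⁺ k *ᶻ (next-on (π ∘ suc) h t -ᶻ π (suc t))) (sym (+-assoc c₀ (z zero) (prefixSum (z ∘ suc) t))))))))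
  (trans (solveᶻ 4 (λ a b c d → (a :+ᶻ b) :+ᶻ (c :+ᶻ d) :=ᶻ a :+ᶻ c :+ᶻ (b :+ᶻ d)) refl
      (⁺ z zero *ᶻ (π zero -ᶻ h)) (Σᶠ (λ t → ⁺ z (suc t) *ᶻ (π (suc t) -ᶻ h))) _ _)
    (trans (cong (⁺ z zero *ᶻ (π zero -ᶻ h) +ᶻ ⁺ (c₀ + z zero) *ᶻ (start-on (π ∘ suc) h -ᶻ π zero) +ᶻ_)
        (path-flux (c₀ + z zero) (z ∘ suc) (π ∘ suc) h))
      (trans (cong (λ k → ⁺ z zero *ᶻ (π zero -ᶻ h) +ᶻ k *ᶻ (start-on (π ∘ suc) h -ᶻ π zero) +ᶻ ℤ.- (k *ᶻ (start-on (π ∘ suc) h -ᶻ h)))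
          (ℤₚ.pos-+ c₀ (z zero)))
        (solveᶻ 5 (λ c z p s h → z :*ᶻ (p :-ᶻ h) :+ᶻ (c :+ᶻ z) :*ᶻ (s :-ᶻ p) :+ᶻ :-ᶻ ((c :+ᶻ z) :*ᶻ (s :-ᶻ h)) :=ᶻ
          :-ᶻ (c :*ᶻ (p :-ᶻ h))) refl (⁺ c₀) (⁺ z zero) (π zero) (start-on (π ∘ suc) h) h))))

-- The potential that separates the vertices up to t from the others.
upTo : ∀ {n} → Fin n → Fin n → ℤ
upTo t       zero     = 1ℤ
upTo zero    (suc t′) = 0ℤ
upTo (suc t) (suc t′) = upTo t t′

Σᶠ-0 : ∀ {n} {f : Fin n → ℤ} → (∀ i → f i ≡ 0ℤ) → Σᶠ f ≡ 0ℤ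
Σᶠ-0 {n} h = trans (Σᶻ-cong (List.allFin n) h) (Σᶻ-0 (List.allFin n))

Σᶠ-upTo : ∀ {n} (y : Fin n → ℕ) t → Σᶠ (λ t′ → ⁺ y t′ *ᶻ upTo t t′) ≡ ⁺ prefixSum y t
Σᶠ-upTo y zero = trans (Σᶠ-suc (λ t′ → ⁺ y t′ *ᶻ upTo zero t′))
  (trans (cong₂ _+ᶻ_ (ℤₚ.*-identityʳ (⁺ y zero)) (Σᶠ-0 (λ t′ → ℤₚ.*-zeroʳ (⁺ y (suc t′))))) (ℤₚ.+-identityʳ _))
Σᶠ-upTo y (suc t) = trans (Σᶠ-suc (λ t′ → ⁺ y t′ *ᶻ upTo (suc t) t′))
  (trans (cong₂ _+ᶻ_ (ℤₚ.*-identityʳ (⁺ y zero)) (Σᶠ-upTo (y ∘ suc) t)) (sym (ℤₚ.pos-+ (y zero) _)))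

start-upTo : ∀ {n} (t : Fin n) → start-on (upTo t) 0ℤ ≡ 1ℤ
start-upTo zero    = refl
start-upTo (suc t) = refl

Σᶠ-next-upTo : ∀ {n} (c : Fin n → ℕ) t → Σᶠ (λ t′ → ⁺ c t′ *ᶻ (next-on (upTo t) 0ℤ t′ -ᶻ upTo t t′)) ≡ ℤ.- (⁺ c t)
Σᶠ-next-upTo {suc n} c zero = trans (Σᶠ-suc (λ t′ → ⁺ c t′ *ᶻ (next-on (upTo zero) 0ℤ t′ -ᶻ upTo zero t′)))
  (trans (cong₂ _+ᶻ_ (cong (λ k → ⁺ c zero *ᶻ (k -ᶻ 1ℤ)) (start-0 n))
    (Σᶠ-0 (λ t′ → trans (cong (λ k → ⁺ c (suc t′) *ᶻ (k -ᶻ 0ℤ)) (next-0 t′)) (ℤₚ.*-zeroʳ (⁺ c (suc t′))))))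
    (solveᶻ 1 (λ c → c :*ᶻ (κᶻ 0ℤ :-ᶻ κᶻ 1ℤ) :+ᶻ κᶻ 0ℤ :=ᶻ :-ᶻ c) refl (⁺ c zero)))
  where
  start-0 : ∀ n → start-on {n = n} (λ _ → 0ℤ) 0ℤ ≡ 0ℤ
  start-0 zero = refl
  start-0 (suc n) = refl
  next-0 : ∀ {n} (t : Fin n) → next-on (λ _ → 0ℤ) 0ℤ t ≡ 0ℤ
  next-0 {suc n} zero = start-0 n
  next-0 (suc t) = next-0 t
Σᶠ-next-upTo {suc n} c (suc t) = trans (Σᶠ-suc (λ t′ → ⁺ c t′ *ᶻ (next-on (upTo (suc t)) 0ℤ t′ -ᶻ upTo (suc t) t′)))
  (trans (cong₂ _+ᶻ_ (trans (cong (λ k → ⁺ c zero *ᶻ (k -ᶻ 1ℤ)) (start-upTo t)) (ℤₚ.*-zeroʳ (⁺ c zero))) (Σᶠ-next-upTo (c ∘ suc) t))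
    (ℤₚ.+-identityˡ _))

module Network (n T : ℕ) where

  -- Resource flows from the hub to a period, from there to the batteries of the agents in that
  -- period, then along each battery from period to period and finally back to the hub. The edge
  -- `carries i t` thus holds everything that agent `i` has received up to `t`, so that a demand is
  -- a lower bound on one edge, just as supply and speed are upper bounds on one edge.
  Vertex Edge : Set
  Vertex = ⊤ ⊎ (Fin T ⊎ (Fin n × Fin T))
  Edge   = Fin T ⊎ ((Fin n × Fin T) ⊎ (Fin n × Fin T))

  pattern hub         = inj₁ tt
  pattern period t    = inj₂ (inj₁ t)
  pattern battery i t = inj₂ (inj₂ (i , t))

  pattern supplies t  = inj₁ t
  pattern charges i t = inj₂ (inj₁ (i , t))
  pattern carries i t = inj₂ (inj₂ (i , t))

  src dst : Edge → Vertex
  src (supplies t)  = hub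
  src (charges i t) = period t
  src (carries i t) = battery i t
  dst (supplies t)  = period t
  dst (charges i t) = battery i t
  dst (carries i t) = next-on (λ t → battery i t) hub t

  vertices : Enumeration Vertex
  vertices = enumeration-⊎ enumeration-⊤ (enumeration-⊎ (enumeration-Fin T) (enumeration-× (enumeration-Fin n) (enumeration-Fin T)))

  edges : Enumeration Edge
  edges = enumeration-⊎ (enumeration-Fin T) (enumeration-⊎ (enumeration-× (enumeration-Fin n) (enumeration-Fin T))
                                                           (enumeration-× (enumeration-Fin n) (enumeration-Fin T)))

  open Rounding vertices edges src dst

  ΣΣ : (Fin n → Fin T → ℤ) → ℤ
  ΣΣ f = Σᶠ (λ i → Σᶠ (λ t → f i t))

  flux-split : ∀ c g → flux c g ≡
    Σᶠ (λ t → c (supplies t) *ᶻ (g (period t) -ᶻ g hub)) +ᶻ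
    (ΣΣ (λ i t → c (charges i t) *ᶻ (g (battery i t) -ᶻ g (period t))) +ᶻ
     ΣΣ (λ i t → c (carries i t) *ᶻ (next-on (λ t → g (battery i t)) (g hub) t -ᶻ g (battery i t))))
  flux-split c g = trans (Σᶻ-++ (List.map inj₁ (List.allFin T)) (List.map inj₂ (List.map inj₁ pairs ++ List.map inj₂ pairs)) term) (cong₂ _+ᶻ_ (Σᶻ-map inj₁ (List.allFin T) term)
    (trans (Σᶻ-map inj₂ (List.map inj₁ pairs ++ List.map inj₂ pairs) term)
      (trans (Σᶻ-++ (List.map inj₁ pairs) (List.map inj₂ pairs) (term ∘ inj₂)) (cong₂ _+ᶻ_
        (trans (Σᶻ-map inj₁ pairs (term ∘ inj₂)) (Σᶻ-× (List.allFin n) (List.allFin T) (term ∘ inj₂ ∘ inj₁)))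
        (trans (Σᶻ-map inj₂ pairs (term ∘ inj₂)) (trans (Σᶻ-× (List.allFin n) (List.allFin T) (term ∘ inj₂ ∘ inj₂))
          (Σᶻ-cong (List.allFin n) λ i → Σᶻ-cong (List.allFin T) λ t →
            cong (λ k → c (carries i t) *ᶻ (k -ᶻ g (battery i t))) (next-on-∘ g (λ t → battery i t) hub t))))))))
    where
    pairs : List (Fin n × Fin T)
    pairs = List.cartesianProduct (List.allFin n) (List.allFin T)
    term : Edge → ℤ
    term e = c e *ᶻ (g (dst e) -ᶻ g (src e))

  flow : (Fin n → Fin T → ℕ) → Edge → ℕ
  flow z (supplies t)  = sumᶠ (λ i → z i t)
  flow z (charges i t) = z i t
  flow z (carries i t) = prefixSum (z i) t

  -- Distributing the supply edges over the agents splits the flow into one circulation per agent,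
  -- which `path-flux` handles with nothing carried in.
  flow-conserved : ∀ z g → flux (λ e → ⁺ flow z e) g ≡ 0ℤ
  flow-conserved z g = trans (flux-split (λ e → ⁺ flow z e) g) (trans
    (cong (_+ᶻ (ΣΣ charging +ᶻ ΣΣ carrying)) supplying)
    (trans (sym (ℤₚ.+-assoc (ΣΣ drawing) (ΣΣ charging) (ΣΣ carrying)))
      (trans (cong (_+ᶻ ΣΣ carrying) (sym (Σᶻ-+ (List.allFin n) (Σᶠ ∘ drawing) (Σᶠ ∘ charging))))
        (trans (sym (Σᶻ-+ (List.allFin n) (λ i → Σᶠ (drawing i) +ᶻ Σᶠ (charging i)) (Σᶠ ∘ carrying))) (Σᶠ-0 per-agent)))))
    where
    drawing charging carrying : Fin n → Fin T → ℤ
    drawing i t = ⁺ z i t *ᶻ (g (period t) -ᶻ g hub)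
    charging i t = ⁺ z i t *ᶻ (g (battery i t) -ᶻ g (period t))
    carrying i t = ⁺ prefixSum (z i) t *ᶻ (next-on (λ t → g (battery i t)) (g hub) t -ᶻ g (battery i t))
    drawn : ∀ t → ⁺ sumᶠ (λ i → z i t) *ᶻ (g (period t) -ᶻ g hub) ≡ Σᶠ (λ i → drawing i t)
    drawn t = trans (cong (_*ᶻ (g (period t) -ᶻ g hub)) (sym (Σᶠ-sumᶠ (λ i → z i t))))
      (trans (ℤₚ.*-comm (Σᶠ (λ i → ⁺ z i t)) (g (period t) -ᶻ g hub))
        (trans (sym (Σᶻ-* (List.allFin n) (g (period t) -ᶻ g hub) (λ i → ⁺ z i t)))
          (Σᶻ-cong (List.allFin n) (λ i → ℤₚ.*-comm (g (period t) -ᶻ g hub) (⁺ z i t)))))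
    supplying : Σᶠ (λ t → ⁺ sumᶠ (λ i → z i t) *ᶻ (g (period t) -ᶻ g hub)) ≡ ΣΣ drawing
    supplying = trans (Σᶻ-cong (List.allFin T) drawn) (Σᶻ-swap (List.allFin T) (List.allFin n) (λ t i → drawing i t))
    per-agent : ∀ i → Σᶠ (drawing i) +ᶻ Σᶠ (charging i) +ᶻ Σᶠ (carrying i) ≡ 0ℤ
    per-agent i = trans (cong (_+ᶻ Σᶠ (carrying i)) (trans (sym (Σᶻ-+ (List.allFin T) (drawing i) (charging i)))
        (Σᶻ-cong (List.allFin T) λ t → solveᶻ 4 (λ z p h b → z :*ᶻ (p :-ᶻ h) :+ᶻ z :*ᶻ (b :-ᶻ p) :=ᶻ z :*ᶻ (b :-ᶻ h)) refl
          (⁺ z i t) (g (period t)) (g hub) (g (battery i t)))))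
      (path-flux 0 (z i) (λ t → g (battery i t)) (g hub))

  module _ (y : Edge → ℕ) (conserved : ∀ g → flux (λ e → ⁺ y e) g ≡ 0ℤ) where

    -- Conservation is applied to the potential that is 1 at `period t` and 0 elsewhere.
    supplies-sum : ∀ t → y (supplies t) ≡ sumᶠ (λ i → y (charges i t))
    supplies-sum t = ℤₚ.+-injective (ℤₚ.i-j≡0⇒i≡j (⁺ y (supplies t)) (⁺ sumᶠ (λ i → y (charges i t)))
      (trans (sym (trans (flux-split (λ e → ⁺ y e) g) (cong₂ _+ᶻ_ supplied
        (trans (cong₂ _+ᶻ_ charged (Σᶠ-0 (λ i → Σᶠ-0 (λ t′ → carried i t′)))) (ℤₚ.+-identityʳ (ℤ.- total))))))
        (conserved g)))
      where
      δ : Fin T → ℤ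
      δ t′ = ⟨ does (t Finₚ.≟ t′) ⟩
      g : Vertex → ℤ
      g (period t′) = δ t′
      g _           = 0ℤ
      total : ℤ
      total = ⁺ sumᶠ (λ i → y (charges i t))
      next-0 : ∀ {k} (t : Fin k) → next-on (λ _ → 0ℤ) 0ℤ t ≡ 0ℤ
      next-0 {suc zero} zero = refl
      next-0 {suc (suc k)} zero = refl
      next-0 (suc t) = next-0 t
      supplied : Σᶠ (λ t′ → ⁺ y (supplies t′) *ᶻ (δ t′ -ᶻ 0ℤ)) ≡ ⁺ y (supplies t)
      supplied = trans (Σᶻ-cong (List.allFin T) (λ t′ → cong (⁺ y (supplies t′) *ᶻ_) (ℤₚ.+-identityʳ (δ t′))))
        (Σᶠ-delta (λ t → ⁺ y (supplies t)) t)
      charged-by : ∀ i → Σᶠ (λ t′ → ⁺ y (charges i t′) *ᶻ (0ℤ -ᶻ δ t′)) ≡ ℤ.-1ℤ *ᶻ ⁺ y (charges i t)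
      charged-by i = trans (Σᶻ-cong (List.allFin T) (λ t′ → solveᶻ 2 (λ f d → f :*ᶻ (κᶻ 0ℤ :-ᶻ d) :=ᶻ κᶻ ℤ.-1ℤ :*ᶻ (f :*ᶻ d)) refl
          (⁺ y (charges i t′)) (δ t′)))
        (trans (Σᶻ-* (List.allFin T) ℤ.-1ℤ (λ t′ → ⁺ y (charges i t′) *ᶻ δ t′))
          (cong (ℤ.-1ℤ *ᶻ_) (Σᶠ-delta (λ t → ⁺ y (charges i t)) t)))
      charged : ΣΣ (λ i t′ → ⁺ y (charges i t′) *ᶻ (0ℤ -ᶻ δ t′)) ≡ ℤ.- total
      charged = trans (Σᶻ-cong (List.allFin n) charged-by)
        (trans (Σᶻ-* (List.allFin n) ℤ.-1ℤ (λ i → ⁺ y (charges i t)))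
          (trans (cong (ℤ.-1ℤ *ᶻ_) (Σᶠ-sumᶠ (λ i → y (charges i t)))) (ℤₚ.-1*i≡-i total)))
      carried : ∀ i t′ → ⁺ y (carries i t′) *ᶻ (next-on (λ _ → 0ℤ) 0ℤ t′ -ᶻ 0ℤ) ≡ 0ℤ
      carried i t′ = trans (cong (λ k → ⁺ y (carries i t′) *ᶻ (k -ᶻ 0ℤ)) (next-0 t′)) (ℤₚ.*-zeroʳ (⁺ y (carries i t′)))

    -- The potential is the indicator of the batteries of agent `i` up to period `t`: the charges up
    -- to `t` enter this set, and only `carries i t` leaves it.
    carries-prefixSum : ∀ i t → y (carries i t) ≡ prefixSum (λ t → y (charges i t)) t
    carries-prefixSum i t = sym (ℤₚ.+-injective (ℤₚ.i-j≡0⇒i≡j (⁺ prefixSum (λ t → y (charges i t)) t) (⁺ y (carries i t))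
      (trans (sym (trans (flux-split (λ e → ⁺ y e) g) (trans (cong₂ _+ᶻ_ (Σᶠ-0 (λ t → ℤₚ.*-zeroʳ (⁺ y (supplies t))))
          (cong₂ _+ᶻ_ charged carried)) (ℤₚ.+-identityˡ _))))
        (conserved g))))
      where
      δ : Fin n → ℤ
      δ i′ = ⟨ does (i Finₚ.≟ i′) ⟩
      g : Vertex → ℤ
      g (battery i′ t′) = δ i′ *ᶻ upTo t t′
      g _               = 0ℤ
      only : ∀ (f : Fin n → ℤ) {k} → f i ≡ k → Σᶠ (λ i′ → δ i′ *ᶻ f i′) ≡ k
      only f e = trans (Σᶻ-cong (List.allFin n) (λ i′ → ℤₚ.*-comm (δ i′) (f i′))) (trans (Σᶠ-delta f i) e)
      charge carry′ : Fin n → Fin T → ℤ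
      charge i′ t′ = ⁺ y (charges i′ t′) *ᶻ upTo t t′
      carry′ i′ t′ = ⁺ y (carries i′ t′) *ᶻ (next-on (upTo t) 0ℤ t′ -ᶻ upTo t t′)
      charged : ΣΣ (λ i′ t′ → ⁺ y (charges i′ t′) *ᶻ (δ i′ *ᶻ upTo t t′ -ᶻ 0ℤ)) ≡ ⁺ prefixSum (λ t → y (charges i t)) t
      charged = trans
        (Σᶻ-cong (List.allFin n) λ i′ → trans (Σᶻ-cong (List.allFin T) λ t′ →
            solveᶻ 3 (λ d y u → y :*ᶻ (d :*ᶻ u :-ᶻ κᶻ 0ℤ) :=ᶻ d :*ᶻ (y :*ᶻ u)) refl (δ i′) (⁺ y (charges i′ t′)) (upTo t t′))
          (Σᶻ-* (List.allFin T) (δ i′) (charge i′)))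
        (only (λ i′ → Σᶠ (charge i′)) (Σᶠ-upTo (λ t → y (charges i t)) t))
      next-scaled : ∀ i′ t′ → next-on (λ t′ → δ i′ *ᶻ upTo t t′) 0ℤ t′ ≡ δ i′ *ᶻ next-on (upTo t) 0ℤ t′
      next-scaled i′ t′ = sym (trans (next-on-∘ (δ i′ *ᶻ_) (upTo t) 0ℤ t′)
        (cong (λ h → next-on (λ t′ → δ i′ *ᶻ upTo t t′) h t′) (ℤₚ.*-zeroʳ (δ i′))))
      carried : ΣΣ (λ i′ t′ → ⁺ y (carries i′ t′) *ᶻ (next-on (λ t′ → δ i′ *ᶻ upTo t t′) 0ℤ t′ -ᶻ δ i′ *ᶻ upTo t t′)) ≡
                ℤ.- (⁺ y (carries i t))
      carried = trans
        (Σᶻ-cong (List.allFin n) λ i′ → trans (Σᶻ-cong (List.allFin T) λ t′ → trans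
            (cong (λ k → ⁺ y (carries i′ t′) *ᶻ (k -ᶻ δ i′ *ᶻ upTo t t′)) (next-scaled i′ t′))
            (solveᶻ 4 (λ d y u v → y :*ᶻ (d :*ᶻ u :-ᶻ d :*ᶻ v) :=ᶻ d :*ᶻ (y :*ᶻ (u :-ᶻ v))) refl
              (δ i′) (⁺ y (carries i′ t′)) (next-on (upTo t) 0ℤ t′) (upTo t t′)))
          (Σᶻ-* (List.allFin T) (δ i′) (carry′ i′)))
        (only (λ i′ → Σᶠ (carry′ i′)) (Σᶠ-next-upTo (λ t → y (carries i t)) t))

  Rounds : ℕ → (Fin n → Fin T → ℕ) → (Fin n → Fin T → ℕ) → Set
  Rounds q z y = (∀ i t s → z i t ≤ s * q → y i t ≤ s) ×
    (∀ t m → sumᶠ (λ i → z i t) ≤ m * q → sumᶠ (λ i → y i t) ≤ m) ×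
    (∀ i d w → w * q ≤ prefixSum (z i) d → w ≤ prefixSum (y i) d)

  rounds : ∀ q z (y : Edge → ℕ) → (∀ g → flux (λ e → ⁺ y e) g ≡ 0ℤ) → (∀ e → q * y e < flow z e + q) →
           (∀ e → flow z e < q * y e + q) → Rounds q z (λ i t → y (charges i t))
  rounds q z y conserved lower upper =
    (λ i t s h → bounded-above (charges i t) s h) ,
    (λ t m h → ≤-trans (≤-reflexive (sym (supplies-sum y conserved t))) (bounded-above (supplies t) m h)) ,
    (λ i d w h → ≤-trans (bounded-below (carries i d) w h) (≤-reflexive (carries-prefixSum y conserved i d)))
    where
    bounded-above : ∀ e s → flow z e ≤ s * q → y e ≤ s
    bounded-above e s h = ≤-pred (*-cancelˡ-< q (y e) (suc s) (≤-trans (lower e)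
      (≤-trans (+-monoˡ-≤ q h) (≤-reflexive (trans (+-comm (s * q) q) (*-comm (suc s) q))))))
    bounded-below : ∀ e w → w * q ≤ flow z e → w ≤ y e
    bounded-below e w h = ≤-pred (*-cancelˡ-< q w (suc (y e)) (≤-trans (s≤s (≤-trans (≤-reflexive (*-comm q w)) h))
      (≤-trans (upper e) (≤-reflexive (trans (+-comm (q * y e) q) (sym (*-suc q (y e))))))))

  abstract
    -- A fractional schedule z / q can be replaced by an integral one.
    round-schedule : ∀ q .⦃ _ : NonZero q ⦄ (z : Fin n → Fin T → ℕ) → Σ[ y ∈ (Fin n → Fin T → ℕ) ] Rounds q z y
    round-schedule q z =
      let y , conserved , lower , upper = round q (flow z) (λ v → flow-conserved z (λ a → indicator a v))
      in (λ i t → y (charges i t)) , rounds q z y conserved lower upper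


-- Rational schedules

-- The rational Z / (k + 1).
ratio : ℕ → ℕ → ℚ
ratio k Z = ⁺ Z ℚ./ suc k

toℚᵘ-ratio : ∀ k Z → ℚ.toℚᵘ (ratio k Z) ℚᵘ.≃ ℚᵘ.mkℚᵘ (⁺ Z) k
toℚᵘ-ratio k Z = ℚₚ.toℚᵘ-fromℚᵘ (ℚᵘ.mkℚᵘ (⁺ Z) k)

ratio-≡ : ∀ k l a b → a * suc l ≡ b * suc k → ratio k a ≡ ratio l b
ratio-≡ k l a b e = ℚₚ.fromℚᵘ-cong {ℚᵘ.mkℚᵘ (⁺ a) k} {ℚᵘ.mkℚᵘ (⁺ b) l}
  (ℚᵘ.*≡* (trans (sym (ℤₚ.pos-* a (suc l))) (trans (cong ⁺_ e) (ℤₚ.pos-* b (suc k)))))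

ratio-≤⁻ : ∀ k l a b → ratio k a ℚ.≤ ratio l b → a * suc l ≤ b * suc k
ratio-≤⁻ k l a b h = ℤₚ.drop‿+≤+ (subst₂ _≤ᶻ_ (sym (ℤₚ.pos-* a (suc l))) (sym (ℤₚ.pos-* b (suc k)))
  (ℚᵘₚ.drop-*≤* (ℚᵘₚ.≤-respʳ-≃ (toℚᵘ-ratio l b) (ℚᵘₚ.≤-respˡ-≃ (toℚᵘ-ratio k a) (ℚₚ.toℚᵘ-mono-≤ h)))))

ratio-≤⁺ : ∀ k l a b → a * suc l ≤ b * suc k → ratio k a ℚ.≤ ratio l b
ratio-≤⁺ k l a b h = ℚₚ.toℚᵘ-cancel-≤ (ℚᵘₚ.≤-respʳ-≃ (ℚᵘₚ.≃-sym (toℚᵘ-ratio l b)) (ℚᵘₚ.≤-respˡ-≃ (ℚᵘₚ.≃-sym (toℚᵘ-ratio k a))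
  (ℚᵘ.*≤* (subst₂ _≤ᶻ_ (ℤₚ.pos-* a (suc l)) (ℤₚ.pos-* b (suc k)) (ℤ.+≤+ h)))))

ratio-+ : ∀ k a b → ratio k a ℚ.+ ratio k b ≡ ratio k (a + b)
ratio-+ k a b = ℚₚ.toℚᵘ-injective (ℚᵘₚ.≃-trans (ℚₚ.toℚᵘ-homo-+ (ratio k a) (ratio k b))
  (ℚᵘₚ.≃-trans (ℚᵘₚ.+-cong (toℚᵘ-ratio k a) (toℚᵘ-ratio k b)) (ℚᵘₚ.≃-trans
    (ℚᵘ.*≡* (trans (solveᶻ 3 (λ a b k → (a :*ᶻ k :+ᶻ b :*ᶻ k) :*ᶻ k :=ᶻ (a :+ᶻ b) :*ᶻ (k :*ᶻ k)) refl (⁺ a) (⁺ b) (⁺ suc k))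
      (cong₂ _*ᶻ_ (sym (ℤₚ.pos-+ a b)) (sym (ℤₚ.pos-* (suc k) (suc k))))))
    (ℚᵘₚ.≃-sym (toℚᵘ-ratio k (a + b))))))

ratio-0 : ∀ k → ratio k 0 ≡ 0ℚ
ratio-0 k = ratio-≡ k 0 0 0 refl

nonNegative-ratio : ∀ p → 0ℚ ℚ.≤ p → ∃[ k ] ∃[ Z ] p ≡ ratio k Z
nonNegative-ratio p@(ℚ.mkℚ (ℤ.+ Z) k _) _ = k , Z , sym (ℚₚ.fromℚᵘ-toℚᵘ p)
nonNegative-ratio (ℚ.mkℚ ℤ.-[1+ _ ] _ _) (ℚ.*≤* ())

common-multiple : ∀ {n} (d : Fin n → ℕ) → ∃[ k ] Σ[ c ∈ (Fin n → ℕ) ] (∀ i → suc k ≡ c i * suc (d i))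
common-multiple {zero} d = 0 , (λ ()) , λ ()
common-multiple {suc n} d =
  let k , c , h = common-multiple (d ∘ suc) in
  k + d zero * suc k , (λ { zero → suc k ; (suc i) → suc (d zero) * c i }) ,
  λ { zero → *-comm (suc (d zero)) (suc k)
    ; (suc i) → trans (cong (suc (d zero) *_) (h i)) (sym (*-assoc (suc (d zero)) (c i) _)) }

abstract
  common-denominator : ∀ {n T} (a : Fin n → Fin T → ℚ) → (∀ i t → 0ℚ ℚ.≤ a i t) →
    ∃[ k ] Σ[ z ∈ (Fin n → Fin T → ℕ) ] (∀ i t → a i t ≡ ratio k (z i t))
  common-denominator {n} {T} a a≥0 = k , (λ i t → num i t * (c i * c′ i t)) , equal
    where
    den num : Fin n → Fin T → ℕ
    den i t = proj₁ (nonNegative-ratio (a i t) (a≥0 i t))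
    num i t = proj₁ (proj₂ (nonNegative-ratio (a i t) (a≥0 i t)))
    k′ : Fin n → ℕ
    k′ i = proj₁ (common-multiple (den i))
    c′ : Fin n → Fin T → ℕ
    c′ i = proj₁ (proj₂ (common-multiple (den i)))
    k : ℕ
    k = proj₁ (common-multiple k′)
    c : Fin n → ℕ
    c = proj₁ (proj₂ (common-multiple k′))
    equal : ∀ i t → a i t ≡ ratio k (num i t * (c i * c′ i t))
    equal i t = trans (proj₂ (proj₂ (nonNegative-ratio (a i t) (a≥0 i t))))
      (ratio-≡ (den i t) k (num i t) (num i t * (c i * c′ i t)) (trans (cong (num i t *_) (trans (proj₂ (proj₂ (common-multiple k′)) i)
        (cong (c i *_) (proj₂ (proj₂ (common-multiple (den i))) t))))
        (solve 4 (λ n c d e → n :* (c :* (d :* e)) := n :* (c :* d) :* e) refl (num i t) (c i) (c′ i t) (suc (den i t)))))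

sumℚ : ∀ {n} → (Fin n → ℚ) → ℚ
sumℚ = Sum.sum ℚₚ.+-0-monoid

sumℚ-ratio : ∀ {n} k (a : Fin n → ℚ) z → (∀ i → a i ≡ ratio k (z i)) → sumℚ a ≡ ratio k (sumᶠ z)
sumℚ-ratio {zero}  k a z h = sym (ratio-0 k)
sumℚ-ratio {suc n} k a z h = trans (cong₂ ℚ._+_ (h zero) (sumℚ-ratio k (a ∘ suc) (z ∘ suc) (h ∘ suc))) (ratio-+ k (z zero) (sumᶠ (z ∘ suc)))

cumulative-ratio : ∀ {n} k (a : Fin n → ℚ) z → (∀ t → a t ≡ ratio k (z t)) → ∀ d →
                   cumulative a d ≡ ratio k (prefixSum z d)
cumulative-ratio k a z h d = trans
  (sumℚ-ratio k _ (λ t → if toℕ t ≤ᵇ toℕ d then z t else 0) cases)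
  (cong (ratio k) (prefixSum-sumᶠ z d))
  where
  cases : ∀ t → (if does (t Finₚ.≤? d) then a t else 0ℚ) ≡ ratio k (if toℕ t ≤ᵇ toℕ d then z t else 0)
  cases t with toℕ t ≤ᵇ toℕ d
  ... | true  = h t
  ... | false = sym (ratio-0 k)

cumulativeℕ-prefixSum : ∀ {n} (x : Vec ℕ n) d → cumulativeℕ x d ≡ prefixSum (lookup x) d
cumulativeℕ-prefixSum x d = prefixSum-sumᶠ (lookup x) d

prefixSum-cong : ∀ {n} {f g : Fin n → ℕ} → (∀ i → f i ≡ g i) → ∀ d → prefixSum f d ≡ prefixSum g d
prefixSum-cong h zero    = h zero
prefixSum-cong h (suc d) = cong₂ _+_ (h zero) (prefixSum-cong (h ∘ suc) d)

sumᶠ-mono : ∀ {n} {f g : Fin n → ℕ} → (∀ i → f i ≤ g i) → sumᶠ f ≤ sumᶠ g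
sumᶠ-mono {zero}  h = z≤n
sumᶠ-mono {suc n} h = +-mono-≤ (h zero) (sumᶠ-mono (h ∘ suc))

module _ {ν : Variant} {T : ℕ} where

  module _ {P : Triple T → Set} (P? : ∀ k → Dec (P k)) (b : Triple T → Bool) where

    filter-≤ : (∀ k → P k → b k ≡ true) → ∀ ks →
      ListAction.sum (List.map value (List.filter P? ks)) ≤ sumOver (λ k → if b k then value k else 0) ks
    filter-≤ h [] = z≤n
    filter-≤ h (k ∷ ks) with P? k
    ... | no _ = ≤-trans (filter-≤ h ks) (m≤n+m _ (if b k then value k else 0))
    ... | yes p rewrite h k p = +-monoʳ-≤ (value k) (filter-≤ h ks)

    filter-≥ : (∀ k → b k ≡ true → P k) → ∀ ks →
      sumOver (λ k → if b k then value k else 0) ks ≤ ListAction.sum (List.map value (List.filter P? ks))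
    filter-≥ h [] = z≤n
    filter-≥ h (k ∷ ks) with P? k | b k in eq
    ... | no _  | false = filter-≥ h ks
    ... | yes _ | false = ≤-trans (filter-≥ h ks) (m≤n+m _ (value k))
    ... | yes _ | true  = +-monoʳ-≤ (value k) (filter-≥ h ks)
    ... | no ¬p | true  = ⊥-elim (¬p (h k eq))

  agentValue-≤ : ∀ (i : Agent ν T) a x →
    (∀ k → fromℕ (demand k) ℚ.≤ cumulative a (deadline k) → demand k ≤ cumulativeℕ x (deadline k)) →
    agentValue i a ≤ agentValueℕ i x
  agentValue-≤ i a x h = filter-≤ (λ k → fromℕ (demand k) ℚₚ.≤? cumulative a (deadline k))
    (λ k → demand k ≤ᵇ cumulativeℕ x (deadline k)) (λ k p → T⇒≡true (≤⇒≤ᵇ (h k p))) (triples i)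

  agentValueℕ-≤ : ∀ (i : Agent ν T) a x →
    (∀ k → demand k ≤ cumulativeℕ x (deadline k) → fromℕ (demand k) ℚ.≤ cumulative a (deadline k)) →
    agentValueℕ i x ≤ agentValue i a
  agentValueℕ-≤ i a x h = filter-≥ (λ k → fromℕ (demand k) ℚₚ.≤? cumulative a (deadline k))
    (λ k → demand k ≤ᵇ cumulativeℕ x (deadline k))
    (λ k eq → h k (≤ᵇ⇒≤ _ _ (subst Bool.T (sym eq) _))) (triples i)

  achieves-sum : ∀ {n} (as : Vec (Agent ν T) n) (x : Fin n → Vec ℕ T) →
    (∀ i → Bool.T (respects ν (speed (lookup as i)) (x i))) →
    Achieves (Vec.toList as) (Vec.tabulate (λ t → sumᶠ (λ i → lookup (x i) t))) (sumᶠ (λ i → agentValueℕ (lookup as i) (x i)))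
  achieves-sum [] x h = []
  achieves-sum (a ∷ as) x h = add (x zero) (h zero)
    (λ t → ≤-reflexive (trans (lookup-+ᵛ (x zero) (Vec.tabulate (λ t → sumᶠ (λ i → lookup (x (suc i)) t))) t)
      (trans (cong (lookup (x zero) t +_) (Vecₚ.lookup∘tabulate _ t)) (sym (Vecₚ.lookup∘tabulate _ t)))))
    (achieves-sum as (x ∘ suc) (h ∘ suc))

  achieves-schedule : ∀ {n} (as : Vec (Agent ν T) n) {r w} → Achieves (Vec.toList as) r w →
    Σ[ x ∈ (Fin n → Vec ℕ T) ] ((∀ i → Bool.T (respects ν (speed (lookup as i)) (x i))) ×
      (∀ t → sumᶠ (λ i → lookup (x i) t) ≤ lookup r t) × w ≡ sumᶠ (λ i → agentValueℕ (lookup as i) (x i)))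
  achieves-schedule [] [] = (λ ()) , (λ ()) , (λ t → z≤n) , refl
  achieves-schedule (a ∷ as) (add {r′ = r′} x₀ s h p) =
    let x , s′ , h′ , e = achieves-schedule as p in
    (λ { zero → x₀ ; (suc i) → x i }) , (λ { zero → s ; (suc i) → s′ i }) ,
    (λ t → ≤-trans (+-monoʳ-≤ (lookup x₀ t) (h′ t)) (≤-trans (≤-reflexive (sym (lookup-+ᵛ x₀ r′ t))) (h t))) ,
    cong (agentValueℕ a x₀ +_) e

  respects⁺ : ∀ ν (s : SpeedLimit ν T) k (a : Allocation T) (z y : Fin T → ℕ) → (∀ t → a t ≡ ratio k (z t)) →
    (∀ t s → z t ≤ s * suc k → y t ≤ s) → (∀ t → MaybeAll.All (λ s → a t ℚ.≤ fromℕ s) (maxSpeed ν s t)) →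
    Bool.T (respects ν s (Vec.tabulate y))
  respects⁺ fixed s k a z y az rounds h = T-allᶠ⁺ λ t → ≤⇒≤ᵇ (subst (_≤ s) (sym (Vecₚ.lookup∘tabulate y t))
    (within t (h t)))
    where
    within : ∀ t → MaybeAll.All (λ s → a t ℚ.≤ fromℕ s) (just s) → y t ≤ s
    within t (MaybeAll.just l) = rounds t s (≤-trans (≤-reflexive (sym (*-identityʳ (z t))))
      (ratio-≤⁻ k 0 (z t) s (subst (ℚ._≤ fromℕ s) (az t) l)))
  respects⁺ unbounded s k a z y az rounds h = _
  respects⁺ gaps s k a z y az rounds h = T-allᶠ⁺ λ t → open-or-zero t (h t)
    where
    open-or-zero : ∀ t → MaybeAll.All (λ s → a t ℚ.≤ fromℕ s) (if lookup s t then nothing else just 0) →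
                   Bool.T (lookup s t ∨ (lookup (Vec.tabulate y) t ≤ᵇ 0))
    open-or-zero t m with lookup s t
    ... | true = _
    open-or-zero t (MaybeAll.just l) | false = ≤⇒≤ᵇ (subst (_≤ 0) (sym (Vecₚ.lookup∘tabulate y t))
      (rounds t 0 (≤-trans (≤-reflexive (sym (*-identityʳ (z t)))) (ratio-≤⁻ k 0 (z t) 0 (subst (ℚ._≤ fromℕ 0) (az t) l)))))

  respects⁻ : ∀ ν (s : SpeedLimit ν T) x → Bool.T (respects ν s x) → ∀ t →
              MaybeAll.All (λ s → fromℕ (lookup x t) ℚ.≤ fromℕ s) (maxSpeed ν s t)
  respects⁻ fixed s x h t = MaybeAll.just (ratio-≤⁺ 0 0 (lookup x t) s (*-monoˡ-≤ 1 (≤ᵇ⇒≤ (lookup x t) s (T-allᶠ⁻ h t))))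
  respects⁻ unbounded s x h t = MaybeAll.nothing
  respects⁻ gaps s x h t = closed (T-allᶠ⁻ h t)
    where
    closed : Bool.T (lookup s t ∨ (lookup x t ≤ᵇ 0)) →
             MaybeAll.All (λ s → fromℕ (lookup x t) ℚ.≤ fromℕ s) (if lookup s t then nothing else just 0)
    closed h with lookup s t
    ... | true  = MaybeAll.nothing
    ... | false = MaybeAll.just (ratio-≤⁺ 0 0 (lookup x t) 0 (*-monoˡ-≤ 1 (≤ᵇ⇒≤ (lookup x t) 0 h)))

  -- Over a common denominator the schedule consists of naturals `z`, and all constraints, like all
  -- satisfied demands, compare sums of them with multiples of the denominator. Rounding preserves
  -- such comparisons, so no satisfied triple is lost.
  schedulable⇒solvable : ∀ (I : ChargeInstance ν T) → Schedulable I → Solvable I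
  schedulable⇒solvable I (a , feasible , target≤) =
    let k , z , az = common-denominator a nonNegative
        y , speeds , supplies , demands = Network.round-schedule (n I) T (suc k) z
    in schedule k z az y speeds supplies demands
    where
    open Feasible feasible
    schedule : ∀ k z → (∀ i t → a i t ≡ ratio k (z i t)) → ∀ y →
      (∀ i t s → z i t ≤ s * suc k → y i t ≤ s) →
      (∀ t m → sumᶠ (λ i → z i t) ≤ m * suc k → sumᶠ (λ i → y i t) ≤ m) →
      (∀ i d w → w * suc k ≤ prefixSum (z i) d → w ≤ prefixSum (y i) d) → Solvable I
    schedule k z az y speeds supplies demands =
      sumᶠ (λ i → agentValueℕ (lookup (agents I) i) (Vec.tabulate (y i))) , ≤-trans target≤ (sumᶠ-mono values) ,
      achieves-mono supplied (achieves-sum (agents I) (λ i → Vec.tabulate (y i))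
        (λ i → respects⁺ ν (speed (lookup (agents I) i)) k (a i) (z i) (y i) (az i) (speeds i) (withinSpeed i)))
      where
      values : ∀ i → agentValue (lookup (agents I) i) (a i) ≤ agentValueℕ (lookup (agents I) i) (Vec.tabulate (y i))
      values i = agentValue-≤ (lookup (agents I) i) (a i) (Vec.tabulate (y i)) λ κ h →
        ≤-trans (demands i (deadline κ) (demand κ) (≤-trans
            (ratio-≤⁻ 0 k (demand κ) (prefixSum (z i) (deadline κ)) (subst (fromℕ (demand κ) ℚ.≤_) (cumulative-ratio k (a i) (z i) (az i) (deadline κ)) h))
            (≤-reflexive (*-identityʳ _))))
          (≤-reflexive (sym (trans (cumulativeℕ-prefixSum (Vec.tabulate (y i)) (deadline κ))
            (prefixSum-cong (Vecₚ.lookup∘tabulate (y i)) (deadline κ)))))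
      supplied : Vec.tabulate (λ t → sumᶠ (λ i → lookup (Vec.tabulate (y i)) t)) ≤ᵛ supply I
      supplied t = ≤-trans (≤-reflexive (trans (Vecₚ.lookup∘tabulate _ t) (sumᶠ-cong (λ i → Vecₚ.lookup∘tabulate (y i) t))))
        (supplies t (lookup (supply I) t) (≤-trans (≤-reflexive (sym (*-identityʳ _)))
          (ratio-≤⁻ k 0 (sumᶠ (λ i → z i t)) (lookup (supply I) t) (subst (ℚ._≤ fromℕ (lookup (supply I) t)) (sumℚ-ratio k (λ i → a i t) (λ i → z i t) (λ i → az i t))
            (withinSupply t)))))

  solvable⇒schedulable : ∀ (I : ChargeInstance ν T) → Solvable I → Schedulable I
  solvable⇒schedulable I (w , target≤w , p) =
    let x , s , h , e = achieves-schedule (agents I) p in schedule x s h (≤-trans target≤w (≤-reflexive e))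
    where
    schedule : ∀ x → (∀ i → Bool.T (respects ν (speed (lookup (agents I) i)) (x i))) →
      (∀ t → sumᶠ (λ i → lookup (x i) t) ≤ lookup (supply I) t) →
      target I ≤ sumᶠ (λ i → agentValueℕ (lookup (agents I) i) (x i)) → Schedulable I
    schedule x s h target≤ = a , record
      { nonNegative  = λ i t → subst (ℚ._≤ a i t) (ratio-0 0) (ratio-≤⁺ 0 0 0 (lookup (x i) t) z≤n)
      ; withinSpeed  = λ i t → respects⁻ ν (speed (lookup (agents I) i)) (x i) (s i) t
      ; withinSupply = λ t → subst (ℚ._≤ fromℕ (lookup (supply I) t))
          (sym (sumℚ-ratio 0 (λ i → a i t) (λ i → lookup (x i) t) (λ i → refl)))
          (ratio-≤⁺ 0 0 (sumᶠ (λ i → lookup (x i) t)) (lookup (supply I) t) (*-monoˡ-≤ 1 (h t)))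
      } , ≤-trans target≤ (sumᶠ-mono values)
      where
      a : Fin (n I) → Allocation T
      a i t = fromℕ (lookup (x i) t)
      values : ∀ i → agentValueℕ (lookup (agents I) i) (x i) ≤ agentValue (lookup (agents I) i) (a i)
      values i = agentValueℕ-≤ (lookup (agents I) i) (a i) (x i) λ κ l →
        subst (fromℕ (demand κ) ℚ.≤_) (sym (cumulative-ratio 0 (a i) (lookup (x i)) (λ _ → refl) (deadline κ)))
          (ratio-≤⁺ 0 0 (demand κ) (prefixSum (lookup (x i)) (deadline κ))
            (*-monoˡ-≤ 1 (≤-trans l (≤-reflexive (cumulativeℕ-prefixSum (x i) (deadline κ))))))


-- Membership in NP and in P

Schedulable-language : ∀ ν T → Language
Schedulable-language ν T = language (chargeScheduling ν T)

inNP : ∀ ν T → InNP (Schedulable-language ν T)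
inNP ν T = (λ x → check {ν} {T} x ≡ true) ,
  (check {ν} {T} , polyTime (consᶜ (checkᶜ {ν} {T}) (constᶜ [])) , (λ x → mk⇔ id id)) ,
  certificate-bound {ν} {T} , λ w → mk⇔
    (λ { (I , refl , s) → check-complete I (schedulable⇒solvable I s) })
    (λ (u , _ , h) → let I , e , s = check-sound {ν} {T} w u h in I , e , solvable⇒schedulable I s)

module _ {ν : Variant} {T : ℕ} where

  respects-anti : ∀ ν (s : SpeedLimit ν T) {x y} → x ≤ᵛ y → Bool.T (respects ν s y) → Bool.T (respects ν s x)
  respects-anti fixed s {x} {y} x≤y h = T-allᶠ⁺ λ t → ≤⇒≤ᵇ (≤-trans (x≤y t) (≤ᵇ⇒≤ (lookup y t) s (T-allᶠ⁻ h t)))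
  respects-anti unbounded s x≤y h = _
  respects-anti gaps s {x} {y} x≤y h = T-allᶠ⁺ λ t → anti (lookup s t) (x≤y t) (T-allᶠ⁻ h t)
    where
    anti : ∀ b {m n} → m ≤ n → Bool.T (b ∨ (n ≤ᵇ 0)) → Bool.T (b ∨ (m ≤ᵇ 0))
    anti true  m≤n h = _
    anti false {m} {n} m≤n h = ≤⇒≤ᵇ (≤-trans m≤n (≤ᵇ⇒≤ n 0 h))

  -- If every agent gets by with at most b per period, then so do all of them with n b.
  achieves-bounded : ∀ b (as : List (Agent ν T)) {m r w} → r ≤ᵛ m →
    (∀ {a} → a ∈ as → ∀ x → x ≤ᵛ m → Bool.T (respects ν (speed a) x) →
      ∃[ y ] (y ≤ᵛ x × (∀ t → lookup y t ≤ b) × agentValueℕ a x ≤ agentValueℕ a y)) →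
    Achieves as r w → ∃[ r′ ] ∃[ w′ ] (r′ ≤ᵛ r × (∀ t → lookup r′ t ≤ length as * b) × w ≤ w′ × Achieves as r′ w′)
  achieves-bounded b [] r≤m h [] =
    Vec.replicate T 0 , 0 , (λ t → ≤-trans (zero≤ t) z≤n) , zero≤ , z≤n , []
    where
    zero≤ : ∀ t → lookup (Vec.replicate T 0) t ≤ 0
    zero≤ t = ≤-reflexive (Vecₚ.lookup-replicate t 0)
  achieves-bounded b (a ∷ as) {m} {r} r≤m h (add {r′ = r′} x s x+r′≤r p) =
    let r″ , w″ , r″≤ , r″-small , w≤ , p″ = achieves-bounded b as {m} (λ t → ≤-trans (r′≤ t) (r≤m t)) (h ∘ there) p
        y , y≤x , y-small , v≤ = h (here refl) x (λ t → ≤-trans (x≤ t) (r≤m t)) s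
    in y +ᵛ r″ , agentValueℕ a y + w″ ,
       (λ t → ≤-trans (≤-reflexive (lookup-+ᵛ y r″ t)) (≤-trans (+-mono-≤ (y≤x t) (r″≤ t))
         (≤-trans (≤-reflexive (sym (lookup-+ᵛ x r′ t))) (x+r′≤r t)))) ,
       (λ t → ≤-trans (≤-reflexive (lookup-+ᵛ y r″ t)) (+-mono-≤ (y-small t) (r″-small t))) ,
       +-mono-≤ v≤ w≤ ,
       add y (respects-anti ν (speed a) y≤x s) (λ t → ≤-refl) p″
    where
    x≤ : x ≤ᵛ r
    x≤ t = ≤-trans (≤-trans (m≤m+n _ (lookup r′ t)) (≤-reflexive (sym (lookup-+ᵛ x r′ t)))) (x+r′≤r t)
    r′≤ : r′ ≤ᵛ r
    r′≤ t = ≤-trans (≤-trans (m≤n+m _ (lookup x t)) (≤-reflexive (sym (lookup-+ᵛ x r′ t)))) (x+r′≤r t)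

-- Keeps the earliest units until `b` of them have been received. Every cumulative total below `b`
-- is unchanged and the others are cut to `b`, so demands of at most `b` stay satisfied.
truncate : ∀ {n} → ℕ → Vec ℕ n → Vec ℕ n
truncate b []       = []
truncate b (x ∷ xs) = (x ℕ.⊓ b) ∷ truncate (b ∸ x) xs

truncate-≤ : ∀ {n} b (xs : Vec ℕ n) → truncate b xs ≤ᵛ xs
truncate-≤ b (x ∷ xs) zero    = m⊓n≤m x b
truncate-≤ b (x ∷ xs) (suc t) = truncate-≤ (b ∸ x) xs t

truncate-small : ∀ {n} b (xs : Vec ℕ n) t → lookup (truncate b xs) t ≤ b
truncate-small b (x ∷ xs) zero    = m⊓n≤n x b
truncate-small b (x ∷ xs) (suc t) = ≤-trans (truncate-small (b ∸ x) xs t) (m∸n≤m b x)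

truncate-prefixSum : ∀ {n} b (xs : Vec ℕ n) d {w} → w ≤ b → w ≤ prefixSum (lookup xs) d →
                     w ≤ prefixSum (lookup (truncate b xs)) d
truncate-prefixSum b (x ∷ xs) zero w≤b h = ⊓-glb h w≤b
truncate-prefixSum b (x ∷ xs) (suc d) {w} w≤b h with ≤-total x b
... | inj₁ x≤b rewrite m≤n⇒m⊓n≡m x≤b = ≤-trans (m≤n+m∸n w x)
  (+-monoʳ-≤ x (truncate-prefixSum (b ∸ x) xs d (∸-monoˡ-≤ x w≤b) (m≤n+o⇒m∸n≤o w x h)))
... | inj₂ b≤x rewrite m≥n⇒m⊓n≡n b≤x = ≤-trans w≤b (m≤m+n b _)

agentValue-truncate : ∀ {ν T} (a : Agent ν T) b x → All (λ k → demand k ≤ b) (triples a) →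
                      agentValueℕ a x ≤ agentValueℕ a (truncate b x)
agentValue-truncate a b x h = go h
  where
  go : ∀ {ks} → All (λ k → demand k ≤ b) ks → sumOver (tripleValue x) ks ≤ sumOver (tripleValue (truncate b x)) ks
  go [] = z≤n
  go {k ∷ ks} (d≤b ∷ h) = +-mono-≤ first (go h)
    where
    first : tripleValue x k ≤ tripleValue (truncate b x) k
    first with demand k ≤ᵇ cumulativeℕ x (deadline k) in eq
    ... | false = z≤n
    ... | true rewrite T⇒≡true (≤⇒≤ᵇ {demand k} (≤-trans
          (truncate-prefixSum b x (deadline k) d≤b (≤-trans (≤ᵇ⇒≤ (demand k) _ (subst Bool.T (sym eq) _))
            (≤-reflexive (cumulativeℕ-prefixSum x (deadline k)))))
          (≤-reflexive (sym (cumulativeℕ-prefixSum (truncate b x) (deadline k)))))) = ≤-refl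

module _ {ν : Variant} {T : ℕ} where

  agent-count : ChargeInstance ν T → Vec Unary 2
  agent-count I = List.map (λ _ → tt) (Vec.toList (agents I)) ∷ List.replicate T tt ∷ []

  length-toList : ∀ {A : Set} {k} (v : Vec A k) → length (Vec.toList v) ≡ k
  length-toList []      = refl
  length-toList (x ∷ v) = cong suc (length-toList v)

  length-bound : ∀ p I → length (⟦ p ⟧ᵘ (agent-count I)) ≡ bound I p
  length-bound p I = trans (length-⟦⟧ᵘ p (agent-count I)) (cong₂ (λ n t → ⟦ p ⟧ (n ∷ t ∷ []))
    (trans (Listₚ.length-map _ (Vec.toList (agents I))) (length-toList (agents I))) (Listₚ.length-replicate T))

  -- The bound per agent times the number of agents, as a unary size for the grid.
  resources : Poly 2 → ChargeInstance ν T → Unary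
  resources p I = ⟦ var zero ⊗ p ⟧ᵘ (agent-count I)

  agent-countᶜ : Poly-time agent-count
  agent-countᶜ = vconsᶜ (unaryᶜ (agentsᶜ idᶜ)) (constᶜ _)

  boundᶜ : ∀ p → Poly-time (λ I → length (⟦ p ⟧ᵘ (agent-count I)))
  boundᶜ p = lengthᶜ (polyᶜ p agent-countᶜ)

  decideᴾ : Poly 2 → (ChargeInstance ν T → Bool) → List Bool → Bool
  decideᴾ p test w = maybe-case (decode (parseInstance {ν} {T}) w) false λ I → test I ∧ decide (resources p I) I

  -- The last hypothesis is all that the three kinds of bounds have to supply: an agent can get by
  -- with at most `bound I p` per period without losing value. The grid then needs only `n` times
  -- that bound, whatever the supply is. The test rejects encodings of instances outside `P`.
  inP : ∀ p {P : ChargeInstance ν T → Set} (test : ChargeInstance ν T → Bool) → Poly-time test →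
        (∀ I → Bool.T (test I) → P I) → (∀ I → P I → Bool.T (test I)) →
        (∀ I → P I → ∀ {a} → a ∈ Vec.toList (agents I) → ∀ x → x ≤ᵛ supply I → Bool.T (respects ν (speed a) x) →
          ∃[ y ] (y ≤ᵛ x × (∀ t → lookup y t ≤ bound I p) × agentValueℕ a x ≤ agentValueℕ a y)) →
        InP (language (restrict (chargeScheduling ν T) P))
  inP p {P} test testᶜ test⁻ test⁺ small = decideᴾ p test ,
    polyTime (consᶜ (maybe-caseᶜ {h = λ (I , _) → test I ∧ decide (resources p I) I}
        (decodeᶜ parseInstanceᶜ) (constᶜ false)
        (∧ᶜ (testᶜ ⊙ fstᶜ) (decideᶜ (polyᶜ (var zero ⊗ p) agent-countᶜ ⊙ fstᶜ) fstᶜ))) (constᶜ [])) ,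
    λ w → mk⇔ (sound′ w) λ { ((I , h) , refl , s) → complete′ I h (schedulable⇒solvable I s) }
    where
    sound′ : ∀ w → decideᴾ p test w ≡ true → language (restrict (chargeScheduling ν T) P) w
    sound′ w = decoded (decode parseInstance w) refl
      where
      decoded : ∀ m → decode parseInstance w ≡ m → maybe-case m false (λ I → test I ∧ decide (resources p I) I) ≡ true →
                language (restrict (chargeScheduling ν T) P) w
      decoded (just I) eq₁ eq =
        let h , h′ = T-∧⁻ {test I} (subst Bool.T (sym eq) _) in
        (I , test⁻ I h) , encode-decode isParser-Instance w eq₁ ,
        solvable⇒schedulable I (decide-sound (resources p I) I (T⇒≡true h′))
    complete′ : ∀ I → P I → Solvable I → decideᴾ p test (encodeInstance I) ≡ true
    complete′ I h (w , t≤w , a) rewrite decode-encode isParser-Instance I =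
      let r , v , r≤m , r-small , w≤v , a′ = achieves-bounded (bound I p) (Vec.toList (agents I)) {supply I} (λ t → ≤-refl) (small I h) a in
      T⇒≡true (T-∧⁺ (test⁺ I h) (subst Bool.T (sym (decide-complete (resources p I) I r≤m
        (λ t → ≤-trans (r-small t) (≤-reflexive (trans (cong (_* bound I p) (length-toList (agents I)))
          (sym (length-bound (var zero ⊗ p) I))))) (≤-trans t≤w w≤v) a′)) _))

  T-all⁻ : ∀ {A : Set} {k} (f : A → Bool) (v : Vec A k) → Bool.T (BoolAction.all f (Vec.toList v)) → ∀ i → Bool.T (f (lookup v i))
  T-all⁻ f (x ∷ v) h zero    = proj₁ (T-∧⁻ {f x} h)
  T-all⁻ f (x ∷ v) h (suc i) = T-all⁻ f v (proj₂ (T-∧⁻ {f x} h)) i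

  T-all⁺ : ∀ {A : Set} {k} (f : A → Bool) (v : Vec A k) → (∀ i → Bool.T (f (lookup v i))) → Bool.T (BoolAction.all f (Vec.toList v))
  T-all⁺ f []      h = _
  T-all⁺ f (x ∷ v) h = T-∧⁺ (h zero) (T-all⁺ f v (h ∘ suc))

  ∈-lookup : ∀ {A : Set} {k} (v : Vec A k) {a} → a ∈ Vec.toList v → ∃[ i ] lookup v i ≡ a
  ∈-lookup (x ∷ v) (here refl) = zero , refl
  ∈-lookup (x ∷ v) (there p) = let i , e = ∈-lookup v p in suc i , e

  demandTest : ℕ → Agent ν T → Bool
  demandTest b a = BoolAction.all (λ k → demand k ≤ᵇ b) (triples a)

  demandTest⁻ : ∀ b ks → Bool.T (BoolAction.all (λ (k : Triple T) → demand k ≤ᵇ b) ks) → All (λ k → demand k ≤ b) ks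
  demandTest⁻ b [] h = []
  demandTest⁻ b (k ∷ ks) h = let h₁ , h₂ = T-∧⁻ {demand k ≤ᵇ b} h in ≤ᵇ⇒≤ _ _ h₁ ∷ demandTest⁻ b ks h₂

  demandTest⁺ : ∀ b ks → All (λ (k : Triple T) → demand k ≤ b) ks → Bool.T (BoolAction.all (λ k → demand k ≤ᵇ b) ks)
  demandTest⁺ b [] [] = _
  demandTest⁺ b (k ∷ ks) (h ∷ hs) = T-∧⁺ (≤⇒≤ᵇ h) (demandTest⁺ b ks hs)

  inP-demand : ∀ p → InP (language (restrict (chargeScheduling ν T) (λ I → DemandBounded I p)))
  inP-demand p = inP p (λ I → BoolAction.all (demandTest (length (⟦ p ⟧ᵘ (agent-count I)))) (Vec.toList (agents I)))
    (allᶜ {p = λ (a , I) → demandTest (length (⟦ p ⟧ᵘ (agent-count I))) a} (agentsᶜ idᶜ)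
      (allᶜ {p = λ (k , (a , I)) → demand k ≤ᵇ length (⟦ p ⟧ᵘ (agent-count I))} (triplesᶜ fstᶜ)
        (≤ᵇᶜ (demandᶜ fstᶜ) (boundᶜ p ⊙ sndᶜ ⊙ sndᶜ))))
    (λ I h i → subst (λ b → All (λ k → demand k ≤ b) (triples (lookup (agents I) i))) (length-bound p I)
      (demandTest⁻ _ _ (T-all⁻ (demandTest (length (⟦ p ⟧ᵘ (agent-count I)))) (agents I) h i)))
    (λ I h → T-all⁺ (demandTest (length (⟦ p ⟧ᵘ (agent-count I)))) (agents I) λ i → demandTest⁺ _ _
      (subst (λ b → All (λ k → demand k ≤ b) (triples (lookup (agents I) i))) (sym (length-bound p I)) (h i)))
    λ I h {a} a∈ x _ _ → let i , e = ∈-lookup (agents I) a∈ in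
      truncate (bound I p) x , truncate-≤ (bound I p) x , truncate-small (bound I p) x ,
      agentValue-truncate a (bound I p) x (subst (λ a → All (λ k → demand k ≤ bound I p) (triples a)) e (h i))

  inP-supply : ∀ p → InP (language (restrict (chargeScheduling ν T) (λ I → SupplyBounded I p)))
  inP-supply p = inP p (λ I → allᶠ (λ t → lookup (supply I) t ≤ᵇ length (⟦ p ⟧ᵘ (agent-count I))))
    (allᶠᶜ (λ t → ≤ᵇᶜ (lookupᶜ (supplyᶜ idᶜ) t) (boundᶜ p)))
    (λ I h t → ≤-trans (≤ᵇ⇒≤ (lookup (supply I) t) _ (T-allᶠ⁻ h t)) (≤-reflexive (length-bound p I)))
    (λ I h → T-allᶠ⁺ λ t → ≤⇒≤ᵇ (≤-trans (h t) (≤-reflexive (sym (length-bound p I)))))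
    λ I h a∈ x x≤m _ → x , (λ t → ≤-refl) , (λ t → ≤-trans (x≤m t) (h t)) , ≤-refl

  -- Tested for each period, as in `SpeedBounded`; for unbounded speed the test succeeds only if
  -- there are no periods.
  speedTest : ∀ ν → ℕ → SpeedLimit ν T → Bool
  speedTest fixed     b s = allᶠ {T} (λ t → s ≤ᵇ b)
  speedTest unbounded b s = allᶠ {T} (λ t → false)
  speedTest gaps      b s = allᶠ {T} (λ t → if lookup s t then false else true)

  speedTest⁻ : ∀ ν b s → Bool.T (speedTest ν b s) → ∀ t → MaybeAny.Any (ℕ._≤ b) (maxSpeed ν s t)
  speedTest⁻ fixed     b s h t = MaybeAny.just (≤ᵇ⇒≤ s b (T-allᶠ⁻ {T} h t))
  speedTest⁻ unbounded b s h t = ⊥-elim (T-allᶠ⁻ {T} {λ _ → false} h t)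
  speedTest⁻ gaps      b s h t = closed (T-allᶠ⁻ h t)
    where
    closed : Bool.T (if lookup s t then false else true) → MaybeAny.Any (ℕ._≤ b) (if lookup s t then nothing else just 0)
    closed h with lookup s t
    ... | false = MaybeAny.just z≤n

  speedTest⁺ : ∀ ν b s → (∀ t → MaybeAny.Any (ℕ._≤ b) (maxSpeed ν s t)) → Bool.T (speedTest ν b s)
  speedTest⁺ fixed     b s h = T-allᶠ⁺ λ t → within (h t)
    where
    within : MaybeAny.Any (ℕ._≤ b) (just s) → Bool.T (s ≤ᵇ b)
    within (MaybeAny.just l) = ≤⇒≤ᵇ l
  speedTest⁺ unbounded b s h = T-allᶠ⁺ {p = λ t → false} λ t → impossible (h t)
    where
    impossible : MaybeAny.Any (ℕ._≤ b) nothing → ⊥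
    impossible ()
  speedTest⁺ gaps      b s h = T-allᶠ⁺ λ t → closed t (h t)
    where
    closed : ∀ t → MaybeAny.Any (ℕ._≤ b) (if lookup s t then nothing else just 0) → Bool.T (if lookup s t then false else true)
    closed t m with lookup s t
    closed t () | true
    ... | false = _

  speedTestᶜ : ∀ ν {X : Set} ⦃ _ : Code X ⦄ {b : X → ℕ} {s : X → SpeedLimit ν T} → let instance _ = code-Speed ν in
               Poly-time b → Poly-time s → Poly-time (λ x → speedTest ν (b x) (s x))
  speedTestᶜ fixed     B S = allᶠᶜ {n = T} (λ t → ≤ᵇᶜ S B)
  speedTestᶜ unbounded B S = allᶠᶜ {n = T} (λ t → constᶜ false)
  speedTestᶜ gaps      B S = allᶠᶜ (λ t → ifᶜ (lookupᶜ S t) (constᶜ false) (constᶜ true))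

  respects-bounded : ∀ ν (s : SpeedLimit ν T) {b} x → (∀ t → MaybeAny.Any (ℕ._≤ b) (maxSpeed ν s t)) →
                     Bool.T (respects ν s x) → ∀ t → lookup x t ≤ b
  respects-bounded ν s {b} x h r t = both (h t) (respects⁻ {ν} ν s x r t)
    where
    both : ∀ {m : Maybe ℕ} → MaybeAny.Any (ℕ._≤ b) m → MaybeAll.All (λ s → fromℕ (lookup x t) ℚ.≤ fromℕ s) m → lookup x t ≤ b
    both (MaybeAny.just {s} s≤b) (MaybeAll.just l) =
      ≤-trans (subst₂ _≤_ (*-identityʳ (lookup x t)) (*-identityʳ s) (ratio-≤⁻ 0 0 (lookup x t) s l)) s≤b

  inP-speed : ∀ p → InP (language (restrict (chargeScheduling ν T) (λ I → SpeedBounded I p)))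
  inP-speed p = inP p (λ I → BoolAction.all (λ a → speedTest ν (length (⟦ p ⟧ᵘ (agent-count I))) (speed a)) (Vec.toList (agents I)))
    (allᶜ {p = λ (a , I) → speedTest ν (length (⟦ p ⟧ᵘ (agent-count I))) (speed a)} (agentsᶜ idᶜ)
      (speedTestᶜ ν (boundᶜ p ⊙ sndᶜ) (speedᶜ fstᶜ)))
    (λ I h i t → subst (λ b → MaybeAny.Any (ℕ._≤ b) (speedAt I i t)) (length-bound p I)
      (speedTest⁻ ν _ (speed (lookup (agents I) i)) (T-all⁻ (λ a → speedTest ν _ (speed a)) (agents I) h i) t))
    (λ I h → T-all⁺ (λ a → speedTest ν _ (speed a)) (agents I) λ i → speedTest⁺ ν _ (speed (lookup (agents I) i))
      (λ t → subst (λ b → MaybeAny.Any (ℕ._≤ b) (speedAt I i t)) (sym (length-bound p I)) (h i t)))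
    λ I h {a} a∈ x _ r → let i , e = ∈-lookup (agents I) a∈ in
      x , (λ t → ≤-refl) ,
      respects-bounded ν (speed a) x (subst (λ a → ∀ t → MaybeAny.Any (ℕ._≤ bound I p) (maxSpeed ν (speed a) t)) e (h i)) r ,
      ≤-refl

-- Pseudo-polynomial time

double : Digit → Unary → Unary
double d u = List.replicate (digit d) tt ++ (u ++ u)

unaryOf : ℕ → Unary
unaryOf m = foldl (λ u d → double d u) [] (List.reverse (digits m))

replicate-+ : ∀ m n → List.replicate (m + n) tt ≡ List.replicate m tt ++ List.replicate n tt
replicate-+ zero    n = refl
replicate-+ (suc m) n = cong (tt ∷_) (replicate-+ m n)

double-value : ∀ d ds → double d (List.replicate (valueᵈ ds) tt) ≡ List.replicate (valueᵈ (d ∷ ds)) tt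
double-value d ds = trans (cong (List.replicate (digit d) tt ++_) (trans (sym (replicate-+ (valueᵈ ds) (valueᵈ ds)))
    (cong (λ k → List.replicate (valueᵈ ds + k) tt) (sym (+-identityʳ (valueᵈ ds))))))
  (sym (replicate-+ (digit d) (2 * valueᵈ ds)))

foldl-double : ∀ ds → foldl (λ u d → double d u) [] (List.reverse ds) ≡ List.replicate (valueᵈ ds) tt
foldl-double ds = trans (Listₚ.reverse-foldl (λ u d → double d u) [] ds) (go ds)
  where
  go : ∀ ds → foldr double [] ds ≡ List.replicate (valueᵈ ds) tt
  go [] = refl
  go (d ∷ ds) = trans (cong (double d) (go ds)) (double-value d ds)

unaryOf-replicate : ∀ m → unaryOf m ≡ List.replicate m tt
unaryOf-replicate m = trans (foldl-double (digits m)) (cong (λ k → List.replicate k tt) (value-digits m))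

value-suffix : ∀ ys zs → valueᵈ zs ≤ valueᵈ (ys ++ zs)
value-suffix [] zs = ≤-refl
value-suffix (y ∷ ys) zs = ≤-trans (value-suffix ys zs) (≤-trans (m≤m+n _ _) (m≤n+m _ (digit y)))

size-replicate : ∀ n → ∣ List.replicate n tt ∣ ≡ 2 * n + 1
size-replicate zero = refl
size-replicate (suc n) = trans (cong (2 +_) (size-replicate n)) (solve 1 (λ n → κ 2 :+ (κ 2 :* n :+ κ 1) := κ 2 :* (κ 1 :+ n) :+ κ 1) refl n)

-- A unary numeral can be exponentially longer than the binary one, so the number itself, and not
-- merely its size, has to be bounded by the measure. This is where the magnitude of an instance
-- enters the running time.
unaryOfᶜ : ∀ {X : Set} ⦃ _ : Code X ⦄ {μ m : X → ℕ} → Computable μ m → m ≲ μ → Computable μ (λ x → unaryOf (m x))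
unaryOfᶜ {μ = μ} {m} F m≲ = foldlᶜ {s = λ (d , (u , _)) → double d u} (constᶜ [] ⊙ F) (reverseᶜ (digitsᶜ idᶜ) ⊙ F)
  (++ᶜ (split-Digitᶜ {f = λ d _ → List.replicate (digit d) tt} fstᶜ (λ d → constᶜ (List.replicate (digit d) tt)))
       (++ᶜ (fstᶜ ⊙ sndᶜ) (fstᶜ ⊙ sndᶜ)))
  (λ x → 2 * m x + 1) (≲-con 2 ≲* m≲ ≲+ ≲-con 1)
  λ x ys zs eq → subst (_≤ 2 * m x + 1)
    (sym (trans (cong (λ l → ∣ foldl (λ u d → double d u) [] l ∣) (sym (Listₚ.reverse-involutive ys)))
      (trans (cong ∣_∣ (foldl-double (List.reverse ys))) (size-replicate (valueᵈ (List.reverse ys))))))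
    (+-monoˡ-≤ 1 (*-monoʳ-≤ 2 (≤-trans (value-suffix (List.reverse zs) (List.reverse ys))
      (≤-reflexive (trans (cong valueᵈ (trans (sym (Listₚ.reverse-++ ys zs))
        (trans (cong List.reverse eq) (Listₚ.reverse-involutive (digits (m x)))))) (value-digits (m x)))))))

module _ {ν : Variant} {T : ℕ} where

  maxSupply : ChargeInstance ν T → ℕ
  maxSupply I = maximum (Vec.toList (supply I))

  pseudoDecide : ChargeInstance ν T → Bool
  pseudoDecide I = decide (unaryOf (maxSupply I)) I

  pseudoDecide-correct : ∀ I → pseudoDecide I ≡ true ⇔ Schedulable I
  pseudoDecide-correct I = mk⇔
    (λ eq → solvable⇒schedulable I (decide-sound (unaryOf (maxSupply I)) I eq))
    (λ s → let w , t≤w , a = schedulable⇒solvable I s in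
      decide-complete (unaryOf (maxSupply I)) I (λ t → ≤-refl)
        (λ t → ≤-trans (≤-maximum (∈-toList (supply I) t))
          (≤-reflexive (sym (trans (cong length (unaryOf-replicate (maxSupply I))) (Listₚ.length-replicate (maxSupply I)))))) t≤w a)
    where
    ∈-toList : ∀ {k} (v : Vec ℕ k) t → lookup v t ∈ Vec.toList v
    ∈-toList (x ∷ v) zero = here refl
    ∈-toList (x ∷ v) (suc t) = there (∈-toList v t)

-- An instance that is represented by its encoding.
record Encoded (ν : Variant) (T : ℕ) : Set where
  constructor encoded
  field instance-of : ChargeInstance ν T

open Encoded public

instance
  code-Encoded : ∀ {ν T} → Code (Encoded ν T)
  code-Encoded = record { code = λ E → code (encodeInstance (instance-of E)) }

module _ {ν : Variant} {T : ℕ} where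

  -- The first two summands bound the size of the code of the encoding, by `size-word`; the last
  -- bounds the supplies.
  measure : Encoded ν T → ℕ
  measure (encoded I) = 4 * length (encodeInstance I) + 1 + instanceMagnitude I

  trivial : ChargeInstance ν T
  trivial = chargeInstance 0 (Vec.replicate T 0) [] 0

  -- The default is never reached, as the pseudo-polynomial algorithm is run on encodings only.
  decodeOr : List Bool → ChargeInstance ν T
  decodeOr w = maybe-case (decode parseInstance w) trivial id

  decodeOrᶜ : Poly-time decodeOr
  decodeOrᶜ = maybe-caseᶜ {h = proj₁} (decodeᶜ parseInstanceᶜ) (constᶜ trivial) fstᶜ

  decodedᶜ : Computable measure (λ (E : Encoded ν T) → instance-of E)
  decodedᶜ = extensional (λ (encoded I) → cong (λ m → maybe-case m trivial id) (decode-encode isParser-Instance I))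
    (remeasure {μ = ∣_∣} {f = decodeOr} (λ E → encodeInstance (instance-of E)) (λ _ → refl)
      (λ (encoded I) → ≤-trans (size-word (encodeInstance I)) (m≤m+n _ (instanceMagnitude I))) decodeOrᶜ)

  maxSupply≤ : ∀ (E : Encoded ν T) → maxSupply (instance-of E) ≤ measure E
  maxSupply≤ (encoded I) = ≤-trans
    (≤-trans (m≤m⊔n (maxSupply I) (maximum (List.map agentMagnitude (Vec.toList (agents I)))))
             (m≤m⊔n (maxSupply I ⊔ maximum (List.map agentMagnitude (Vec.toList (agents I)))) (target I)))
    (m≤n+m (instanceMagnitude I) (4 * length (encodeInstance I) + 1))

  maxSupplyᶜ : Computable measure (λ (E : Encoded ν T) → maxSupply (instance-of E))
  maxSupplyᶜ = maximumᶜ (toListᶜ (supplyᶜ idᶜ)) ⊙ decodedᶜ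

  pseudoDecideᶜ : Computable measure (λ (E : Encoded ν T) → [ pseudoDecide (instance-of E) ])
  pseudoDecideᶜ = consᶜ (decideᶜ fstᶜ sndᶜ) (constᶜ []) ⊙ (unaryOfᶜ maxSupplyᶜ (≲-mono maxSupply≤ ≲-id) ▵ decodedᶜ)

  μ-poly : Poly 2
  μ-poly = ((con 4 ⊗ var zero) ⊕ con 1) ⊕ var (suc zero)

  pseudo-machine : ∀ {f : ChargeInstance ν T → List Bool} → Computable measure (λ (E : Encoded ν T) → f (instance-of E)) →
    Σ[ N ∈ Machine ] ∃[ p ] ∀ I → Machine.Outputs_On_Within_ N (f I) (encodeInstance I)
      (⟦ p ⟧ (length (encodeInstance I) ∷ instanceMagnitude I ∷ []))
  pseudo-machine {f} F =
    let N , p , h = computable-machine (λ (E : Encoded ν T) → encodeInstance (instance-of E)) F in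
    N , substitute p μ-poly , λ I →
      subst (Machine.Outputs_On_Within_ N (f I) (encodeInstance I))
        (sym (substitute-⟦⟧ p μ-poly (length (encodeInstance I) ∷ instanceMagnitude I ∷ []))) (h (encoded I))

  pseudoPolynomial : PseudoPolynomial (chargeScheduling ν T)
  pseudoPolynomial = pseudoDecide , pseudoDecide-correct , pseudo-machine pseudoDecideᶜ


-- Runs of a Turing machine, seen cell by cell

nth : ∀ {g} → List (Symbol g) → ℕ → Symbol g
nth []       p       = blank
nth (s ∷ ss) zero    = s
nth (s ∷ ss) (suc p) = nth ss p

nth-blank : ∀ {g} (ss : List (Symbol g)) p → nth (ss ++ [ blank ]) p ≡ nth ss p
nth-blank [] zero    = refl
nth-blank [] (suc p) = refl
nth-blank (s ∷ ss) zero    = refl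
nth-blank (s ∷ ss) (suc p) = nth-blank ss p

first : ∀ {g} → List (Symbol g) → Symbol g
first ss = nth ss 0

-- Moves c cells from before the head to the other side.
unroll : ∀ {g} → ℕ → List (Symbol g) → List (Symbol g) → List (Symbol g)
unroll zero    bs rs = rs
unroll (suc c) bs rs = unroll c (List.drop 1 bs) (first bs ∷ rs)

-- The cells are numbered from the left; the scanned cell has number c.
cell : ∀ {g} → ℕ → Tape g → ℕ → Symbol g
cell c (tape bs s rs) p = nth (unroll c bs (s ∷ rs)) p

unroll-suc : ∀ {g} c (bs rs : List (Symbol g)) p → nth (unroll (suc c) bs rs) (suc p) ≡ nth (unroll c bs rs) p
unroll-suc zero    bs rs p = refl
unroll-suc (suc c) bs rs p = unroll-suc c (List.drop 1 bs) (first bs ∷ rs) p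

unroll-blank : ∀ {g} c (bs rs : List (Symbol g)) p → nth (unroll c bs (rs ++ [ blank ])) p ≡ nth (unroll c bs rs) p
unroll-blank zero    bs rs p = nth-blank rs p
unroll-blank (suc c) bs rs p = unroll-blank c (List.drop 1 bs) (first bs ∷ rs) p

nth-write : ∀ {g} (xs rs : List (Symbol g)) s w p →
            nth (xs ++ w ∷ rs) p ≡ (if p ≡ᵇ length xs then w else nth (xs ++ s ∷ rs) p)
nth-write []       rs s w zero    = refl
nth-write []       rs s w (suc p) = refl
nth-write (x ∷ xs) rs s w zero    = refl
nth-write (x ∷ xs) rs s w (suc p) = nth-write xs rs s w p

unroll-write : ∀ {g} c (bs xs rs : List (Symbol g)) s w p → nth (unroll c bs (xs ++ w ∷ rs)) p ≡
               (if p ≡ᵇ c + length xs then w else nth (unroll c bs (xs ++ s ∷ rs)) p)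
unroll-write zero    bs xs rs s w p = nth-write xs rs s w p
unroll-write (suc c) bs xs rs s w p =
  trans (unroll-write c (List.drop 1 bs) (first bs ∷ xs) rs s w p)
    (cong (λ k → if p ≡ᵇ k then w else nth (unroll c (List.drop 1 bs) (first bs ∷ xs ++ s ∷ rs)) p) (+-suc c (length xs)))

-- The scanned cell keeps its number, so a move of the head renumbers the whole tape: what is cell
-- `p + 1` after the step was cell `source m p` before it.
source : Move → ℕ → ℕ
source left  p = p
source stay  p = suc p
source right p = suc (suc p)

cell-move : ∀ {g} c m (t : Tape g) p → cell c (move m t) (suc p) ≡ cell c t (source m p)
cell-move c left (tape [] s rs) p = unroll-suc c [] (s ∷ rs) p
cell-move c left (tape (b ∷ bs) s rs) p = unroll-suc c (b ∷ bs) (s ∷ rs) p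
cell-move c stay t p = refl
cell-move c right (tape bs s []) p = trans (sym (unroll-suc c (s ∷ bs) [ blank ] (suc p)))
  (trans (unroll-blank c bs [ s ] (suc (suc p))) refl)
cell-move c right (tape bs s (r ∷ rs)) p = sym (unroll-suc c (s ∷ bs) (r ∷ rs) (suc p))

cell-act : ∀ {g} c w m (t : Tape g) p → cell c (act (w , m) t) (suc p) ≡
           (if source m p ≡ᵇ c then w else cell c t (source m p))
cell-act c w m t@(tape bs s rs) p = trans (cell-move c m (record t { scanned = w }) p)
  (trans (unroll-write c bs [] rs s w (source m p))
    (cong (λ k → if source m p ≡ᵇ k then w else cell c t (source m p)) (+-identityʳ c)))

cell-scanned : ∀ {g} c (t : Tape g) → cell c t c ≡ Tape.scanned t
cell-scanned c t@(tape bs s rs) = trans (unroll-write c bs [] rs s s c)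
  (trans (cong (λ k → if c ≡ᵇ k then s else nth (unroll c bs (s ∷ rs)) c) (+-identityʳ c))
    (cong (λ b → if b then s else nth (unroll c bs (s ∷ rs)) c) (T⇒≡true (≡⇒≡ᵇ c c refl))))

unroll-[] : ∀ {g} c (rs : List (Symbol g)) → unroll c [] rs ≡ List.replicate c blank ++ rs
unroll-[] zero    rs = refl
unroll-[] (suc c) rs = trans (unroll-[] c (blank ∷ rs)) (shift c)
  where
  shift : ∀ c → List.replicate c blank ++ blank ∷ rs ≡ blank ∷ List.replicate c blank ++ rs
  shift zero    = refl
  shift (suc c) = cong (blank ∷_) (shift c)

nth-replicate-< : ∀ {g} c (rs : List (Symbol g)) {p} → p < c → nth (List.replicate c blank ++ rs) p ≡ blank
nth-replicate-< (suc c) rs {zero}  _       = refl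
nth-replicate-< (suc c) rs {suc p} (s≤s l) = nth-replicate-< c rs l

nth-replicate-+ : ∀ {g} c (rs : List (Symbol g)) i → nth (List.replicate c blank ++ rs) (c + i) ≡ nth rs i
nth-replicate-+ zero    rs i = refl
nth-replicate-+ (suc c) rs i = nth-replicate-+ c rs i

cell-input-< : ∀ {g} c w {p} → p < c → cell {g} c (inputTape w) p ≡ blank
cell-input-< c []      l = trans (cong (λ z → nth z _) (unroll-[] c _)) (nth-replicate-< c _ l)
cell-input-< c (_ ∷ _) l = trans (cong (λ z → nth z _) (unroll-[] c _)) (nth-replicate-< c _ l)

cell-input-+ : ∀ {g} c w i → cell {g} c (inputTape w) (c + i) ≡ nth (List.map bit w) i
cell-input-+ c []      i = trans (cong (λ z → nth z _) (unroll-[] c _)) (trans (nth-replicate-+ c _ i) (nth-blank [] i))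
cell-input-+ c (_ ∷ _) i = trans (cong (λ z → nth z _) (unroll-[] c _)) (nth-replicate-+ c _ i)

cell-empty : ∀ {g} c p → cell {g} c emptyTape p ≡ blank
cell-empty c p = trans (unroll-blank c [] [] p) (trans (cong (λ z → nth z p) (unroll-[] c [])) (all-blank c p))
  where
  all-blank : ∀ c p → nth (List.replicate c blank ++ []) p ≡ blank
  all-blank zero    p       = refl
  all-blank (suc c) zero    = refl
  all-blank (suc c) (suc p) = all-blank c p

module Run-of (N : Machine) where
  open Machine N public

  tapes : ℕ
  tapes = suc extraTapes

  -- The machine stays in a configuration in which it has halted.
  action : Fin states → Vec Sym tapes → Fin states × Vec (Sym × Move) tapes
  action q ss = maybe-case (δ q ss) (q , Vec.map (_, stay) ss) id

  advance : Config → Config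
  advance (q , ts) = let q′ , as = action q (Vec.map Tape.scanned ts) in q′ , Vec.zipWith act as ts

  advance-just : ∀ c {c′} → step c ≡ just c′ → advance c ≡ c′
  advance-just (q , ts) e with δ q (Vec.map Tape.scanned ts)
  advance-just (q , ts) refl | just _ = refl

  advance-nothing : ∀ c → step c ≡ nothing → advance c ≡ c
  advance-nothing (q , ts) e with δ q (Vec.map Tape.scanned ts)
  ... | nothing = cong (q ,_) (idle-tapes ts)
    where
    idle-tapes : ∀ {k} (ts : Vec (Tape auxSymbols) k) →
                 Vec.zipWith act (Vec.map (_, stay) (Vec.map Tape.scanned ts)) ts ≡ ts
    idle-tapes []       = refl
    idle-tapes (t ∷ ts) = cong (t ∷_) (idle-tapes ts)

  after : ℕ → Config → Config
  after zero    c = c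
  after (suc n) c = advance (after n c)

  after-advance : ∀ n c → after (suc n) c ≡ after n (advance c)
  after-advance zero    c = refl
  after-advance (suc n) c = cong advance (after-advance n c)

  after-halted : ∀ n c → step c ≡ nothing → after n c ≡ c
  after-halted zero    c e = refl
  after-halted (suc n) c e = trans (cong advance (after-halted n c e)) (advance-nothing c e)

  after-run : ∀ {c n d} m → c ⇓[ n ] d → n ≤ m → after m c ≡ d
  after-run {c} m (halt e) _ = after-halted m c e
  after-run {c} (suc m) (next e r) (s≤s l) =
    trans (after-advance m c) (trans (cong (after m) (advance-just c e)) (after-run m r l))

  answer : Config → Sym
  answer (_ , t ∷ _) = Tape.scanned t

  answer-output : ∀ {w b n} m → Outputs [ b ] On w Within n → n ≤ m → answer (after m (initial w)) ≡ bit b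
  answer-output m ((q , tape ls s rs ∷ ts) , r , e) l rewrite after-run m r l = first-bit s e
    where
    first-bit : ∀ {b} s → readWord (tape ls s rs) ≡ [ b ] → s ≡ bit b
    first-bit (bit _) e = cong bit (Listₚ.∷-injectiveˡ e)
    first-bit blank ()
    first-bit (aux _) ()


-- Satisfiability

Literal : Set → Set
Literal A = Bool × A

Clause Formula : Set → Set
Clause A  = List (Literal A)
Formula A = List (Clause A)

Satisfied : ∀ {A : Set} → (A → Bool) → Clause A → Set
Satisfied σ c = ∃[ l ] (l ∈ c × σ (proj₂ l) ≡ proj₁ l)

_⊨_ : ∀ {A : Set} → (A → Bool) → Formula A → Set
σ ⊨ Φ = ∀ {c} → c ∈ Φ → Satisfied σ c

⊨-++ : ∀ {A : Set} {σ : A → Bool} {Φ Ψ} → σ ⊨ Φ → σ ⊨ Ψ → σ ⊨ (Φ ++ Ψ)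
⊨-++ {Φ = Φ} f g c∈ with ∈ₚ.∈-++⁻ Φ c∈
... | inj₁ p = f p
... | inj₂ p = g p

⊨-map : ∀ {A B : Set} {σ : A → Bool} (f : B → Clause A) xs → (∀ {x} → x ∈ xs → Satisfied σ (f x)) → σ ⊨ List.map f xs
⊨-map f xs h c∈ with ∈ₚ.∈-map⁻ _ c∈
... | x , x∈ , refl = h x∈

⊨-concatMap : ∀ {A B : Set} {σ : A → Bool} (f : B → Formula A) xs → (∀ {x} → x ∈ xs → σ ⊨ f x) → σ ⊨ List.concatMap f xs
⊨-concatMap f xs h c∈ with find (∈ₚ.∈-concatMap⁻ f {xs = xs} c∈)
... | x , x∈ , p = h x∈ p

_⇒ᶜ_ : ∀ {A : Set} → List A → A → Clause A
as ⇒ᶜ a = List.map (false ,_) as ++ [ (true , a) ]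

⇒ᶜ-elim : ∀ {A : Set} {σ : A → Bool} as {a} → All (λ a → σ a ≡ true) as → Satisfied σ (as ⇒ᶜ a) → σ a ≡ true
⇒ᶜ-elim as h (l , l∈ , e) with ∈ₚ.∈-++⁻ (List.map (false ,_) as) l∈
... | inj₂ (here refl) = e
... | inj₁ p with ∈ₚ.∈-map⁻ _ p
...   | a , a∈ , refl with () ← trans (sym (All.lookup h a∈)) e

⇒ᶜ-intro : ∀ {A : Set} {σ : A → Bool} as {a} → (All (λ a → σ a ≡ true) as → σ a ≡ true) → Satisfied σ (as ⇒ᶜ a)
⇒ᶜ-intro [] h = _ , here refl , h []
⇒ᶜ-intro {σ = σ} (a ∷ as) h with σ a in eq
... | false = _ , here refl , eq
... | true with ⇒ᶜ-intro {σ = σ} as (λ hs → h (eq ∷ hs))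
...   | l , l∈ , e = l , there l∈ , e

finite-× : ∀ {A B} → Finite A → Finite B → Finite (A × B)
finite-× F G = record
  { count = count F * count G
  ; index = λ (a , b) → Fin.combine (index F a) (index G b)
  ; element = λ i → let j , k = Fin.remQuot (count G) i in element F j , element G k
  ; element-index = λ (a , b) → trans
      (cong (λ (j , k) → element F j , element G k) (Finₚ.remQuot-combine (index F a) (index G b)))
      (cong₂ _,_ (element-index F a) (element-index G b))
  }

finite-Fin : ∀ n → Finite (Fin n)
finite-Fin n = record { count = n ; index = id ; element = id ; element-index = λ _ → refl }

finite-Vec : ∀ {A} → Finite A → ∀ n → Finite (Vec A n)
finite-Vec F zero    = finite-retract (λ _ → tt) (λ _ → []) (λ { [] → refl }) finite-⊤
finite-Vec F (suc n) = finite-retract (λ v → Vec.head v , Vec.tail v) (λ (a , v) → a ∷ v) (λ { (_ ∷ _) → refl })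
  (finite-× F (finite-Vec F n))

finite-Symbol : ∀ g → Finite (Symbol g)
finite-Symbol g = finite-retract
  (λ { blank → inj₁ tt ; (bit b) → inj₂ (inj₁ b) ; (aux i) → inj₂ (inj₂ i) })
  (λ { (inj₁ _) → blank ; (inj₂ (inj₁ b)) → bit b ; (inj₂ (inj₂ i)) → aux i })
  (λ { blank → refl ; (bit _) → refl ; (aux _) → refl })
  (finite-⊎ finite-⊤ (finite-⊎ finite-Bool (finite-Fin g)))

elements : ∀ {A} → Finite A → List A
elements F = List.map (element F) (List.allFin (count F))

∈-elements : ∀ {A} (F : Finite A) a → a ∈ elements F
∈-elements F a = subst (_∈ elements F) (element-index F a) (∈ₚ.∈-map⁺ (element F) (∈ₚ.∈-allFin (index F a)))

finite-≟ : ∀ {A} → Finite A → DecidableEquality A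
finite-≟ F a b with index F a Finₚ.≟ index F b
... | yes e = yes (trans (sym (element-index F a)) (trans (cong (element F) e) (element-index F b)))
... | no ne = no (λ e → ne (cong (index F) e))

does-true : ∀ {P : Set} (d : Dec P) → P → does d ≡ true
does-true (yes _) p = refl
does-true (no ¬p) p = ⊥-elim (¬p p)

does-elim : ∀ {P : Set} (d : Dec P) → does d ≡ true → P
does-elim (yes p) _ = p

lookup-ext : ∀ {A : Set} {n} {v w : Vec A n} → (∀ i → lookup v i ≡ lookup w i) → v ≡ w
lookup-ext {v = []}    {[]}    h = refl
lookup-ext {v = _ ∷ _} {_ ∷ _} h = cong₂ _∷_ (h zero) (lookup-ext (h ∘ suc))

nth-++ : ∀ {g} (x u : List Bool) k → nth {g} (List.map bit (x ++ u)) (length x + k) ≡ nth (List.map bit u) k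
nth-++ []      u k = refl
nth-++ (b ∷ x) u k = nth-++ x u k

indexed-from : ∀ {A : Set} → List (ℕ × A) → List A → List (ℕ × A)
indexed-from = foldl (λ acc x → (length acc , x) ∷ acc)

indexed-from-∈ : ∀ {A : Set} {p : ℕ × A} acc xs → p ∈ acc → p ∈ indexed-from acc xs
indexed-from-∈ acc []       h = h
indexed-from-∈ acc (x ∷ xs) h = indexed-from-∈ ((length acc , x) ∷ acc) xs (there h)

indexed-from-complete : ∀ {g} acc w i b → nth {g} (List.map bit w) i ≡ bit b → (length acc + i , b) ∈ indexed-from acc w
indexed-from-complete acc (b ∷ w) zero .b refl =
  subst (λ k → (k , b) ∈ indexed-from acc (b ∷ w)) (sym (+-identityʳ (length acc))) (indexed-from-∈ ((length acc , b) ∷ acc) w (here refl))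
indexed-from-complete acc (x ∷ w) (suc i) b e =
  subst (λ k → (k , b) ∈ indexed-from acc (x ∷ w)) (sym (+-suc (length acc) i)) (indexed-from-complete ((length acc , x) ∷ acc) w i b e)

indexed-from-sound : ∀ {g} acc w {i b} → (i , b) ∈ indexed-from acc w →
  (i , b) ∈ acc ⊎ ∃[ k ] (i ≡ length acc + k × nth {g} (List.map bit w) k ≡ bit b)
indexed-from-sound acc [] h = inj₁ h
indexed-from-sound acc (x ∷ w) h with indexed-from-sound ((length acc , x) ∷ acc) w h
... | inj₁ (here refl) = inj₂ (0 , sym (+-identityʳ _) , refl)
... | inj₁ (there p)   = inj₁ p
... | inj₂ (k , e , q) = inj₂ (suc k , trans e (sym (+-suc (length acc) k)) , q)

-- The formula that describes an accepting run of at most n steps on an input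
-- that starts with x and continues with at most l unknown bits.
module Tableau (N : Machine) where
  open Run-of N

  Tag : Set
  Tag = Fin states ⊎ (Fin tapes × Sym)

  abstract
    finite-Sym : Finite Sym
    finite-Sym = finite-Symbol auxSymbols

    finite-Tag : Finite Tag
    finite-Tag = finite-⊎ (finite-Fin states) (finite-× (finite-Fin tapes) finite-Sym)

  -- A time, the number of a tag and a position. Numbers stand for the tags because they have codes
  -- and an equality test on stacks; atoms for states have the dummy position 0.
  Atom : Set
  Atom = ℕ × (Fin (count finite-Tag) × ℕ)

  state-at : ℕ → Fin states → Atom
  state-at t q = t , (index finite-Tag (inj₁ q) , 0)

  cell-at : ℕ → Fin tapes → Sym → ℕ → Atom
  cell-at t j s p = t , (index finite-Tag (inj₂ (j , s)) , p)

  -- What a transition depends on. For a fixed machine there are only constantly many views, so the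
  -- transition table can be written out as one clause per view.
  View : Set
  View = Fin states × Vec Sym tapes

  abstract
    finite-View : Finite View
    finite-View = finite-× (finite-Fin states) (finite-Vec finite-Sym tapes)

    finite-View-cell : Finite (View × (Fin tapes × Sym))
    finite-View-cell = finite-× finite-View (finite-× (finite-Fin tapes) finite-Sym)

  viewed : ℕ → ℕ → View → List Atom
  viewed n t (q , ss) = state-at t q ∷ List.map (λ j → cell-at t j (lookup ss j) n) (List.allFin tapes)

  state-clause : ℕ → ℕ → View → Clause Atom
  state-clause n t (q , ss) = viewed n t (q , ss) ⇒ᶜ state-at (suc t) (proj₁ (action q ss))

  cell-clause : ℕ → ℕ → ℕ → View × (Fin tapes × Sym) → Clause Atom
  cell-clause n t p ((q , ss) , (j , s)) =
    let w , m = lookup (proj₂ (action q ss)) j in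
    (cell-at t j s (source m p) ∷ viewed n t (q , ss)) ⇒ᶜ
    (if source m p ≡ᵇ n then cell-at (suc t) j w (suc p) else cell-at (suc t) j s (suc p))

  step-formula : ℕ → ℕ → ℕ → Formula Atom
  step-formula n t p = List.map (state-clause n t) (elements finite-View) ++
                       List.map (cell-clause n t p) (elements finite-View-cell)

  run-formula : ℕ → Formula Atom
  run-formula n = List.concatMap (λ t → List.concatMap (λ p → step-formula n t p) (List.downFrom (2 * n))) (List.downFrom n)

  fact : Atom → Clause Atom
  fact a = [ (true , a) ]

  -- The cell holds a bit or a blank, and after a blank comes another blank. The guessed cells
  -- therefore form a word followed by blanks, as on a genuine input tape.
  guess : ℕ → Formula Atom
  guess p = ((true , cell-at 0 zero (bit false) p) ∷ (true , cell-at 0 zero (bit true) p) ∷ (true , cell-at 0 zero blank p) ∷ []) ∷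
            ((false , cell-at 0 zero blank p) ∷ (true , cell-at 0 zero blank (suc p)) ∷ []) ∷ []

  blank-tapes : ℕ → Formula Atom
  blank-tapes n = List.concatMap (λ p → List.map (λ j → fact (cell-at 0 (suc j) blank p)) (List.allFin extraTapes)) (List.downFrom (suc (2 * n)))

  blanks : ℕ → ℕ → Formula Atom
  blanks p k = List.map (λ i → fact (cell-at 0 zero blank (p + i))) (List.downFrom k)

  known-bits : ℕ → List Bool → Formula Atom
  known-bits n x = List.map
    (λ (i , b) → if b then fact (cell-at 0 zero (bit true) (n + i)) else fact (cell-at 0 zero (bit false) (n + i))) (indexed-from [] x)

  guesses : ℕ → ℕ → Formula Atom
  guesses p l = List.concatMap (λ i → guess (p + i)) (List.downFrom l)

  start-formula : ℕ → List Bool → ℕ → Formula Atom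
  start-formula n x l = [ fact (state-at 0 start) ] ++ blank-tapes n ++ blanks 0 n ++ known-bits n x ++
                        guesses (n + length x) l ++ blanks ((n + length x) + l) (suc (2 * n))

  rejecting : List Sym
  rejecting = blank ∷ bit false ∷ List.map aux (List.allFin auxSymbols)

  accept-formula : ℕ → Formula Atom
  accept-formula n = List.map (λ s → [ (false , cell-at n zero s n) ]) rejecting

  formula : ℕ → List Bool → ℕ → Formula Atom
  formula n x l = run-formula n ++ start-formula n x l ++ accept-formula n

  ∈-downFrom⁻ : ∀ {k m} → k ∈ List.downFrom m → k < m
  ∈-downFrom⁻ {m = suc m} (here refl) = ≤-refl
  ∈-downFrom⁻ {m = suc m} (there p)   = m≤n⇒m≤1+n (∈-downFrom⁻ p)

  ∈-downFrom⁺ : ∀ {k m} → k < m → k ∈ List.downFrom m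
  ∈-downFrom⁺ = ∈-downFrom {unbounded} {0}

  module Soundness (n : ℕ) (x : List Bool) (l : ℕ) (σ : Atom → Bool) (sat : σ ⊨ formula n x l) where

    -- No clause forbids two symbols in one cell. It suffices that the atoms of the actual run are
    -- true under `σ`; others may be true as well, because `accept-formula` excludes every answer
    -- but `bit true`. A new cell depends on an old one at distance at most 1, so the known window
    -- loses one cell at either end per step; at time `n` just the scanned cell is left.
    Known : ℕ → Config → Set
    Known t (q , ts) = σ (state-at t q) ≡ true ×
      (∀ j p → t ≤ p → p + t ≤ 2 * n → σ (cell-at t j (cell n (lookup ts j) p) p) ≡ true)

    sat-run : σ ⊨ run-formula n
    sat-run c∈ = sat (∈ₚ.∈-++⁺ˡ c∈)

    sat-start : σ ⊨ start-formula n x l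
    sat-start c∈ = sat (∈ₚ.∈-++⁺ʳ (run-formula n) (∈ₚ.∈-++⁺ˡ c∈))

    sat-accept : σ ⊨ accept-formula n
    sat-accept c∈ = sat (∈ₚ.∈-++⁺ʳ (run-formula n) (∈ₚ.∈-++⁺ʳ (start-formula n x l) c∈))

    fact-true : ∀ {a} → Satisfied σ (fact a) → σ a ≡ true
    fact-true (_ , here refl , e) = e

    step-sat : ∀ {t p} → t < n → p < 2 * n → σ ⊨ step-formula n t p
    step-sat {t} t<n p<2n c∈ = sat-run (∈ₚ.∈-concatMap⁺ (λ t → List.concatMap (step-formula n t) (List.downFrom (2 * n)))
      (lose (∈-downFrom⁺ t<n) (∈ₚ.∈-concatMap⁺ (step-formula n t) (lose (∈-downFrom⁺ p<2n) c∈))))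

    viewed-true : ∀ {t q ts} → t ≤ n → Known t (q , ts) → All (λ a → σ a ≡ true) (viewed n t (q , Vec.map Tape.scanned ts))
    viewed-true {t} {q} {ts} t≤n (state , cells) = state ∷ Allₚ.map⁺ (All.tabulate λ {j} _ →
      subst (λ s → σ (cell-at t j s n) ≡ true) (trans (cell-scanned n (lookup ts j)) (sym (Vecₚ.lookup-map j Tape.scanned ts)))
        (cells j n t≤n (+-monoʳ-≤ n (≤-trans t≤n (≤-reflexive (sym (+-identityʳ n)))))))

    known-advance : ∀ {t c} → t < n → Known t c → Known (suc t) (advance c)
    known-advance {t} {q , ts} t<n known@(state , cells) =
      ⇒ᶜ-elim (viewed n t (q , ss)) (viewed-true {t} {q} {ts} (<⇒≤ t<n) known)
        (step-sat {p = 0} t<n (≤-trans (s≤s z≤n) (≤-trans t<n (m≤m+n n _)))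
          (∈ₚ.∈-++⁺ˡ (∈ₚ.∈-map⁺ (state-clause n t) (∈-elements finite-View (q , ss))))) ,
      cells′
      where
      ss = Vec.map Tape.scanned ts
      as = proj₂ (action q ss)
      cells′ : ∀ j p → suc t ≤ p → p + suc t ≤ 2 * n → σ (cell-at (suc t) j (cell n (lookup (Vec.zipWith act as ts) j) p) p) ≡ true
      cells′ j (suc p) (s≤s t≤p) p+t≤2n rewrite Vecₚ.lookup-zipWith act j as ts =
        subst (λ s → σ (cell-at (suc t) j s (suc p)) ≡ true) (sym (cell-act n w m (lookup ts j) p))
          (trans (cong σ (if-cell (source m p ≡ᵇ n)))
            (⇒ᶜ-elim (cell-at t j s (source m p) ∷ viewed n t (q , ss))
              (cells j (source m p) (t≤source m) (source≤ m) ∷ viewed-true {t} {q} {ts} (<⇒≤ t<n) known)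
              (step-sat t<n p<2n (∈ₚ.∈-++⁺ʳ (List.map (state-clause n t) (elements finite-View))
                (∈ₚ.∈-map⁺ (cell-clause n t p) (∈-elements finite-View-cell ((q , ss) , (j , s))))))))
        where
        w = proj₁ (lookup as j)
        m = proj₂ (lookup as j)
        s = cell n (lookup ts j) (source m p)
        if-cell : ∀ b → cell-at (suc t) j (if b then w else s) (suc p) ≡
                  (if b then cell-at (suc t) j w (suc p) else cell-at (suc t) j s (suc p))
        if-cell true  = refl
        if-cell false = refl
        2+p+t≤2n : suc (suc p) + t ≤ 2 * n
        2+p+t≤2n = ≤-trans (≤-reflexive (cong suc (sym (+-suc p t)))) p+t≤2n
        p<2n : p < 2 * n
        p<2n = ≤-trans (≤-trans (n≤1+n _) (m≤m+n _ t)) 2+p+t≤2n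
        t≤source : ∀ m → t ≤ source m p
        t≤source left  = t≤p
        t≤source stay  = m≤n⇒m≤1+n t≤p
        t≤source right = m≤n⇒m≤1+n (m≤n⇒m≤1+n t≤p)
        source≤ : ∀ m → source m p + t ≤ 2 * n
        source≤ left  = ≤-trans (≤-trans (n≤1+n _) (n≤1+n _)) 2+p+t≤2n
        source≤ stay  = ≤-trans (n≤1+n _) 2+p+t≤2n
        source≤ right = 2+p+t≤2n

    -- If several symbols are true in a guessed cell, any of the true bits will do, and `false` is
    -- preferred. If neither bit is true, the cell must be blank and the word ends there.
    extract : ℕ → ℕ → List Bool
    extract zero    p = []
    extract (suc k) p = if σ (cell-at 0 zero (bit false) p) then false ∷ extract k (suc p)
                        else if σ (cell-at 0 zero (bit true) p) then true ∷ extract k (suc p) else []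

    unknown : List Bool
    unknown = extract l (n + length x)

    length-extract : ∀ k p → length (extract k p) ≤ k
    length-extract zero p = z≤n
    length-extract (suc k) p with σ (cell-at 0 zero (bit false) p) | σ (cell-at 0 zero (bit true) p)
    ... | true  | _     = s≤s (length-extract k (suc p))
    ... | false | true  = s≤s (length-extract k (suc p))
    ... | false | false = z≤n

    private
      p₀ : ℕ
      p₀ = n + length x

      sat₁ : σ ⊨ (blank-tapes n ++ blanks 0 n ++ known-bits n x ++ guesses p₀ l ++ blanks (p₀ + l) (suc (2 * n)))
      sat₁ c∈ = sat-start (there c∈)

      sat₂ : σ ⊨ (blanks 0 n ++ known-bits n x ++ guesses p₀ l ++ blanks (p₀ + l) (suc (2 * n)))
      sat₂ c∈ = sat₁ (∈ₚ.∈-++⁺ʳ (blank-tapes n) c∈)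

      sat₃ : σ ⊨ (known-bits n x ++ guesses p₀ l ++ blanks (p₀ + l) (suc (2 * n)))
      sat₃ c∈ = sat₂ (∈ₚ.∈-++⁺ʳ (blanks 0 n) c∈)

      sat₄ : σ ⊨ (guesses p₀ l ++ blanks (p₀ + l) (suc (2 * n)))
      sat₄ c∈ = sat₃ (∈ₚ.∈-++⁺ʳ (known-bits n x) c∈)

    sat-blanks : ∀ {p k} → σ ⊨ blanks p k → ∀ {i} → i < k → σ (cell-at 0 zero blank (p + i)) ≡ true
    sat-blanks {p} h i<k = fact-true (h (∈ₚ.∈-map⁺ (λ i → fact (cell-at 0 zero blank (p + i))) (∈-downFrom⁺ i<k)))

    known-bit : ∀ {i b} → (i , b) ∈ indexed-from [] x → σ (cell-at 0 zero (bit b) (n + i)) ≡ true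
    known-bit {i} {true}  h = fact-true (sat₃ (∈ₚ.∈-++⁺ˡ (∈ₚ.∈-map⁺ _ h)))
    known-bit {i} {false} h = fact-true (sat₃ (∈ₚ.∈-++⁺ˡ (∈ₚ.∈-map⁺ _ h)))

    sat-guess : ∀ p → p₀ ≤ p → p < p₀ + l → σ ⊨ guess p
    sat-guess p p₀≤p p<e = subst (λ k → σ ⊨ guess k) (m+[n∸m]≡n p₀≤p) λ c∈ →
      sat₄ (∈ₚ.∈-++⁺ˡ (∈ₚ.∈-concatMap⁺ (λ i → guess (p₀ + i)) (lose (∈-downFrom⁺ {p ∸ p₀} {l}
        (+-cancelˡ-< p₀ (p ∸ p₀) l (subst (_< p₀ + l) (sym (m+[n∸m]≡n p₀≤p)) p<e))) c∈)))

    tail-blank : ∀ p → p₀ + l ≤ p → p ≤ 2 * n → σ (cell-at 0 zero blank p) ≡ true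
    tail-blank p e≤p p≤2n = subst (λ k → σ (cell-at 0 zero blank k) ≡ true) (m+[n∸m]≡n e≤p)
      (sat-blanks {p₀ + l} {suc (2 * n)} (λ c∈ → sat₄ (∈ₚ.∈-++⁺ʳ (guesses p₀ l) c∈)) (s≤s (≤-trans (m∸n≤m p (p₀ + l)) p≤2n)))

    guess-next : ∀ {p} → σ ⊨ guess p → σ (cell-at 0 zero blank p) ≡ true → σ (cell-at 0 zero blank (suc p)) ≡ true
    guess-next {p} h e = ⇒ᶜ-elim [ cell-at 0 zero blank p ] (e ∷ []) (h (there (here refl)))

    guess-blank : ∀ {p} → σ ⊨ guess p → σ (cell-at 0 zero (bit false) p) ≡ false → σ (cell-at 0 zero (bit true) p) ≡ false →
                  σ (cell-at 0 zero blank p) ≡ true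
    guess-blank h e e′ with h (here refl)
    ... | _ , here refl , e″ with () ← trans (sym e) e″
    ... | _ , there (here refl) , e″ with () ← trans (sym e′) e″
    ... | _ , there (there (here refl)) , e″ = e″

    -- Within the `f` remaining guessed cells blankness passes to the right by the second clause of
    -- `guess`; beyond them the cells are blank by `blanks`.
    chain : ∀ f p k → p₀ ≤ p → p + f ≡ p₀ + l → p + k ≤ 2 * n → σ (cell-at 0 zero blank p) ≡ true →
            σ (cell-at 0 zero blank (p + k)) ≡ true
    chain f p zero p₀≤p e p+k≤ b = subst (λ q → σ (cell-at 0 zero blank q) ≡ true) (sym (+-identityʳ p)) b
    chain zero p (suc k) p₀≤p e p+k≤ b =
      tail-blank (p + suc k) (≤-trans (≤-reflexive (trans (sym e) (+-identityʳ p))) (m≤m+n p (suc k))) p+k≤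
    chain (suc f) p (suc k) p₀≤p e p+k≤ b = subst (λ q → σ (cell-at 0 zero blank q) ≡ true) (sym (+-suc p k))
      (chain f (suc p) k (m≤n⇒m≤1+n p₀≤p) (trans (sym (+-suc p f)) e) (≤-trans (≤-reflexive (sym (+-suc p k))) p+k≤)
        (guess-next (sat-guess p p₀≤p (≤-trans (≤-trans (s≤s (m≤m+n p f)) (≤-reflexive (sym (+-suc p f)))) (≤-reflexive e))) b))

    known-unknown : ∀ f p k → p₀ ≤ p → p + f ≡ p₀ + l → p + k ≤ 2 * n →
                    σ (cell-at 0 zero (nth (List.map bit (extract f p)) k) (p + k)) ≡ true
    known-unknown zero p k p₀≤p e p+k≤ =
      tail-blank (p + k) (≤-trans (≤-reflexive (trans (sym e) (+-identityʳ p))) (m≤m+n p k)) p+k≤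
    known-unknown (suc f) p k p₀≤p e p+k≤
      with σ (cell-at 0 zero (bit false) p) in eq₁ | σ (cell-at 0 zero (bit true) p) in eq₂ | k
    ... | true | _ | zero = subst (λ q → σ (cell-at 0 zero (bit false) q) ≡ true) (sym (+-identityʳ p)) eq₁
    ... | true | _ | suc k = subst (λ q → σ (cell-at 0 zero (nth (List.map bit (extract f (suc p))) k) q) ≡ true) (sym (+-suc p k))
          (known-unknown f (suc p) k (m≤n⇒m≤1+n p₀≤p) (trans (sym (+-suc p f)) e) (≤-trans (≤-reflexive (sym (+-suc p k))) p+k≤))
    ... | false | true | zero = subst (λ q → σ (cell-at 0 zero (bit true) q) ≡ true) (sym (+-identityʳ p)) eq₂
    ... | false | true | suc k = subst (λ q → σ (cell-at 0 zero (nth (List.map bit (extract f (suc p))) k) q) ≡ true) (sym (+-suc p k))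
          (known-unknown f (suc p) k (m≤n⇒m≤1+n p₀≤p) (trans (sym (+-suc p f)) e) (≤-trans (≤-reflexive (sym (+-suc p k))) p+k≤))
    ... | false | false | k = chain (suc f) p k p₀≤p e p+k≤
          (guess-blank (sat-guess p p₀≤p (≤-trans (≤-trans (s≤s (m≤m+n p f)) (≤-reflexive (sym (+-suc p f)))) (≤-reflexive e))) eq₁ eq₂)

    known-input : ∀ i → n + i ≤ 2 * n → σ (cell-at 0 zero (nth (List.map bit (x ++ unknown)) i) (n + i)) ≡ true
    known-input i n+i≤ with i ℕₚ.<? length x
    ... | yes i<x = let b , e = nth-bit {auxSymbols} x unknown i<x in
          subst (λ s → σ (cell-at 0 zero s (n + i)) ≡ true) (sym (proj₂ e))
            (known-bit (indexed-from-complete {auxSymbols} [] x i b (proj₁ e)))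
      where
      nth-bit : ∀ {g} (x u : List Bool) {i} → i < length x →
                ∃[ b ] (nth {g} (List.map bit x) i ≡ bit b × nth {g} (List.map bit (x ++ u)) i ≡ bit b)
      nth-bit (b ∷ x) u {zero}  _       = b , refl , refl
      nth-bit (b ∷ x) u {suc i} (s≤s l) = nth-bit x u l
    ... | no i≮x = subst (λ s → σ (cell-at 0 zero s (n + i)) ≡ true)
            (trans (sym (nth-++ x unknown (i ∸ length x))) (cong (nth (List.map bit (x ++ unknown))) i≡))
            (subst (λ q → σ (cell-at 0 zero (nth (List.map bit unknown) (i ∸ length x)) q) ≡ true) position
              (known-unknown l p₀ (i ∸ length x) ≤-refl refl (≤-trans (≤-reflexive position) n+i≤)))
      where
      i≡ : length x + (i ∸ length x) ≡ i
      i≡ = m+[n∸m]≡n (≮⇒≥ i≮x)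
      position : p₀ + (i ∸ length x) ≡ n + i
      position = trans (+-assoc n (length x) _) (cong (λ k → n + k) i≡)

    known-initial : Known 0 (initial (x ++ unknown))
    known-initial = fact-true (sat-start (here refl)) , cells
      where
      cells : ∀ j p → 0 ≤ p → p + 0 ≤ 2 * n →
              σ (cell-at 0 j (cell n (lookup (proj₂ (initial (x ++ unknown))) j) p) p) ≡ true
      cells (suc j) p _ p≤ rewrite Vecₚ.lookup-replicate j (emptyTape {auxSymbols}) | cell-empty {auxSymbols} n p =
        fact-true (sat₁ (∈ₚ.∈-++⁺ˡ (∈ₚ.∈-concatMap⁺ (λ p → List.map (λ j → fact (cell-at 0 (suc j) blank p)) (List.allFin extraTapes))
          (lose (∈-downFrom⁺ (s≤s (≤-trans (≤-reflexive (sym (+-identityʳ p))) p≤)))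
            (∈ₚ.∈-map⁺ (λ j → fact (cell-at 0 (suc j) blank p)) (∈ₚ.∈-allFin j))))))
      cells zero p _ p≤ with p ℕₚ.<? n
      ... | yes p<n = subst (λ s → σ (cell-at 0 zero s p) ≡ true) (sym (cell-input-< n (x ++ unknown) p<n))
            (sat-blanks {0} {n} (λ c∈ → sat₂ (∈ₚ.∈-++⁺ˡ c∈)) p<n)
      ... | no p≮n = subst (λ q → σ (cell-at 0 zero (cell n (inputTape (x ++ unknown)) q) q) ≡ true) p≡
            (subst (λ s → σ (cell-at 0 zero s (n + (p ∸ n))) ≡ true) (sym (cell-input-+ n (x ++ unknown) (p ∸ n)))
              (known-input (p ∸ n) (≤-trans (≤-reflexive (trans p≡ (sym (+-identityʳ p)))) p≤)))
        where
        p≡ : n + (p ∸ n) ≡ p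
        p≡ = m+[n∸m]≡n (≮⇒≥ p≮n)

    known-after : ∀ t → t ≤ n → Known t (after t (initial (x ++ unknown)))
    known-after zero    _   = known-initial
    known-after (suc t) t<n = known-advance t<n (known-after t (<⇒≤ t<n))

    accepted : answer (after n (initial (x ++ unknown))) ≡ bit true
    accepted with after n (initial (x ++ unknown)) | known-after n ≤-refl
    ... | q , t ∷ ts | _ , cells = not-rejecting (Tape.scanned t)
          (subst (λ s → σ (cell-at n zero s n) ≡ true) (cell-scanned n t) (cells zero n ≤-refl (≤-reflexive (cong (λ k → n + k) (sym (+-identityʳ n))))))
      where
      rejected : ∀ {s} → s ∈ rejecting → σ (cell-at n zero s n) ≡ true → ⊥
      rejected {s} s∈ e with sat-accept (∈ₚ.∈-map⁺ (λ s → [ (false , cell-at n zero s n) ]) s∈)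
      ... | _ , here refl , e′ with () ← trans (sym e) e′
      not-rejecting : ∀ s → σ (cell-at n zero s n) ≡ true → s ≡ bit true
      not-rejecting blank       e = ⊥-elim (rejected (here refl) e)
      not-rejecting (bit false) e = ⊥-elim (rejected (there (here refl)) e)
      not-rejecting (bit true)  e = refl
      not-rejecting (aux i)     e = ⊥-elim (rejected (there (there (∈ₚ.∈-map⁺ aux (∈ₚ.∈-allFin i)))) e)

  module Completeness (n : ℕ) (x u : List Bool) (l : ℕ) (u≤l : length u ≤ l)
                      (accepting : answer (after n (initial (x ++ u))) ≡ bit true) where

    c₀ : Config
    c₀ = initial (x ++ u)

    holds : Config → Tag → ℕ → Bool
    holds (q , ts) (inj₁ q′)      p = does (q Finₚ.≟ q′)
    holds (q , ts) (inj₂ (j , s)) p = does (finite-≟ finite-Sym (cell n (lookup ts j) p) s)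

    σ : Atom → Bool
    σ (t , (τ , p)) = holds (after t c₀) (element finite-Tag τ) p

    σ-state : ∀ t q → σ (state-at t q) ≡ does (proj₁ (after t c₀) Finₚ.≟ q)
    σ-state t q = cong (λ τ → holds (after t c₀) τ 0) (element-index finite-Tag (inj₁ q))

    σ-cell : ∀ t j s p → σ (cell-at t j s p) ≡ does (finite-≟ finite-Sym (cell n (lookup (proj₂ (after t c₀)) j) p) s)
    σ-cell t j s p = cong (λ τ → holds (after t c₀) τ p) (element-index finite-Tag (inj₂ (j , s)))

    cell-true : ∀ {t j s p} → cell n (lookup (proj₂ (after t c₀)) j) p ≡ s → σ (cell-at t j s p) ≡ true
    cell-true {t} {j} {s} {p} e = trans (σ-cell t j s p) (does-true (finite-≟ finite-Sym _ s) e)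

    cell-elim : ∀ {t j s p} → σ (cell-at t j s p) ≡ true → cell n (lookup (proj₂ (after t c₀)) j) p ≡ s
    cell-elim {t} {j} {s} {p} e = does-elim (finite-≟ finite-Sym _ s) (trans (sym (σ-cell t j s p)) e)

    state-true : ∀ {t q} → proj₁ (after t c₀) ≡ q → σ (state-at t q) ≡ true
    state-true {t} {q} e = trans (σ-state t q) (does-true (_ Finₚ.≟ q) e)

    viewed-elim : ∀ t q ss → All (λ a → σ a ≡ true) (viewed n t (q , ss)) →
                  proj₁ (after t c₀) ≡ q × Vec.map Tape.scanned (proj₂ (after t c₀)) ≡ ss
    viewed-elim t q ss (h ∷ hs) = does-elim (_ Finₚ.≟ q) (trans (sym (σ-state t q)) h) ,
      lookup-ext λ j → trans (Vecₚ.lookup-map j Tape.scanned ts)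
        (trans (sym (cell-scanned n (lookup ts j))) (cell-elim {t} {j} (All.lookup (Allₚ.map⁻ hs) (∈ₚ.∈-allFin j))))
      where
      ts = proj₂ (after t c₀)

    satisfied-fact : ∀ {a} → σ a ≡ true → Satisfied σ (fact a)
    satisfied-fact e = _ , here refl , e

    satisfied-state : ∀ t v → Satisfied σ (state-clause n t v)
    satisfied-state t (q , ss) = ⇒ᶜ-intro (viewed n t (q , ss)) λ h →
      let e , e′ = viewed-elim t q ss h in
      state-true {suc t} (cong₂ (λ q ss → proj₁ (action q ss)) e e′)

    satisfied-cell : ∀ t p v → Satisfied σ (cell-clause n t p v)
    satisfied-cell t p ((q , ss) , (j , s)) = ⇒ᶜ-intro (cell-at t j s (source m p) ∷ viewed n t (q , ss)) λ { (here-cell ∷ h) →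
      let e , e′ = viewed-elim t q ss h in head-true e e′ (cell-elim {t} {j} here-cell) }
      where
      ts = proj₂ (after t c₀)
      w = proj₁ (lookup (proj₂ (action q ss)) j)
      m = proj₂ (lookup (proj₂ (action q ss)) j)
      head-true : proj₁ (after t c₀) ≡ q → Vec.map Tape.scanned ts ≡ ss → cell n (lookup ts j) (source m p) ≡ s →
        σ (if source m p ≡ᵇ n then cell-at (suc t) j w (suc p) else cell-at (suc t) j s (suc p)) ≡ true
      head-true e e′ e″ = pick (source m p ≡ᵇ n) (trans
        (cong (λ t → cell n t (suc p)) (trans (Vecₚ.lookup-zipWith act j (proj₂ (action _ _)) ts)
          (cong (λ as → act (lookup as j) (lookup ts j)) (cong₂ (λ q ss → proj₂ (action q ss)) e e′))))
        (trans (cell-act n w m (lookup ts j) p) (cong (λ k → if source m p ≡ᵇ n then w else k) e″)))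
        where
        pick : ∀ b → cell n (lookup (proj₂ (after (suc t) c₀)) j) (suc p) ≡ (if b then w else s) →
               σ (if b then cell-at (suc t) j w (suc p) else cell-at (suc t) j s (suc p)) ≡ true
        pick true  h = cell-true {suc t} {j} h
        pick false h = cell-true {suc t} {j} h

    input-cell : ∀ i → cell n (lookup (proj₂ c₀) zero) (n + i) ≡ nth (List.map bit (x ++ u)) i
    input-cell i = cell-input-+ n (x ++ u) i

    beyond : ∀ k → nth (List.map bit (x ++ u)) (length x + k) ≡ nth {auxSymbols} (List.map bit u) k
    beyond k = nth-++ x u k

    unknown-cell : ∀ k → cell n (lookup (proj₂ c₀) zero) ((n + length x) + k) ≡ nth (List.map bit u) k
    unknown-cell k = trans (cong (cell n (lookup (proj₂ c₀) zero)) (+-assoc n (length x) k)) (trans (input-cell (length x + k)) (beyond k))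

    nth-beyond : ∀ (u : List Bool) {k} → length u ≤ k → nth {auxSymbols} (List.map bit u) k ≡ blank
    nth-beyond []      _ = refl
    nth-beyond (b ∷ u) (s≤s l) = nth-beyond u l

    nth-blank-suc : ∀ (u : List Bool) k → nth {auxSymbols} (List.map bit u) k ≡ blank → nth {auxSymbols} (List.map bit u) (suc k) ≡ blank
    nth-blank-suc []      k       e = refl
    nth-blank-suc (b ∷ u) (suc k) e = nth-blank-suc u k e

    satisfied-guess : ∀ k → σ ⊨ guess ((n + length x) + k)
    satisfied-guess k (here refl) with nth {auxSymbols} (List.map bit u) k in eq | unknown-cell k
    ... | blank     | e = _ , there (there (here refl)) , cell-true {0} {zero} e
    ... | bit false | e = _ , here refl , cell-true {0} {zero} e
    ... | bit true  | e = _ , there (here refl) , cell-true {0} {zero} e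
    ... | aux i     | e = ⊥-elim (no-aux u k eq)
      where
      no-aux : ∀ (u : List Bool) k → nth (List.map bit u) k ≡ aux i → ⊥
      no-aux (b ∷ u) (suc k) e = no-aux u k e
    satisfied-guess k (there (here refl)) = ⇒ᶜ-intro [ cell-at 0 zero blank ((n + length x) + k) ] λ { (h ∷ []) →
      cell-true {0} {zero} (trans (cong (cell n (lookup (proj₂ c₀) zero)) (sym (+-suc (n + length x) k)))
        (trans (unknown-cell (suc k)) (nth-blank-suc u k (trans (sym (unknown-cell k)) (cell-elim {0} {zero} h))))) }

    satisfied-formula : σ ⊨ formula n x l
    satisfied-formula = ⊨-++ {Φ = run-formula n}
      (⊨-concatMap (λ t → List.concatMap (step-formula n t) (List.downFrom (2 * n))) (List.downFrom n) λ {t} _ →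
        ⊨-concatMap (step-formula n t) (List.downFrom (2 * n)) λ {p} _ → ⊨-++ {Φ = List.map (state-clause n t) (elements finite-View)}
          (⊨-map (state-clause n t) (elements finite-View) λ {v} _ → satisfied-state t v)
          (⊨-map (cell-clause n t p) (elements finite-View-cell) λ {v} _ → satisfied-cell t p v))
      (⊨-++ {Φ = start-formula n x l}
        (⊨-++ {Φ = [ fact (state-at 0 start) ]} (λ { (here refl) → satisfied-fact (state-true {0} refl) })
        (⊨-++ {Φ = blank-tapes n} (⊨-concatMap _ (List.downFrom (suc (2 * n))) λ {p} _ → ⊨-map _ (List.allFin extraTapes) λ {j} _ →
            satisfied-fact {cell-at 0 (suc j) blank p} (cell-true {0} {suc j}
              (trans (cong (λ t → cell n t p) (Vecₚ.lookup-replicate j (emptyTape {auxSymbols}))) (cell-empty n p))))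
        (⊨-++ {Φ = blanks 0 n} (⊨-map _ (List.downFrom n) λ {p} p∈ → satisfied-fact {cell-at 0 zero blank p}
            (cell-true {0} {zero} (cell-input-< n (x ++ u) (∈-downFrom⁻ p∈))))
        (⊨-++ {Φ = known-bits n x} (⊨-map _ (indexed-from [] x) known)
        (⊨-++ {Φ = guesses (n + length x) l} (⊨-concatMap _ (List.downFrom l) λ {k} _ → satisfied-guess k)
          (⊨-map _ (List.downFrom (suc (2 * n))) λ {i} _ → satisfied-fact {cell-at 0 zero blank (((n + length x) + l) + i)} (cell-true {0} {zero}
            (trans (cong (cell n (lookup (proj₂ c₀) zero)) (+-assoc (n + length x) l i))
              (trans (unknown-cell (l + i)) (nth-beyond u (≤-trans u≤l (m≤m+n l i)))))))))))
        )
        (⊨-map (λ s → [ (false , cell-at n zero s n) ]) rejecting λ {s} s∈ → _ , here refl , rejected s∈))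
      where
      known : ∀ {ib} → ib ∈ indexed-from [] x →
              Satisfied σ (if proj₂ ib then fact (cell-at 0 zero (bit true) (n + proj₁ ib)) else fact (cell-at 0 zero (bit false) (n + proj₁ ib)))
      known {i , b} h with indexed-from-sound {auxSymbols} [] x h
      ... | inj₂ (_ , refl , e) = pick b (trans (input-cell i) (in-prefix x e))
        where
        in-prefix : ∀ x {i b} → nth {auxSymbols} (List.map bit x) i ≡ bit b → nth {auxSymbols} (List.map bit (x ++ u)) i ≡ bit b
        in-prefix (_ ∷ x) {zero}  e = e
        in-prefix (_ ∷ x) {suc i} e = in-prefix x e
        pick : ∀ b → cell n (lookup (proj₂ c₀) zero) (n + i) ≡ bit b →
               Satisfied σ (if b then fact (cell-at 0 zero (bit true) (n + i)) else fact (cell-at 0 zero (bit false) (n + i)))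
        pick true  h = satisfied-fact (cell-true {0} {zero} h)
        pick false h = satisfied-fact (cell-true {0} {zero} h)
      rejected : ∀ {s} → s ∈ rejecting → σ (cell-at n zero s n) ≡ false
      rejected {s} s∈ with σ (cell-at n zero s n) in eq
      ... | false = refl
      ... | true = ⊥-elim (not-true s∈ (trans (sym (cell-elim {n} {zero} eq)) (trans (scanned-answer (after n c₀)) accepting)))
        where
        scanned-answer : ∀ c → cell n (lookup (proj₂ c) zero) n ≡ answer c
        scanned-answer (q , t ∷ ts) = cell-scanned n t
        not-true : ∀ {s} → s ∈ rejecting → s ≡ bit true → ⊥
        not-true (there (there p)) refl with ∈ₚ.∈-map⁻ aux p
        ... | _ , _ , ()


-- From satisfiability to subset sums

data _◁_ {A : Set} : List A → List A → Set where
  []   : [] ◁ []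
  skip : ∀ {y xs ys} → xs ◁ ys → xs ◁ (y ∷ ys)
  take : ∀ {y xs ys} → xs ◁ ys → (y ∷ xs) ◁ (y ∷ ys)

◁-∈ : ∀ {A : Set} {xs ys : List A} {a} → xs ◁ ys → a ∈ xs → a ∈ ys
◁-∈ (skip p) h           = there (◁-∈ p h)
◁-∈ (take p) (here refl) = here refl
◁-∈ (take p) (there h)   = there (◁-∈ p h)

◁-length : ∀ {A : Set} {xs ys : List A} → xs ◁ ys → length xs ≤ length ys
◁-length []       = z≤n
◁-length (skip p) = m≤n⇒m≤1+n (◁-length p)
◁-length (take p) = s≤s (◁-length p)

◁-++⁺ : ∀ {A : Set} {xs ys xs′ ys′ : List A} → xs ◁ ys → xs′ ◁ ys′ → (xs ++ xs′) ◁ (ys ++ ys′)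
◁-++⁺ []       q = q
◁-++⁺ (skip p) q = skip (◁-++⁺ p q)
◁-++⁺ (take p) q = take (◁-++⁺ p q)

◁-++⁻ : ∀ {A : Set} {xs} (ys ys′ : List A) → xs ◁ (ys ++ ys′) → ∃[ us ] ∃[ vs ] (xs ≡ us ++ vs × us ◁ ys × vs ◁ ys′)
◁-++⁻ []       ys′ p = [] , _ , refl , [] , p
◁-++⁻ (y ∷ ys) ys′ (skip p) = let us , vs , e , q , r = ◁-++⁻ ys ys′ p in us , vs , e , skip q , r
◁-++⁻ (y ∷ ys) ys′ (take p) = let us , vs , e , q , r = ◁-++⁻ ys ys′ p in y ∷ us , vs , cong (y ∷_) e , take q , r

◁-map⁺ : ∀ {A B : Set} (f : A → B) {xs ys} → xs ◁ ys → List.map f xs ◁ List.map f ys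
◁-map⁺ f []       = []
◁-map⁺ f (skip p) = skip (◁-map⁺ f p)
◁-map⁺ f (take p) = take (◁-map⁺ f p)

◁-map⁻ : ∀ {A B : Set} (f : A → B) {xs} ys → xs ◁ List.map f ys → ∃[ us ] (xs ≡ List.map f us × us ◁ ys)
◁-map⁻ f []       []       = [] , refl , []
◁-map⁻ f (y ∷ ys) (skip p) = let us , e , q = ◁-map⁻ f ys p in us , e , skip q
◁-map⁻ f (y ∷ ys) (take p) = let us , e , q = ◁-map⁻ f ys p in y ∷ us , cong (f y ∷_) e , take q

total : List ℕ → ℕ
total = sumOver id

sumOver-++ : ∀ {A : Set} (f : A → ℕ) xs ys → sumOver f (xs ++ ys) ≡ sumOver f xs + sumOver f ys
sumOver-++ f []       ys = refl
sumOver-++ f (x ∷ xs) ys = trans (cong (f x +_) (sumOver-++ f xs ys)) (sym (+-assoc (f x) _ _))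

sumOver-map : ∀ {A B : Set} (f : B → ℕ) (g : A → B) xs → sumOver f (List.map g xs) ≡ sumOver (f ∘ g) xs
sumOver-map f g []       = refl
sumOver-map f g (x ∷ xs) = cong (f (g x) +_) (sumOver-map f g xs)

digits-unique : ∀ b {m n k l} → k < b → l < b → b * m + k ≡ b * n + l → m ≡ n × k ≡ l
digits-unique b {m} {n} {k} {l} k<b l<b e with <-cmp m n
... | tri≈ _ refl _ = refl , +-cancelˡ-≡ (b * m) k l e
... | tri< m<n _ _ = ⊥-elim (<-irrefl e (impossible k<b m<n))
  where
  impossible : ∀ {m n k l} → k < b → m < n → b * m + k < b * n + l
  impossible {m} {n} {k} {l} k<b m<n = ≤-trans (+-monoʳ-< (b * m) k<b)
    (≤-trans (≤-reflexive (trans (+-comm (b * m) b) (sym (*-suc b m)))) (≤-trans (*-monoʳ-≤ b m<n) (m≤m+n (b * n) l)))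
... | tri> _ _ n<m = ⊥-elim (<-irrefl (sym e) (impossible l<b n<m))
  where
  impossible : ∀ {m n k l} → k < b → m < n → b * m + k < b * n + l
  impossible {m} {n} {k} {l} k<b m<n = ≤-trans (+-monoʳ-< (b * m) k<b)
    (≤-trans (≤-reflexive (trans (+-comm (b * m) b) (sym (*-suc b m)))) (≤-trans (*-monoʳ-≤ b m<n) (m≤m+n (b * n) l)))

-- Multiplication by a power of two, performed by doubling. Choosing a power of two as base avoids a
-- general multiplication; its exponent already bounds the numbers that have to stay below it, by
-- `length<power`.
shift : Unary → ℕ → ℕ
shift L x = foldr (λ _ y → y + y) x L

power : Unary → ℕ
power L = shift L 1

shift-* : ∀ L x → shift L x ≡ power L * x
shift-* []      x = sym (+-identityʳ x)
shift-* (_ ∷ L) x = trans (cong₂ _+_ (shift-* L x) (shift-* L x)) (sym (*-distribʳ-+ x (power L) (power L)))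

length<power : ∀ L → length L < power L
length<power []      = s≤s z≤n
length<power (_ ∷ L) = ≤-trans (s≤s (length<power L)) (+-monoˡ-≤ (power L) (≤-trans (s≤s z≤n) (length<power L)))

-- A row asks that the chosen elements that occur in a list, together with some
-- of the available slack, have a given number.
module Rows {A : Set} (mem : A → List A → Bool) (universe : List A) (L : Unary) where

  Row Item : Set
  Row  = List A × (Unary × ℕ)
  Item = Maybe A × ℕ

  occurrence : List A → A → ℕ
  occurrence as a = if mem a as then 1 else 0

  digit-of : List A → Item → ℕ
  digit-of as (t , _) = maybe-case t 0 (occurrence as)

  scale : List A → Item → Item
  scale as i = proj₁ i , shift L (proj₂ i) + digit-of as i

  -- The row becomes a new lowest digit in base `power L`. Items of elements get their occurrence in
  -- `as` there, older slack items get 0, and the new slack items are 1 in this digit and 0 in all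
  -- others.
  addRow : Row → List Item × ℕ → List Item × ℕ
  addRow (as , (sl , g)) (is , k) = List.map (scale as) is ++ List.map (λ _ → nothing , 1) sl , shift L k + g

  encodeRows : List Row → List Item × ℕ
  encodeRows = foldr addRow (List.map (λ a → just a , 0) universe , 0)

  items : List Row → List Item
  items rows = proj₁ (encodeRows rows)

  goal : List Row → ℕ
  goal rows = proj₂ (encodeRows rows)

  Meets : List A → Row → Set
  Meets T (as , (sl , g)) = ∃[ c ] (c ≤ length sl × sumOver (occurrence as) T + c ≡ g)

  tagged : List Item → List A
  tagged []                   = []
  tagged ((just a , _) ∷ is)  = a ∷ tagged is
  tagged ((nothing , _) ∷ is) = tagged is

  tagged-++ : ∀ is js → tagged (is ++ js) ≡ tagged is ++ tagged js
  tagged-++ [] js = refl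
  tagged-++ ((just a , _) ∷ is) js = cong (a ∷_) (tagged-++ is js)
  tagged-++ ((nothing , _) ∷ is) js = tagged-++ is js

  tagged-scale : ∀ as is → tagged (List.map (scale as) is) ≡ tagged is
  tagged-scale as [] = refl
  tagged-scale as ((just a , _) ∷ is) = cong (a ∷_) (tagged-scale as is)
  tagged-scale as ((nothing , _) ∷ is) = tagged-scale as is

  tagged-slack : ∀ (us : Unary) → tagged (List.map (λ _ → nothing , 1) us) ≡ []
  tagged-slack [] = refl
  tagged-slack (_ ∷ us) = tagged-slack us

  sum-slack : ∀ (us : Unary) → sumOver proj₂ (List.map {B = Item} (λ _ → nothing , 1) us) ≡ length us
  sum-slack [] = refl
  sum-slack (_ ∷ us) = cong suc (sum-slack us)

  sum-scale : ∀ as is → sumOver proj₂ (List.map (scale as) is) ≡ power L * sumOver proj₂ is + sumOver (occurrence as) (tagged is)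
  sum-scale as [] = sym (trans (+-identityʳ (power L * 0)) (*-zeroʳ (power L)))
  sum-scale as ((t , x) ∷ is) = trans
    (cong₂ _+_ (cong (_+ digit-of as (t , x)) (shift-* L x)) (sum-scale as is))
    (trans (solve 5 (λ b x d y c → (b :* x :+ d) :+ (b :* y :+ c) := b :* (x :+ y) :+ (d :+ c)) refl
      (power L) x (digit-of as (t , x)) (sumOver proj₂ is) (sumOver (occurrence as) (tagged is)))
      (cong (power L * (x + sumOver proj₂ is) +_) (digit-tagged t)))
    where
    digit-tagged : ∀ t → digit-of as (t , x) + sumOver (occurrence as) (tagged is) ≡ sumOver (occurrence as) (tagged ((t , x) ∷ is))
    digit-tagged (just a) = refl
    digit-tagged nothing  = refl

  slack-total : List Row → ℕ
  slack-total = sumOver (λ (_ , (sl , _)) → length sl)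

  length-items : ∀ rows → length (items rows) ≡ length universe + slack-total rows
  length-items [] = trans (Listₚ.length-map _ universe) (sym (+-identityʳ _))
  length-items ((as , (sl , g)) ∷ rows) = trans (Listₚ.length-++ (List.map (scale as) (items rows)))
    (trans (cong₂ _+_ (trans (Listₚ.length-map _ (items rows)) (length-items rows)) (Listₚ.length-map _ sl))
      (trans (+-assoc (length universe) _ _) (cong (length universe +_) (+-comm (slack-total rows) (length sl)))))

  occurrences≤ : ∀ as T → sumOver (occurrence as) T ≤ length T
  occurrences≤ as [] = z≤n
  occurrences≤ as (a ∷ T) with mem a as
  ... | true  = s≤s (occurrences≤ as T)
  ... | false = m≤n⇒m≤1+n (occurrences≤ as T)

  length-tagged : ∀ is → length (tagged is) ≤ length is
  length-tagged [] = z≤n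
  length-tagged ((just _ , _) ∷ is) = s≤s (length-tagged is)
  length-tagged ((nothing , _) ∷ is) = m≤n⇒m≤1+n (length-tagged is)

  -- Every item contributes at most 1 to a digit and there are fewer than `power L` items. No
  -- carries arise, so equality of the sums means equality digit by digit, that is, row by row.
  rows-sound : ∀ rows → All (λ (_ , (_ , g)) → g < power L) rows → length universe + slack-total rows < power L →
    ∀ {C} → C ◁ items rows → sumOver proj₂ C ≡ goal rows → All (Meets (tagged C)) rows × tagged C ◁ universe
  rows-sound [] _ _ p _ with ◁-map⁻ (λ a → just a , 0) universe p
  ... | us , refl , q = [] , subst (_◁ universe) (sym (tagged-universe us)) q
    where
    tagged-universe : ∀ us → tagged (List.map (λ a → just a , 0) us) ≡ us
    tagged-universe [] = refl
    tagged-universe (u ∷ us) = cong (u ∷_) (tagged-universe us)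
  rows-sound ((as , (sl , g)) ∷ rows) (g< ∷ gs<) size< p e
    with ◁-++⁻ (List.map (scale as) (items rows)) (List.map (λ _ → nothing , 1) sl) p
  ... | C₁ , C₂ , refl , p₁ , p₂ with ◁-map⁻ (scale as) (items rows) p₁ | ◁-map⁻ (λ _ → nothing , 1) sl p₂
  ... | C , refl , q | us , refl , r =
    let high , low = digits-unique (power L) low< g< equation
        met , q′ = rows-sound rows gs< (≤-trans (s≤s (+-monoʳ-≤ (length universe) (m≤n+m (slack-total rows) (length sl)))) size<) q high
    in (length us , ◁-length r , trans (cong (λ T → sumOver (occurrence as) T + length us) tagged≡) low) ∷
       subst (λ T → All (Meets T) rows) (sym tagged≡) met ,
       subst (_◁ universe) (sym tagged≡) q′
    where
    tagged≡ : tagged (List.map (scale as) C ++ List.map (λ _ → nothing , 1) us) ≡ tagged C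
    tagged≡ = trans (tagged-++ (List.map (scale as) C) _)
      (trans (cong₂ _++_ (tagged-scale as C) (tagged-slack us)) (Listₚ.++-identityʳ (tagged C)))
    equation : power L * sumOver proj₂ C + (sumOver (occurrence as) (tagged C) + length us) ≡ power L * goal rows + g
    equation = trans (sym (+-assoc (power L * sumOver proj₂ C) _ _))
      (trans (sym (trans (sumOver-++ proj₂ (List.map (scale as) C) _) (cong₂ _+_ (sum-scale as C) (sum-slack us))))
        (trans e (cong (_+ g) (shift-* L (goal rows)))))
    low< : sumOver (occurrence as) (tagged C) + length us < power L
    low< = ≤-trans (s≤s (≤-trans (+-mono-≤ (≤-trans (occurrences≤ as (tagged C)) (≤-trans (length-tagged C) (◁-length q))) (◁-length r))
      (≤-reflexive (trans (cong (_+ length sl) (length-items rows)) (trans (+-assoc (length universe) _ _)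
        (cong (length universe +_) (+-comm (slack-total rows) (length sl)))))))) size<

  rows-complete : ∀ rows {T} → T ◁ universe → All (Meets T) rows →
    ∃[ C ] (C ◁ items rows × tagged C ≡ T × sumOver proj₂ C ≡ goal rows)
  rows-complete [] {T} p [] = List.map (λ a → just a , 0) T , ◁-map⁺ _ p , tagged-universe T , zero-sum T
    where
    tagged-universe : ∀ us → tagged (List.map (λ a → just a , 0) us) ≡ us
    tagged-universe [] = refl
    tagged-universe (u ∷ us) = cong (u ∷_) (tagged-universe us)
    zero-sum : ∀ (us : List A) → sumOver proj₂ (List.map {B = Item} (λ a → just a , 0) us) ≡ 0
    zero-sum [] = refl
    zero-sum (u ∷ us) = zero-sum us
  rows-complete ((as , (sl , g)) ∷ rows) {T} p ((c , c≤ , e) ∷ met) with rows-complete rows p met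
  ... | C , q , refl , s =
    List.map (scale as) C ++ List.map (λ _ → nothing , 1) (List.take c sl) ,
    ◁-++⁺ (◁-map⁺ (scale as) q) (◁-map⁺ _ (take-◁ c sl)) ,
    trans (tagged-++ (List.map (scale as) C) _)
      (trans (cong₂ _++_ (tagged-scale as C) (tagged-slack (List.take c sl))) (Listₚ.++-identityʳ (tagged C))) ,
    trans (sumOver-++ proj₂ (List.map (scale as) C) _)
      (trans (cong₂ _+_ (sum-scale as C) (trans (sum-slack (List.take c sl)) (trans (Listₚ.length-take c sl) (m≤n⇒m⊓n≡m c≤))))
        (trans (+-assoc (power L * sumOver proj₂ C) _ c)
          (cong₂ _+_ (trans (cong (power L *_) s) (sym (shift-* L (goal rows)))) e)))
    where
    take-◁ : ∀ c (us : Unary) → List.take c us ◁ us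
    take-◁ zero    []       = []
    take-◁ zero    (_ ∷ us) = skip (take-◁ zero us)
    take-◁ (suc c) []       = []
    take-◁ (suc c) (_ ∷ us) = take (take-◁ c us)

-- Formulas as rows

SubsetSum : List ℕ → ℕ → Set
SubsetSum xs k = ∃[ ys ] (ys ◁ xs × total ys ≡ k)

module Reduction {A : Set} (eq : A → A → Bool) (eq⁻ : ∀ {a b} → eq a b ≡ true → a ≡ b) (eq⁺ : ∀ a → eq a a ≡ true) where

  member : A → List A → Bool
  member a = foldr (λ b m → eq a b ∨ m) false

  member⁻ : ∀ {a} as → member a as ≡ true → a ∈ as
  member⁻ {a} (b ∷ as) h with eq a b in e
  ... | true  = here (eq⁻ e)
  ... | false = there (member⁻ as h)

  member⁺ : ∀ {a as} → a ∈ as → member a as ≡ true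
  member⁺ {a} {b ∷ as} (here refl) rewrite eq⁺ a = refl
  member⁺ {a} {b ∷ as} (there p) with eq a b
  ... | true  = refl
  ... | false = member⁺ p

  nub : List A → List A
  nub = foldr (λ a as → if member a as then as else a ∷ as) []

  ∈-nub : ∀ {a} as → a ∈ as → a ∈ nub as
  ∈-nub (b ∷ as) (here refl) with member b (nub as) in e
  ... | true  = member⁻ (nub as) e
  ... | false = here refl
  ∈-nub (b ∷ as) (there p) with member b (nub as)
  ... | true  = ∈-nub as p
  ... | false = there (∈-nub as p)

  nub-unique : ∀ as → Unique (nub as)
  nub-unique [] = []
  nub-unique (a ∷ as) with member a (nub as) in e
  ... | true  = nub-unique as
  ... | false = All.tabulate (λ b∈ a≡b → case trans (sym e) (member⁺ (subst (_∈ nub as) (sym a≡b) b∈)) of λ ()) ∷ nub-unique as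

  eqLit : Literal A → Literal A → Bool
  eqLit (b , a) (c , d) = (if b then c else not c) ∧ eq a d

  eqLit⁻ : ∀ {l m} → eqLit l m ≡ true → l ≡ m
  eqLit⁻ {true , a}  {true , d}  h = cong (true ,_) (eq⁻ h)
  eqLit⁻ {false , a} {false , d} h = cong (false ,_) (eq⁻ h)

  eqLit⁺ : ∀ l → eqLit l l ≡ true
  eqLit⁺ (true , a)  = eq⁺ a
  eqLit⁺ (false , a) = eq⁺ a

  memberLit : Literal A → List (Literal A) → Bool
  memberLit l = foldr (λ m b → eqLit l m ∨ b) false

  memberLit⁻ : ∀ {l} ms → memberLit l ms ≡ true → l ∈ ms
  memberLit⁻ {l} (m ∷ ms) h with eqLit l m in e
  ... | true  = here (eqLit⁻ e)
  ... | false = there (memberLit⁻ ms h)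

  memberLit⁺ : ∀ {l ms} → l ∈ ms → memberLit l ms ≡ true
  memberLit⁺ {l} {m ∷ ms} (here refl) rewrite eqLit⁺ l = refl
  memberLit⁺ {l} {m ∷ ms} (there p) with eqLit l m
  ... | true  = refl
  ... | false = memberLit⁺ p

  both : A → List (Literal A)
  both v = (true , v) ∷ (false , v) ∷ []

  variables : Formula A → List A
  variables Φ = nub (List.concatMap (List.map proj₂) Φ)

  literals : Formula A → List (Literal A)
  literals Φ = List.concatMap both (variables Φ)

  slack : Formula A → Unary
  slack Φ = List.map (λ _ → tt) (literals Φ)

  -- Without slack and with goal 1, a variable must be chosen with exactly one sign. For a clause
  -- the slack is the number `N` of all literals and the goal is `N + 1`: the slack alone falls
  -- short by one, and any positive number of chosen literals up to `N` can be completed.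
  variable-rows clause-rows rows : Formula A → List (List (Literal A) × (Unary × ℕ))
  variable-rows Φ = List.map (λ v → both v , ([] , 1)) (variables Φ)
  clause-rows   Φ = List.map (λ c → c , (slack Φ , suc (length (literals Φ)))) Φ
  rows          Φ = variable-rows Φ ++ clause-rows Φ

  -- Two more than the number of all items, so that the base exceeds every digit sum as well as
  -- every goal, the largest goal being one more than the number of literals.
  width : Formula A → Unary
  width Φ = tt ∷ tt ∷ (slack Φ ++ List.concatMap (λ (_ , (sl , _)) → sl) (rows Φ))

  module _ (Φ : Formula A) where
    open Rows memberLit (literals Φ) (width Φ)

    length-slack : length (slack Φ) ≡ length (literals Φ)
    length-slack = Listₚ.length-map _ (literals Φ)

    length-width : length (width Φ) ≡ 2 + (length (literals Φ) + slack-total (rows Φ))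
    length-width = cong (2 +_) (trans (Listₚ.length-++ (slack Φ)) (cong₂ _+_ length-slack (concat-length (rows Φ))))
      where
      concat-length : ∀ rs → length (List.concatMap (λ ((_ , (sl , _)) : Row) → sl) rs) ≡ slack-total rs
      concat-length [] = refl
      concat-length ((_ , (sl , _)) ∷ rs) = trans (Listₚ.length-++ sl) (cong (length sl +_) (concat-length rs))

    width< : 2 + (length (literals Φ) + slack-total (rows Φ)) < power (width Φ)
    width< = subst (_< power (width Φ)) length-width (length<power (width Φ))

    goals< : All (λ (_ , (_ , g)) → g < power (width Φ)) (rows Φ)
    goals< = Allₚ.++⁺ (Allₚ.map⁺ {xs = variables Φ} (All.tabulate λ _ → ≤-trans (s≤s (s≤s z≤n)) width<))
      (Allₚ.map⁺ {xs = Φ} (All.tabulate λ _ → ≤-trans (s≤s (s≤s (≤-trans (m≤m+n (length (literals Φ)) (slack-total (rows Φ))) (n≤1+n _)))) width<))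

    ∈-both : ∀ {l u} → l ∈ both u → proj₂ l ≡ u
    ∈-both (here refl)         = refl
    ∈-both (there (here refl)) = refl

    both-◁ : ∀ (σ : A → Bool) vs → List.map (λ v → σ v , v) vs ◁ List.concatMap both vs
    both-◁ σ [] = []
    both-◁ σ (v ∷ vs) with σ v
    ... | true  = take (skip (both-◁ σ vs))
    ... | false = skip (take (both-◁ σ vs))

    ∈-variables : ∀ {c b v} → c ∈ Φ → (b , v) ∈ c → v ∈ variables Φ
    ∈-variables c∈ l∈ = ∈-nub _ (∈ₚ.∈-concatMap⁺ (List.map proj₂) (lose c∈ (∈ₚ.∈-map⁺ proj₂ l∈)))

    occurs : ∀ {c l T} → l ∈ T → l ∈ c → 1 ≤ sumOver (occurrence c) T
    occurs {c} {l} (here refl) l∈c rewrite memberLit⁺ l∈c = s≤s z≤n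
    occurs {c} (there {x} p) l∈c = ≤-trans (occurs p l∈c) (m≤n+m _ (occurrence c x))

    assignment-meets : ∀ {σ} → σ ⊨ Φ → All (Meets (List.map (λ v → σ v , v) (variables Φ))) (rows Φ)
    assignment-meets {σ} sat = Allₚ.++⁺ (Allₚ.map⁺ (All.tabulate λ {v} v∈ → 0 , z≤n ,
        trans (+-identityʳ _) (trans (sumOver-map (occurrence (both v)) (λ v → σ v , v) (variables Φ))
          (exactly-one (nub-unique (List.concatMap (List.map proj₂) Φ)) v∈))))
      (Allₚ.map⁺ (All.tabulate λ {c} c∈ → clause c (sat c∈) c∈))
      where
      chosen = List.map (λ v → σ v , v) (variables Φ)
      length-chosen : length chosen ≤ length (literals Φ)
      length-chosen = ◁-length (both-◁ σ (variables Φ))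
      own : ∀ u → (σ u , u) ∈ both u
      own u with σ u
      ... | true  = here refl
      ... | false = there (here refl)
      none : ∀ {u vs} → All (u ≢_) vs → sumOver (λ w → occurrence (both u) (σ w , w)) vs ≡ 0
      none [] = refl
      none {u} {w ∷ vs} (u≢w ∷ h) with memberLit (σ w , w) (both u) in e
      ... | false = none h
      ... | true = ⊥-elim (u≢w (sym (∈-both (memberLit⁻ {σ w , w} (both u) e))))
      exactly-one : ∀ {vs v} → Unique vs → v ∈ vs → sumOver (λ u → occurrence (both v) (σ u , u)) vs ≡ 1
      exactly-one {u ∷ vs} (u∉ ∷ _) (here refl) = cong₂ (λ b n → (if b then 1 else 0) + n) (memberLit⁺ (own u)) (none u∉)
      exactly-one {u ∷ vs} {v} (u∉ ∷ uq) (there p) with memberLit (σ u , u) (both v) in e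
      ... | false = exactly-one uq p
      ... | true = ⊥-elim (All.lookup u∉ p (∈-both (memberLit⁻ {σ u , u} (both v) e)))
      clause : ∀ c → Satisfied σ c → c ∈ Φ → Meets chosen (c , (slack Φ , suc (length (literals Φ))))
      clause c ((b , v) , l∈ , refl) c∈ =
        suc (length (literals Φ)) ∸ hits ,
        ≤-trans (∸-monoʳ-≤ (suc (length (literals Φ))) (occurs (∈ₚ.∈-map⁺ (λ v → σ v , v) (∈-variables c∈ l∈)) l∈)) (≤-reflexive (sym length-slack)) ,
        m+[n∸m]≡n (≤-trans (occurrences≤ c chosen) (≤-trans length-chosen (n≤1+n _)))
        where
        hits = sumOver (occurrence c) chosen

    occurring : ∀ c T → 1 ≤ sumOver (occurrence c) T → ∃[ l ] (l ∈ T × l ∈ c)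
    occurring c (l ∷ T) h with memberLit l c in e
    ... | true  = l , here refl , memberLit⁻ c e
    ... | false = let m , p , q = occurring c T h in m , there p , q

    occurs-twice : ∀ {c l m T} → l ≢ m → l ∈ T → m ∈ T → l ∈ c → m ∈ c → 2 ≤ sumOver (occurrence c) T
    occurs-twice l≢m (here refl) (here refl) _ _ = ⊥-elim (l≢m refl)
    occurs-twice l≢m (here refl) (there q) l∈c m∈c rewrite memberLit⁺ l∈c = s≤s (occurs q m∈c)
    occurs-twice l≢m (there p) (here refl) l∈c m∈c rewrite memberLit⁺ m∈c = s≤s (occurs p l∈c)
    occurs-twice {c} l≢m (there {x} p) (there q) l∈c m∈c =
      ≤-trans (occurs-twice l≢m p q l∈c m∈c) (m≤n+m _ (occurrence c x))

    ∈-literals : ∀ {b v} → (b , v) ∈ literals Φ → v ∈ variables Φ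
    ∈-literals h with find (∈ₚ.∈-concatMap⁻ both {xs = variables Φ} h)
    ... | v , v∈ , here refl         = v∈
    ... | v , v∈ , there (here refl) = v∈

    -- The row of a clause yields a chosen literal in it. If that literal is negative, the row of
    -- its variable forbids choosing the positive one too, so the assignment gives it the right
    -- value.
    meets-assignment : ∀ {T} → T ◁ literals Φ → All (Meets T) (rows Φ) → (λ v → memberLit (true , v) T) ⊨ Φ
    meets-assignment {T} T◁ met {c} c∈ =
      let k , k≤ , e = All.lookup met (∈ₚ.∈-++⁺ʳ (variable-rows Φ) (∈ₚ.∈-map⁺ (λ c → c , (slack Φ , suc (length (literals Φ)))) c∈))
          (b , v) , l∈T , l∈c = occurring c T (positive e (≤-trans k≤ (≤-reflexive length-slack)))
      in (b , v) , l∈c , value-of b l∈T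
      where
      positive : ∀ {n k m} → n + k ≡ suc m → k ≤ m → 1 ≤ n
      positive {zero}  refl k≤m = ⊥-elim (<-irrefl refl k≤m)
      positive {suc n} _    _   = s≤s z≤n
      value-of : ∀ b {v} → (b , v) ∈ T → memberLit (true , v) T ≡ b
      value-of true l∈ = memberLit⁺ l∈
      value-of false {v} l∈ with memberLit (true , v) T in e
      ... | false = refl
      ... | true with All.lookup met (∈ₚ.∈-++⁺ˡ (∈ₚ.∈-map⁺ (λ v → both v , ([] , 1)) (∈-literals (◁-∈ T◁ l∈))))
      ...   | zero , z≤n , one-of = ⊥-elim (<-irrefl refl (≤-trans
                (occurs-twice {both v} (λ ()) (memberLit⁻ T e) l∈ (here refl) (there (here refl)))
                (≤-reflexive (trans (sym (+-identityʳ _)) one-of))))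

    reduction : List ℕ × ℕ
    reduction = List.map proj₂ (items (rows Φ)) , goal (rows Φ)

    satisfiable⇒subsetSum : ∀ {σ} → σ ⊨ Φ → SubsetSum (proj₁ reduction) (proj₂ reduction)
    satisfiable⇒subsetSum {σ} sat =
      let C , C◁ , _ , e = rows-complete (rows Φ) (both-◁ σ (variables Φ)) (assignment-meets sat) in
      List.map proj₂ C , ◁-map⁺ proj₂ C◁ , trans (sumOver-map id proj₂ C) e

    subsetSum⇒satisfiable : SubsetSum (proj₁ reduction) (proj₂ reduction) → ∃[ σ ] σ ⊨ Φ
    subsetSum⇒satisfiable (ys , ys◁ , e) with ◁-map⁻ proj₂ (items (rows Φ)) ys◁
    ... | C , refl , C◁ =
      let met , T◁ = rows-sound (rows Φ) goals< (≤-trans (s≤s (≤-trans (n≤1+n _) (n≤1+n _))) width<) C◁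
                       (trans (sym (sumOver-map id proj₂ C)) e)
      in _ , meets-assignment T◁ met


-- From subset sums to schedules

-- In every variant the agent can receive all its `x` units in a single period.
freeSpeed : ∀ ν {n} → ℕ → SpeedLimit ν n
freeSpeed fixed     {n} x = x
freeSpeed unbounded {n} x = tt
freeSpeed gaps      {n} x = Vec.replicate n true

module _ {ν : Variant} {n : ℕ} where

  item : ℕ → Agent ν (suc n)
  item x = agent [ triple x zero x ] (freeSpeed ν x)

  subsetSumInstance : List ℕ × ℕ → ChargeInstance ν (suc n)
  subsetSumInstance (xs , k) = fromParts (Vec.replicate (suc n) k , (List.map item xs , k))

  at-start : ℕ → Vec ℕ (suc n)
  at-start x = x ∷ Vec.replicate n 0

  cumulativeℕ-zero : ∀ (v : Vec ℕ (suc n)) → cumulativeℕ v zero ≡ lookup v zero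
  cumulativeℕ-zero v = trans (cong (lookup v zero +_) (none n)) (+-identityʳ (lookup v zero))
    where
    none : ∀ m → sumᶠ {m} (λ _ → 0) ≡ 0
    none zero    = refl
    none (suc m) = none m

  item-value : ∀ x v → agentValueℕ (item x) v ≡ (if x ≤ᵇ lookup v zero then x else 0)
  item-value x v = trans (+-identityʳ _) (cong (λ c → if x ≤ᵇ c then x else 0) (cumulativeℕ-zero v))

  -- Value `x` requires `x` units by the deadline, which is the first period, so the total value
  -- never exceeds the resources of that period. With target and supply both `k`, the chosen numbers
  -- sum to exactly `k`.
  achieves⇒subset : ∀ xs {r w} → Achieves (List.map item xs) r w → ∃[ ys ] (ys ◁ xs × total ys ≡ w × w ≤ lookup r zero)
  achieves⇒subset [] [] = [] , [] , refl , z≤n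
  achieves⇒subset (x ∷ xs) {r} (add {r′ = r′} {w} v _ v+r′≤r p) with achieves⇒subset xs p
  ... | ys , ys◁ , refl , w≤r′ = subst (λ k → ∃[ ys′ ] (ys′ ◁ (x ∷ xs) × total ys′ ≡ k + total ys × k + total ys ≤ lookup r zero))
          (sym (item-value x v)) (either (x ≤ᵇ lookup v zero) refl)
    where
    v+w≤r : lookup v zero + total ys ≤ lookup r zero
    v+w≤r = ≤-trans (+-monoʳ-≤ (lookup v zero) w≤r′) (≤-trans (≤-reflexive (sym (lookup-+ᵛ v r′ zero))) (v+r′≤r zero))
    either : ∀ b → (x ≤ᵇ lookup v zero) ≡ b → let k = if b then x else 0 in
             ∃[ ys′ ] (ys′ ◁ (x ∷ xs) × total ys′ ≡ k + total ys × k + total ys ≤ lookup r zero)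
    either true  e = x ∷ ys , take ys◁ , refl , ≤-trans (+-monoˡ-≤ (total ys) (≤ᵇ⇒≤ x _ (subst Bool.T (sym e) _))) v+w≤r
    either false e = ys , skip ys◁ , refl , ≤-trans (m≤n+m (total ys) (lookup v zero)) v+w≤r

  lookup-at-start : ∀ x t → lookup (at-start x) t ≤ x
  lookup-at-start x zero    = ≤-refl
  lookup-at-start x (suc t) = ≤-trans (≤-reflexive (Vecₚ.lookup-replicate t 0)) z≤n

  respects-free : ∀ ν x v → (∀ t → lookup v t ≤ x) → Bool.T (respects ν (freeSpeed ν {suc n} x) v)
  respects-free fixed     x v h = T-allᶠ⁺ λ t → ≤⇒≤ᵇ (h t)
  respects-free unbounded x v h = _
  respects-free gaps      x v h = T-allᶠ⁺ {p = λ t → lookup (Vec.replicate (suc n) true) t ∨ (lookup v t ≤ᵇ 0)} λ t →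
    subst (λ b → Bool.T (b ∨ (lookup v t ≤ᵇ 0))) (sym (Vecₚ.lookup-replicate t true)) _

  at-start-+ : ∀ x y → (at-start x +ᵛ at-start y) ≤ᵛ at-start (x + y)
  at-start-+ x y zero    = ≤-refl
  at-start-+ x y (suc t) = ≤-reflexive (trans (lookup-+ᵛ (at-start x) (at-start y) (suc t))
    (trans (cong₂ _+_ (Vecₚ.lookup-replicate t 0) (Vecₚ.lookup-replicate t 0)) (sym (Vecₚ.lookup-replicate t 0))))

  subset⇒achieves : ∀ {ys xs} → ys ◁ xs → Achieves (List.map item xs) (at-start (total ys)) (total ys)
  subset⇒achieves [] = []
  subset⇒achieves {ys} {x ∷ xs} (skip p) = subst (λ k → Achieves (item x ∷ List.map item xs) (at-start (total ys)) (k + total ys))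
    (trans (item-value x (at-start 0)) (nothing-for-nothing x))
    (add (at-start 0) (respects-free ν x (at-start 0) λ t → ≤-trans (lookup-at-start 0 t) z≤n) (at-start-+ 0 (total ys)) (subset⇒achieves p))
    where
    nothing-for-nothing : ∀ x → (if x ≤ᵇ 0 then x else 0) ≡ 0
    nothing-for-nothing zero    = refl
    nothing-for-nothing (suc x) = refl
  subset⇒achieves {x ∷ ys} {_ ∷ xs} (take p) = subst (λ k → Achieves (item x ∷ List.map item xs) (at-start (x + total ys)) (k + total ys))
    (trans (item-value x (at-start x)) (cong (λ b → if b then x else 0) (T⇒≡true (≤⇒≤ᵇ (≤-refl {x})))))
    (add (at-start x) (respects-free ν x (at-start x) (lookup-at-start x)) (at-start-+ x (total ys)) (subset⇒achieves p))

  solvable⇔subsetSum : ∀ xs k → Solvable (subsetSumInstance (xs , k)) ⇔ SubsetSum xs k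
  solvable⇔subsetSum xs k = mk⇔
    (λ (w , k≤w , a) → let ys , ys◁ , e , w≤ = achieves⇒subset xs (subst (λ as → Achieves as supplies w) (Vecₚ.toList∘fromList (List.map item xs)) a)
                       in ys , ys◁ , trans e (≤-antisym w≤ k≤w))
    λ { (ys , ys◁ , refl) → total ys , ≤-refl , subst (λ as → Achieves as supplies (total ys)) (sym (Vecₚ.toList∘fromList (List.map item xs)))
          (achieves-mono (λ t → ≤-trans (lookup-at-start (total ys) t) (≤-reflexive (sym (Vecₚ.lookup-replicate t k)))) (subset⇒achieves ys◁)) }
    where
    supplies = Vec.replicate (suc n) k


-- The reductions are computable in polynomial time

module _ {X Z : Set} ⦃ _ : Code X ⦄ ⦃ _ : Code Z ⦄ {E : Set} where

  -- Over a list that is fixed beforehand, such as the views of a machine, each element may have a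
  -- program of its own, and the elements need no codes.
  constant-mapᶜ : ∀ (es : List E) {f : E → X → Z} → (∀ e → Poly-time (f e)) → Poly-time (λ x → List.map (λ e → f e x) es)
  constant-mapᶜ []       F = constᶜ []
  constant-mapᶜ (e ∷ es) F = consᶜ (F e) (constant-mapᶜ es F)

module _ {X E : Set} ⦃ _ : Code X ⦄ ⦃ _ : Code E ⦄ where

  anyᶜ : ∀ {l : X → List E} {p : E × X → Bool} → Poly-time l → Poly-time p →
         Poly-time (λ x → foldr (λ e b → p (e , x) ∨ b) false (l x))
  anyᶜ {l} {p} L P = foldr-growthᶜ {i = λ _ → false} {s = λ (e , b , x) → p (e , x) ∨ b} (constᶜ false) L
    (∨ᶜ (P ⊙ (fstᶜ ▵ sndᶜ ⊙ sndᶜ)) (fstᶜ ⊙ sndᶜ)) (λ _ → 3) (≲-con 3) λ e b x → size-∨ (p (e , x)) b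
    where
    size-∨ : ∀ a b → ∣ a ∨ b ∣ ≤ ∣ b ∣ + 3
    size-∨ true  b = m≤n+m 3 ∣ b ∣
    size-∨ false b = m≤m+n ∣ b ∣ 3

-- Putting the digit `one` in front yields `2 n + 1`, so doubling adds at most one digit. The
-- general bound for sums would double the size each time and be useless under iteration.
size-double : ∀ (n : ℕ) → ∣ n + n ∣ ≤ ∣ n ∣ + 6
size-double n = ≤-trans (size-ℕ-mono (≤-trans (n≤1+n (n + n)) (≤-reflexive odd)))
  (≤-reflexive (trans (size-ℕ m) (trans (cong (λ ds → 6 * length ds + 1) (digits-value (one ∷ digits n)))
    (trans (solve 1 (λ k → κ 6 :* (κ 1 :+ k) :+ κ 1 := κ 6 :* k :+ κ 1 :+ κ 6) refl (length (digits n)))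
      (cong (_+ 6) (sym (size-ℕ n)))))))
  where
  m = valueᵈ (one ∷ digits n)
  odd : suc (n + n) ≡ m
  odd = cong suc (sym (trans (cong (2 *_) (value-digits n)) (cong (n +_) (+-identityʳ n))))

size-shift : ∀ (L : Unary) (n : ℕ) → ∣ shift L n ∣ ≤ ∣ n ∣ + 6 * length L
size-shift []      n = m≤m+n ∣ n ∣ 0
size-shift (_ ∷ L) n = ≤-trans (size-double (shift L n)) (≤-trans (+-monoˡ-≤ 6 (size-shift L n))
  (≤-reflexive (solve 2 (λ a b → a :+ κ 6 :* b :+ κ 6 := a :+ κ 6 :* (κ 1 :+ b)) refl ∣ n ∣ (length L))))

shiftᶜ : ∀ {X} ⦃ _ : Code X ⦄ {L : X → Unary} {n : X → ℕ} → Poly-time L → Poly-time n → Poly-time (λ x → shift (L x) (n x))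
shiftᶜ L N = foldr-growthᶜ {s = λ (_ , y , _) → y + y} N L (+ᶜ (fstᶜ ⊙ sndᶜ) (fstᶜ ⊙ sndᶜ)) (λ _ → 6) (≲-con 6)
  λ _ y _ → size-double y

size-list : ∀ {E} ⦃ _ : Code E ⦄ {b} (es : List E) → All (λ e → ∣ e ∣ ≤ b) es → ∣ es ∣ ≤ 1 + length es * (1 + b)
size-list []       []       = ≤-refl
size-list {b = b} (e ∷ es) (h ∷ hs) = s≤s (≤-trans (+-mono-≤ h (size-list es hs)) (≤-reflexive (+-suc b _)))

module _ {A : Set} ⦃ _ : Code A ⦄ {mem : A → List A → Bool}
         (memᶜ : Poly-time {A × List A} (λ (a , as) → mem a as)) where

  private
    R : Set
    R = List A × (Unary × ℕ)
    In : Set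
    In = List R × (List A × Unary)
    module At (x : In) = Rows mem (proj₁ (proj₂ x)) (proj₂ (proj₂ x))

  -- The growth of an item per row: 6 for each of the doublings, and 12 for the addition of a digit
  -- 0 or 1, whose code has size at most 7, to which `size-+` adds 5.
  item-growth : In → ℕ
  item-growth x = 6 * ∣ x ∣ + 12

  module _ (x : In) where
    open At x
    private
      universe = proj₁ (proj₂ x)
      L = proj₂ (proj₂ x)
      L≤ : length L ≤ ∣ x ∣
      L≤ = ≤-trans (length≤size L) (m≤n⇒m≤1+n (≤-trans (m≤n+m ∣ L ∣ ∣ universe ∣) (≤-trans (n≤1+n _) (m≤n+m _ ∣ proj₁ x ∣))))

    size-occurrence : ∀ as t → ∣ maybe-case t 0 (occurrence as) ∣ ≤ 7
    size-occurrence as nothing = s≤s z≤n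
    size-occurrence as (just a) with mem a as
    ... | true  = ≤-refl
    ... | false = s≤s z≤n

    size-scale : ∀ as i → ∣ scale as i ∣ ≤ ∣ i ∣ + item-growth x
    size-scale as (t , n) = s≤s (≤-trans (+-monoʳ-≤ ∣ t ∣ (≤-trans (size-+ (shift L n) (digit-of as (t , n)))
        (+-mono-≤ (≤-trans (size-shift L n) (+-monoʳ-≤ ∣ n ∣ (*-monoʳ-≤ 6 L≤))) (+-monoˡ-≤ 5 (size-occurrence as t)))))
      (≤-reflexive (solve 3 (λ t n l → t :+ (n :+ l :+ κ 12) := t :+ n :+ (l :+ κ 12)) refl (∣ t ∣) (∣ n ∣) (6 * ∣ x ∣))))

    item-bound : ℕ → ℕ
    item-bound k = 10 + ∣ x ∣ + k * item-growth x

    size-items : ∀ rs → All (λ i → ∣ i ∣ ≤ item-bound (length rs)) (items rs)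
    size-items [] = Allₚ.map⁺ (All.tabulate λ {a} a∈ → ≤-trans
      (≤-reflexive (solve 1 (λ a → κ 1 :+ (κ 1 :+ (a :+ κ 1) :+ κ 1) := κ 4 :+ a) refl ∣ a ∣))
      (≤-trans (+-mono-≤ (m≤m+n 4 6) (≤-trans (size-∈ a∈) universe≤)) (m≤m+n _ 0)))
      where
      universe≤ : ∣ universe ∣ ≤ ∣ x ∣
      universe≤ = m≤n⇒m≤1+n (≤-trans (m≤m+n ∣ universe ∣ ∣ L ∣) (≤-trans (n≤1+n _) (m≤n+m _ ∣ proj₁ x ∣)))
    size-items ((as , (sl , g)) ∷ rs) = Allₚ.++⁺
      (Allₚ.map⁺ (All.map (λ {i} h → ≤-trans (size-scale as i) (≤-trans (+-monoˡ-≤ (item-growth x) h)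
        (≤-reflexive (solve 3 (λ a b k → a :+ k :* b :+ b := a :+ (b :+ k :* b)) refl (10 + ∣ x ∣) (item-growth x) (length rs)))))
        (size-items rs)))
      (Allₚ.map⁺ (All.tabulate λ _ → ≤-trans (m≤m+n 9 1) (≤-trans (m≤m+n 10 ∣ x ∣) (m≤m+n _ _))))

    size-goal : ∀ rs → ∣ goal rs ∣ ≤ 1 + (length rs * item-growth x + ∣ rs ∣)
    size-goal [] = s≤s z≤n
    size-goal ((as , (sl , g)) ∷ rs) = ≤-trans (size-+ (shift L (goal rs)) g)
      (≤-trans (+-monoˡ-≤ (∣ g ∣ + 5) (≤-trans (size-shift L (goal rs)) (+-mono-≤ (size-goal rs) (*-monoʳ-≤ 6 L≤))))
        (≤-trans (m≤m+n _ (7 + 3 + ∣ as ∣ + ∣ sl ∣)) (≤-reflexive (solve 6 (λ k r l g as sl →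
          κ 1 :+ (k :+ r) :+ l :+ (g :+ κ 5) :+ (κ 10 :+ as :+ sl) :=
          κ 1 :+ (l :+ κ 12 :+ k :+ (κ 1 :+ (κ 1 :+ (as :+ (κ 1 :+ (sl :+ g))) :+ r)))) refl
          (length rs * item-growth x) (∣ rs ∣) (6 * ∣ x ∣) (∣ g ∣) (∣ as ∣) (∣ sl ∣)))))

    slack-total≤ : ∀ rs → slack-total rs ≤ ∣ rs ∣
    slack-total≤ [] = z≤n
    slack-total≤ ((as , (sl , g)) ∷ rs) = m≤n⇒m≤1+n (+-mono-≤ (≤-trans (length≤size sl)
      (m≤n⇒m≤1+n (≤-trans (m≤m+n ∣ sl ∣ ∣ g ∣) (≤-trans (n≤1+n _) (m≤n+m _ ∣ as ∣))))) (slack-total≤ rs))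

  state-bound : In → ℕ
  state-bound x = 1 + (1 + (∣ x ∣ + ∣ x ∣) * (1 + item-bound x ∣ x ∣) + (1 + (∣ x ∣ * item-growth x + ∣ x ∣)))

  size-state : ∀ x ys zs → ys ++ zs ≡ proj₁ x → ∣ At.encodeRows x zs ∣ ≤ state-bound x
  size-state x ys zs e = s≤s (+-mono-≤
    (≤-trans (size-list (At.items x zs) (size-items x zs)) (s≤s (*-mono-≤
      (≤-trans (≤-reflexive (At.length-items x zs)) (+-mono-≤ universe≤ (≤-trans (slack-total≤ x zs) zs≤)))
      (s≤s (+-monoʳ-≤ (10 + ∣ x ∣) (*-monoˡ-≤ (item-growth x) length≤))))))
    (≤-trans (size-goal x zs) (s≤s (+-mono-≤ (*-monoˡ-≤ (item-growth x) length≤) zs≤))))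
    where
    zs≤ : ∣ zs ∣ ≤ ∣ x ∣
    zs≤ = ≤-trans (size-suffix ys e) (m≤n⇒m≤1+n (m≤m+n ∣ proj₁ x ∣ _))
    length≤ : length zs ≤ ∣ x ∣
    length≤ = ≤-trans (length≤size zs) zs≤
    universe≤ : length (proj₁ (proj₂ x)) ≤ ∣ x ∣
    universe≤ = ≤-trans (length≤size (proj₁ (proj₂ x))) (m≤n⇒m≤1+n (≤-trans (m≤m+n _ ∣ proj₂ (proj₂ x) ∣) (≤-trans (n≤1+n _) (m≤n+m _ ∣ proj₁ x ∣))))

  scaleᶜ : Poly-time {(Maybe A × ℕ) × (List A × Unary)} (λ (i , (as , L)) → Rows.scale mem [] L as i)
  scaleᶜ = fstᶜ ⊙ fstᶜ ▵ +ᶜ (shiftᶜ (sndᶜ ⊙ sndᶜ) (sndᶜ ⊙ fstᶜ))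
    (maybe-caseᶜ {h = λ (a , (_ , (as , _))) → if mem a as then 1 else 0} (fstᶜ ⊙ fstᶜ) (constᶜ 0)
      (ifᶜ (memᶜ ⊙ (fstᶜ ▵ fstᶜ ⊙ sndᶜ ⊙ sndᶜ)) (constᶜ 1) (constᶜ 0)))

  scaleAllᶜ : Poly-time {List (Maybe A × ℕ) × (List A × Unary)} (λ (is , (as , L)) → List.map (Rows.scale mem [] L as) is)
  scaleAllᶜ = mapᶜ {s = λ (i , (_ , (as , L))) → Rows.scale mem [] L as i} fstᶜ (scaleᶜ ⊙ (fstᶜ ▵ sndᶜ ⊙ sndᶜ))

  addRowᶜ : Poly-time {R × ((List (Maybe A × ℕ) × ℕ) × In)} (λ (r , (s , x)) → At.addRow x r s)
  addRowᶜ = ++ᶜ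
      (scaleAllᶜ ⊙ (fstᶜ ⊙ fstᶜ ⊙ sndᶜ ▵ (fstᶜ ⊙ fstᶜ ▵ Lᶜ)))
      (mapᶜ {s = λ _ → nothing , 1} idᶜ (constᶜ (nothing , 1)) ⊙ fstᶜ ⊙ sndᶜ ⊙ fstᶜ)
    ▵ +ᶜ (shiftᶜ Lᶜ (sndᶜ ⊙ fstᶜ ⊙ sndᶜ)) (sndᶜ ⊙ sndᶜ ⊙ fstᶜ)
    where
    Lᶜ : Poly-time {R × ((List (Maybe A × ℕ) × ℕ) × In)} (λ (_ , (_ , (_ , (_ , L)))) → L)
    Lᶜ = sndᶜ ⊙ sndᶜ ⊙ sndᶜ ⊙ sndᶜ

  encodeRowsᶜ : Poly-time (λ (x : In) → At.encodeRows x (proj₁ x))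
  encodeRowsᶜ = foldrᶜ {i = λ x → List.map (λ a → just a , 0) (proj₁ (proj₂ x)) , 0} {l = proj₁} {s = λ (r , (s , x)) → At.addRow x r s}
    (mapᶜ {s = λ (a , _) → just a , 0} (fstᶜ ⊙ sndᶜ) (justᶜ fstᶜ ▵ constᶜ 0) ▵ constᶜ 0) fstᶜ addRowᶜ
    state-bound
    (≲-con 1 ≲+ (≲-con 1 ≲+ (≲-id ≲+ ≲-id) ≲* (≲-con 1 ≲+ (≲-con 10 ≲+ ≲-id ≲+ ≲-id ≲* growth≲)) ≲+ (≲-con 1 ≲+ (≲-id ≲* growth≲ ≲+ ≲-id))))
    size-state
    where
    growth≲ : item-growth ≲ ∣_∣
    growth≲ = ≲-con 6 ≲* ≲-id ≲+ ≲-con 12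

module _ {A : Set} ⦃ _ : Code A ⦄ (eq : A → A → Bool) (eq⁻ : ∀ {a b} → eq a b ≡ true → a ≡ b) (eq⁺ : ∀ a → eq a a ≡ true)
         (eqᶜ : Poly-time {A × A} (λ (a , b) → eq a b)) where
  open Reduction eq (λ {a} {b} → eq⁻ {a} {b}) eq⁺

  memberᶜ : Poly-time {A × List A} (λ (a , as) → member a as)
  memberᶜ = anyᶜ {p = λ (b , (a , _)) → eq a b} sndᶜ (eqᶜ ⊙ (fstᶜ ⊙ sndᶜ ▵ fstᶜ))

  nubᶜ : Poly-time nub
  nubᶜ = foldr-growthᶜ {s = λ (a , (as , _)) → if member a as then as else a ∷ as} (constᶜ []) idᶜ
    (ifᶜ (memberᶜ ⊙ (fstᶜ ▵ fstᶜ ⊙ sndᶜ)) (fstᶜ ⊙ sndᶜ) (consᶜ fstᶜ (fstᶜ ⊙ sndᶜ)))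
    (λ (a , _) → suc ∣ a ∣) (≲-con 1 ≲+ output≲ fstᶜ) λ a as _ → grows (member a as) a as
    where
    grows : ∀ b a as → ∣ (if b then as else a ∷ as) ∣ ≤ ∣ as ∣ + suc ∣ a ∣
    grows true  a as = m≤m+n ∣ as ∣ _
    grows false a as = ≤-reflexive (+-comm (suc ∣ a ∣) ∣ as ∣)

  eqLitᶜ : Poly-time {Literal A × Literal A} (λ (l , m) → eqLit l m)
  eqLitᶜ = ∧ᶜ
    (ifᶜ (fstᶜ ⊙ fstᶜ) (fstᶜ ⊙ sndᶜ) (split-Boolᶜ {f = λ c _ → not c} (fstᶜ ⊙ sndᶜ) (λ c → constᶜ (not c))))
    (eqᶜ ⊙ (sndᶜ ⊙ fstᶜ ▵ sndᶜ ⊙ sndᶜ))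

  memberLitᶜ : Poly-time {Literal A × List (Literal A)} (λ (l , ms) → memberLit l ms)
  memberLitᶜ = anyᶜ {p = λ (m , (l , _)) → eqLit l m} sndᶜ (eqLitᶜ ⊙ (fstᶜ ⊙ sndᶜ ▵ fstᶜ))

  variablesᶜ : Poly-time variables
  variablesᶜ = nubᶜ ⊙ concatMapᶜ {s = λ (c , _) → List.map proj₂ c} idᶜ (mapᶜ {s = λ (l , _) → proj₂ l} fstᶜ (sndᶜ ⊙ fstᶜ))

  bothᶜ : Poly-time both
  bothᶜ = consᶜ (constᶜ true ▵ idᶜ) (consᶜ (constᶜ false ▵ idᶜ) (constᶜ []))

  literalsᶜ : Poly-time literals
  literalsᶜ = concatMapᶜ {s = λ (v , _) → both v} variablesᶜ (bothᶜ ⊙ fstᶜ)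

  slackᶜ : Poly-time slack
  slackᶜ = unaryᶜ literalsᶜ

  rowsᶜ : Poly-time rows
  rowsᶜ = ++ᶜ (mapᶜ {s = λ (v , _) → both v , ([] , 1)} variablesᶜ (bothᶜ ⊙ fstᶜ ▵ constᶜ ([] , 1)))
    (mapᶜ {s = λ (c , Φ) → c , (slack Φ , suc (length (literals Φ)))} idᶜ
      (fstᶜ ▵ (slackᶜ ⊙ sndᶜ ▵ sucᶜ (lengthᶜ literalsᶜ ⊙ sndᶜ))))

  widthᶜ : Poly-time width
  widthᶜ = consᶜ (constᶜ tt) (consᶜ (constᶜ tt) (++ᶜ slackᶜ (concatMapᶜ {s = λ ((_ , (sl , _)) , _) → sl} rowsᶜ (fstᶜ ⊙ sndᶜ ⊙ fstᶜ))))

  reductionᶜ : Poly-time reduction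
  reductionᶜ = (mapᶜ {s = λ ((_ , n) , _) → n} fstᶜ (sndᶜ ⊙ fstᶜ) ▵ sndᶜ) ⊙ encodeRowsᶜ memberLitᶜ ⊙ (rowsᶜ ▵ (literalsᶜ ▵ widthᶜ))


indexed-fromᶜ : ∀ {X} ⦃ _ : Code X ⦄ {x : X → List Bool} → Poly-time x → Poly-time (λ w → indexed-from [] (x w))
indexed-fromᶜ {X} {x} F = foldlᶜ {i = λ _ → []} {s = λ (b , (acc , _)) → (length acc , b) ∷ acc} (constᶜ []) F
  (consᶜ (lengthᶜ (fstᶜ ⊙ sndᶜ) ▵ fstᶜ) (fstᶜ ⊙ sndᶜ))
  (λ w → 1 + length (x w) * (1 + (1 + (6 * length (x w) + 1 + 3))))
  (≲-con 1 ≲+ x≲ ≲* (≲-con 1 ≲+ (≲-con 1 ≲+ (≲-con 6 ≲* x≲ ≲+ ≲-con 1 ≲+ ≲-con 3))))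
  λ w ys zs e → ≤-trans (size-list (indexed-from [] ys) (small [] ys (shorter w ys zs e) []))
    (s≤s (*-monoˡ-≤ _ (≤-trans (≤-reflexive (length-indexed [] ys)) (shorter w ys zs e))))
  where
  x≲ : (λ w → length (x w)) ≲ ∣_∣
  x≲ = ≲-mono (λ w → length≤size (x w)) (output≲ F)
  length-indexed : ∀ acc ys → length (indexed-from {Bool} acc ys) ≡ length acc + length ys
  length-indexed acc []       = sym (+-identityʳ _)
  length-indexed acc (y ∷ ys) = trans (length-indexed _ ys) (sym (+-suc (length acc) (length ys)))
  shorter : ∀ w ys zs → ys ++ zs ≡ x w → length ys ≤ length (x w)
  shorter w ys zs e = ≤-trans (m≤m+n (length ys) (length zs)) (≤-reflexive (trans (sym (Listₚ.length-++ ys)) (cong length e)))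
  small : ∀ {m} (acc : List (ℕ × Bool)) ys → length acc + length ys ≤ m →
          All (λ p → ∣ p ∣ ≤ 1 + (6 * m + 1 + 3)) acc → All (λ p → ∣ p ∣ ≤ 1 + (6 * m + 1 + 3)) (indexed-from acc ys)
  small acc []       l h = h
  small {m} acc (y ∷ ys) l h = small ((length acc , y) ∷ acc) ys (≤-trans (≤-reflexive (sym (+-suc (length acc) (length ys)))) l)
    (s≤s (+-mono-≤ (≤-trans (size-ℕ≤ (length acc)) (+-monoˡ-≤ 1 (*-monoʳ-≤ 6 (≤-trans (m≤m+n (length acc) (length (y ∷ ys))) l)))) (size-Bool y)) ∷ h)

downFrom-ℕᶜ : ∀ {X E} ⦃ _ : Code X ⦄ ⦃ _ : Code E ⦄ {l : X → List E} {m : X → ℕ} → Poly-time l → (∀ x → length (l x) ≡ m x) →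
              Poly-time (λ x → List.downFrom (m x))
downFrom-ℕᶜ L e = extensional (λ x → cong List.downFrom (e x)) (downFromᶜ L)

module _ (N : Machine) where
  open Run-of N
  open Tableau N

  private
    module _ {X : Set} ⦃ _ : Code X ⦄ where

      ⇒ᶜᶜ : ∀ {as : X → List Atom} {a : X → Atom} → Poly-time as → Poly-time a → Poly-time (λ x → as x ⇒ᶜ a x)
      ⇒ᶜᶜ A B = ++ᶜ (mapᶜ {s = λ (a , _) → false , a} A (constᶜ false ▵ fstᶜ)) (consᶜ (constᶜ true ▵ B) (constᶜ []))

      sourceᶜ : ∀ m {p : X → ℕ} → Poly-time p → Poly-time (λ x → source m (p x))
      sourceᶜ left  P = P
      sourceᶜ stay  P = sucᶜ P
      sourceᶜ right P = sucᶜ (sucᶜ P)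

      state-atᶜ : ∀ {t : X → ℕ} q → Poly-time t → Poly-time (λ x → state-at (t x) q)
      state-atᶜ q T = T ▵ constᶜ (index finite-Tag (inj₁ q) , 0)

      cell-atᶜ : ∀ {t p : X → ℕ} j s → Poly-time t → Poly-time p → Poly-time (λ x → cell-at (t x) j s (p x))
      cell-atᶜ j s T P = T ▵ (constᶜ (index finite-Tag (inj₂ (j , s))) ▵ P)

      factᶜ : ∀ {a : X → Atom} → Poly-time a → Poly-time (λ x → fact (a x))
      factᶜ A = consᶜ (constᶜ true ▵ A) (constᶜ [])

      viewedᶜ : ∀ {n t : X → ℕ} v → Poly-time n → Poly-time t → Poly-time (λ x → viewed (n x) (t x) v)
      viewedᶜ (q , ss) N T = consᶜ (state-atᶜ q T) (constant-mapᶜ (List.allFin tapes) λ j → cell-atᶜ j (lookup ss j) T N)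

      step-formulaᶜ : ∀ {n t p : X → ℕ} → Poly-time n → Poly-time t → Poly-time p → Poly-time (λ x → step-formula (n x) (t x) (p x))
      step-formulaᶜ N T P = ++ᶜ
        (constant-mapᶜ (elements finite-View) λ (q , ss) → ⇒ᶜᶜ (viewedᶜ (q , ss) N T) (state-atᶜ (proj₁ (action q ss)) (sucᶜ T)))
        (constant-mapᶜ (elements finite-View-cell) λ ((q , ss) , (j , s)) →
          let w = proj₁ (lookup (proj₂ (action q ss)) j) ; m = proj₂ (lookup (proj₂ (action q ss)) j) in
          ⇒ᶜᶜ (consᶜ (cell-atᶜ j s T (sourceᶜ m P)) (viewedᶜ (q , ss) N T))
            (ifᶜ (≡ᵇᶜ (sourceᶜ m P) N) (cell-atᶜ j w (sucᶜ T) (sucᶜ P)) (cell-atᶜ j s (sucᶜ T) (sucᶜ P))))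

      guessᶜ : ∀ {p : X → ℕ} → Poly-time p → Poly-time (λ x → guess (p x))
      guessᶜ P = consᶜ
        (consᶜ (constᶜ true ▵ cell-atᶜ zero (bit false) (constᶜ 0) P) (consᶜ (constᶜ true ▵ cell-atᶜ zero (bit true) (constᶜ 0) P)
          (consᶜ (constᶜ true ▵ cell-atᶜ zero blank (constᶜ 0) P) (constᶜ []))))
        (consᶜ (consᶜ (constᶜ false ▵ cell-atᶜ zero blank (constᶜ 0) P)
          (consᶜ (constᶜ true ▵ cell-atᶜ zero blank (constᶜ 0) (sucᶜ P)) (constᶜ []))) (constᶜ []))

    In : Set
    In = Unary × (List Bool × Unary)

    nᶜ : Poly-time {In} (λ (u , _) → length u)
    nᶜ = lengthᶜ fstᶜ

    twice : In → Unary
    twice (u , _) = u ++ (u ++ [])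

    twiceᶜ : Poly-time twice
    twiceᶜ = ++ᶜ fstᶜ (++ᶜ fstᶜ (constᶜ []))

    length-twice : ∀ x → length (twice x) ≡ 2 * length (proj₁ x)
    length-twice (u , _) = trans (Listₚ.length-++ u) (cong (length u +_) (trans (Listₚ.length-++ u) refl))

    upToᶜ : Poly-time {In} (λ (u , _) → List.downFrom (suc (2 * length u)))
    upToᶜ = downFrom-ℕᶜ (consᶜ (constᶜ tt) twiceᶜ) (λ x → cong suc (length-twice x))

    run-formulaᶜ : Poly-time {In} (λ (u , _) → run-formula (length u))
    run-formulaᶜ = concatMapᶜ {s = λ (t , (u , _)) → List.concatMap (λ p → step-formula (length u) t p) (List.downFrom (2 * length u))}
      (downFromᶜ fstᶜ)
      (concatMapᶜ {s = λ (p , (t , (u , _))) → step-formula (length u) t p} (downFrom-ℕᶜ twiceᶜ length-twice ⊙ sndᶜ)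
        (step-formulaᶜ (nᶜ ⊙ sndᶜ ⊙ sndᶜ) (fstᶜ ⊙ sndᶜ) fstᶜ))

    blanksᶜ : ∀ {p k : In → ℕ} → Poly-time p → Poly-time (λ x → List.downFrom (k x)) → Poly-time (λ x → blanks (p x) (k x))
    blanksᶜ {p} P K = mapᶜ {s = λ (i , x) → fact (cell-at 0 zero blank (p x + i))} K
      (factᶜ (cell-atᶜ zero blank (constᶜ 0) (+ᶜ (P ⊙ sndᶜ) fstᶜ)))

    start-formulaᶜ : Poly-time {In} (λ (u , (x , l)) → start-formula (length u) x (length l))
    start-formulaᶜ = ++ᶜ (consᶜ (factᶜ (state-atᶜ start (constᶜ 0))) (constᶜ []))
      (++ᶜ (concatMapᶜ {s = λ (p , _) → List.map (λ j → fact (cell-at 0 (suc j) blank p)) (List.allFin extraTapes)} upToᶜ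
             (constant-mapᶜ (List.allFin extraTapes) λ j → factᶜ (cell-atᶜ (suc j) blank (constᶜ 0) fstᶜ)))
      (++ᶜ (blanksᶜ (constᶜ 0) (downFromᶜ fstᶜ))
      (++ᶜ (mapᶜ {s = λ ((i , b) , (u , _)) → if b then fact (cell-at 0 zero (bit true) (length u + i))
                                                      else fact (cell-at 0 zero (bit false) (length u + i))}
             (indexed-fromᶜ (fstᶜ ⊙ sndᶜ))
             (ifᶜ (sndᶜ ⊙ fstᶜ) (factᶜ (cell-atᶜ zero (bit true) (constᶜ 0) (+ᶜ (nᶜ ⊙ sndᶜ) (fstᶜ ⊙ fstᶜ))))
                                (factᶜ (cell-atᶜ zero (bit false) (constᶜ 0) (+ᶜ (nᶜ ⊙ sndᶜ) (fstᶜ ⊙ fstᶜ))))))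
      (++ᶜ (concatMapᶜ {s = λ (i , (u , (x , _))) → guess ((length u + length x) + i)} (downFromᶜ (sndᶜ ⊙ sndᶜ))
             (guessᶜ (+ᶜ (p₀ᶜ ⊙ sndᶜ) fstᶜ)))
           (blanksᶜ (+ᶜ p₀ᶜ (lengthᶜ (sndᶜ ⊙ sndᶜ))) upToᶜ)))))
      where
      p₀ᶜ : Poly-time {In} (λ (u , (x , _)) → length u + length x)
      p₀ᶜ = +ᶜ nᶜ (lengthᶜ (fstᶜ ⊙ sndᶜ))

  formulaᶜ : Poly-time {Unary × (List Bool × Unary)} (λ (u , (x , l)) → formula (length u) x (length l))
  formulaᶜ = ++ᶜ run-formulaᶜ (++ᶜ start-formulaᶜ
    (constant-mapᶜ rejecting λ s → consᶜ (constᶜ false ▵ cell-atᶜ zero s nᶜ nᶜ) (constᶜ [])))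

  sameAtom : Atom → Atom → Bool
  sameAtom (t , (τ , p)) (t′ , (τ′ , p′)) = (t ≡ᵇ t′) ∧ ((toℕ τ ≡ᵇ toℕ τ′) ∧ (p ≡ᵇ p′))

  sameAtomᶜ : Poly-time {Atom × Atom} (λ (a , b) → sameAtom a b)
  sameAtomᶜ = ∧ᶜ (≡ᵇᶜ (fstᶜ ⊙ fstᶜ) (fstᶜ ⊙ sndᶜ))
    (∧ᶜ (≡ᵇᶜ (toℕᶜ (fstᶜ ⊙ sndᶜ ⊙ fstᶜ)) (toℕᶜ (fstᶜ ⊙ sndᶜ ⊙ sndᶜ))) (≡ᵇᶜ (sndᶜ ⊙ sndᶜ ⊙ fstᶜ) (sndᶜ ⊙ sndᶜ ⊙ sndᶜ)))
    where
    toℕᶜ : ∀ {X m} ⦃ _ : Code X ⦄ {i : X → Fin m} → Poly-time i → Poly-time (λ x → toℕ (i x))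
    toℕᶜ I = recode toℕ (λ _ → refl) (λ _ → ≤-refl) ⊙ I

  ≡ᵇ-refl : ∀ n → (n ≡ᵇ n) ≡ true
  ≡ᵇ-refl n = T⇒≡true (≡⇒≡ᵇ n n refl)

  sameAtom⁺ : ∀ a → sameAtom a a ≡ true
  sameAtom⁺ (t , (τ , p)) = cong₂ _∧_ (≡ᵇ-refl t) (cong₂ _∧_ (≡ᵇ-refl (toℕ τ)) (≡ᵇ-refl p))

  sameAtom⁻ : ∀ {a b} → sameAtom a b ≡ true → a ≡ b
  sameAtom⁻ {t , (τ , p)} {t′ , (τ′ , p′)} h =
    let h₁ , h₂ = T-∧⁻ {t ≡ᵇ t′} (subst Bool.T (sym h) _) ; h₃ , h₄ = T-∧⁻ {toℕ τ ≡ᵇ toℕ τ′} h₂ in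
    cong₂ _,_ (≡ᵇ⇒≡ t t′ h₁) (cong₂ _,_ (Finₚ.toℕ-injective (≡ᵇ⇒≡ (toℕ τ) (toℕ τ′) h₃)) (≡ᵇ⇒≡ p p′ h₄))


-- Encodings are computable in polynomial time

module _ {X E : Set} ⦃ _ : Code X ⦄ ⦃ _ : Code E ⦄ {encode : E → List Bool} (encodeᶜ : Poly-time encode) where

  encodeListᶜ : ∀ {l : X → List E} → Poly-time l → Poly-time (λ x → encodeList encode (l x))
  encodeListᶜ {l} L = extensional (λ x → concatMap-encodeList (l x))
    (++ᶜ (concatMapᶜ {s = λ (e , _) → true ∷ encode e} L (consᶜ (constᶜ true) (encodeᶜ ⊙ fstᶜ))) (constᶜ [ false ]))
    where
    concatMap-encodeList : ∀ es → List.concatMap (λ e → true ∷ encode e) es ++ [ false ] ≡ encodeList encode es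
    concatMap-encodeList []       = refl
    concatMap-encodeList (e ∷ es) = cong (true ∷_)
      (trans (Listₚ.++-assoc (encode e) _ _) (cong (encode e ++_) (concatMap-encodeList es)))

  encodeVecᶜ : ∀ {k} {v : X → Vec E k} → Poly-time v → Poly-time (λ x → encodeVec encode (v x))
  encodeVecᶜ {zero}  {v} V = extensional (λ x → empty (v x)) (constᶜ [])
    where
    empty : ∀ (v : Vec E 0) → [] ≡ encodeVec encode v
    empty [] = refl
  encodeVecᶜ {suc k} {v} V = extensional (λ x → step (v x)) (++ᶜ (encodeᶜ ⊙ fstᶜ ⊙ unconsᶜ V) (encodeVecᶜ (sndᶜ ⊙ unconsᶜ V)))
    where
    step : ∀ (v : Vec E (suc k)) → encode (Vec.head v) ++ encodeVec encode (Vec.tail v) ≡ encodeVec encode v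
    step (_ ∷ _) = refl

encodeBitsᶜ : ∀ {X} ⦃ _ : Code X ⦄ {w : X → List Bool} → Poly-time w → Poly-time (λ x → encodeList [_] (w x))
encodeBitsᶜ = encodeListᶜ (consᶜ idᶜ (constᶜ []))

encodeℕᶜ : ∀ {X} ⦃ _ : Code X ⦄ {n : X → ℕ} → Poly-time n → Poly-time (λ x → encodeℕ (n x))
encodeℕᶜ {n = n} N = extensional (λ x → sym (encodeℕᵇ-digits (ℕᵇ.fromℕ (n x))))
  (encodeBitsᶜ (mapᶜ {s = λ (d , _) → isOne d} (digitsᶜ N) (isOneᶜ ⊙ fstᶜ)))

module _ {X : Set} ⦃ _ : Code X ⦄ {T : ℕ} where

  encodeTripleᶜ : ∀ {k : X → Triple T} → Poly-time k → Poly-time (λ x → encodeTriple (k x))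
  encodeTripleᶜ K = ++ᶜ (encodeℕᶜ (valueᶜ K)) (++ᶜ (encodeℕᶜ (deadlineᶜ K)) (encodeℕᶜ (demandᶜ K)))

  encodeSpeedᶜ : ∀ ν {s : X → SpeedLimit ν T} → let instance _ = code-Speed ν in Poly-time s → Poly-time (λ x → encodeSpeed ν (s x))
  encodeSpeedᶜ fixed     S = encodeℕᶜ S
  encodeSpeedᶜ unbounded S = constᶜ []
  encodeSpeedᶜ gaps      S = toListᶜ S

module _ {ν : Variant} {T : ℕ} where

  encodeAgentᶜ : Poly-time (encodeAgent {ν} {T})
  encodeAgentᶜ = ++ᶜ (encodeListᶜ (encodeTripleᶜ idᶜ) (triplesᶜ idᶜ)) (encodeSpeedᶜ ν (speedᶜ idᶜ))

  encodeInstanceᶜ : Poly-time (encodeInstance {ν} {T})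
  encodeInstanceᶜ = ++ᶜ (encodeVecᶜ (encodeℕᶜ idᶜ) (supplyᶜ idᶜ))
    (++ᶜ (encodeListᶜ encodeAgentᶜ (agentsᶜ idᶜ)) (encodeℕᶜ (targetᶜ idᶜ)))

module _ {ν : Variant} {n : ℕ} where

  freeSpeedᶜ : ∀ ν → let instance _ = code-Speed ν in Poly-time (freeSpeed ν {suc n})
  freeSpeedᶜ fixed     = idᶜ
  freeSpeedᶜ unbounded = constᶜ tt
  freeSpeedᶜ gaps      = constᶜ (Vec.replicate (suc n) true)

  itemᶜ : Poly-time (item {ν} {n})
  itemᶜ = recode (λ (ks , s) → agent ks s) (λ _ → refl) (λ _ → ≤-refl) ⊙
    (consᶜ (recode (λ (v , (d , w)) → triple v d w) (λ _ → refl) (λ _ → ≤-refl) ⊙ (idᶜ ▵ (constᶜ zero ▵ idᶜ))) (constᶜ []) ▵ freeSpeedᶜ ν)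
    where instance _ = code-Speed ν

  subsetSumInstanceᶜ : Poly-time (subsetSumInstance {ν} {n})
  subsetSumInstanceᶜ = recode fromParts (λ p → cong code (toParts-fromParts p)) (λ _ → ≤-refl) ⊙
    (replicateᶜ (suc n) ▵ (mapᶜ {s = λ (x , _) → item x} fstᶜ (itemᶜ ⊙ fstᶜ) ▵ sndᶜ))
    where
    replicateᶜ : ∀ m → Poly-time {List ℕ × ℕ} (λ (_ , k) → Vec.replicate m k)
    replicateᶜ zero    = constᶜ []
    replicateᶜ (suc m) = vconsᶜ sndᶜ (replicateᶜ m)


-- Hardness

module _ (N : Machine) where
  open Run-of N
  open Tableau N

  open Reduction (sameAtom N) (λ {a} {b} → sameAtom⁻ N {a} {b}) (sameAtom⁺ N)

  Acceptable : ℕ → List Bool → ℕ → Set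
  Acceptable n x l = ∃[ u ] (length u ≤ l × answer (after n (initial (x ++ u))) ≡ bit true)

  module _ (ν : Variant) (T : ℕ) where

    tableauInstance : Unary × (List Bool × Unary) → ChargeInstance ν (suc T)
    tableauInstance (n , (x , l)) = subsetSumInstance (reduction (formula (length n) x (length l)))

    tableauInstanceᶜ : Poly-time tableauInstance
    tableauInstanceᶜ = subsetSumInstanceᶜ ⊙ reductionᶜ (sameAtom N) (λ {a} {b} → sameAtom⁻ N {a} {b}) (sameAtom⁺ N) (sameAtomᶜ N) ⊙ formulaᶜ N

    acceptable⇒schedulable : ∀ n x l → Acceptable (length n) x (length l) → Schedulable (tableauInstance (n , (x , l)))
    acceptable⇒schedulable n x l (u , u≤l , accepting) =
      solvable⇒schedulable (tableauInstance (n , (x , l)))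
        (Equivalence.from (solvable⇔subsetSum (proj₁ (reduction Φ)) (proj₂ (reduction Φ)))
          (satisfiable⇒subsetSum Φ (Completeness.satisfied-formula (length n) x u (length l) u≤l accepting)))
      where
      Φ = formula (length n) x (length l)

    schedulable⇒acceptable : ∀ n x l → Schedulable (tableauInstance (n , (x , l))) → Acceptable (length n) x (length l)
    schedulable⇒acceptable n x l s =
      let σ , sat = subsetSum⇒satisfiable Φ (Equivalence.to (solvable⇔subsetSum (proj₁ (reduction Φ)) (proj₂ (reduction Φ)))
                      (schedulable⇒solvable (tableauInstance (n , (x , l))) s))
          open Soundness (length n) x (length l) σ sat
      in unknown , length-extract (length l) (length n + length x) , accepted
      where
      Φ = formula (length n) x (length l)

length-pair : ∀ w u → length (pair w u) ≡ length w + (length w + suc (length u))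
length-pair []      u = refl
length-pair (b ∷ w) u = cong suc (trans (cong suc (length-pair w u)) (sym (+-suc (length w) _)))

encodeInstance-injective : ∀ {ν T} {I J : ChargeInstance ν T} → encodeInstance I ≡ encodeInstance J → I ≡ J
encodeInstance-injective {I = I} {J} e = just-injective (trans (sym (decode-encode isParser-Instance I))
  (trans (cong (decode parseInstance) e) (decode-encode isParser-Instance J)))
  where
  just-injective : ∀ {A : Set} {a b : A} → just a ≡ just b → a ≡ b
  just-injective refl = refl

bit-injective : ∀ {g b c} → bit {g} b ≡ bit c → b ≡ c
bit-injective refl = refl

-- The run is long enough for all certificates of the length that is allowed.
module Certificates (N : Machine) (p q : Poly 1) where

  word guess-length run-length : List Bool → Unary
  word w         = List.map (λ _ → tt) w
  guess-length w = ⟦ p ⟧ᵘ (word w ∷ [])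
  -- The argument of `q` is the length of `pair w u` for the longest admissible `u`: two letters for
  -- each letter of `w`, the end mark and `u` itself.
  run-length w   = ⟦ q ⟧ᵘ ((word w ++ (word w ++ (tt ∷ guess-length w))) ∷ [])

  guess-lengthᶜ : Poly-time guess-length
  guess-lengthᶜ = polyᶜ p (vconsᶜ (unaryᶜ idᶜ) (constᶜ []))

  -- The known part of the input is `pair w u` without `u`, which by `pair-encode` is
  -- `encodeList [_] w`; the certificate is what the formula has to guess.
  tableau : List Bool → Unary × (List Bool × Unary)
  tableau w = run-length w , (encodeList [_] w , guess-length w)

  tableauᶜ : Poly-time tableau
  tableauᶜ = polyᶜ q (vconsᶜ (++ᶜ (unaryᶜ idᶜ) (++ᶜ (unaryᶜ idᶜ) (consᶜ (constᶜ tt) guess-lengthᶜ))) (constᶜ [])) ▵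
             (encodeBitsᶜ idᶜ ▵ guess-lengthᶜ)

  length-word : ∀ w → length (word w) ≡ length w
  length-word w = Listₚ.length-map _ w

  length-guess : ∀ w → length (guess-length w) ≡ ⟦ p ⟧ (length w ∷ [])
  length-guess w = trans (length-⟦⟧ᵘ p (word w ∷ [])) (cong (λ k → ⟦ p ⟧ (k ∷ [])) (length-word w))

  long-enough : ∀ w u → length u ≤ ⟦ p ⟧ (length w ∷ []) → ⟦ q ⟧ (length (pair w u) ∷ []) ≤ length (run-length w)
  long-enough w u u≤ = ≤-trans (⟦⟧-mono q (≤-trans (≤-reflexive (length-pair w u))
      (≤-trans (+-monoʳ-≤ (length w) (+-monoʳ-≤ (length w) (s≤s u≤))) (≤-reflexive (sym total-length)))))
    (≤-reflexive (sym (length-⟦⟧ᵘ q _)))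
    where
    total-length : length (word w ++ (word w ++ (tt ∷ guess-length w))) ≡ length w + (length w + suc (⟦ p ⟧ (length w ∷ [])))
    total-length = trans (Listₚ.length-++ (word w)) (cong₂ _+_ (length-word w)
      (trans (Listₚ.length-++ (word w)) (cong₂ (λ a b → a + suc b) (length-word w) (length-guess w))))

  module _ (accepts : List Bool → Bool) (outputs : ∀ w → Machine.Outputs_On_Within_ N [ accepts w ] w (⟦ q ⟧ (length w ∷ []))) where
    open Run-of N

    answers : ∀ w u → length u ≤ ⟦ p ⟧ (length w ∷ []) →
      answer (after (length (run-length w)) (initial (encodeList [_] w ++ u))) ≡ bit (accepts (pair w u))
    answers w u u≤ = subst (λ x → answer (after (length (run-length w)) (initial x)) ≡ bit (accepts (pair w u))) (pair-encode w u)
      (answer-output (length (run-length w)) (outputs (pair w u)) (long-enough w u u≤))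

    Certified : List Bool → Set
    Certified w = ∃[ u ] (length u ≤ ⟦ p ⟧ (length w ∷ []) × accepts (pair w u) ≡ true)

    certified⇔acceptable : ∀ w → Certified w ⇔ Acceptable N (length (run-length w)) (encodeList [_] w) (length (guess-length w))
    certified⇔acceptable w = mk⇔
      (λ (u , u≤ , h) → u , ≤-trans u≤ (≤-reflexive (sym (length-guess w))) , trans (answers w u u≤) (cong bit h))
      (λ (u , u≤ , a) → let u≤p = ≤-trans u≤ (≤-reflexive (length-guess w)) in
        u , u≤p , bit-injective (trans (sym (answers w u u≤p)) a))

-- Membership only provides some schedulable instance with the same encoding; injectivity of the
-- encoding identifies it with `I`.
schedulable-language⇔ : ∀ {ν T} (I : ChargeInstance ν T) → Schedulable-language ν T (encodeInstance I) ⇔ Schedulable I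
schedulable-language⇔ I = mk⇔ (λ (J , e , s) → subst Schedulable (encodeInstance-injective {I = J} {I} e) s) (λ s → I , refl , s)

module _ (ν : Variant) (T : ℕ) (N : Machine) (p q : Poly 1) where
  open Certificates N p q

  abstract
    hardInstance : List Bool → ChargeInstance ν (suc T)
    hardInstance w = tableauInstance N ν T (tableau w)

    hardInstanceᶜ : Poly-time hardInstance
    hardInstanceᶜ = _⊙_ {f = tableau} {g = tableauInstance N ν T} (tableauInstanceᶜ N ν T) tableauᶜ

    acceptable⇔schedulable : ∀ w →
      Acceptable N (length (run-length w)) (encodeList [_] w) (length (guess-length w)) ⇔ Schedulable (hardInstance w)
    acceptable⇔schedulable w = mk⇔
      (acceptable⇒schedulable N ν T (run-length w) (encodeList [_] w) (guess-length w))
      (schedulable⇒acceptable N ν T (run-length w) (encodeList [_] w) (guess-length w))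

npHard : ∀ ν T → NPHard (Schedulable-language ν (suc T))
npHard ν T L (V , (accepts , (N , q , outputs) , accepts⇔V) , p , L⇔) =
  (λ w → encodeInstance (instanceOf w)) , polyTime (encodeInstanceᶜ ⊙ hardInstanceᶜ ν T N p q) , λ w → mk⇔
    (λ h → let u , u≤ , v = Equivalence.to (L⇔ w) h in
      Equivalence.from (schedulable-language⇔ (instanceOf w)) (Equivalence.to (acceptable⇔schedulable ν T N p q w)
        (Equivalence.to (certified⇔acceptable accepts outputs w) (u , u≤ , Equivalence.from (accepts⇔V (pair w u)) v))))
    (λ h → let u , u≤ , e = Equivalence.from (certified⇔acceptable accepts outputs w)
                 (Equivalence.from (acceptable⇔schedulable ν T N p q w) (Equivalence.to (schedulable-language⇔ (instanceOf w)) h))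
           in Equivalence.from (L⇔ w) (u , u≤ , Equivalence.to (accepts⇔V (pair w u)) e))
  where
  open Certificates N p q
  instanceOf = hardInstance ν T N p q

corollary1 :
  (ν : Variant) (T : ℕ) .{{_ : NonZero T}} →
  WeaklyNPComplete (chargeScheduling ν T) ×
  (∀ p → InP (language (restrict (chargeScheduling ν T) (λ I → DemandBounded I p)))) ×
  (∀ p → InP (language (restrict (chargeScheduling ν T) (λ I → SupplyBounded I p)))) ×
  (∀ p → InP (language (restrict (chargeScheduling ν T) (λ I → SpeedBounded I p))))
corollary1 ν (suc T) = ((inNP ν (suc T) , npHard ν T) , pseudoPolynomial) , inP-demand , inP-supply , inP-speed
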